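{- The maximum density of the ball/corner scheme (a cutting scheme of the $3$-simplex) is $12/11$; hence $\tau_3^* \le 12/11$.
   Context: Simplex and length. For $k\ge 3$ let $\Delta=\{x\in\mathbb{R}^k : x\ge 0,\ \sum_i x_i=1\}$; its $i$-th vertex (also called terminal $i$) is the point with $x_i=1$. The length $|e|$ of a line segment $e$ in $\Delta$ is half the $L_1$ distance between its endpoints. Cutting schemes. A $k$-way cut of the simplex is a partition of $\Delta$ into $k$ polytopes (polyhedral regions, not necessarily convex; how points on the common boundaries are assigned is immaterial), each containing exactly one vertex of $\Delta$. A cutting scheme is a probability distribution $P$ on $k$-way cuts of $\Delta$. For a line segment $e$ of positive length, the density $\tau_k(P,e)$ is the expected number of times a random cut from $P$ cuts $e$ (the number of points of $e$ at which $e$ crosses a boundary between blocks), divided by $|e|$. The maximum density of $P$ is $\tau_k(P)=\sup_e\tau_k(P,e)$, and $\tau_k^*=\inf_P\tau_k(P)$, the infimum being over all cutting schemes. The ball/corner scheme ($k=3$). Let $a=(2/3,1/3,0)$, $b=(2/3,0,1/3)$, $c=(0,2/3,1/3)$, $d=(0,1/3,2/3)$. With probability $8/11$ choose a ball cut, otherwise (probability $3/11$) choose a corner cut, where: Ball cut: choose a point $r$ uniformly at random from the union of the two segments $a$–$c$ and $b$–$d$. The three lines $\{x\in\Delta: x_i=r_i\}$, $i=1,2,3$, through $r$ parallel to the sides of the triangle are each divided by $r$ into two rays, giving six rays; each side of the triangle is hit by two of these rays. For each side choose (independently) uniformly at random one of the two rays that hit it. The three chosen rays form the boundary of the $3$-way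 cut. Corner cut: choose two of the three terminals uniformly at random, and choose $\rho\in(2/3,1]$ uniformly at random. The lines $\{x\in\Delta: x_i=\rho\}$ for the two chosen terminals $i$ form the boundary of the $3$-way cut. -}

module Defs where

open import Level using (Level; 0ℓ) renaming (suc to lsuc)
open import Algebra.Bundles using (CommutativeRing)
open import Algebra.Core using (Op₁)
import Algebra.Construct.NaturalChoice.Max as Max
import Algebra.Properties.Monoid.Sum as Sum
import Algebra.Properties.Monoid.Mult as Mult
open import Data.Empty using (⊥)
open import Data.Fin.Base using (Fin; zero; suc; toℕ; punchIn)
open import Data.List.Base using (List)
open import Data.List.Relation.Unary.All using (All)
open import Data.List.Relation.Unary.Any using (Any)
open import Data.Nat.Base using (ℕ)
open import Data.Product.Base using (Σ; ∃; ∃-syntax; _×_; _,_)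
open import Data.Vec.Base using (Vec; lookup)
open import Data.Vec.Functional using (Vector; []; _∷_)
open import Function.Base using (flip)
open import Function.Bundles using (_⇔_)
open import Relation.Binary.Bundles using (TotalOrder)
open import Relation.Binary.Core using (Rel)
import Relation.Binary.Construct.Add.Supremum.NonStrict as AddSupremum
import Relation.Binary.Construct.NonStrictToStrict as ToStrict
open import Relation.Binary.PropositionalEquality.Core using (_≡_; _≢_)
open import Relation.Binary.Structures using (IsTotalOrder)
open import Relation.Nullary.Construct.Add.Supremum using (_⁺; [_]; ⊤⁺)
open import Relation.Nullary.Negation.Core using (¬_)
open import Relation.Unary using (Pred; _∈_; _⊆_; _≐_; U; ∁; ⋃; _⊢_; Empty; _∩_)

private variable
  a ℓ ℓ₁ : Level
  A : Set a
  k : ℕ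

IsSup : Rel A ℓ₁ → Pred A ℓ → Pred A _
IsSup _≤_ S s = (∀ x → x ∈ S → x ≤ s) × (∀ u → (∀ x → x ∈ S → x ≤ u) → s ≤ u)

IsInf : Rel A ℓ₁ → Pred A ℓ → Pred A _
IsInf _≤_ = IsSup (flip _≤_)

-- The real numbers, axiomatised (the axioms are categorical in classical logic).
record CompleteOrderedField : Set₁ where
  infix  4 _≤_
  infixl 8 _⁻¹
  field
    commutativeRing : CommutativeRing 0ℓ 0ℓ

  open CommutativeRing commutativeRing public renaming (Carrier to ℝ)

  field
    _≤_          : Rel ℝ 0ℓ
    isTotalOrder : IsTotalOrder _≈_ _≤_
    +-monoˡ-≤    : ∀ {x y} z → x ≤ y → x + z ≤ y + z
    *-nonNeg     : ∀ {x y} → 0# ≤ x → 0# ≤ y → 0# ≤ x * y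
    0≉1          : ¬ (0# ≈ 1#)
    -- The value of 0# ⁻¹ is unspecified.
    _⁻¹          : Op₁ ℝ
    *-inverseʳ   : ∀ {x} → ¬ (x ≈ 0#) → x * x ⁻¹ ≈ 1#
    complete     : (S : Pred ℝ 0ℓ) → ∃ S → (∃[ b ] ∀ x → x ∈ S → x ≤ b) →
                   ∃ (IsSup _≤_ S)

  totalOrder : TotalOrder 0ℓ 0ℓ 0ℓ
  totalOrder = record { isTotalOrder = isTotalOrder }

  open ToStrict _≈_ _≤_ public using (_<_)
  open Max totalOrder public using () renaming (_⊔_ to max)
  open Sum +-monoid public using (sum)
  open Mult +-monoid public using () renaming (_×_ to _·_)
  open AddSupremum _≤_ public using (_≤⁺_)

  ∣_∣ : Op₁ ℝ
  ∣ x ∣ = max x (- x)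

  infixl 7 _÷_
  _÷_ : ℕ → ℕ → ℝ
  m ÷ n = (m · 1#) * (n · 1#) ⁻¹

module Simplex (𝓡 : CompleteOrderedField) where
  open CompleteOrderedField 𝓡

  Point : ℕ → Set
  Point k = Vector ℝ k

  Δ : Pred (Point k) 0ℓ
  Δ x = (∀ i → 0# ≤ x i) × sum x ≈ 1#

  IsVertex : Fin k → Pred (Point k) 0ℓ
  IsVertex i x = x ∈ Δ × x i ≈ 1#

  dist : Point k → Point k → ℝ
  dist x y = (1 ÷ 2) * sum (λ i → ∣ x i - y i ∣)

  lerp : Point k → Point k → ℝ → Point k
  lerp p q t i = (1# - t) * p i + t * q i

  record Segment (k : ℕ) : Set where
    field
      source target : Point k
      source∈Δ      : source ∈ Δ
      target∈Δ      : target ∈ Δ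

    length : ℝ
    length = dist source target

    field
      0<length : 0# < length

    at : ℝ → Point k
    at = lerp source target

  ----------------------------------------------------------------------
  -- Cuts

  -- Both kinds of half-space are allowed, so that the common boundary of two
  -- blocks may be assigned to either of them.
  data HalfSpace (k : ℕ) : Set where
    closed open′ : (normal : Vector ℝ k) (offset : ℝ) → HalfSpace k

  _∈ʰ_ : Point k → HalfSpace k → Set
  x ∈ʰ closed n c = sum (λ i → n i * x i) ≤ c
  x ∈ʰ open′  n c = sum (λ i → n i * x i) < c

  -- Within Δ, a finite union of finite intersections of half-spaces.
  Polyhedral : Pred (Point k) 0ℓ → Set
  Polyhedral {k} B = Σ (List (List (HalfSpace k))) λ Hss →
    ∀ x → x ∈ Δ → x ∈ B ⇔ Any (All (x ∈ʰ_)) Hss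

  -- Each block contains exactly one vertex, so blocks are indexed by the vertex
  -- they contain; `disjoint` excludes the other vertices.
  record Cut (k : ℕ) : Set₁ where
    field
      block      : Fin k → Pred (Point k) 0ℓ
      covers     : ∀ x → x ∈ Δ → ∃[ i ] x ∈ block i
      disjoint   : ∀ x i j → x ∈ Δ → x ∈ block i → x ∈ block j → i ≡ j
      polyhedral : ∀ i → Polyhedral (block i)
      vertex     : ∀ i x → x ∈ IsVertex i → x ∈ block i

  module _ (C : Cut k) where
    open Cut C

    Separated : Rel (Point k) 0ℓ
    Separated x y = ∃[ i ] ∃[ j ] i ≢ j × x ∈ block i × y ∈ block j

    Boundary : Pred (Point k) 0ℓ
    Boundary x = x ∈ Δ × (∀ δ → 0# < δ → ∃[ y ] ∃[ z ]
      y ∈ Δ × z ∈ Δ × dist x y < δ × dist x z < δ × Separated y z)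

    -- The segment passes from one block to another at parameter t.  Near t a
    -- polyhedral cut is constant along e on either side, so this says that the
    -- two sides lie in different blocks; the block of the point at t itself is
    -- irrelevant.
    Crossing : Segment k → Pred ℝ 0ℓ
    Crossing e t = ∀ δ → 0# < δ → ∃[ s ] ∃[ s′ ]
      0# ≤ s × t - δ < s × s < t × t < s′ × s′ < t + δ × s′ ≤ 1# ×
      Separated (Segment.at e s) (Segment.at e s′)

    CutsAtLeast : Segment k → ℕ → Set
    CutsAtLeast e n = Σ (Fin n → ℝ) λ t → (∀ i → t i ∈ Crossing e) ×
                                          (∀ i j → i ≢ j → ¬ (t i ≈ t j))

  ----------------------------------------------------------------------
  -- Probability

  record ProbabilitySpace : Set₂ where
    field
      Ω          : Set
      -- A σ-algebra
      Measurable : Pred (Pred Ω 0ℓ) (lsuc 0ℓ)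
      resp-≐     : ∀ {A B} → A ≐ B → Measurable A → Measurable B
      univ       : Measurable U
      compl      : ∀ {A} → Measurable A → Measurable (∁ A)
      union      : ∀ (A : ℕ → Pred Ω 0ℓ) → (∀ n → Measurable (A n)) →
                   Measurable (⋃ ℕ A)
      -- A measure; the value of μ is meaningful on measurable sets only.
      μ          : Pred Ω 0ℓ → ℝ
      μ-cong     : ∀ {A B} → Measurable A → A ≐ B → μ A ≈ μ B
      μ-nonNeg   : ∀ {A} → Measurable A → 0# ≤ μ A
      μ-univ     : μ U ≈ 1#
      μ-union    : ∀ (A : ℕ → Pred Ω 0ℓ) → (∀ n → Measurable (A n)) →
                   (∀ m n → m ≢ n → Empty (A m ∩ A n)) →
                   IsSup _≤_ (λ s → ∃[ n ] s ≈ sum {n} (λ i → μ (A (toℕ i))))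
                             (μ (⋃ ℕ A))

  -- A distribution on cuts, presented as the law of a random cut.
  record CuttingScheme (k : ℕ) : Set₂ where
    field
      space : ProbabilitySpace
    open ProbabilitySpace space public
    field
      cut            : Ω → Cut k
      cut-measurable : ∀ e n → Measurable (λ ω → CutsAtLeast (cut ω) e n)

  module _ (P : CuttingScheme k) where
    open CuttingScheme P

    -- Integrals of the simple functions below the number of cuts of e.  That
    -- number lies in ℕ ∪ {∞}, so natural-valued simple functions suffice.
    IsLowerSum : Segment k → Pred (ℝ ⁺) _
    IsLowerSum e v = ∃[ m ] Σ (Fin m → ℕ) λ n → Σ (Fin m → Pred Ω 0ℓ) λ A →
      (∀ i → Measurable (A i)) ×
      (∀ i j → i ≢ j → Empty (A i ∩ A j)) ×
      (∀ i → A i ⊆ λ ω → CutsAtLeast (cut ω) e (n i)) ×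
      v ≡ [ sum (λ i → n i · μ (A i)) ]

    -- The Lebesgue integral over Ω of the number of cuts of e.
    IsExpectedCuts : Segment k → Pred (ℝ ⁺) _
    IsExpectedCuts e = IsSup _≤⁺_ (IsLowerSum e)

    data IsDensity (e : Segment k) : Pred (ℝ ⁺) (lsuc 0ℓ) where
      finite   : ∀ {c} → IsExpectedCuts e [ c ] →
                 IsDensity e [ c * Segment.length e ⁻¹ ]
      infinite : IsExpectedCuts e ⊤⁺ → IsDensity e ⊤⁺

    IsMaximumDensity : Pred (ℝ ⁺) _
    IsMaximumDensity = IsSup _≤⁺_ (λ d → ∃[ e ] IsDensity e d)

  -- The property of being τₖ*.
  IsMinimumMaximumDensity : (k : ℕ) → Pred (ℝ ⁺) _
  IsMinimumMaximumDensity k =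
    IsInf _≤⁺_ (λ d → Σ (CuttingScheme k) λ P → IsMaximumDensity P d)

  ----------------------------------------------------------------------
  -- The ball/corner scheme

  data Line : Set where
    ac bd : Line

  centre : Line → ℝ → Point 3
  centre ac = lerp (2 ÷ 3 ∷ 1 ÷ 3 ∷ 0# ∷ []) (0# ∷ 2 ÷ 3 ∷ 1 ÷ 3 ∷ [])
  centre bd = lerp (2 ÷ 3 ∷ 0# ∷ 1 ÷ 3 ∷ []) (0# ∷ 1 ÷ 3 ∷ 2 ÷ 3 ∷ [])

  -- The side of the triangle opposite vertex j is hit by one ray of each of the
  -- lines x i = r i with i ≢ j, namely the ray along which x j decreases from
  -- r j to 0.  The two possible i are punchIn j applied to Fin 2.
  Ray : Point 3 → (side : Fin 3) → Fin 2 → Pred (Point 3) 0ℓ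
  Ray r j b x = x ∈ Δ × x (punchIn j b) ≈ r (punchIn j b) × x j ≤ r j

  -- The random choices made by the scheme: either the line and the parameter
  -- determining r and the ray selected on each side, or the terminal that is
  -- not chosen and ρ.
  data Choice : Set where
    ball   : (l : Line) (t : ℝ) (rays : Vec (Fin 2) 3) → Choice
    corner : (unchosen : Fin 3) (ρ : ℝ) → Choice

  -- The null events t = 0 and t = 1, in which rays run along the sides of the
  -- triangle, are excluded.
  Realises : Choice → Pred (Cut 3) 0ℓ
  Realises (ball l t rays) C = 0# < t × t < 1# ×
    (∀ x → x ∈ Boundary C ⇔ (∃[ j ] x ∈ Ray (centre l t) j (lookup rays j)))
  Realises (corner k ρ) C = 2 ÷ 3 < ρ × ρ ≤ 1# ×
    (∀ x → x ∈ Boundary C ⇔ (x ∈ Δ × ∃[ i ] i ≢ k × x i ≈ ρ))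

  BallUpTo : Line → Vec (Fin 2) 3 → ℝ → Pred Choice 0ℓ
  BallUpTo l rays u (ball l′ t rays′) = l′ ≡ l × rays′ ≡ rays × t ≤ u
  BallUpTo l rays u (corner _ _)      = ⊥

  CornerUpTo : Fin 3 → ℝ → Pred Choice 0ℓ
  CornerUpTo k u (ball _ _ _)  = ⊥
  CornerUpTo k u (corner k′ ρ) = k′ ≡ k × ρ ≤ u

  -- The joint law of the choices.  The segments a–c and b–d have equal length,
  -- so each carries r with probability 1/2; the three rays are independent fair
  -- choices, hence the factor 1/8.
  record IsBallCornerScheme (P : CuttingScheme 3) : Set₁ where
    open CuttingScheme P
    field
      choice   : Ω → Choice
      realises : ∀ ω → Realises (choice ω) (cut ω)

      ball-measurable   : ∀ l rays u → Measurable (choice ⊢ BallUpTo l rays u)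
      ball-law          : ∀ l rays u → 0# ≤ u → u ≤ 1# →
        μ (choice ⊢ BallUpTo l rays u) ≈ (8 ÷ 11) * (1 ÷ 2) * (1 ÷ 8) * u

      corner-measurable : ∀ k u → Measurable (choice ⊢ CornerUpTo k u)
      corner-law        : ∀ k u → 2 ÷ 3 ≤ u → u ≤ 1# →
        μ (choice ⊢ CornerUpTo k u) ≈
          (3 ÷ 11) * (1 ÷ 3) * ((u - 2 ÷ 3) * (1 ÷ 3) ⁻¹)

-- Off a null set of choices, a segment e meets each ray of a cut at most once, and the
-- number of cuts of e is the number of rays it meets.  The parameters for which it
-- meets a given ray form an interval.  The two rays which the line x i = r i sends to
-- the sides of the triangle are met for complementary parameters, since on that line
-- x j - r j and x k - r k have opposite signs, and each is selected with probability
-- 1/2.  So only the measure of the parameters with r i between the values of x i at the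
-- ends of e matters.  In each coordinate the two lines of centres cover the range
-- from 0 to 2/3, and the corner cuts the range from 2/3 to 1, at a rate of 6/11
-- throughout, so at most 6/11 sum |d i| = 12/11 |e| cuts are expected; equality holds on
-- the segment from (2/3,1/3,0) to (2/3,0,1/3).  If e runs along a line of centres,
-- the three lines x i = r i meet it in one point, and the number of cuts only drops.
--
-- A cut is known only through its boundary, but that determines its blocks: a point
-- which a segment joins to a vertex without meeting the boundary is in the block of
-- that vertex.
--
-- The scheme exists on a disjoint union of intervals, by Carathéodory's theorem.  The
-- set of parameters with at least n cuts is measurable, being a finite combination of
-- intervals up to finitely many points.

module Submission where

open import Algebra.Bundles using (CommutativeRing)
open import Axiom.ExcludedMiddle using (ExcludedMiddle)
open import Data.Bool.Base as Bool using (Bool; true; false; if_then_else_; _∧_; _∨_; not)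
open import Data.Empty using (⊥; ⊥-elim)
open import Data.Fin.Base using (Fin; zero; suc; toℕ; punchIn; opposite; punchOut)
open import Data.Fin.Patterns using (0F; 1F; 2F; 3F; 4F; 5F; 6F; 7F)
open import Data.List.Base using (List; []; _∷_; foldr; map; _++_; tabulate; concatMap; replicate; filter)
open import Data.List.Membership.Propositional.Properties using (∈-map⁺; ∈-++⁺ˡ; ∈-++⁺ʳ; ∈-map⁻; ∈-filter⁺; ∈-filter⁻)
open import Data.List.Properties using (≡-dec)
open import Data.List.Relation.Unary.All as All using (All; []; _∷_)
open import Data.List.Relation.Unary.AllPairs using ([]; _∷_)
open import Data.List.Relation.Unary.Any as Any using (Any; here; there)
open import Data.List.Relation.Unary.Any.Properties using (++⁺ˡ; ++⁺ʳ; tabulate⁺)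
open import Data.List.Relation.Unary.Unique.Propositional using (Unique)
open import Data.Nat.Base as ℕ using (ℕ; zero; suc)
open import Data.Product.Base using (_×_; _,_; proj₁; proj₂; ∃; ∃-syntax; Σ; Σ-syntax)
open import Data.Sum.Base using (_⊎_; inj₁; inj₂)
open import Data.Unit.Base using (⊤; tt)
open import Data.Vec.Base using (Vec; lookup; []; _∷_)
open import Defs
open import Function.Base using (_∘_)
open import Function.Bundles using (Equivalence; _⇔_; mk⇔)
open import Level using (0ℓ; Level) renaming (suc to lsuc)
open import Relation.Binary.Definitions using (tri<; tri≈; tri>; DecidableEquality)
open import Relation.Binary.PropositionalEquality.Core as ≡ using (_≡_; _≢_)
open import Relation.Binary.Structures using (IsTotalOrder)
open import Relation.Nullary.Construct.Add.Supremum using ([_]; ⊤⁺)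
open import Relation.Nullary.Decidable.Core using (yes; no; Dec; True; toWitness; fromWitness; from-yes; _→-dec_)
open import Relation.Nullary.Negation.Core using (¬_)
open import Relation.Unary using (Pred; _∈_; _⊆_; _≐_; U; ∅; ∁; ⋃; Empty; _∩_; _∪_; _⊢_)
import Algebra.Properties.CommutativeSemigroup as CommutativeSemigroupProperties
import Algebra.Properties.Monoid.Mult as Mult
import Algebra.Properties.Monoid.Sum as MonoidSum
import Algebra.Properties.Ring as RingProperties
import Algebra.Properties.Semiring.Mult as SemiringMult
import Algebra.Solver.Ring.NaturalCoefficients.Default as NaturalCoefficients
import Data.Fin.Properties as Fin
import Data.List.Membership.Propositional as List
import Data.List.Relation.Unary.All.Properties as All
import Data.List.Relation.Unary.Unique.DecPropositional as DecUnique
import Data.Nat.Properties as ℕ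
import Data.Vec.Functional as Vector
import Data.Vec.Properties as Vec
import Relation.Binary.Construct.Add.Supremum.NonStrict as AddSupremum
import Relation.Binary.Reasoning.Setoid as SetoidReasoning

-- The proportion of ball cuts to corner cuts is what makes the rates in the overview agree. If ball
-- cuts have probability p, each line of centres with each of the eight ray selections has density
-- p/16 in its parameter. A given ray belongs to four of the selections, and a coordinate of the
-- centre moves at speed 1/3 (or at 2/3, but then over the same range on both lines), so the rate is
-- 3p/4. Corner cuts give 2(1 - p). The two are equal exactly for p = 8/11, with value 6/11.
--
-- The obstacle in the upper bound is that an expectation is a supremum of lower sums, while at the
-- finitely many excepted parameters `e` may run along the boundary, and the analysis says nothing
-- about the number of its cuts there. A single lower sum, however, has a largest value N. Each
-- excepted parameter is enclosed in an event of probability at most ε which is made to count N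
-- times; the error is a fixed multiple of ε and vanishes in the limit.
--
-- Lower sums and schemes live in higher universes, but completeness concerns predicates in the
-- lowest one; excluded middle closes this gap.

private

  -- Ring identities for arithmetic with fractions.

  module RingIdentities (R : CommutativeRing 0ℓ 0ℓ) where
    open CommutativeRing R
    open RingProperties ring using (-‿involutive; -‿+-comm; -‿distribˡ-*; -‿distribʳ-*)
    open NaturalCoefficients commutativeSemiring

    scale-∷ : ∀ a b c d e → a * b * (c * d) + a * c * e ≈ a * c * (b * d + e)
    scale-∷ = solve 5 (λ a b c d e → a :* b :* (c :* d) :+ a :* c :* e := a :* c :* (b :* d :+ e)) refl

    -- The solver treats semirings only. Negatives are therefore given to it as atoms such as `- B`,
    -- after the rules of signs have been applied by hand. Here `D` and `E` stand for denominators
    -- and `i` and `j` for their inverses.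
    fraction-+ : ∀ A A′ B B′ D E i j → ((A * E + A′ * D) + (- (B * E + B′ * D))) * (i * j) ≈
      (A + (- B)) * i * (E * j) + (A′ + (- B′)) * j * (D * i)
    fraction-+ A A′ B B′ D E i j = trans
      (*-congʳ (+-congˡ (trans (sym (-‿+-comm _ _)) (+-cong (-‿distribˡ-* _ _) (-‿distribˡ-* _ _)))))
      (solve 8 (λ A A′ B B′ D E i j → ((A :* E :+ A′ :* D) :+ (B :* E :+ B′ :* D)) :* (i :* j) :=
         (A :+ B) :* i :* (E :* j) :+ (A′ :+ B′) :* j :* (D :* i)) refl A A′ (- B) (- B′) D E i j)

    fraction-* : ∀ A A′ B B′ i j → ((A * A′ + B * B′) + (- (A * B′ + B * A′))) * (i * j) ≈
      (A + (- B)) * i * ((A′ + (- B′)) * j)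
    fraction-* A A′ B B′ i j = trans
      (*-congʳ (+-cong (+-congˡ (trans (sym (-‿involutive _))
          (trans (-‿cong (-‿distribˡ-* _ _)) (-‿distribʳ-* _ _))))
        (trans (sym (-‿+-comm _ _)) (+-cong (-‿distribʳ-* _ _) (-‿distribˡ-* _ _)))))
      (solve 6 (λ A A′ B B′ i j → ((A :* A′ :+ B :* B′) :+ (A :* B′ :+ B :* A′)) :* (i :* j) :=
         (A :+ B) :* i :* ((A′ :+ B′) :* j)) refl A A′ (- B) (- B′) i j)

    fraction-neg : ∀ A B i → (B + (- A)) * i ≈ - ((A + (- B)) * i)
    fraction-neg A B i = trans (*-congʳ (trans (+-comm _ _) (trans (+-congˡ (sym (-‿involutive B)))
      (-‿+-comm _ _)))) (sym (-‿distribˡ-* _ _))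

    telescope : ∀ a o b → ((a + (- o)) + o) + (- b) ≈ (a + (- (o + b))) + o
    telescope a o b = trans
      (solve 4 (λ a o n b → ((a :+ n) :+ o) :+ b := (a :+ (n :+ b)) :+ o) refl a o (- o) (- b))
      (+-congʳ (+-congˡ (-‿+-comm _ _)))

-- Linear (and polynomial) arithmetic over an ordered field, by reflection: an
-- inequality between polynomials is verified as a nonnegative combination of
-- given ones plus a nonnegative constant (Farkas' lemma).
module LinearArithmetic (𝓡 : CompleteOrderedField) where
  open CompleteOrderedField 𝓡
  open RingProperties ring using (-0#≈0#; -‿involutive; -1*x≈-x; -‿distribˡ-*; -‿distribʳ-*)
  open SetoidReasoning setoid
  open RingIdentities commutativeRing

  private
    module * = CommutativeSemigroupProperties *-commutativeSemigroup
    module + = CommutativeSemigroupProperties +-commutativeSemigroup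

  private module ≤ = IsTotalOrder isTotalOrder

  <-irrefl : ∀ {x} → x < x → ⊥
  <-irrefl p = proj₂ p refl

  ≤-resp-≈ : ∀ {a b c d} → a ≈ c → b ≈ d → a ≤ b → c ≤ d
  ≤-resp-≈ p q r = ≤.trans (≤.reflexive (sym p)) (≤.trans r (≤.reflexive q))

  +-mono-≤ : ∀ {a b c d} → a ≤ b → c ≤ d → a + c ≤ b + d
  +-mono-≤ {a} {b} {c} {d} p q = ≤.trans (+-monoˡ-≤ c p)
    (≤-resp-≈ (+-comm c b) (+-comm d b) (+-monoˡ-≤ b q))

  0≤x+y : ∀ {x y} → 0# ≤ x → 0# ≤ y → 0# ≤ x + y
  0≤x+y p q = ≤-resp-≈ (+-identityˡ 0#) refl (+-mono-≤ p q)

  x≤y⇒0≤y-x : ∀ {x y} → x ≤ y → 0# ≤ y - x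
  x≤y⇒0≤y-x {x} p = ≤-resp-≈ (-‿inverseʳ x) refl (+-monoˡ-≤ (- x) p)

  y-x+x≈y : ∀ x y → (y - x) + x ≈ y
  y-x+x≈y x y = trans (+-assoc y (- x) x) (trans (+-congˡ (-‿inverseˡ x)) (+-identityʳ y))

  0≤y-x⇒x≤y : ∀ {x y} → 0# ≤ y - x → x ≤ y
  0≤y-x⇒x≤y {x} {y} p = ≤-resp-≈ (+-identityˡ x) (y-x+x≈y x y) (+-monoˡ-≤ x p)

  y-x≈0⇒x≈y : ∀ {x y} → y - x ≈ 0# → x ≈ y
  y-x≈0⇒x≈y {x} {y} p = trans (sym (+-identityˡ x)) (trans (+-congʳ (sym p)) (y-x+x≈y x y))

  0≤1 : 0# ≤ 1#
  0≤1 with ≤.total 0# 1#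
  ... | inj₁ p = p
  ... | inj₂ p = ≤-resp-≈ refl
          (trans (-1*x≈-x (0# - 1#)) (trans (-‿cong (+-identityˡ _)) (-‿involutive 1#)))
          (*-nonNeg 0≤-1 (≤-resp-≈ refl refl (x≤y⇒0≤y-x p)))
    where
    0≤-1 : 0# ≤ - 1#
    0≤-1 = ≤-resp-≈ refl (+-identityˡ (- 1#)) (x≤y⇒0≤y-x p)

  0≤n : ∀ n → 0# ≤ n · 1#
  0≤n zero    = ≤.refl
  0≤n (suc n) = 0≤x+y 0≤1 (0≤n n)

  0≤x∧0<y⇒x+y≉0 : ∀ {x y} → 0# ≤ x → 0# ≤ y → ¬ (0# ≈ y) → ¬ (0# ≈ x + y)
  0≤x∧0<y⇒x+y≉0 {x} {y} p q y≉0 e = y≉0 (≤.antisym q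
    (≤-resp-≈ (+-identityˡ y) (sym e) (+-monoˡ-≤ y p)))

  1+n≉0 : ∀ n → ¬ (suc n · 1# ≈ 0#)
  1+n≉0 n e = 0≤x∧0<y⇒x+y≉0 (0≤n n) 0≤1 0≉1 (trans (sym e) (+-comm 1# _))

  inv : ℕ → ℝ
  inv d = (suc d · 1#) ⁻¹

  *-inv : ∀ d → (suc d · 1#) * inv d ≈ 1#
  *-inv d = *-inverseʳ (1+n≉0 d)

  x*y≈0⇒y≈0 : ∀ {x y} → ¬ (x ≈ 0#) → x * y ≈ 0# → y ≈ 0#
  x*y≈0⇒y≈0 {x} {y} x≉0 e = begin
    y               ≈⟨ *-identityˡ y ⟨
    1# * y          ≈⟨ *-congʳ (trans (*-comm _ _) (*-inverseʳ x≉0)) ⟨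
    x ⁻¹ * x * y    ≈⟨ *-assoc _ _ _ ⟩
    x ⁻¹ * (x * y)  ≈⟨ *-congˡ e ⟩
    x ⁻¹ * 0#       ≈⟨ zeroʳ _ ⟩
    0#              ∎

  0≤x⁻¹ : ∀ {x} → 0# ≤ x → ¬ (x ≈ 0#) → 0# ≤ x ⁻¹
  0≤x⁻¹ {x} p x≉0 with ≤.total 0# (x ⁻¹)
  ... | inj₁ q = q
  ... | inj₂ q = ⊥-elim (0≉1 (≤.antisym 0≤1 (0≤y-x⇒x≤y
        (≤-resp-≈ refl (trans (distribˡ x 0# (- (x ⁻¹)))
          (+-cong (zeroʳ x) (trans (sym (-‿distribʳ-* x _)) (-‿cong (*-inverseʳ x≉0)))))
          (*-nonNeg p (x≤y⇒0≤y-x q))))))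

  0≤inv : ∀ d → 0# ≤ inv d
  0≤inv d = 0≤x⁻¹ (0≤n (suc d)) (1+n≉0 d)

  inv-unique : ∀ d x → (suc d · 1#) * x ≈ 1# → x ≈ inv d
  inv-unique d x p = begin
    x                             ≈⟨ *-identityˡ x ⟨
    1# * x                        ≈⟨ *-congʳ (*-inv d) ⟨
    (suc d · 1#) * inv d * x      ≈⟨ *.xy∙z≈y∙xz _ _ _ ⟩
    inv d * ((suc d · 1#) * x)    ≈⟨ *-congˡ p ⟩
    inv d * 1#                    ≈⟨ *-identityʳ _ ⟩
    inv d                         ∎

  private
    nat-+ : ∀ m n → (m ℕ.+ n) · 1# ≈ m · 1# + n · 1#
    nat-+ = Mult.×-homo-+ +-monoid 1#

    nat-* : ∀ m n → (m ℕ.* n) · 1# ≈ (m · 1#) * (n · 1#)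
    nat-* = SemiringMult.×1-homo-* semiring

  -- (a , b , d) stands for (a - b) / (1 + d).
  record Coeff : Set where
    constructor coeff
    field pos neg den-1 : ℕ
  open Coeff

  ⟦_⟧ᶜ : Coeff → ℝ
  ⟦ coeff a b d ⟧ᶜ = (a · 1# - b · 1#) * inv d

  -- Chosen so that `suc (den* d e)` reduces to `suc d * suc e`: denominators are stored as
  -- predecessors, which excludes zero, and products must stay in this form.
  den* : ℕ → ℕ → ℕ
  den* d e = e ℕ.+ d ℕ.* suc e

  inv-den* : ∀ d e → inv d * inv e ≈ inv (den* d e)
  inv-den* d e = inv-unique (den* d e) _ (begin
    (suc (den* d e) · 1#) * (inv d * inv e)            ≈⟨ *-congʳ (nat-* (suc d) (suc e)) ⟩
    (suc d · 1#) * (suc e · 1#) * (inv d * inv e)      ≈⟨ *.interchange _ _ _ _ ⟩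
    ((suc d · 1#) * inv d) * ((suc e · 1#) * inv e)    ≈⟨ *-cong (*-inv d) (*-inv e) ⟩
    1# * 1#                                            ≈⟨ *-identityˡ 1# ⟩
    1#                                                 ∎)

  infixl 6 _+ᶜ_
  infixl 7 _*ᶜ_

  _+ᶜ_ _*ᶜ_ : Coeff → Coeff → Coeff
  coeff a b d +ᶜ coeff a′ b′ e =
    coeff (a ℕ.* suc e ℕ.+ a′ ℕ.* suc d) (b ℕ.* suc e ℕ.+ b′ ℕ.* suc d) (den* d e)
  coeff a b d *ᶜ coeff a′ b′ e =
    coeff (a ℕ.* a′ ℕ.+ b ℕ.* b′) (a ℕ.* b′ ℕ.+ b ℕ.* a′) (den* d e)

  -ᶜ_ : Coeff → Coeff
  -ᶜ coeff a b d = coeff b a d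

  +ᶜ-homo : ∀ p q → ⟦ p +ᶜ q ⟧ᶜ ≈ ⟦ p ⟧ᶜ + ⟦ q ⟧ᶜ
  +ᶜ-homo (coeff a b d) (coeff a′ b′ e) = begin
    ((a ℕ.* suc e ℕ.+ a′ ℕ.* suc d) · 1# - (b ℕ.* suc e ℕ.+ b′ ℕ.* suc d) · 1#) * inv (den* d e)
      ≈⟨ *-cong (+-cong (lem a a′) (-‿cong (lem b b′))) (sym (inv-den* d e)) ⟩
    ((A * E + A′ * D) - (B * E + B′ * D)) * (inv d * inv e)
      ≈⟨ fraction-+ A A′ B B′ D E (inv d) (inv e) ⟩
    (A - B) * inv d * (E * inv e) + (A′ - B′) * inv e * (D * inv d)
      ≈⟨ +-cong (*-congˡ (*-inv e)) (*-congˡ (*-inv d)) ⟩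
    (A - B) * inv d * 1# + (A′ - B′) * inv e * 1#
      ≈⟨ +-cong (*-identityʳ _) (*-identityʳ _) ⟩
    (A - B) * inv d + (A′ - B′) * inv e ∎
    where
    A = a · 1#
    B = b · 1#
    A′ = a′ · 1#
    B′ = b′ · 1#
    D = suc d · 1#
    E = suc e · 1#
    lem : ∀ m n → (m ℕ.* suc e ℕ.+ n ℕ.* suc d) · 1# ≈ (m · 1#) * E + (n · 1#) * D
    lem m n = trans (nat-+ (m ℕ.* suc e) (n ℕ.* suc d)) (+-cong (nat-* m (suc e)) (nat-* n (suc d)))

  *ᶜ-homo : ∀ p q → ⟦ p *ᶜ q ⟧ᶜ ≈ ⟦ p ⟧ᶜ * ⟦ q ⟧ᶜ
  *ᶜ-homo (coeff a b d) (coeff a′ b′ e) = begin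
    ((a ℕ.* a′ ℕ.+ b ℕ.* b′) · 1# - (a ℕ.* b′ ℕ.+ b ℕ.* a′) · 1#) * inv (den* d e)
      ≈⟨ *-cong (+-cong (lem a a′ b b′) (-‿cong (lem a b′ b a′))) (sym (inv-den* d e)) ⟩
    ((A * A′ + B * B′) - (A * B′ + B * A′)) * (inv d * inv e)
      ≈⟨ fraction-* A A′ B B′ (inv d) (inv e) ⟩
    (A - B) * inv d * ((A′ - B′) * inv e) ∎
    where
    A = a · 1#
    B = b · 1#
    A′ = a′ · 1#
    B′ = b′ · 1#
    lem : ∀ m n o p → (m ℕ.* n ℕ.+ o ℕ.* p) · 1# ≈ (m · 1#) * (n · 1#) + (o · 1#) * (p · 1#)
    lem m n o p = trans (nat-+ (m ℕ.* n) (o ℕ.* p)) (+-cong (nat-* m n) (nat-* o p))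

  -ᶜ-homo : ∀ p → ⟦ -ᶜ p ⟧ᶜ ≈ - ⟦ p ⟧ᶜ
  -ᶜ-homo (coeff a b d) = fraction-neg (a · 1#) (b · 1#) (inv d)

  -- A monomial is a sorted list of variables.
  Mono : Set
  Mono = List ℕ

  Poly : Set
  Poly = List (Coeff × Mono)

  Env : Set
  Env = List ℝ

  valueOf : Env → ℕ → ℝ
  valueOf []      _       = 0#
  valueOf (x ∷ ρ) zero    = x
  valueOf (x ∷ ρ) (suc n) = valueOf ρ n

  insertVar : ℕ → Mono → Mono
  insertVar i []      = i ∷ []
  insertVar i (j ∷ m) = if i ℕ.≤ᵇ j then i ∷ j ∷ m else j ∷ insertVar i m

  insertMono : Coeff → Mono → Poly → Poly
  insertMono c m [] = (c , m) ∷ []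
  insertMono c m ((c′ , m′) ∷ p) with ≡-dec ℕ._≟_ m m′
  ... | yes _ = (c +ᶜ c′ , m) ∷ p
  ... | no  _ = (c′ , m′) ∷ insertMono c m p

  infixl 6 _+ᵖ_
  infixl 7 _*ᵖ_

  _+ᵖ_ _*ᵖ_ : Poly → Poly → Poly
  []            +ᵖ q = q
  ((c , m) ∷ p) +ᵖ q = insertMono c m (p +ᵖ q)

  scale : Coeff → Mono → Poly → Poly
  scale c m []              = []
  scale c m ((c′ , m′) ∷ p) = insertMono (c *ᶜ c′) (foldr insertVar m′ m) (scale c m p)

  []            *ᵖ q = []
  ((c , m) ∷ p) *ᵖ q = scale c m q +ᵖ (p *ᵖ q)

  infix  9 _/1+_
  infix  8 ⊖_
  infixl 7 _⊗_
  infixl 6 _⊕_ _⊝_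

  -- m /1+ d is the fraction m / (1 + d); in m /1+ d ▸ c it is the factor with which
  -- the hypothesis c enters the combination.
  data Expr : Set where
    var         : ℕ → Expr
    _/1+_       : (m d : ℕ) → Expr
    𝟘 𝟙         : Expr
    ⊖_          : Expr → Expr
    _⊕_ _⊝_ _⊗_ : Expr → Expr → Expr

  normalise : Expr → Poly
  normalise (var i)  = (coeff 1 0 0 , i ∷ []) ∷ []
  normalise (m /1+ d) = (coeff m 0 d , []) ∷ []
  normalise 𝟘         = []
  normalise 𝟙         = (coeff 1 0 0 , []) ∷ []
  normalise (⊖ e)     = scale (coeff 0 1 0) [] (normalise e)
  normalise (e ⊕ f)   = normalise e +ᵖ normalise f
  normalise (e ⊝ f)   = normalise e +ᵖ scale (coeff 0 1 0) [] (normalise f)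
  normalise (e ⊗ f)   = normalise e *ᵖ normalise f

  isZero isNonNeg isPos : Coeff → Bool
  isZero   c = pos c ℕ.≡ᵇ neg c
  isNonNeg c = neg c ℕ.≤ᵇ pos c
  isPos    c = neg c ℕ.<ᵇ pos c

  allZero : Poly → Bool
  allZero []            = true
  allZero ((c , _) ∷ p) = isZero c ∧ allZero p

  -- Monomials that cancel are not removed from a polynomial but stay with a coefficient equal to
  -- zero, so every entry other than the constant one is tested for vanishing.
  constantWith : (Coeff → Bool) → Poly → Bool
  constantWith P []                = P (coeff 0 0 0)
  constantWith P ((c , [])    ∷ p) = P c ∧ allZero p
  constantWith P ((c , _ ∷ _) ∷ p) = isZero c ∧ constantWith P p

  infix 5.5 _⊑_ _⊏_ _≃_

  data Claim : Set where
    _⊑_ _⊏_ _≃_ : Expr → Expr → Claim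

  difference : Claim → Expr
  difference (l ⊑ r) = r ⊝ l
  difference (l ⊏ r) = r ⊝ l
  difference (l ≃ r) = r ⊝ l

  infix 5.2 _/1+_▸_ ▹_

  record Hypothesis : Set where
    constructor _/1+_▸_
    field
      factor   : ℕ
      divisor  : ℕ
      claim    : Claim
  open Hypothesis

  pattern ▹_ c = 1 /1+ 0 ▸ c

  combination : List Hypothesis → Expr
  combination []               = 𝟘
  combination (m /1+ d ▸ c ∷ hs) = m /1+ d ⊗ difference c ⊕ combination hs

  strict : List Hypothesis → Bool
  strict []                       = false
  strict (suc m /1+ d ▸ l ⊏ r ∷ hs) = true
  strict (_ ∷ hs)                 = strict hs

  equational : List Hypothesis → Bool
  equational []                   = true
  equational (m /1+ d ▸ l ≃ r ∷ hs) = equational hs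
  equational (_ ∷ hs)             = false

  check : List Hypothesis → Claim → Bool
  check hs c = decide c (normalise (difference c ⊝ combination hs))
    where
    decide : Claim → Poly → Bool
    decide (l ⊑ r) p = constantWith isNonNeg p
    -- Strictness comes either from the constant that remains or from a strict hypothesis entering
    -- with a nonzero factor.
    decide (l ⊏ r) p = constantWith isPos p ∨ (strict hs ∧ constantWith isNonNeg p)
    decide (l ≃ r) p = equational hs ∧ constantWith isZero p

  module _ (ρ : Env) where

    ⟦_⟧ᵐ : Mono → ℝ
    ⟦ [] ⟧ᵐ    = 1#
    ⟦ i ∷ m ⟧ᵐ = valueOf ρ i * ⟦ m ⟧ᵐ

    ⟦_⟧ᵖ : Poly → ℝ
    ⟦ [] ⟧ᵖ          = 0#
    ⟦ (c , m) ∷ p ⟧ᵖ = ⟦ c ⟧ᶜ * ⟦ m ⟧ᵐ + ⟦ p ⟧ᵖ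

    ⟦_⟧ : Expr → ℝ
    ⟦ var i ⟧  = valueOf ρ i
    ⟦ m /1+ d ⟧ = m ÷ suc d
    ⟦ 𝟘 ⟧      = 0#
    ⟦ 𝟙 ⟧      = 1#
    ⟦ ⊖ e ⟧    = - ⟦ e ⟧
    ⟦ e ⊕ f ⟧  = ⟦ e ⟧ + ⟦ f ⟧
    ⟦ e ⊝ f ⟧  = ⟦ e ⟧ - ⟦ f ⟧
    ⟦ e ⊗ f ⟧  = ⟦ e ⟧ * ⟦ f ⟧

    Holds : Claim → Set
    Holds (l ⊑ r) = ⟦ l ⟧ ≤ ⟦ r ⟧
    Holds (l ⊏ r) = ⟦ l ⟧ < ⟦ r ⟧
    Holds (l ≃ r) = ⟦ l ⟧ ≈ ⟦ r ⟧

    AllHold : List Hypothesis → Set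
    AllHold []       = ⊤
    AllHold (h ∷ hs) = Holds (claim h) × AllHold hs

  private
    module Soundness (ρ : Env) where
      ev : Expr → ℝ
      ev = ⟦_⟧ ρ
      evᵐ : Mono → ℝ
      evᵐ = ⟦_⟧ᵐ ρ
      evᵖ : Poly → ℝ
      evᵖ = ⟦_⟧ᵖ ρ

      insertVar-sound : ∀ i m → evᵐ (insertVar i m) ≈ valueOf ρ i * evᵐ m
      insertVar-sound i [] = refl
      insertVar-sound i (j ∷ m) with i ℕ.≤ᵇ j
      ... | true  = refl
      ... | false = trans (*-congˡ (insertVar-sound i m)) (*.x∙yz≈y∙xz (valueOf ρ j) (valueOf ρ i) (evᵐ m))

      mono-* : ∀ m m′ → evᵐ (foldr insertVar m′ m) ≈ evᵐ m * evᵐ m′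
      mono-* []      m′ = sym (*-identityˡ _)
      mono-* (i ∷ m) m′ = trans (insertVar-sound i (foldr insertVar m′ m))
        (trans (*-congˡ (mono-* m m′)) (sym (*-assoc _ _ _)))

      insertMono-sound : ∀ c m p → evᵖ (insertMono c m p) ≈ ⟦ c ⟧ᶜ * evᵐ m + evᵖ p
      insertMono-sound c m [] = refl
      insertMono-sound c m ((c′ , m′) ∷ p) with ≡-dec ℕ._≟_ m m′
      ... | yes ≡.refl = trans (+-congʳ (trans (*-congʳ (+ᶜ-homo c c′)) (distribʳ _ _ _)))
                           (+-assoc _ _ _)
      ... | no _ = trans (+-congˡ (insertMono-sound c m p)) (+.x∙yz≈y∙xz _ _ _)

      +ᵖ-sound : ∀ p q → evᵖ (p +ᵖ q) ≈ evᵖ p + evᵖ q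
      +ᵖ-sound []            q = sym (+-identityˡ _)
      +ᵖ-sound ((c , m) ∷ p) q = trans (insertMono-sound c m (p +ᵖ q))
        (trans (+-congˡ (+ᵖ-sound p q)) (sym (+-assoc _ _ _)))

      scale-sound : ∀ c m p → evᵖ (scale c m p) ≈ ⟦ c ⟧ᶜ * evᵐ m * evᵖ p
      scale-sound c m [] = sym (zeroʳ _)
      scale-sound c m ((c′ , m′) ∷ p) = begin
        evᵖ (insertMono (c *ᶜ c′) (foldr insertVar m′ m) (scale c m p))
          ≈⟨ insertMono-sound _ _ (scale c m p) ⟩
        ⟦ c *ᶜ c′ ⟧ᶜ * evᵐ (foldr insertVar m′ m) + evᵖ (scale c m p)
          ≈⟨ +-cong (*-cong (*ᶜ-homo c c′) (mono-* m m′)) (scale-sound c m p) ⟩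
        ⟦ c ⟧ᶜ * ⟦ c′ ⟧ᶜ * (evᵐ m * evᵐ m′) + ⟦ c ⟧ᶜ * evᵐ m * evᵖ p
          ≈⟨ scale-∷ ⟦ c ⟧ᶜ ⟦ c′ ⟧ᶜ (evᵐ m) (evᵐ m′) (evᵖ p) ⟩
        ⟦ c ⟧ᶜ * evᵐ m * (⟦ c′ ⟧ᶜ * evᵐ m′ + evᵖ p) ∎

      *ᵖ-sound : ∀ p q → evᵖ (p *ᵖ q) ≈ evᵖ p * evᵖ q
      *ᵖ-sound []            q = sym (zeroˡ _)
      *ᵖ-sound ((c , m) ∷ p) q = trans (+ᵖ-sound (scale c m q) (p *ᵖ q))
        (trans (+-cong (scale-sound c m q) (*ᵖ-sound p q)) (sym (distribʳ _ _ _)))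

      coeff-ℕ : ∀ m d → ⟦ coeff m 0 d ⟧ᶜ ≈ m ÷ suc d
      coeff-ℕ m d = *-congʳ (trans (+-congˡ -0#≈0#) (+-identityʳ _))

      coeff-1 : ⟦ coeff 1 0 0 ⟧ᶜ ≈ 1#
      coeff-1 = trans (coeff-ℕ 1 0) (*-inv 0)

      coeff--1 : ∀ x → ⟦ coeff 0 1 0 ⟧ᶜ * 1# * x ≈ - x
      coeff--1 x = trans (*-congʳ (trans (*-identityʳ _) (trans (-ᶜ-homo (coeff 1 0 0)) (-‿cong coeff-1))))
        (-1*x≈-x x)

      normalise-sound : ∀ e → evᵖ (normalise e) ≈ ev e
      normalise-sound (var i)   = trans (+-identityʳ _) (trans (*-cong coeff-1 (*-identityʳ _)) (*-identityˡ _))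
      normalise-sound (m /1+ d) = trans (+-identityʳ _) (trans (*-identityʳ _) (coeff-ℕ m d))
      normalise-sound 𝟘         = refl
      normalise-sound 𝟙         = trans (+-identityʳ _) (trans (*-identityʳ _) coeff-1)
      normalise-sound (⊖ e)     = trans (scale-sound _ [] (normalise e))
        (trans (coeff--1 _) (-‿cong (normalise-sound e)))
      normalise-sound (e ⊕ f)   = trans (+ᵖ-sound (normalise e) (normalise f))
        (+-cong (normalise-sound e) (normalise-sound f))
      normalise-sound (e ⊝ f)   = trans (+ᵖ-sound (normalise e) _) (+-cong (normalise-sound e)
        (trans (scale-sound _ [] (normalise f)) (trans (coeff--1 _) (-‿cong (normalise-sound f)))))
      normalise-sound (e ⊗ f)   = trans (*ᵖ-sound (normalise e) (normalise f))
        (*-cong (normalise-sound e) (normalise-sound f))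

      T-∧ˡ : ∀ {a b} → Bool.T (a ∧ b) → Bool.T a
      T-∧ˡ {true} _ = tt

      T-∧ʳ : ∀ {a b} → Bool.T (a ∧ b) → Bool.T b
      T-∧ʳ {true} p = p

      ≥⇒nonNeg : ∀ {m n} → n ℕ.≤ m → 0# ≤ m · 1# - n · 1#
      ≥⇒nonNeg {m} ℕ.z≤n = ≤-resp-≈ refl (sym (trans (+-congˡ -0#≈0#) (+-identityʳ _))) (0≤n m)
      ≥⇒nonNeg {suc m} {suc n} (ℕ.s≤s p) = x≤y⇒0≤y-x
        (+-mono-≤ ≤.refl (0≤y-x⇒x≤y (≥⇒nonNeg p)))

      zero-sound : ∀ c → Bool.T (isZero c) → ⟦ c ⟧ᶜ ≈ 0#
      zero-sound (coeff a b d) t with ℕ.≡ᵇ⇒≡ a b t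
      ... | ≡.refl = trans (*-congʳ (-‿inverseʳ _)) (zeroˡ _)

      nonNeg-sound : ∀ c → Bool.T (isNonNeg c) → 0# ≤ ⟦ c ⟧ᶜ
      nonNeg-sound (coeff a b d) t = *-nonNeg (≥⇒nonNeg (ℕ.≤ᵇ⇒≤ b a t)) (0≤inv d)

      1+m/≉0 : ∀ m d → ¬ (suc m ÷ suc d ≈ 0#)
      1+m/≉0 m d e = 0≉1 (trans (sym (zeroʳ (suc d · 1#)))
        (trans (*-congˡ (sym (x*y≈0⇒y≈0 (1+n≉0 m) e))) (*-inv d)))

      pos-sound : ∀ c → Bool.T (isPos c) → ¬ (0# ≈ ⟦ c ⟧ᶜ) × 0# ≤ ⟦ c ⟧ᶜ
      pos-sound (coeff a b d) t = ne , *-nonNeg (≥⇒nonNeg (ℕ.<⇒≤ b<a)) (0≤inv d)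
        where
        b<a : b ℕ.< a
        b<a = ℕ.<ᵇ⇒< b a t
        ne : ¬ (0# ≈ (a · 1# - b · 1#) * inv d)
        ne e = 0≤x∧0<y⇒x+y≉0 (≥⇒nonNeg b<a) 0≤1 0≉1 (begin
          0#                              ≈⟨ trans (sym (zeroˡ _)) (trans (*-congʳ e) (trans (*-assoc _ _ _)
                                               (trans (*-congˡ (trans (*-comm _ _) (*-inv d))) (*-identityʳ _)))) ⟩
          a · 1# - b · 1#                 ≈⟨ trans (+-congʳ (sym (y-x+x≈y 1# _))) (telescope (a · 1#) 1# (b · 1#)) ⟩
          (a · 1# - suc b · 1#) + 1#      ∎)

      constantWith-sound : ∀ P (Q : ℝ → Set) → (∀ {x y} → x ≈ y → Q x → Q y) →
        (∀ c → Bool.T (P c) → Q ⟦ c ⟧ᶜ) → ∀ p → Bool.T (constantWith P p) → Q (evᵖ p)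
      constantWith-sound P Q resp PQ [] t = resp (trans (*-congʳ (-‿inverseʳ _)) (zeroˡ _)) (PQ _ t)
      constantWith-sound P Q resp PQ ((c , []) ∷ p) t =
        resp (sym (trans (+-cong (*-identityʳ _) (rest p (T-∧ʳ {P c} t))) (+-identityʳ _))) (PQ c (T-∧ˡ {P c} t))
        where
        rest : ∀ p → Bool.T (allZero p) → evᵖ p ≈ 0#
        rest []             _ = refl
        rest ((c , m) ∷ p) t = trans (+-cong (trans (*-congʳ (zero-sound c (T-∧ˡ {isZero c} t))) (zeroˡ _))
          (rest p (T-∧ʳ {isZero c} t))) (+-identityˡ _)
      constantWith-sound P Q resp PQ ((c , _ ∷ _) ∷ p) t =
        resp (sym (trans (+-congʳ (trans (*-congʳ (zero-sound c (T-∧ˡ {isZero c} t))) (zeroˡ _))) (+-identityˡ _)))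
          (constantWith-sound P Q resp PQ p (T-∧ʳ {isZero c} t))

      difference-nonNeg : ∀ c → Holds ρ c → 0# ≤ ev (difference c)
      difference-nonNeg (l ⊑ r) h = x≤y⇒0≤y-x h
      difference-nonNeg (l ⊏ r) h = x≤y⇒0≤y-x (proj₁ h)
      difference-nonNeg (l ≃ r) h = x≤y⇒0≤y-x (≤.reflexive h)

      combination-nonNeg : ∀ hs → AllHold ρ hs → 0# ≤ ev (combination hs)
      combination-nonNeg [] _ = ≤.refl
      combination-nonNeg (m /1+ d ▸ c ∷ hs) (h , hs′) =
        0≤x+y (*-nonNeg (*-nonNeg (0≤n m) (0≤inv d)) (difference-nonNeg c h)) (combination-nonNeg hs hs′)

      x≉0∨y≉0⇒x+y≉0 : ∀ {x y} → 0# ≤ x → 0# ≤ y → ¬ (0# ≈ x) ⊎ ¬ (0# ≈ y) → ¬ (0# ≈ x + y)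
      x≉0∨y≉0⇒x+y≉0 p q (inj₁ n) e = 0≤x∧0<y⇒x+y≉0 q p n (trans e (+-comm _ _))
      x≉0∨y≉0⇒x+y≉0 p q (inj₂ n) e = 0≤x∧0<y⇒x+y≉0 p q n e

      strict-sound : ∀ hs → Bool.T (strict hs) → AllHold ρ hs → ¬ (0# ≈ ev (combination hs))
      strict-sound (m /1+ d ▸ c ∷ hs) t (h , hs′) =
        x≉0∨y≉0⇒x+y≉0 (*-nonNeg (*-nonNeg (0≤n m) (0≤inv d)) (difference-nonNeg c h))
          (combination-nonNeg hs hs′) (split m c h t)
        where
        split : ∀ m c → Holds ρ c → Bool.T (strict (m /1+ d ▸ c ∷ hs)) →
                ¬ (0# ≈ (m ÷ suc d) * ev (difference c)) ⊎ ¬ (0# ≈ ev (combination hs))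
        split zero    c       h t = inj₂ (strict-sound hs t hs′)
        split (suc m) (l ⊑ r) h t = inj₂ (strict-sound hs t hs′)
        split (suc m) (l ≃ r) h t = inj₂ (strict-sound hs t hs′)
        split (suc m) (l ⊏ r) h t = inj₁ λ e →
          proj₂ h (y-x≈0⇒x≈y (x*y≈0⇒y≈0 (1+m/≉0 m d) (sym e)))

      equational-sound : ∀ hs → Bool.T (equational hs) → AllHold ρ hs → ev (combination hs) ≈ 0#
      equational-sound [] _ _ = refl
      equational-sound (m /1+ d ▸ l ≃ r ∷ hs) t (h , hs′) = trans (+-cong
        (trans (*-congˡ (trans (+-congʳ (sym h)) (-‿inverseʳ _))) (zeroʳ _)) (equational-sound hs t hs′))
        (+-identityˡ 0#)

      remainder : ∀ hs c → evᵖ (normalise (difference c ⊝ combination hs)) + ev (combination hs) ≈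
                  ev (difference c)
      remainder hs c = trans (+-congʳ (normalise-sound (difference c ⊝ combination hs))) (y-x+x≈y _ _)

      T-∨ : ∀ {a b} → Bool.T (a ∨ b) → Bool.T a ⊎ Bool.T b
      T-∨ {true}  p = inj₁ p
      T-∨ {false} p = inj₂ p

      Q : ℝ → Set
      Q x = ¬ (0# ≈ x) × 0# ≤ x

      sound : ∀ c hs → Bool.T (check hs c) → AllHold ρ hs → Holds ρ c
      sound (l ⊑ r) hs t h = 0≤y-x⇒x≤y (≤-resp-≈ refl (remainder hs (l ⊑ r)) (0≤x+y
        (constantWith-sound isNonNeg (0# ≤_) (≤-resp-≈ refl) nonNeg-sound (normalise (difference (l ⊑ r) ⊝ combination hs)) t)
        (combination-nonNeg hs h)))
      sound (l ≃ r) hs t h = y-x≈0⇒x≈y (trans (sym (remainder hs (l ≃ r))) (trans (+-cong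
        (constantWith-sound isZero (_≈ 0#) (λ e → trans (sym e)) zero-sound
          (normalise (difference (l ≃ r) ⊝ combination hs)) (T-∧ʳ {equational hs} t))
        (equational-sound hs (T-∧ˡ t) h)) (+-identityˡ 0#)))
      sound (l ⊏ r) hs t h = either (T-∨ {constantWith isPos p} t)
        where
        p : Poly
        p = normalise (difference (l ⊏ r) ⊝ combination hs)
        conclude : 0# ≤ evᵖ p → ¬ (0# ≈ evᵖ p) ⊎ ¬ (0# ≈ ev (combination hs)) → ev l < ev r
        conclude 0≤p ne = 0≤y-x⇒x≤y (≤-resp-≈ refl (remainder hs (l ⊏ r)) (0≤x+y 0≤p (combination-nonNeg hs h))) ,
          λ e → x≉0∨y≉0⇒x+y≉0 0≤p (combination-nonNeg hs h) ne
            (trans (sym (trans (+-congʳ (sym e)) (-‿inverseʳ _))) (sym (remainder hs (l ⊏ r))))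
        fromPos : Bool.T (constantWith isPos p) → ev l < ev r
        fromPos t = conclude (proj₂ q) (inj₁ (proj₁ q))
          where
          q : Q (evᵖ p)
          q = constantWith-sound isPos Q (λ e q → (λ z → proj₁ q (trans z (sym e))) , ≤-resp-≈ refl e (proj₂ q))
                pos-sound p t
        fromStrict : Bool.T (strict hs ∧ constantWith isNonNeg p) → ev l < ev r
        fromStrict t = conclude (constantWith-sound isNonNeg (0# ≤_) (≤-resp-≈ refl) nonNeg-sound p (T-∧ʳ {strict hs} t))
          (inj₂ (strict-sound hs (T-∧ˡ t) h))
        either : Bool.T (constantWith isPos p) ⊎ Bool.T (strict hs ∧ constantWith isNonNeg p) → ev l < ev r
        either (inj₁ u) = fromPos u
        either (inj₂ u) = fromStrict u

  -- The factors in a certificate are rational constants. Nonlinear steps are possible because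
  -- hypotheses may be polynomial: a product with a variable is supplied as a hypothesis of its own,
  -- obtained from `*-nonNeg`, `*-pos` or `*-congᵗ`. The hidden argument is the outcome of the check
  -- and is filled in by computation.
  lin : ∀ ρ c hs {_ : Bool.T (check hs c)} → AllHold ρ hs → Holds ρ c
  lin ρ c hs {t} h = Soundness.sound ρ c hs t h

  pattern x₀ = var 0
  pattern x₁ = var 1
  pattern x₂ = var 2
  pattern x₃ = var 3
  pattern x₄ = var 4
  pattern x₅ = var 5
  pattern x₆ = var 6
  pattern x₇ = var 7
  pattern x₈ = var 8
  pattern x₉ = var 9

-- Order, suprema, continuous induction and clamping in the real numbers.

module RealNumbers (em : ∀ {ℓ} → ExcludedMiddle ℓ) (𝓡 : CompleteOrderedField) where
  open CompleteOrderedField 𝓡 hiding (zero)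
  open LinearArithmetic 𝓡

  private variable
    ℓ : Level

  by-contradiction : {P : Set ℓ} → (¬ P → ⊥) → P
  by-contradiction {P = P} h with em {P = P}
  ... | yes p = p
  ... | no ¬p = ⊥-elim (h ¬p)

  -- Excluded middle resizes every proposition to the lowest universe.
  Small : Set ℓ → Set
  Small P = True (em {P = P})

  small : {P : Set ℓ} → P → Small P
  small = fromWitness

  large : {P : Set ℓ} → Small P → P
  large = toWitness

  ≤-reflexive : ∀ {x y} → x ≈ y → x ≤ y
  ≤-reflexive = IsTotalOrder.reflexive isTotalOrder

  ≤-refl : ∀ {x} → x ≤ x
  ≤-refl = ≤-reflexive refl

  ≤-antisym : ∀ {x y} → x ≤ y → y ≤ x → x ≈ y
  ≤-antisym = IsTotalOrder.antisym isTotalOrder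

  ≤-trans : ∀ {x y z} → x ≤ y → y ≤ z → x ≤ z
  ≤-trans {x} {y} {z} p q = lin (x ∷ z ∷ y ∷ []) (x₀ ⊑ x₁) (▹ x₀ ⊑ x₂ ∷ ▹ x₂ ⊑ x₁ ∷ []) (p , q , tt)

  ≤-<-trans : ∀ {x y z} → x ≤ y → y < z → x < z
  ≤-<-trans {x} {y} {z} p q = lin (x ∷ z ∷ y ∷ []) (x₀ ⊏ x₁) (▹ x₀ ⊑ x₂ ∷ ▹ x₂ ⊏ x₁ ∷ []) (p , q ,
    tt)

  <-≤-trans : ∀ {x y z} → x < y → y ≤ z → x < z
  <-≤-trans {x} {y} {z} p q = lin (x ∷ z ∷ y ∷ []) (x₀ ⊏ x₁) (▹ x₀ ⊏ x₂ ∷ ▹ x₂ ⊑ x₁ ∷ []) (p , q ,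
    tt)

  <-trans : ∀ {x y z} → x < y → y < z → x < z
  <-trans {x} {y} {z} p q = lin (x ∷ z ∷ y ∷ []) (x₀ ⊏ x₁) (▹ x₀ ⊏ x₂ ∷ ▹ x₂ ⊏ x₁ ∷ []) (p , q , tt)

  <⇒≤ : ∀ {x y} → x < y → x ≤ y
  <⇒≤ = proj₁

  ≤-<-connex : ∀ x y → x ≤ y ⊎ y < x
  ≤-<-connex x y with em {P = x ≤ y} | IsTotalOrder.total isTotalOrder x y
  ... | yes p | _      = inj₁ p
  ... | no ¬p | inj₁ p = inj₁ p
  ... | no ¬p | inj₂ q = inj₂ (q , λ e → ¬p (≤-reflexive (sym e)))

  ≤∧≉⇒< : ∀ {x y} → x ≤ y → ¬ (x ≈ y) → x < y
  ≤∧≉⇒< = _,_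

  ≰⇒> : ∀ {x y} → ¬ (x ≤ y) → y < x
  ≰⇒> {x} {y} n with ≤-<-connex x y
  ... | inj₁ p = ⊥-elim (n p)
  ... | inj₂ q = q

  ≮⇒≥ : ∀ {x y} → ¬ (x < y) → y ≤ x
  ≮⇒≥ {x} {y} n with ≤-<-connex y x
  ... | inj₁ p = p
  ... | inj₂ q = ⊥-elim (n q)

  compare : ∀ x y → x < y ⊎ x ≈ y ⊎ y < x
  compare x y with em {P = x ≈ y} | ≤-<-connex x y
  ... | yes e | _      = inj₂ (inj₁ e)
  ... | no ne | inj₁ p = inj₁ (p , ne)
  ... | no ne | inj₂ q = inj₂ (inj₂ q)

  >⇒≉ : ∀ {x y} → y < x → ¬ (x ≈ y)
  >⇒≉ p e = proj₂ p (sym e)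

  <⇒≉ : ∀ {x y} → x < y → ¬ (x ≈ y)
  <⇒≉ = proj₂

  *-congᵗ : ∀ c {a b} → a ≈ b → c * a ≈ c * b
  *-congᵗ c = *-congˡ

  *-monoˡ-nonNeg : ∀ {a b c} → 0# ≤ c → a ≤ b → c * a ≤ c * b
  *-monoˡ-nonNeg {a} {b} {c} p q = lin (c ∷ a ∷ b ∷ []) (x₀ ⊗ x₁ ⊑ x₀ ⊗ x₂) (▹ 𝟘 ⊑ x₀ ⊗ (x₂ ⊝ x₁) ∷
    []) (*-nonNeg p (x≤y⇒0≤y-x q) , tt)

  *-pos : ∀ {x y} → 0# < x → 0# < y → 0# < x * y
  *-pos {x} {y} (p , x≉0) (q , y≉0) =
    *-nonNeg p q , λ e → y≉0 (sym (x*y≈0⇒y≈0 (λ e′ → x≉0 (sym e′)) (sym e)))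

  x<y⇒0<y-x : ∀ {x y} → x < y → 0# < y - x
  x<y⇒0<y-x {x} {y} p = lin (y ∷ x ∷ []) (𝟘 ⊏ x₀ ⊝ x₁) (▹ x₁ ⊏ x₀ ∷ []) (p , tt)

  -‿anti-≤ : ∀ {x y} → x ≤ y → - y ≤ - x
  -‿anti-≤ {x} {y} p = lin (y ∷ x ∷ []) (⊖ x₀ ⊑ ⊖ x₁) (▹ x₁ ⊑ x₀ ∷ []) (p , tt)

  -‿anti-< : ∀ {x y} → x < y → - y < - x
  -‿anti-< {x} {y} p = lin (y ∷ x ∷ []) (⊖ x₀ ⊏ ⊖ x₁) (▹ x₁ ⊏ x₀ ∷ []) (p , tt)

  ⁻¹-pos : ∀ {x} → 0# < x → 0# < x ⁻¹
  ⁻¹-pos {x} p = 0≤x⁻¹ (proj₁ p) (>⇒≉ p) , λ e →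
    0≉1 (lin (x ∷ (x ⁻¹) ∷ []) (𝟘 ≃ 𝟙) (▹ x₀ ⊗ x₁ ≃ 𝟙 ∷ ▹ x₀ ⊗ 𝟘 ≃ x₀ ⊗ x₁ ∷ [])
      (*-inverseʳ (>⇒≉ p) , *-congᵗ x e , tt))

  x*x⁻¹≈1 : ∀ {x} → 0# < x → x * x ⁻¹ ≈ 1#
  x*x⁻¹≈1 p = *-inverseʳ (>⇒≉ p)

  half-pos : ∀ {ε} → 0# < ε → 0# < (1 ÷ 2) * ε
  half-pos {ε} p = lin (ε ∷ []) (𝟘 ⊏ 1 /1+ 1 ⊗ x₀) (1 /1+ 1 ▸ 𝟘 ⊏ x₀ ∷ []) (p , tt)

  divide : ∀ a {b} → ¬ (b ≈ 0#) → ∃[ q ] b * q ≈ a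
  divide a {b} b≉0 = a * b ⁻¹ , (lin (b ∷ a ∷ (b ⁻¹) ∷ []) (x₀ ⊗ (x₁ ⊗ x₂) ≃ x₁)
    (▹ x₁ ⊗ (x₀ ⊗ x₂) ≃ x₁ ⊗ 𝟙 ∷ []) (*-congᵗ a (*-inverseʳ b≉0) , tt))

  *-cancelˡ-≈ : ∀ {a b c} → ¬ (c ≈ 0#) → c * a ≈ c * b → a ≈ b
  *-cancelˡ-≈ {a} {b} {c} c≉0 e = lin (a ∷ b ∷ []) (x₀ ≃ x₁) (▹ x₀ ⊝ x₁ ≃ 𝟘 ∷ []) (d , tt)
    where
    d : a - b ≈ 0#
    d = x*y≈0⇒y≈0 c≉0 (lin (c ∷ a ∷ b ∷ []) (x₀ ⊗ (x₁ ⊝ x₂) ≃ 𝟘) (▹ x₀ ⊗ x₁ ≃ x₀ ⊗ x₂ ∷ []) (e , tt))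

  *-cancelˡ-< : ∀ {a b c} → 0# < c → c * a < c * b → a < b
  *-cancelˡ-< {a} {b} {c} p q with ≤-<-connex b a
  ... | inj₂ r = r
  ... | inj₁ r = ⊥-elim (<-irrefl (lin (c ∷ b ∷ a ∷ []) (𝟘 ⊏ 𝟘) (▹ x₀ ⊗ x₁ ⊑ x₀ ⊗ x₂ ∷ ▹ x₀ ⊗ x₂ ⊏ x₀ ⊗ x₁ ∷ [])
    (*-monoˡ-nonNeg (<⇒≤ p) r , q , tt)))

  -- Otherwise choose ε with `(K + 1#) * ε ≈ a - b`; then `a - b ≤ K * ε` is absurd. Dividing by
  -- `K + 1#` also serves the case that `K` is zero.
  ≤-by-ε : ∀ {a b} K → 0# ≤ K → (∀ ε → 0# < ε → a ≤ b + K * ε) → a ≤ b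
  ≤-by-ε {a} {b} K 0≤K h with ≤-<-connex a b
  ... | inj₁ p = p
  ... | inj₂ b<a = ⊥-elim (<-irrefl (lin (a ∷ b ∷ K ∷ ε ∷ []) (𝟘 ⊏ 𝟘) (▹ x₀ ⊑ x₁ ⊕ x₂ ⊗ x₃ ∷
    ▹ (x₂ ⊕ 𝟙) ⊗ x₃ ≃ x₀ ⊝ x₁ ∷ ▹ 𝟘 ⊏ x₃ ∷ []) (h ε 0<ε , e , 0<ε , tt)))
    where
    2K+1>0 : 0# < K + 1#
    2K+1>0 = lin (K ∷ []) (𝟘 ⊏ x₀ ⊕ 𝟙) (▹ 𝟘 ⊑ x₀ ∷ []) (0≤K , tt)
    ε : ℝ
    ε = proj₁ (divide (a - b) (>⇒≉ 2K+1>0))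
    e : (K + 1#) * ε ≈ a - b
    e = proj₂ (divide (a - b) (>⇒≉ 2K+1>0))
    0<ε : 0# < ε
    0<ε = *-cancelˡ-< 2K+1>0 (lin (K ∷ ε ∷ a ∷ b ∷ []) ((x₀ ⊕ 𝟙) ⊗ 𝟘 ⊏ (x₀ ⊕ 𝟙) ⊗ x₁)
      (▹ x₂ ⊝ x₃ ≃ (x₀ ⊕ 𝟙) ⊗ x₁ ∷ ▹ x₃ ⊏ x₂ ∷ []) (sym e , b<a , tt))

  open IsTotalOrder isTotalOrder using (total)

  x≤max : ∀ x y → x ≤ max x y
  x≤max x y with total y x
  ... | inj₁ p = ≤-refl
  ... | inj₂ p = p

  y≤max : ∀ x y → y ≤ max x y
  y≤max x y with total y x
  ... | inj₁ p = p
  ... | inj₂ p = ≤-refl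

  max-lub : ∀ {x y z} → x ≤ z → y ≤ z → max x y ≤ z
  max-lub {x} {y} p q with total y x
  ... | inj₁ _ = p
  ... | inj₂ _ = q

  max-lub-< : ∀ {x y z} → x < z → y < z → max x y < z
  max-lub-< {x} {y} p q with total y x
  ... | inj₁ _ = p
  ... | inj₂ _ = q

  abstract
    min : ℝ → ℝ → ℝ
    min x y = - max (- x) (- y)

    min≤x : ∀ x y → min x y ≤ x
    min≤x x y = lin (max (- x) (- y) ∷ x ∷ []) (⊖ x₀ ⊑ x₁) (▹ ⊖ x₁ ⊑ x₀ ∷ []) (x≤max (- x) (- y) ,
      tt)

    min≤y : ∀ x y → min x y ≤ y
    min≤y x y = lin (max (- x) (- y) ∷ y ∷ []) (⊖ x₀ ⊑ x₁) (▹ ⊖ x₁ ⊑ x₀ ∷ []) (y≤max (- x) (- y) ,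
      tt)

    min-glb : ∀ {x y z} → z ≤ x → z ≤ y → z ≤ min x y
    min-glb {x} {y} {z} p q = lin (z ∷ max (- x) (- y) ∷ []) (x₀ ⊑ ⊖ x₁) (▹ x₁ ⊑ ⊖ x₀ ∷ [])
      (max-lub (-‿anti-≤ p) (-‿anti-≤ q) , tt)

    min-glb-< : ∀ {x y z} → z < x → z < y → z < min x y
    min-glb-< {x} {y} {z} p q = lin (z ∷ max (- x) (- y) ∷ []) (x₀ ⊏ ⊖ x₁) (▹ x₁ ⊏ ⊖ x₀ ∷ [])
      (max-lub-< (-‿anti-< p) (-‿anti-< q) , tt)

  x≤∣x∣ : ∀ x → x ≤ ∣ x ∣
  x≤∣x∣ x = x≤max x (- x)

  -x≤∣x∣ : ∀ x → - x ≤ ∣ x ∣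
  -x≤∣x∣ x = y≤max x (- x)

  ∣x∣≤ : ∀ {x y} → x ≤ y → - x ≤ y → ∣ x ∣ ≤ y
  ∣x∣≤ = max-lub

  ∣x∣< : ∀ {x y} → x < y → - x < y → ∣ x ∣ < y
  ∣x∣< = max-lub-<

  0≤∣x∣ : ∀ x → 0# ≤ ∣ x ∣
  0≤∣x∣ x = lin (∣ x ∣ ∷ x ∷ []) (𝟘 ⊑ x₀) (1 /1+ 1 ▸ x₁ ⊑ x₀ ∷ 1 /1+ 1 ▸ ⊖ x₁ ⊑ x₀ ∷ []) (x≤∣x∣ x ,
    -x≤∣x∣ x , tt)

  ∣x∣≈x : ∀ {x} → 0# ≤ x → ∣ x ∣ ≈ x
  ∣x∣≈x {x} p = ≤-antisym (∣x∣≤ ≤-refl (lin (x ∷ []) (⊖ x₀ ⊑ x₀) (2 /1+ 0 ▸ 𝟘 ⊑ x₀ ∷ []) (p , tt))) (x≤∣x∣ x)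

  ∣x∣≈-x : ∀ {x} → x ≤ 0# → ∣ x ∣ ≈ - x
  ∣x∣≈-x {x} p = ≤-antisym (∣x∣≤ (lin (x ∷ []) (x₀ ⊑ ⊖ x₀) (2 /1+ 0 ▸ x₀ ⊑ 𝟘 ∷ []) (p , tt)) ≤-refl) (-x≤∣x∣ x)

  sumOver : {A : Set ℓ} → (A → ℝ) → List A → ℝ
  sumOver f []       = 0#
  sumOver f (x ∷ xs) = f x + sumOver f xs

  sumOver-++ : ∀ {A : Set ℓ} (f : A → ℝ) xs ys → sumOver f (xs ++ ys) ≈ sumOver f xs + sumOver f ys
  sumOver-++ f []       ys = sym (+-identityˡ _)
  sumOver-++ f (x ∷ xs) ys = trans (+-congˡ (sumOver-++ f xs ys)) (sym (+-assoc _ _ _))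

  IsInfimum : Pred ℝ ℓ → ℝ → Set ℓ
  IsInfimum = IsInf _≤_

  -- The set may lie in any universe, as that of the costs of covers and that of the maximum
  -- densities do. `Small` brings its reflection down to where `complete` applies.
  infimum : (S : Pred ℝ ℓ) → ∃ S → (∃[ b ] ∀ x → x ∈ S → b ≤ x) → ∃ (IsInfimum S)
  infimum S (x , x∈S) (b , b≤) = - s ,
    (λ y y∈S → (lin (s ∷ y ∷ []) (⊖ x₀ ⊑ x₁) (▹ ⊖ x₁ ⊑ x₀ ∷ [])
      (proj₁ s-sup (- y) (small (y , y∈S , refl)) , tt))) ,
    λ u u≤ → lin (u ∷ s ∷ []) (x₀ ⊑ ⊖ x₁) (▹ x₁ ⊑ ⊖ x₀ ∷ [])
      (proj₂ s-sup (- u) (λ z z∈ → above u u≤ z (large z∈)) , tt)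
    where
    -S : Pred ℝ 0ℓ
    -S z = Small (∃[ y ] y ∈ S × z ≈ - y)
    above : ∀ u → (∀ y → y ∈ S → u ≤ y) → ∀ z → (∃[ y ] y ∈ S × z ≈ - y) → z ≤ - u
    above u u≤ z (y , y∈S , e) = lin (z ∷ u ∷ y ∷ []) (x₀ ⊑ ⊖ x₁) (▹ x₀ ≃ ⊖ x₂ ∷ ▹ x₁ ⊑ x₂ ∷ [])
      (e , u≤ y y∈S , tt)
    supremum : ∃ (IsSup _≤_ -S)
    supremum = complete -S (- x , small (x , x∈S , refl)) (- b , λ z z∈ → above b b≤ z (large z∈))
    s : ℝ
    s = proj₁ supremum
    s-sup : IsSup _≤_ -S s
    s-sup = proj₂ supremum

  -- Continuous induction, which replaces both compactness (in the Heine-Borel argument) and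
  -- connectedness (of paths in the triangle). At the supremum `c` of the points reached, the local
  -- hypothesis leads from a point just before `c` to points beyond it, unless `b` comes first.
  real-induction : ∀ {a b} → a ≤ b → (Q : Pred ℝ 0ℓ) → Q a →
    (∀ c → a ≤ c → c ≤ b → ∃[ η ] 0# < η ×
      (∀ x y → a ≤ x → c - η < x → x ≤ c → c ≤ y → y < c + η → y ≤ b → Q x → Q y)) →
    Q b
  real-induction {a} {b} a≤b Q Qa step = conclude (≤-<-connex (c + η) b)
    where
    S : Pred ℝ 0ℓ
    S x = a ≤ x × x ≤ b × Q x
    supremum : ∃ (IsSup _≤_ S)
    supremum = complete S (a , ≤-refl , a≤b , Qa) (b , λ x x∈S → proj₁ (proj₂ x∈S))
    c : ℝ
    c = proj₁ supremum
    a≤c : a ≤ c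
    a≤c = proj₁ (proj₂ supremum) a (≤-refl , a≤b , Qa)
    c≤b : c ≤ b
    c≤b = proj₂ (proj₂ supremum) b (λ x x∈S → proj₁ (proj₂ x∈S))
    η : ℝ
    η = proj₁ (step c a≤c c≤b)
    0<η : 0# < η
    0<η = proj₁ (proj₂ (step c a≤c c≤b))
    near : ∃[ x ] x ∈ S × c - η < x
    near = by-contradiction λ n → <-irrefl (lin (η ∷ c ∷ []) (𝟘 ⊏ 𝟘) (▹ 𝟘 ⊏ x₀ ∷ ▹ x₁ ⊑ x₁ ⊝ x₀ ∷ []) (0<η ,
      proj₂ (proj₂ supremum) (c - η) (λ x x∈S → ≮⇒≥ λ p → n (x , x∈S , p)) , tt))
    jump : ∀ y → c ≤ y → y < c + η → y ≤ b → Q y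
    jump y c≤y y<c+η y≤b = let x , x∈S@(a≤x , _ , Qx) , c-η<x = near in
      proj₂ (proj₂ (step c a≤c c≤b)) x y a≤x c-η<x (proj₁ (proj₂ supremum) x x∈S) c≤y y<c+η y≤b Qx
    y : ℝ
    y = c + (1 ÷ 2) * η
    conclude : c + η ≤ b ⊎ b < c + η → Q b
    conclude (inj₂ p) = jump b c≤b p ≤-refl
    conclude (inj₁ p) = ⊥-elim (<-irrefl (lin (c ∷ η ∷ []) (𝟘 ⊏ 𝟘) (2 /1+ 0 ▸ x₀ ⊕ 1 /1+ 1 ⊗ x₁ ⊑ x₀ ∷
      ▹ 𝟘 ⊏ x₁ ∷ []) (proj₁ (proj₂ supremum) y (a≤y , y≤b , jump y c≤y y<c+η y≤b) , 0<η , tt)))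
      where
      c≤y : c ≤ y
      c≤y = lin (c ∷ η ∷ []) (x₀ ⊑ x₀ ⊕ 1 /1+ 1 ⊗ x₁) (1 /1+ 1 ▸ 𝟘 ⊏ x₁ ∷ []) (0<η , tt)
      a≤y : a ≤ y
      a≤y = lin (a ∷ c ∷ η ∷ []) (x₀ ⊑ x₁ ⊕ 1 /1+ 1 ⊗ x₂) (▹ x₀ ⊑ x₁ ∷ 1 /1+ 1 ▸ 𝟘 ⊏ x₂ ∷ []) (a≤c ,
        0<η , tt)
      y<c+η : y < c + η
      y<c+η = lin (c ∷ η ∷ []) (x₀ ⊕ 1 /1+ 1 ⊗ x₁ ⊏ x₀ ⊕ x₁) (1 /1+ 1 ▸ 𝟘 ⊏ x₁ ∷ []) (0<η , tt)
      y≤b : y ≤ b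
      y≤b = lin (c ∷ η ∷ b ∷ []) (x₀ ⊕ 1 /1+ 1 ⊗ x₁ ⊑ x₂) (▹ x₀ ⊕ x₁ ⊑ x₂ ∷ 1 /1+ 1 ▸ 𝟘 ⊏ x₁ ∷ [])
        (p , 0<η , tt)

  abstract
    -- For `a ≤ b` the projection onto the interval from `a` to `b`. Clamping both ends of an
    -- interval cuts it down to its part in the range of a parameter, without a case distinction on
    -- how the two overlap.
    clamp : ℝ → ℝ → ℝ → ℝ
    clamp a b x = max a (min b x)

    a≤clamp : ∀ a b x → a ≤ clamp a b x
    a≤clamp a b x = x≤max a (min b x)

    clamp≤b : ∀ {a b} x → a ≤ b → clamp a b x ≤ b
    clamp≤b {a} {b} x p = max-lub p (min≤x b x)

    clamp-mono : ∀ a b {x y} → x ≤ y → clamp a b x ≤ clamp a b y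
    clamp-mono a b {x} {y} p = max-lub (x≤max a (min b y))
      (≤-trans (min-glb (min≤x b x) (≤-trans (min≤y b x) p)) (y≤max a (min b y)))

    clamp-inside : ∀ {a b x} → a ≤ x → x ≤ b → clamp a b x ≈ x
    clamp-inside {a} {b} {x} p q = ≤-antisym (max-lub p (min≤y b x))
      (≤-trans (min-glb q ≤-refl) (y≤max a (min b x)))

    clamp-below : ∀ {a b x} → x ≤ a → clamp a b x ≈ a
    clamp-below {a} {b} {x} p = ≤-antisym (max-lub ≤-refl (≤-trans (min≤y b x) p)) (a≤clamp a b x)

    clamp-above : ∀ {a b x} → a ≤ b → b ≤ x → clamp a b x ≈ b
    clamp-above {a} {b} {x} p q = ≤-antisym (clamp≤b x p)
      (≤-trans (min-glb ≤-refl q) (y≤max a (min b x)))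

    clamp-< : ∀ {a z} b {x} → a < z → x < z → clamp a b x < z
    clamp-< {a} b {x} p q = max-lub-< p (≤-<-trans (min≤y b x) q)

    clamp-Lipschitz : ∀ {a b x y} → x ≤ y → clamp a b y - clamp a b x ≤ y - x
    clamp-Lipschitz {a} {b} {x} {y} p = lin (max a (min b y) ∷ clamp a b x ∷ y ∷ x ∷ [])
      (x₀ ⊝ x₁ ⊑ x₂ ⊝ x₃) (▹ x₀ ⊑ x₁ ⊕ (x₂ ⊝ x₃) ∷ [])
      (max-lub {a} {min b y} {clamp a b x + (y - x)} below inside , tt)
      where
      below : a ≤ clamp a b x + (y - x)
      below = lin (a ∷ max a (min b x) ∷ y ∷ x ∷ []) (x₀ ⊑ x₁ ⊕ (x₂ ⊝ x₃)) (▹ x₀ ⊑ x₁ ∷ ▹ x₃ ⊑ x₂ ∷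
        []) (x≤max a (min b x) , p , tt)
      inside : min b y ≤ clamp a b x + (y - x)
      inside = by-order (≤-<-connex b x)
        where
        by-order : b ≤ x ⊎ x < b → min b y ≤ clamp a b x + (y - x)
        by-order (inj₁ q) = lin (min b y ∷ max a (min b x) ∷ y ∷ x ∷ b ∷ min b x ∷ [])
          (x₀ ⊑ x₁ ⊕ (x₂ ⊝ x₃)) (▹ x₀ ⊑ x₄ ∷ ▹ x₅ ⊑ x₁ ∷ ▹ x₄ ⊑ x₅ ∷ ▹ x₃ ⊑ x₂ ∷ []) (min≤x b y ,
          y≤max a (min b x) , min-glb {b} {x} {b} ≤-refl q , p , tt)
        by-order (inj₂ q) = lin (min b y ∷ max a (min b x) ∷ y ∷ x ∷ min b x ∷ [])
          (x₀ ⊑ x₁ ⊕ (x₂ ⊝ x₃)) (▹ x₀ ⊑ x₂ ∷ ▹ x₄ ⊑ x₁ ∷ ▹ x₃ ⊑ x₄ ∷ []) (min≤y b y ,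
          y≤max a (min b x) , min-glb {b} {x} {x} (<⇒≤ q) ≤-refl , tt)

-- Carathéodory's theorem.

module MeasureTheory (em : ∀ {ℓ} → ExcludedMiddle ℓ) (𝓡 : CompleteOrderedField) where
  open CompleteOrderedField 𝓡 hiding (zero)
  open LinearArithmetic 𝓡
  open RealNumbers em 𝓡
  open Simplex 𝓡 using (ProbabilitySpace)

  Σ< : ℕ → (ℕ → ℝ) → ℝ
  Σ< n f = sum {n} (λ i → f (toℕ i))

  Σ<-mono : ∀ n {f g} → (∀ i → f i ≤ g i) → Σ< n f ≤ Σ< n g
  Σ<-mono zero    h = ≤-refl
  Σ<-mono (suc n) h = +-mono-≤ (h 0) (Σ<-mono n (h ∘ suc))

  Σ<-cong : ∀ n {f g} → (∀ i → f i ≈ g i) → Σ< n f ≈ Σ< n g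
  Σ<-cong zero    h = refl
  Σ<-cong (suc n) h = +-cong (h 0) (Σ<-cong n (h ∘ suc))

  Σ<-nonNeg : ∀ n {f} → (∀ i → 0# ≤ f i) → 0# ≤ Σ< n f
  Σ<-nonNeg zero    h = ≤-refl
  Σ<-nonNeg (suc n) h = 0≤x+y (h 0) (Σ<-nonNeg n (h ∘ suc))

  Σ<-+ : ∀ n f g → Σ< n (λ i → f i + g i) ≈ Σ< n f + Σ< n g
  Σ<-+ zero    f g = sym (+-identityˡ 0#)
  Σ<-+ (suc n) f g = lin (f 0 ∷ g 0 ∷ Σ< n (λ u → f (suc u) + g (suc u)) ∷ Σ< n (λ u → f (suc u)) ∷
    Σ< n (λ u → g (suc u)) ∷ []) (x₀ ⊕ x₁ ⊕ x₂ ≃ x₀ ⊕ x₃ ⊕ (x₁ ⊕ x₄)) (▹ x₂ ≃ x₃ ⊕ x₄ ∷ [])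
    (Σ<-+ n (λ i → f (suc i)) (λ i → g (suc i)) , tt)

  Σ<-monoˡ : ∀ {m n f} → (∀ i → 0# ≤ f i) → m ℕ.≤ n → Σ< m f ≤ Σ< n f
  Σ<-monoˡ {n = n} h ℕ.z≤n     = Σ<-nonNeg n h
  Σ<-monoˡ         h (ℕ.s≤s p) = +-mono-≤ ≤-refl (Σ<-monoˡ (h ∘ suc) p)

  Σ<-zero : ∀ n {f} → (∀ i → f i ≈ 0#) → Σ< n f ≈ 0#
  Σ<-zero zero    h = refl
  Σ<-zero (suc n) h = trans (+-cong (h 0) (Σ<-zero n (h ∘ suc))) (+-identityˡ 0#)

  term≤Σ< : ∀ {i n f} → (∀ i → 0# ≤ f i) → i ℕ.< n → f i ≤ Σ< n f
  term≤Σ< {zero} {suc n} {f} h _ = lin (f 0 ∷ Σ< n (λ u → f (suc u)) ∷ []) (x₀ ⊑ x₀ ⊕ x₁)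
    (▹ 𝟘 ⊑ x₁ ∷ []) (Σ<-nonNeg n (λ i → h (suc i)) , tt)
  term≤Σ< {suc i} {suc n} {f} h (ℕ.s≤s p) = lin (f (suc i) ∷ f 0 ∷ Σ< n (λ u → f (suc u)) ∷ [])
    (x₀ ⊑ x₁ ⊕ x₂) (▹ x₀ ⊑ x₂ ∷ ▹ 𝟘 ⊑ x₁ ∷ []) (term≤Σ< (λ i → h (suc i)) p , h 0 , tt)

  -- The sequence ε/2, ε/4, ε/8 and so on. Recursion on a halved ε lets the partial sums be bounded
  -- by induction without powers of two.
  halves : ℝ → ℕ → ℝ
  halves ε zero    = (1 ÷ 2) * ε
  halves ε (suc n) = halves ((1 ÷ 2) * ε) n

  halves-pos : ∀ {ε} n → 0# < ε → 0# < halves ε n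
  halves-pos zero    p = half-pos p
  halves-pos (suc n) p = halves-pos n (half-pos p)

  Σ<-halves : ∀ n {ε} → 0# < ε → Σ< n (halves ε) ≤ ε
  Σ<-halves zero    p = proj₁ p
  Σ<-halves (suc n) {ε} p = lin (ε ∷ Σ< n (halves (1 ÷ 2 * ε)) ∷ []) (1 /1+ 1 ⊗ x₀ ⊕ x₁ ⊑ x₀)
    (▹ x₁ ⊑ 1 /1+ 1 ⊗ x₀ ∷ []) (Σ<-halves n (half-pos p) , tt)

  pairing : {X : Set} → Pred X 0ℓ → Pred X 0ℓ → ℕ → Pred X 0ℓ
  pairing A B zero          = A
  pairing A B (suc zero)    = B
  pairing A B (suc (suc n)) = ∅

  ∪⊆⋃pairing : ∀ {X : Set} {A B : Pred X 0ℓ} → A ∪ B ⊆ ⋃ ℕ (pairing A B)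
  ∪⊆⋃pairing (inj₁ a) = 0 , a
  ∪⊆⋃pairing (inj₂ b) = 1 , b

  ⋃pairing⊆∪ : ∀ {X : Set} {A B : Pred X 0ℓ} → ⋃ ℕ (pairing A B) ⊆ A ∪ B
  ⋃pairing⊆∪ (0 , a) = inj₁ a
  ⋃pairing⊆∪ (1 , b) = inj₂ b

  -- The last hypothesis is countable subadditivity. A bound on all partial sums takes the place of
  -- the sum of the series, so that convergence is never discussed.
  module Carathéodory (X : Set) (ν : Pred X 0ℓ → ℝ)
    (ν-mono   : ∀ A B → A ⊆ B → ν A ≤ ν B)
    (ν-nonNeg : ∀ A → 0# ≤ ν A)
    (ν-∅      : ν ∅ ≈ 0#)
    (ν-⋃      : ∀ A s → (∀ n → Σ< n (ν ∘ A) ≤ s) → ν (⋃ ℕ A) ≤ s) where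

    private variable
      A B E : Pred X 0ℓ

    -- Carathéodory's criterion. The reverse inequality always holds by subadditivity, `ν-∪`.
    IsMeasurable : Pred X 0ℓ → Set (lsuc 0ℓ)
    IsMeasurable A = ∀ E → ν (E ∩ A) + ν (E ∩ ∁ A) ≤ ν E

    ν-∪ : ∀ A B → ν (A ∪ B) ≤ ν A + ν B
    ν-∪ A B = ≤-trans (ν-mono _ _ ∪⊆⋃pairing) (ν-⋃ (pairing A B) _ bound)
      where
      bound : ∀ n → Σ< n (ν ∘ pairing A B) ≤ ν A + ν B
      bound 0 = 0≤x+y (ν-nonNeg A) (ν-nonNeg B)
      bound 1 = lin (ν A ∷ ν B ∷ []) (x₀ ⊕ 𝟘 ⊑ x₀ ⊕ x₁) (▹ 𝟘 ⊑ x₁ ∷ []) (ν-nonNeg B , tt)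
      bound (suc (suc n)) = lin (ν A ∷ ν B ∷ Σ< n (λ _ → ν ∅) ∷ []) (x₀ ⊕ (x₁ ⊕ x₂) ⊑ x₀ ⊕ x₁)
        (▹ x₂ ≃ 𝟘 ∷ []) (Σ<-zero n (λ _ → ν-∅) , tt)

    measurable-≐ : A ≐ B → IsMeasurable A → IsMeasurable B
    measurable-≐ (A⊆B , B⊆A) mA E = ≤-trans
      (+-mono-≤ (ν-mono _ _ λ (e , b) → e , B⊆A b) (ν-mono _ _ λ (e , ¬b) → e , λ a → ¬b (A⊆B a))) (mA E)

    measurable-∁ : IsMeasurable A → IsMeasurable (∁ A)
    measurable-∁ mA E = ≤-trans
      (+-mono-≤ ≤-refl (ν-mono _ _ λ (e , ¬¬a) → e , by-contradiction ¬¬a))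
      (≤-resp-≈ (+-comm _ _) refl (mA E))

    measurable-∩ : IsMeasurable A → IsMeasurable B → IsMeasurable (A ∩ B)
    measurable-∩ {A} {B} mA mB E =
      lin (ν (E ∩ A ∩ B) ∷ ν (E ∩ ∁ (A ∩ B)) ∷ ν E ∷ ν ((E ∩ A) ∩ B) ∷ ν ((E ∩ A) ∩ ∁ B) ∷
        ν (E ∩ A) ∷ ν (E ∩ ∁ A) ∷ ν ((E ∩ A) ∩ ∁ B ∪ E ∩ ∁ A) ∷ []) (x₀ ⊕ x₁ ⊑ x₂) (▹ x₀ ⊑ x₃ ∷
        ▹ x₃ ⊕ x₄ ⊑ x₅ ∷ ▹ x₅ ⊕ x₆ ⊑ x₂ ∷ ▹ x₁ ⊑ x₇ ∷ ▹ x₇ ⊑ x₄ ⊕ x₆ ∷ [])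
        (ν-mono (E ∩ (A ∩ B)) ((E ∩ A) ∩ B) (λ (e , a , b) → (e , a) , b) , mB (E ∩ A) , mA E ,
        ν-mono (E ∩ ∁ (A ∩ B)) (((E ∩ A) ∩ ∁ B) ∪ (E ∩ ∁ A)) outside ,
        ν-∪ ((E ∩ A) ∩ ∁ B) (E ∩ ∁ A) , tt)
      where
      outside : E ∩ ∁ (A ∩ B) ⊆ ((E ∩ A) ∩ ∁ B) ∪ (E ∩ ∁ A)
      outside {x} (e , n) with em {P = x ∈ A}
      ... | yes a = inj₁ ((e , a) , λ b → n (a , b))
      ... | no ¬a = inj₂ (e , ¬a)

    measurable-∪ : IsMeasurable A → IsMeasurable B → IsMeasurable (A ∪ B)
    measurable-∪ {A} {B} mA mB =
      measurable-≐ (fwd , λ { (inj₁ a) (¬a , _) → ¬a a ; (inj₂ b) (_ , ¬b) → ¬b b })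
        (measurable-∁ (measurable-∩ (measurable-∁ mA) (measurable-∁ mB)))
      where
      fwd : ∁ (∁ A ∩ ∁ B) ⊆ A ∪ B
      fwd {x} n = by-contradiction λ m → n ((λ a → m (inj₁ a)) , λ b → m (inj₂ b))

    measurable-∅ : IsMeasurable ∅
    measurable-∅ E = lin (ν (E ∩ ∅) ∷ ν (E ∩ ∁ ∅) ∷ ν E ∷ ν ∅ ∷ []) (x₀ ⊕ x₁ ⊑ x₂) (▹ x₀ ⊑ x₃ ∷
      ▹ x₃ ≃ 𝟘 ∷ ▹ x₁ ⊑ x₂ ∷ []) (ν-mono (E ∩ ∅) ∅ proj₂ , ν-∅ , ν-mono (E ∩ ∁ ∅) E proj₁ , tt)

    measurable-U : IsMeasurable U
    measurable-U = measurable-≐ ((λ _ → tt) , λ _ ()) (measurable-∁ measurable-∅)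

    ⋃< : ℕ → (ℕ → Pred X 0ℓ) → Pred X 0ℓ
    ⋃< zero    A = ∅
    ⋃< (suc n) A = A 0 ∪ ⋃< n (A ∘ suc)

    ⋃<⊆⋃ : ∀ n A → ⋃< n A ⊆ ⋃ ℕ A
    ⋃<⊆⋃ (suc n) A (inj₁ a) = 0 , a
    ⋃<⊆⋃ (suc n) A (inj₂ b) = let i , a = ⋃<⊆⋃ n (A ∘ suc) b in suc i , a

    measurable-⋃< : ∀ n A → (∀ i → IsMeasurable (A i)) → IsMeasurable (⋃< n A)
    measurable-⋃< zero    A mA = measurable-∅
    measurable-⋃< (suc n) A mA = measurable-∪ (mA 0) (measurable-⋃< n (A ∘ suc) (mA ∘ suc))

    PairwiseDisjoint : (ℕ → Pred X 0ℓ) → Set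
    PairwiseDisjoint A = ∀ m n → m ≢ n → Empty (A m ∩ A n)

    -- The measurability of `A 0`, tested on `E ∩ ⋃< (suc n) A`, splits off one summand. Keeping `E`
    -- arbitrary is what later gives the measurability of the infinite union and not just the
    -- additivity of `ν`.
    Σ<-disjoint : ∀ n A → (∀ i → IsMeasurable (A i)) → PairwiseDisjoint A →
                  ∀ E → Σ< n (λ i → ν (E ∩ A i)) ≤ ν (E ∩ ⋃< n A)
    Σ<-disjoint zero    A mA dA E = ν-nonNeg _
    Σ<-disjoint (suc n) A mA dA E =
      lin (ν (E ∩ A 0) ∷ Σ< n (λ u → ν (E ∩ A (suc u))) ∷ ν (E ∩ ⋃< (suc n) A) ∷
        ν ((E ∩ ⋃< (suc n) A) ∩ A 0) ∷ ν ((E ∩ ⋃< (suc n) A) ∩ ∁ (A 0)) ∷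
        ν (E ∩ ⋃< n (λ u → A (suc u))) ∷ []) (x₀ ⊕ x₁ ⊑ x₂) (▹ x₃ ⊕ x₄ ⊑ x₂ ∷ ▹ x₁ ⊑ x₅ ∷
        ▹ x₀ ⊑ x₃ ∷ ▹ x₅ ⊑ x₄ ∷ []) (mA 0 (E ∩ ⋃< (suc n) A) ,
        Σ<-disjoint n (λ i → A (suc i)) (λ i → mA (suc i)) dA′ E ,
        ν-mono (E ∩ A 0) ((E ∩ ⋃< (suc n) A) ∩ A 0) first ,
        ν-mono (E ∩ ⋃< n (λ i → A (suc i))) ((E ∩ ⋃< (suc n) A) ∩ ∁ (A 0)) rest , tt)
      where
      dA′ : PairwiseDisjoint (A ∘ suc)
      dA′ i j i≢j = dA (suc i) (suc j) (i≢j ∘ ℕ.suc-injective)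
      first : E ∩ A 0 ⊆ (E ∩ ⋃< (suc n) A) ∩ A 0
      first (e , a) = (e , inj₁ a) , a
      rest : E ∩ ⋃< n (λ i → A (suc i)) ⊆ (E ∩ ⋃< (suc n) A) ∩ ∁ (A 0)
      rest {x} (e , b) = (e , inj₂ b) , λ a →
        let i , a′ = ⋃<⊆⋃ n (λ i → A (suc i)) b in dA 0 (suc i) (λ ()) x (a , a′)

    measurable-⋃-disjoint : ∀ A → (∀ i → IsMeasurable (A i)) → PairwiseDisjoint A → IsMeasurable (⋃ ℕ A)
    measurable-⋃-disjoint A mA dA E =
      lin (ν (E ∩ ⋃ ℕ A) ∷ ν (E ∩ ∁ (⋃ ℕ A)) ∷ ν E ∷ ν (⋃ ℕ (λ u → E ∩ A u)) ∷ []) (x₀ ⊕ x₁ ⊑ x₂)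
        (▹ x₀ ⊑ x₃ ∷ ▹ x₃ ⊑ x₂ ⊝ x₁ ∷ []) (ν-mono (E ∩ ⋃ ℕ A) (⋃ ℕ (λ i → E ∩ A i)) split ,
        (ν-⋃ (λ i → E ∩ A i) (ν E - ν (E ∩ ∁ (⋃ ℕ A))) bound) , tt)
      where
      split : E ∩ ⋃ ℕ A ⊆ ⋃ ℕ (λ i → E ∩ A i)
      split (e , i , a) = i , e , a
      -- The right-hand side does not depend on `n`, since removing the whole union leaves less than
      -- removing finitely many of its sets. So `ν-⋃` passes to the limit.
      bound : ∀ n → Σ< n (λ i → ν (E ∩ A i)) ≤ ν E - ν (E ∩ ∁ (⋃ ℕ A))
      bound n = lin (Σ< n (λ u → ν (E ∩ A u)) ∷ ν E ∷ ν (E ∩ ∁ (⋃ ℕ A)) ∷ ν (E ∩ ⋃< n A) ∷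
        ν (E ∩ ∁ (⋃< n A)) ∷ []) (x₀ ⊑ x₁ ⊝ x₂) (▹ x₀ ⊑ x₃ ∷ ▹ x₃ ⊕ x₄ ⊑ x₁ ∷ ▹ x₂ ⊑ x₄ ∷ [])
        (Σ<-disjoint n A mA dA E , measurable-⋃< n A mA E ,
        ν-mono (E ∩ ∁ (⋃ ℕ A)) (E ∩ ∁ (⋃< n A)) (λ (e , m) → e , λ m′ → m (⋃<⊆⋃ n A m′)) , tt)

    ν-⋃-disjoint : ∀ A → (∀ i → IsMeasurable (A i)) → PairwiseDisjoint A →
      IsSup _≤_ (λ s → ∃[ n ] s ≈ Σ< n (ν ∘ A)) (ν (⋃ ℕ A))
    ν-⋃-disjoint A mA dA = upper , λ u h → ν-⋃ A u (λ n → h _ (n , refl))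
      where
      upper : ∀ x → (∃[ n ] x ≈ Σ< n (ν ∘ A)) → x ≤ ν (⋃ ℕ A)
      upper x (n , e) = lin (x ∷ ν (⋃ ℕ A) ∷ Σ< n (λ u → ν (A u)) ∷ Σ< n (λ u → ν (U ∩ A u)) ∷
        ν (U ∩ ⋃< n A) ∷ []) (x₀ ⊑ x₁) (▹ x₀ ≃ x₂ ∷ ▹ x₂ ⊑ x₃ ∷ ▹ x₃ ⊑ x₄ ∷ ▹ x₄ ⊑ x₁ ∷ []) (e ,
        Σ<-mono n (λ i → ν-mono (A i) (U ∩ A i) (λ a → tt , a)) , Σ<-disjoint n A mA dA U ,
        ν-mono (U ∩ ⋃< n A) (⋃ ℕ A) (λ (_ , m) → ⋃<⊆⋃ n A m) , tt)

    first-entry : (ℕ → Pred X 0ℓ) → ℕ → Pred X 0ℓ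
    first-entry A n = A n ∩ ∁ (⋃< n A)

    ⊆⋃< : ∀ {m n} A → m ℕ.< n → A m ⊆ ⋃< n A
    ⊆⋃< {zero}  A (ℕ.s≤s p) a = inj₁ a
    ⊆⋃< {suc m} A (ℕ.s≤s p) a = inj₂ (⊆⋃< (A ∘ suc) p a)

    first-entry-disjoint : ∀ A → PairwiseDisjoint (first-entry A)
    first-entry-disjoint A m n m≢n x ((a , ¬<m) , b , ¬<n) with ℕ.<-cmp m n
    ... | tri< p _ _ = ¬<n (⊆⋃< A p a)
    ... | tri≈ _ e _ = m≢n e
    ... | tri> _ _ p = ¬<m (⊆⋃< A p b)

    ⋃<⊆⋃first-entry : ∀ n A → ⋃< n A ⊆ ⋃ ℕ (first-entry A)
    ⋃<⊆⋃first-entry n A {x} m = by-contradiction λ h → nowhere h n m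
      where
      snoc : ∀ n A → x ∈ ⋃< (suc n) A → x ∈ ⋃< n A ⊎ x ∈ A n
      snoc zero    A (inj₁ a) = inj₂ a
      snoc (suc n) A (inj₁ a) = inj₁ (inj₁ a)
      snoc (suc n) A (inj₂ b) with snoc n (A ∘ suc) b
      ... | inj₁ p = inj₁ (inj₂ p)
      ... | inj₂ p = inj₂ p
      nowhere : ¬ (x ∈ ⋃ ℕ (first-entry A)) → ∀ n → ¬ (x ∈ ⋃< n A)
      nowhere h (suc n) p with snoc n A p
      ... | inj₁ q = nowhere h n q
      ... | inj₂ a = h (n , a , nowhere h n)

    measurable-⋃ : ∀ A → (∀ i → IsMeasurable (A i)) → IsMeasurable (⋃ ℕ A)
    measurable-⋃ A mA = measurable-≐
      ((λ (n , a , _) → n , a) , λ (n , a) → ⋃<⊆⋃first-entry (suc n) A (⊆⋃< A ℕ.≤-refl a))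
      (measurable-⋃-disjoint (first-entry A)
        (λ n → measurable-∩ (mA n) (measurable-∁ (measurable-⋃< n A mA))) (first-entry-disjoint A))

    probabilitySpace : ν U ≈ 1# → ProbabilitySpace
    probabilitySpace ν-U = record
      { Ω          = X
      ; Measurable = IsMeasurable
      ; resp-≐     = measurable-≐
      ; univ       = measurable-U
      ; compl      = measurable-∁
      ; union      = measurable-⋃
      ; μ          = ν
      ; μ-cong     = λ _ (A⊆B , B⊆A) → ≤-antisym (ν-mono _ _ A⊆B) (ν-mono _ _ B⊆A)
      ; μ-nonNeg   = λ _ → ν-nonNeg _
      ; μ-univ     = ν-U
      ; μ-union    = ν-⋃-disjoint
      }

    -- The criterion is transferred for one test set `E` at a time, because the set `A` to compare
    -- with and the null set `N` will depend on the interval that contains `E`.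
    measurable-mod-null : ∀ {A B N E} → ν N ≈ 0# → (∀ x → x ∈ E → ¬ (x ∈ N) → (x ∈ A → x ∈ B) × (x ∈ B → x ∈ A)) →
      ν (E ∩ A) + ν (E ∩ ∁ A) ≤ ν E → ν (E ∩ B) + ν (E ∩ ∁ B) ≤ ν E
    measurable-mod-null {A} {B} {N} {E} νN h p =
      lin (ν (E ∩ B) ∷ ν (E ∩ ∁ B) ∷ ν E ∷ ν (E ∩ A) ∷ ν (E ∩ ∁ A) ∷ ν N ∷ ν (E ∩ A ∪ N) ∷
        ν (E ∩ ∁ A ∪ N) ∷ []) (x₀ ⊕ x₁ ⊑ x₂) (▹ x₃ ⊕ x₄ ⊑ x₂ ∷ 2 /1+ 0 ▸ x₅ ≃ 𝟘 ∷ ▹ x₀ ⊑ x₆ ∷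
        ▹ x₁ ⊑ x₇ ∷ ▹ x₆ ⊑ x₃ ⊕ x₅ ∷ ▹ x₇ ⊑ x₄ ⊕ x₅ ∷ []) (p , νN ,
        ν-mono (E ∩ B) ((E ∩ A) ∪ N) inside , ν-mono (E ∩ ∁ B) ((E ∩ ∁ A) ∪ N) outside ,
        ν-∪ (E ∩ A) N , ν-∪ (E ∩ ∁ A) N , tt)
      where
      inside : E ∩ B ⊆ (E ∩ A) ∪ N
      inside {x} (e , b) with em {P = x ∈ N}
      ... | yes n = inj₂ n
      ... | no ¬n = inj₁ (e , proj₂ (h x e ¬n) b)
      outside : E ∩ ∁ B ⊆ (E ∩ ∁ A) ∪ N
      outside {x} (e , ¬b) with em {P = x ∈ N}
      ... | yes n = inj₂ n
      ... | no ¬n = inj₁ (e , λ a → ¬b (proj₁ (h x e ¬n) a))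

-- Weighted Lebesgue measure on a disjoint union of intervals.

module IntervalMixture (em : ∀ {ℓ} → ExcludedMiddle ℓ) (𝓡 : CompleteOrderedField) where
  open CompleteOrderedField 𝓡 hiding (zero)
  open LinearArithmetic 𝓡
  open RealNumbers em 𝓡
  open MeasureTheory em 𝓡
  open Simplex 𝓡 using (ProbabilitySpace)

  -- The measure on a finite disjoint union of intervals (lo c , hi c) which on the
  -- c-th one is w c times Lebesgue measure.
  module Mixture (I : Set) (_≟_ : DecidableEquality I) (w lo hi : I → ℝ)
    (0≤w : ∀ c → 0# ≤ w c) (lo<hi : ∀ c → lo c < hi c)
    (cs : List I) (complete-cs : ∀ c → c List.∈ cs) (unique-cs : Unique cs) (c₀ : I) where

    Ω : Set
    Ω = Σ[ c ∈ I ] Σ[ z ∈ ℝ ] lo c < z × z < hi c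

    index : Ω → I
    index = proj₁

    position : Ω → ℝ
    position (_ , z , _) = z

    Box : I → ℝ → ℝ → Pred Ω 0ℓ
    Box c a b ω = index ω ≡ c × a < position ω × position ω < b

    -- Countable covers by open intervals, as well-founded trees and with an upper bound of the cost
    -- in place of the cost. Nesting makes countable subadditivity immediate, without rearranging a
    -- double sequence into a single one.
    data Cover (A : Pred Ω 0ℓ) (s : ℝ) : Set₁ where
      box   : ∀ c a b → a ≤ b → A ⊆ Box c a b → w c * (b - a) ≤ s → Cover A s
      union : ∀ (B : ℕ → Pred Ω 0ℓ) t → (∀ n → Cover (B n) (t n)) → A ⊆ ⋃ ℕ B →
              (∀ n → Σ< n t ≤ s) → Cover A s

    private variable
      A B E : Pred Ω 0ℓ
      s t : ℝ

    cost-nonNeg : ∀ {a b} c → a ≤ b → 0# ≤ w c * (b - a)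
    cost-nonNeg c p = *-nonNeg (0≤w c) (x≤y⇒0≤y-x p)

    cover-nonNeg : Cover A s → 0# ≤ s
    cover-nonNeg (box c a b a≤b _ p)  = ≤-trans (cost-nonNeg c a≤b) p
    cover-nonNeg (union _ _ _ _ p)    = p 0

    cover-mono : A ⊆ B → s ≤ t → Cover B s → Cover A t
    cover-mono A⊆B s≤t (box c a b a≤b B⊆ p) = box c a b a≤b (λ x → B⊆ (A⊆B x)) (≤-trans p s≤t)
    cover-mono A⊆B s≤t (union D u C B⊆ p)   = union D u C (λ x → B⊆ (A⊆B x)) (λ n → ≤-trans (p n) s≤t)

    cover-∅ : Cover ∅ 0#
    cover-∅ = box c₀ 0# 0# ≤-refl (λ {ω} → ∅⊆Box {ω}) (lin (w c₀ ∷ []) (x₀ ⊗ (𝟘 ⊝ 𝟘) ⊑ 𝟘) [] tt)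
      where
      ∅⊆Box : ∅ ⊆ Box c₀ 0# 0#
      ∅⊆Box ()

    cover-∪ : Cover A s → Cover B t → Cover (A ∪ B) (s + t)
    cover-∪ {A} {s} {B} {t} C D = union (pairing A B) costs covers ∪⊆⋃pairing bound
      where
      costs : ℕ → ℝ
      costs 0             = s
      costs 1             = t
      costs (suc (suc n)) = 0#
      covers : ∀ n → Cover (pairing A B n) (costs n)
      covers 0             = C
      covers 1             = D
      covers (suc (suc n)) = cover-∅
      bound : ∀ n → Σ< n costs ≤ s + t
      bound 0 = 0≤x+y (cover-nonNeg C) (cover-nonNeg D)
      bound 1 = lin (s ∷ t ∷ []) (x₀ ⊕ 𝟘 ⊑ x₀ ⊕ x₁) (▹ 𝟘 ⊑ x₁ ∷ []) (cover-nonNeg D , tt)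
      bound (suc (suc n)) = lin (s ∷ t ∷ Σ< n (λ _ → 0#) ∷ []) (x₀ ⊕ (x₁ ⊕ x₂) ⊑ x₀ ⊕ x₁)
        (▹ x₂ ≃ 𝟘 ∷ []) (Σ<-zero n {λ _ → 0#} (λ _ → refl) , tt)

    Pieces : List I → Pred Ω 0ℓ
    Pieces ds ω = index ω List.∈ ds

    total : List I → ℝ
    total []       = 0#
    total (d ∷ ds) = w d * (hi d - lo d) + total ds

    cover-pieces : ∀ ds → Cover (Pieces ds) (total ds)
    cover-pieces []       = cover-mono {B = ∅} (λ { {_} () }) ≤-refl cover-∅
    cover-pieces (d ∷ ds) = cover-mono (λ {ω} → split {ω}) ≤-refl
      (cover-∪ (box d (lo d) (hi d) (<⇒≤ (lo<hi d)) (λ x → x) ≤-refl) (cover-pieces ds))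
      where
      split : Pieces (d ∷ ds) ⊆ Box d (lo d) (hi d) ∪ Pieces ds
      split {_ , _ , p , q} (here ≡.refl) = inj₁ (≡.refl , p , q)
      split (there i)                     = inj₂ i

    cover-any : ∀ A → Cover A (total cs)
    cover-any A = cover-mono (λ {ω} _ → complete-cs (index ω)) ≤-refl (cover-pieces cs)

    abstract
      ν-infimum : ∀ A → ∃ (IsInfimum (Cover A))
      ν-infimum A = infimum (Cover A) (total cs , cover-any A) (0# , λ _ → cover-nonNeg)

      ν : Pred Ω 0ℓ → ℝ
      ν A = proj₁ (ν-infimum A)

      ν≤ : Cover A s → ν A ≤ s
      ν≤ {A} C = proj₁ (proj₂ (ν-infimum A)) _ C

      ≤ν : (∀ t → Cover A t → s ≤ t) → s ≤ ν A
      ≤ν {A} h = proj₂ (proj₂ (ν-infimum A)) _ h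

    cover-ν : ∀ {ε} A → 0# < ε → Cover A (ν A + ε)
    cover-ν {ε} A 0<ε = by-contradiction λ n →
      (<-irrefl (lin (ε ∷ ν A ∷ []) (𝟘 ⊏ 𝟘) (▹ 𝟘 ⊏ x₀ ∷ ▹ x₁ ⊕ x₀ ⊑ x₁ ∷ []) (0<ε ,
        ≤ν {A} {ν A + ε} (λ t C → <⇒≤ (≰⇒> λ p → n (cover-mono (λ x → x) p C))) , tt)))

    ν-mono : ∀ A B → A ⊆ B → ν A ≤ ν B
    ν-mono A B A⊆B = ≤ν {B} λ t C → ν≤ {A} (cover-mono A⊆B ≤-refl C)

    ν-nonNeg : ∀ A → 0# ≤ ν A
    ν-nonNeg A = ≤ν {A} λ _ → cover-nonNeg

    ν-∅ : ν ∅ ≈ 0#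
    ν-∅ = ≤-antisym (ν≤ cover-∅) (ν-nonNeg ∅)

    -- The `n`-th set is covered at a cost exceeding its measure by at most `halves ε n`; the covers
    -- are then joined by a single `union` node.
    ν-⋃ : ∀ A s → (∀ n → Σ< n (ν ∘ A) ≤ s) → ν (⋃ ℕ A) ≤ s
    ν-⋃ A s h = ≤-by-ε 1# 0≤1 λ ε 0<ε → lin (ν (⋃ ℕ A) ∷ s ∷ ε ∷ []) (x₀ ⊑ x₁ ⊕ 𝟙 ⊗ x₂)
      (▹ x₀ ⊑ x₁ ⊕ x₂ ∷ [])
      (ν≤ {⋃ ℕ A} (union A (λ n → ν (A n) + halves ε n) (λ n → cover-ν (A n) (halves-pos n 0<ε)) (λ x → x) (bound ε 0<ε)) ,
      tt)
      where
      bound : ∀ ε → 0# < ε → ∀ n → Σ< n (λ n → ν (A n) + halves ε n) ≤ s + ε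
      bound ε 0<ε n = lin (Σ< n (λ u → ν (A u) + halves ε u) ∷ s ∷ ε ∷ Σ< n (λ u → ν (A u)) ∷
        Σ< n (halves ε) ∷ []) (x₀ ⊑ x₁ ⊕ x₂) (▹ x₀ ≃ x₃ ⊕ x₄ ∷ ▹ x₃ ⊑ x₁ ∷ ▹ x₄ ⊑ x₂ ∷ [])
        (Σ<-+ n (λ i → ν (A i)) (halves ε) , h n , Σ<-halves n 0<ε , tt)

    open Carathéodory Ω ν ν-mono ν-nonNeg ν-∅ ν-⋃ public

    -- Splitting every interval of a cover of `E` along `A` splits `E`, at no more than the cost of
    -- the cover. Induction over the tree carries the inequality from intervals to all covers, and
    -- then to their infimum.
    measurable-from-boxes : (∀ c a b → a ≤ b → ν (Box c a b ∩ A) + ν (Box c a b ∩ ∁ A) ≤ w c * (b - a)) →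
                            IsMeasurable A
    measurable-from-boxes {A} h E = ≤ν {E} (λ t → split)
      where
      split : ∀ {E s} → Cover E s → ν (E ∩ A) + ν (E ∩ ∁ A) ≤ s
      split {E} {s} (box c a b a≤b E⊆ p) = lin (ν (E ∩ A) ∷ ν (E ∩ ∁ A) ∷ s ∷ ν (Box c a b ∩ A) ∷
        ν (Box c a b ∩ ∁ A) ∷ w c ∷ b ∷ a ∷ []) (x₀ ⊕ x₁ ⊑ x₂) (▹ x₃ ⊕ x₄ ⊑ x₅ ⊗ (x₆ ⊝ x₇) ∷
        ▹ x₅ ⊗ (x₆ ⊝ x₇) ⊑ x₂ ∷ ▹ x₀ ⊑ x₃ ∷ ▹ x₁ ⊑ x₄ ∷ []) (h c a b a≤b , p ,
        ν-mono (E ∩ A) (Box c a b ∩ A) (λ (e , x) → E⊆ e , x) ,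
        ν-mono (E ∩ ∁ A) (Box c a b ∩ ∁ A) (λ (e , x) → E⊆ e , x) , tt)
      split {E} {s} (union D t C E⊆ p) = lin (ν (E ∩ A) ∷ ν (E ∩ ∁ A) ∷ s ∷ ν (⋃ ℕ D∖A) ∷ [])
        (x₀ ⊕ x₁ ⊑ x₂) (▹ x₁ ⊑ x₃ ∷ ▹ x₃ ⊑ x₂ ⊝ x₀ ∷ [])
        (ν-mono (E ∩ ∁ A) (⋃ ℕ D∖A) (λ (e , x) → proj₁ (E⊆ e) , proj₂ (E⊆ e) , x) ,
        ν-⋃ D∖A (s - ν (E ∩ A)) (λ m → outer m) , tt)
        where
        D∩A D∖A : ℕ → Pred Ω 0ℓ
        D∩A n = D n ∩ A
        D∖A n = D n ∩ ∁ A
        -- The two unions are bounded one after the other, each by `ν-⋃`, which requires independent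
        -- numbers of terms. Both partial sums are extended to the larger number.
        both : ∀ n m → Σ< n (λ i → ν (D∩A i)) + Σ< m (λ i → ν (D∖A i)) ≤ s
        both n m = lin (Σ< n (λ u → ν (D∩A u)) ∷ Σ< m (λ u → ν (D∖A u)) ∷ s ∷
          Σ< (n ℕ.⊔ m) (λ u → ν (D∩A u)) ∷ Σ< (n ℕ.⊔ m) (λ u → ν (D∖A u)) ∷
          Σ< (n ℕ.⊔ m) (λ u → ν (D∩A u) + ν (D∖A u)) ∷ Σ< (n ℕ.⊔ m) t ∷ []) (x₀ ⊕ x₁ ⊑ x₂)
          (▹ x₀ ⊑ x₃ ∷ ▹ x₁ ⊑ x₄ ∷ ▹ x₃ ⊕ x₄ ≃ x₅ ∷ ▹ x₅ ⊑ x₆ ∷ ▹ x₆ ⊑ x₂ ∷ [])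
          (Σ<-monoˡ {n} {n ℕ.⊔ m} {λ i → ν (D∩A i)} (λ i → ν-nonNeg _) (ℕ.m≤m⊔n n m) ,
          Σ<-monoˡ {m} {n ℕ.⊔ m} {λ i → ν (D∖A i)} (λ i → ν-nonNeg _) (ℕ.m≤n⊔m n m) ,
          sym (Σ<-+ (n ℕ.⊔ m) (λ i → ν (D∩A i)) (λ i → ν (D∖A i))) ,
          Σ<-mono (n ℕ.⊔ m) {λ i → ν (D∩A i) + ν (D∖A i)} {t} (λ i → split (C i)) , p (n ℕ.⊔ m) ,
          tt)
        inner : ∀ m → ν (E ∩ A) ≤ s - Σ< m (λ i → ν (D∖A i))
        inner m = lin (ν (E ∩ A) ∷ s ∷ Σ< m (λ u → ν (D∖A u)) ∷ ν (⋃ ℕ D∩A) ∷ []) (x₀ ⊑ x₁ ⊝ x₂)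
          (▹ x₀ ⊑ x₃ ∷ ▹ x₃ ⊑ x₁ ⊝ x₂ ∷ [])
          (ν-mono (E ∩ A) (⋃ ℕ D∩A) (λ (e , x) → proj₁ (E⊆ e) , proj₂ (E⊆ e) , x) ,
          ν-⋃ D∩A (s - Σ< m (λ i → ν (D∖A i))) (λ n → bound n) , tt)
          where
          bound : ∀ n → Σ< n (λ i → ν (D∩A i)) ≤ s - Σ< m (λ i → ν (D∖A i))
          bound n = lin (Σ< n (λ u → ν (D∩A u)) ∷ s ∷ Σ< m (λ u → ν (D∖A u)) ∷ []) (x₀ ⊑ x₁ ⊝ x₂)
            (▹ x₀ ⊕ x₂ ⊑ x₁ ∷ []) (both n m , tt)
        outer : ∀ m → Σ< m (λ i → ν (D∖A i)) ≤ s - ν (E ∩ A)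
        outer m = lin (Σ< m (λ u → ν (D∖A u)) ∷ s ∷ ν (E ∩ A) ∷ []) (x₀ ⊑ x₁ ⊝ x₂) (▹ x₂ ⊑ x₁ ⊝ x₀ ∷
          []) (inner m , tt)

    module HeineBorel (c : I) where

      -- The cost of the part of the box from `a` to `b` that lies between `x` and `y`, provided
      -- that the box is in piece `c`.
      leaf : {d : I} → Dec (d ≡ c) → (a b x y : ℝ) → ℝ
      leaf (yes _) a b x y = w c * (clamp a b y - clamp a b x)
      leaf (no _)  a b x y = 0#

      leaf-nonNeg : ∀ {d} (d≟c : Dec (d ≡ c)) a b {x y} → x ≤ y → 0# ≤ leaf d≟c a b x y
      leaf-nonNeg (yes _) a b p = cost-nonNeg c (clamp-mono a b p)
      leaf-nonNeg (no _)  a b p = ≤-refl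

      leaf≤cost : ∀ {d} (d≟c : Dec (d ≡ c)) {a b} x y → a ≤ b → leaf d≟c a b x y ≤ w d * (b - a)
      leaf≤cost {d} (no _) x y a≤b = cost-nonNeg d a≤b
      leaf≤cost (yes ≡.refl) {a} {b} x y a≤b =
        *-monoˡ-nonNeg (0≤w c) (lin (clamp a b y ∷ clamp a b x ∷ b ∷ a ∷ []) (x₀ ⊝ x₁ ⊑ x₂ ⊝ x₃)
          (▹ x₃ ⊑ x₁ ∷ ▹ x₀ ⊑ x₂ ∷ []) (a≤clamp a b x , clamp≤b y a≤b , tt))

      leaf-+ : ∀ {d} (d≟c : Dec (d ≡ c)) a b x y z →
               leaf d≟c a b x z ≈ leaf d≟c a b x y + leaf d≟c a b y z
      leaf-+ (yes p) a b x y z = lin (w c ∷ clamp a b z ∷ clamp a b x ∷ clamp a b y ∷ [])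
        (x₀ ⊗ (x₁ ⊝ x₂) ≃ x₀ ⊗ (x₃ ⊝ x₂) ⊕ x₀ ⊗ (x₁ ⊝ x₃)) [] tt
      leaf-+ (no _)  a b x y z = sym (+-identityˡ 0#)

      leaf-inside : (c≟c : Dec (c ≡ c)) → ∀ {a b x y} → a ≤ x → x ≤ y → y ≤ b →
                    w c * (y - x) ≤ leaf c≟c a b x y
      leaf-inside (no n)  = ⊥-elim (n ≡.refl)
      leaf-inside (yes _) {a} {b} {x} {y} a≤x x≤y y≤b = *-monoˡ-nonNeg (0≤w c)
        (lin (y ∷ x ∷ clamp a b y ∷ clamp a b x ∷ []) (x₀ ⊝ x₁ ⊑ x₂ ⊝ x₃) (▹ x₀ ≃ x₂ ∷ ▹ x₃ ≃ x₁ ∷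
          []) (sym (clamp-inside (≤-trans a≤x x≤y) y≤b) , clamp-inside a≤x (≤-trans x≤y y≤b) , tt))

      -- The cost that a cover spends between `x` and `y` on piece `c`, counting only the first `K`
      -- branches at each node. The truncation `K` plays the role of a finite subcover.
      variation : Cover A s → ℕ → ℝ → ℝ → ℝ
      variation (box d a b _ _ _)   K x y = leaf (d ≟ c) a b x y
      variation (union _ _ C _ _) K x y = Σ< K (λ n → variation (C n) K x y)

      variation-nonNeg : ∀ (C : Cover A s) K {x y} → x ≤ y → 0# ≤ variation C K x y
      variation-nonNeg (box d a b _ _ _)   K p = leaf-nonNeg (d ≟ c) a b p
      variation-nonNeg (union _ _ C _ _) K p = Σ<-nonNeg K (λ n → variation-nonNeg (C n) K p)

      variation≤cost : ∀ (C : Cover A s) K x y → variation C K x y ≤ s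
      variation≤cost (box d a b a≤b _ q) K x y = ≤-trans (leaf≤cost (d ≟ c) x y a≤b) q
      variation≤cost (union _ _ C _ q) K x y = ≤-trans (Σ<-mono K (λ n → variation≤cost (C n) K x y)) (q K)

      variation-+ : ∀ (C : Cover A s) K x y z → variation C K x z ≈ variation C K x y + variation C K y z
      variation-+ (box d a b _ _ _)   K x y z = leaf-+ (d ≟ c) a b x y z
      variation-+ (union _ _ C _ _) K x y z = trans (Σ<-cong K (λ n → variation-+ (C n) K x y z))
        (Σ<-+ K (λ n → variation (C n) K x y) (λ n → variation (C n) K y z))

      variation-monoˡ : ∀ (C : Cover A s) {K L x y} → K ℕ.≤ L → x ≤ y → variation C K x y ≤ variation C L x y
      variation-monoˡ (box d a b _ _ _)   K≤L p = ≤-refl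
      variation-monoˡ (union _ _ C _ _) {K} {L} K≤L p = ≤-trans
        (Σ<-mono K (λ n → variation-monoˡ (C n) K≤L p))
        (Σ<-monoˡ (λ n → variation-nonNeg (C n) L p) K≤L)

      -- The point lies in some box of the tree, and boxes are open. A neighbourhood is therefore
      -- paid for in full by this one box once `K` is large enough for all branches leading to it to
      -- be counted.
      variation-near : ∀ (C : Cover A s) z p → (c , z , p) ∈ A → ∃[ η ] 0# < η × (∃[ K ] ∀ L → K ℕ.≤ L →
        ∀ x y → z - η < x → x ≤ z → z ≤ y → y < z + η → w c * (y - x) ≤ variation C L x y)
      variation-near (box d a b _ A⊆ _) z p z∈A with A⊆ z∈A
      ... | ≡.refl , a<z , z<b =
        min (z - a) (b - z) , min-glb-< (x<y⇒0<y-x a<z) (x<y⇒0<y-x z<b) , 0 , λ _ _ → near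
        where
        near : ∀ x y → z - min (z - a) (b - z) < x → x ≤ z → z ≤ y → y < z + min (z - a) (b - z) →
               w c * (y - x) ≤ leaf (c ≟ c) a b x y
        near x y p q r s = leaf-inside (c ≟ c) (lin (a ∷ x ∷ z ∷ min (z - a) (b - z) ∷ []) (x₀ ⊑ x₁)
          (▹ x₂ ⊝ x₃ ⊏ x₁ ∷ ▹ x₃ ⊑ x₂ ⊝ x₀ ∷ []) (p , min≤x (z - a) (b - z) , tt)) (≤-trans q r)
          (lin (y ∷ b ∷ z ∷ min (z - a) (b - z) ∷ []) (x₀ ⊑ x₁) (▹ x₀ ⊏ x₂ ⊕ x₃ ∷ ▹ x₃ ⊑ x₁ ⊝ x₂ ∷
            []) (s , min≤y (z - a) (b - z) , tt))
      variation-near (union _ _ C A⊆ _) z p z∈A = let n , z∈Bn = A⊆ z∈A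
                                                      η , 0<η , K , h = variation-near (C n) z p z∈Bn in
        -- Branch `n` is among those counted only from the truncation `suc n` on.
        η , 0<η , K ℕ.⊔ suc n , λ L le x y a b c d → ≤-trans
          (h L (ℕ.≤-trans (ℕ.m≤m⊔n K (suc n)) le) x y a b c d)
          (term≤Σ< (λ i → variation-nonNeg (C i) L (≤-trans b c)) (ℕ.≤-trans (ℕ.m≤n⊔m K (suc n)) le))

      -- The Heine-Borel theorem by continuous induction: the points `y` for which some finite
      -- truncation already pays for the interval from `a` to `y` can be continued past each of
      -- their limits, by additivity of `variation` and `variation-near`.
      length≤cost : ∀ {a b} → lo c < a → a ≤ b → b < hi c →
        (∀ z p → a ≤ z → z ≤ b → (c , z , p) ∈ A) → Cover A s → w c * (b - a) ≤ s
      length≤cost {a = a} {b} lo<a a≤b b<hi inA C =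
        let K , h = real-induction a≤b (λ y → ∃[ K ] w c * (y - a) ≤ variation C K a y)
                      (0 , (lin (w c ∷ a ∷ variation C 0 a a ∷ []) (x₀ ⊗ (x₁ ⊝ x₁) ⊑ x₂) (▹ 𝟘 ⊑ x₂ ∷
                        []) (variation-nonNeg C 0 (≤-refl {a}) , tt))) step
        in ≤-trans h (variation≤cost C K a b)
        where
        step : ∀ z → a ≤ z → z ≤ b → ∃[ η ] 0# < η ×
          (∀ x y → a ≤ x → z - η < x → x ≤ z → z ≤ y → y < z + η → y ≤ b →
           (∃[ K ] w c * (x - a) ≤ variation C K a x) → ∃[ K ] w c * (y - a) ≤ variation C K a y)
        step z a≤z z≤b = let lo<z = lin (lo c ∷ z ∷ a ∷ []) (x₀ ⊏ x₁) (▹ x₀ ⊏ x₂ ∷ ▹ x₂ ⊑ x₁ ∷ [])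
                               (lo<a , a≤z , tt)
                             z<hi = lin (z ∷ hi c ∷ b ∷ []) (x₀ ⊏ x₁) (▹ x₂ ⊏ x₁ ∷ ▹ x₀ ⊑ x₂ ∷ [])
                               (b<hi , z≤b , tt)
                             η , 0<η , K , h = variation-near C z (lo<z , z<hi) (inA z _ a≤z z≤b) in
          η , 0<η , λ x y a≤x p q r s y≤b (L , g) → K ℕ.⊔ L ,
            extend a≤x g (ℕ.m≤n⊔m K L) (h (K ℕ.⊔ L) (ℕ.m≤m⊔n K L) x y p q r s)
          where
          extend : ∀ {x y L M} → a ≤ x → w c * (x - a) ≤ variation C L a x → L ℕ.≤ M →
                   w c * (y - x) ≤ variation C M x y → w c * (y - a) ≤ variation C M a y
          extend {x} {y} {L} {M} a≤x g L≤M h = lin (w c ∷ y ∷ a ∷ variation C M a y ∷ x ∷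
            variation C L a x ∷ variation C M a x ∷ variation C M x y ∷ []) (x₀ ⊗ (x₁ ⊝ x₂) ⊑ x₃)
            (▹ x₀ ⊗ (x₄ ⊝ x₂) ⊑ x₅ ∷ ▹ x₅ ⊑ x₆ ∷ ▹ x₀ ⊗ (x₁ ⊝ x₄) ⊑ x₇ ∷ ▹ x₆ ⊕ x₇ ≃ x₃ ∷ []) (g ,
            variation-monoˡ C L≤M a≤x , h , sym (variation-+ C M a x y) , tt)

    open HeineBorel using (length≤cost)

    UpTo : I → ℝ → Pred Ω 0ℓ
    UpTo c u ω = index ω ≡ c × position ω ≤ u

    -- For the upper bound a single box suffices; it ends at `u + ε` since boxes are open but `u`
    -- belongs to the set. For the lower bound `length≤cost` is applied to a closed interval shorter
    -- by ε/2 at each end; if nothing remains of it, the length is already below ε.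
    ν-UpTo : ∀ {c u} → lo c ≤ u → u ≤ hi c → ν (UpTo c u) ≈ w c * (u - lo c)
    ν-UpTo {c} {u} lo≤u u≤hi = ≤-antisym (≤-by-ε (w c) (0≤w c) upper) (≤-by-ε (w c) (0≤w c) lower)
      where
      upper : ∀ ε → 0# < ε → ν (UpTo c u) ≤ w c * (u - lo c) + w c * ε
      upper ε 0<ε = ν≤ (box c (lo c) (u + ε) (lin (lo c ∷ u ∷ ε ∷ []) (x₀ ⊑ x₁ ⊕ x₂) (▹ x₀ ⊑ x₁ ∷
        ▹ 𝟘 ⊏ x₂ ∷ []) (lo≤u , 0<ε , tt)) (λ {ω} → inside {ω}) (lin (w c ∷
        u ∷ ε ∷ lo c ∷ []) (x₀ ⊗ (x₁ ⊕ x₂ ⊝ x₃) ⊑ x₀ ⊗ (x₁ ⊝ x₃) ⊕ x₀ ⊗ x₂) [] tt))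
        where
        inside : UpTo c u ⊆ Box c (lo c) (u + ε)
        inside {_ , z , lo<z , _} (≡.refl , z≤u) = ≡.refl , lo<z , (lin (z ∷ u ∷ ε ∷ [])
          (x₀ ⊏ x₁ ⊕ x₂) (▹ x₀ ⊑ x₁ ∷ ▹ 𝟘 ⊏ x₂ ∷ []) (z≤u , 0<ε , tt))
      lower : ∀ ε → 0# < ε → w c * (u - lo c) ≤ ν (UpTo c u) + w c * ε
      lower ε 0<ε = conclude (≤-<-connex (lo c + (1 ÷ 2) * ε) (u - (1 ÷ 2) * ε))
        where
        lo<a : lo c < lo c + (1 ÷ 2) * ε
        lo<a = lin (lo c ∷ ε ∷ []) (x₀ ⊏ x₀ ⊕ 1 /1+ 1 ⊗ x₁) (1 /1+ 1 ▸ 𝟘 ⊏ x₁ ∷ []) (0<ε , tt)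
        b<hi : u - (1 ÷ 2) * ε < hi c
        b<hi = lin (u ∷ ε ∷ hi c ∷ []) (x₀ ⊝ 1 /1+ 1 ⊗ x₁ ⊏ x₂) (1 /1+ 1 ▸ 𝟘 ⊏ x₁ ∷ ▹ x₀ ⊑ x₂ ∷ [])
          (0<ε , u≤hi , tt)
        inside : ∀ z p → lo c + (1 ÷ 2) * ε ≤ z → z ≤ u - (1 ÷ 2) * ε → (c , z , p) ∈ UpTo c u
        inside z _ _ z≤ = ≡.refl , z≤u
          where
          z≤u : z ≤ u
          z≤u = lin (z ∷ u ∷ ε ∷ []) (x₀ ⊑ x₁) (▹ x₀ ⊑ x₁ ⊝ 1 /1+ 1 ⊗ x₂ ∷ 1 /1+ 1 ▸ 𝟘 ⊏ x₂ ∷ [])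
            (z≤ , 0<ε , tt)
        conclude : (lo c + (1 ÷ 2) * ε ≤ u - (1 ÷ 2) * ε) ⊎ (u - (1 ÷ 2) * ε < lo c + (1 ÷ 2) * ε) →
                   w c * (u - lo c) ≤ ν (UpTo c u) + w c * ε
        conclude (inj₂ p) = lin (w c ∷ u ∷ lo c ∷ ν (UpTo c u) ∷ ε ∷ [])
          (x₀ ⊗ (x₁ ⊝ x₂) ⊑ x₃ ⊕ x₀ ⊗ x₄) (▹ 𝟘 ⊑ x₃ ∷
          ▹ x₀ ⊗ (x₁ ⊝ 1 /1+ 1 ⊗ x₄) ⊑ x₀ ⊗ (x₂ ⊕ 1 /1+ 1 ⊗ x₄) ∷ []) (ν-nonNeg (UpTo c u) ,
          *-monoˡ-nonNeg (0≤w c) (<⇒≤ p) , tt)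
        conclude (inj₁ p) = lin (w c ∷ u ∷ lo c ∷ ν (UpTo c u) ∷ ε ∷ [])
          (x₀ ⊗ (x₁ ⊝ x₂) ⊑ x₃ ⊕ x₀ ⊗ x₄) (▹ x₀ ⊗ (x₁ ⊝ 1 /1+ 1 ⊗ x₄ ⊝ (x₂ ⊕ 1 /1+ 1 ⊗ x₄)) ⊑ x₃ ∷
          []) (≤ν {UpTo c u} (λ t C → length≤cost c lo<a p b<hi inside C) , tt)

    measurable-UpTo : ∀ c u → IsMeasurable (UpTo c u)
    measurable-UpTo c u = measurable-from-boxes split
      where
      split : ∀ d a b → a ≤ b → ν (Box d a b ∩ UpTo c u) + ν (Box d a b ∩ ∁ (UpTo c u)) ≤ w d * (b - a)
      split d a b a≤b = by-index (d ≟ c)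
        where
        by-index : Dec (d ≡ c) → ν (Box d a b ∩ UpTo c u) + ν (Box d a b ∩ ∁ (UpTo c u)) ≤ w d * (b - a)
        by-index (no d≢c) = lin (ν (Box d a b ∩ UpTo c u) ∷ ν (Box d a b ∩ ∁ (UpTo c u)) ∷ w d ∷ b ∷
          a ∷ ν ∅ ∷ []) (x₀ ⊕ x₁ ⊑ x₂ ⊗ (x₃ ⊝ x₄)) (▹ x₀ ⊑ x₅ ∷ ▹ x₅ ≃ 𝟘 ∷ ▹ x₁ ⊑ x₂ ⊗ (x₃ ⊝ x₄) ∷
          []) (ν-mono (Box d a b ∩ UpTo c u) ∅ (λ { ((≡.refl , _) , ≡.refl , _) → d≢c ≡.refl }) ,
          ν-∅ , ν≤ {Box d a b ∩ ∁ (UpTo c u)} (box d a b a≤b proj₁ ≤-refl) , tt)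
        by-index (yes ≡.refl) = ≤-by-ε (w c) (0≤w c) (λ ε 0<ε → case ε 0<ε (≤-<-connex u a) (≤-<-connex b u))
          where
          case : ∀ ε → 0# < ε → u ≤ a ⊎ a < u → b ≤ u ⊎ u < b →
                 ν (Box c a b ∩ UpTo c u) + ν (Box c a b ∩ ∁ (UpTo c u)) ≤ w c * (b - a) + w c * ε
          case ε 0<ε (inj₁ u≤a) _ = lin (ν (Box c a b ∩ UpTo c u) ∷ ν (Box c a b ∩ ∁ (UpTo c u)) ∷
            w c ∷ b ∷ a ∷ ε ∷ ν ∅ ∷ []) (x₀ ⊕ x₁ ⊑ x₂ ⊗ (x₃ ⊝ x₄) ⊕ x₂ ⊗ x₅) (▹ x₀ ⊑ x₆ ∷ ▹ x₆ ≃ 𝟘 ∷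
            ▹ x₁ ⊑ x₂ ⊗ (x₃ ⊝ x₄) ∷ ▹ 𝟘 ⊑ x₂ ⊗ x₅ ∷ [])
            (ν-mono (Box c a b ∩ UpTo c u) ∅ (λ { ((_ , a<z , _) , _ , z≤u) → <-irrefl (≤-<-trans (≤-trans z≤u u≤a) a<z) }) ,
            ν-∅ , ν≤ {Box c a b ∩ ∁ (UpTo c u)} (box c a b a≤b proj₁ ≤-refl) ,
            *-nonNeg (0≤w c) (<⇒≤ 0<ε) , tt)
          case ε 0<ε (inj₂ _) (inj₁ b≤u) = lin (ν (Box c a b ∩ UpTo c u) ∷
            ν (Box c a b ∩ ∁ (UpTo c u)) ∷ w c ∷ b ∷ a ∷ ε ∷ ν ∅ ∷ [])
            (x₀ ⊕ x₁ ⊑ x₂ ⊗ (x₃ ⊝ x₄) ⊕ x₂ ⊗ x₅) (▹ x₁ ⊑ x₆ ∷ ▹ x₆ ≃ 𝟘 ∷ ▹ x₀ ⊑ x₂ ⊗ (x₃ ⊝ x₄) ∷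
            ▹ 𝟘 ⊑ x₂ ⊗ x₅ ∷ [])
            (ν-mono (Box c a b ∩ ∁ (UpTo c u)) ∅ (λ { ((e , _ , z<b) , n) → n (e , ≤-trans (<⇒≤ z<b) b≤u) }) ,
            ν-∅ , ν≤ {Box c a b ∩ UpTo c u} (box c a b a≤b proj₁ ≤-refl) ,
            *-nonNeg (0≤w c) (<⇒≤ 0<ε) , tt)
          -- The box is divided at `u` into two open boxes. The left one is extended by ε in order
          -- to contain `u`, which accounts for the error term.
          case ε 0<ε (inj₂ a<u) (inj₂ u<b) = lin (ν (Box c a b ∩ UpTo c u) ∷
            ν (Box c a b ∩ ∁ (UpTo c u)) ∷ w c ∷ b ∷ a ∷ ε ∷ u ∷ [])
            (x₀ ⊕ x₁ ⊑ x₂ ⊗ (x₃ ⊝ x₄) ⊕ x₂ ⊗ x₅) (▹ x₀ ⊑ x₂ ⊗ (x₆ ⊕ x₅ ⊝ x₄) ∷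
            ▹ x₁ ⊑ x₂ ⊗ (x₃ ⊝ x₆) ∷ [])
            (ν≤ {Box c a b ∩ UpTo c u} (box c a (u + ε) a≤u+ε (λ {ω} → inside {ω}) ≤-refl) ,
            ν≤ {Box c a b ∩ ∁ (UpTo c u)} (box c u b (<⇒≤ u<b) (λ {ω} → outside {ω}) ≤-refl) , tt)
            where
            a≤u+ε : a ≤ u + ε
            a≤u+ε = lin (a ∷ u ∷ ε ∷ []) (x₀ ⊑ x₁ ⊕ x₂) (▹ x₀ ⊏ x₁ ∷ ▹ 𝟘 ⊏ x₂ ∷ []) (a<u , 0<ε , tt)
            inside : Box c a b ∩ UpTo c u ⊆ Box c a (u + ε)
            inside {_ , z , _} ((e , a<z , _) , _ , z≤u) = e , a<z , z<u+ε
              where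
              z<u+ε : z < u + ε
              z<u+ε = lin (z ∷ u ∷ ε ∷ []) (x₀ ⊏ x₁ ⊕ x₂) (▹ x₀ ⊑ x₁ ∷ ▹ 𝟘 ⊏ x₂ ∷ []) (z≤u , 0<ε ,
                tt)
            outside : Box c a b ∩ ∁ (UpTo c u) ⊆ Box c u b
            outside ((e , _ , z<b) , n) = e , ≰⇒> (λ p → n (e , p)) , z<b

    Piece : I → Pred Ω 0ℓ
    Piece c ω = index ω ≡ c

    UpTo-hi : ∀ c → UpTo c (hi c) ≐ Piece c
    UpTo-hi c = proj₁ , λ { {_ , _ , _ , z<hi} ≡.refl → ≡.refl , <⇒≤ z<hi }

    measurable-Piece : ∀ c → IsMeasurable (Piece c)
    measurable-Piece c = measurable-≐ (UpTo-hi c) (measurable-UpTo c (hi c))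

    ν-Piece : ∀ c → ν (Piece c) ≈ w c * (hi c - lo c)
    ν-Piece c = trans
      (≤-antisym (ν-mono _ _ λ {ω} → proj₂ (UpTo-hi c) {ω}) (ν-mono _ _ λ {ω} → proj₁ (UpTo-hi c) {ω}))
      (ν-UpTo (<⇒≤ (lo<hi c)) ≤-refl)

    -- One inequality is subadditivity; the other tests the measurability of `Piece d` on the union
    -- of all pieces.
    ν-Pieces : ∀ {ds} → Unique ds → ν (Pieces ds) ≈ total ds
    ν-Pieces {[]} [] = trans (≤-antisym (ν-mono (Pieces []) ∅ λ ()) (ν-mono ∅ (Pieces []) λ ())) ν-∅
    ν-Pieces {d ∷ ds} (d∉ds ∷ u) = ≤-antisym
      (lin (ν (Pieces (d ∷ ds)) ∷ w d ∷ hi d ∷ lo d ∷ total ds ∷ ν (Piece d ∪ Pieces ds) ∷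
        ν (Piece d) ∷ ν (Pieces ds) ∷ []) (x₀ ⊑ x₁ ⊗ (x₂ ⊝ x₃) ⊕ x₄) (▹ x₀ ⊑ x₅ ∷ ▹ x₅ ⊑ x₆ ⊕ x₇ ∷
        ▹ x₆ ≃ x₁ ⊗ (x₂ ⊝ x₃) ∷ ▹ x₇ ≃ x₄ ∷ [])
        (ν-mono (Pieces (d ∷ ds)) (Piece d ∪ Pieces ds) (λ { (here e) → inj₁ e ; (there i) → inj₂ i }) ,
        ν-∪ (Piece d) (Pieces ds) , ν-Piece d , ν-Pieces u , tt))
      (lin (w d ∷ hi d ∷ lo d ∷ total ds ∷ ν (Pieces (d ∷ ds)) ∷ ν (Pieces (d ∷ ds) ∩ Piece d) ∷
        ν (Pieces (d ∷ ds) ∩ ∁ (Piece d)) ∷ ν (Piece d) ∷ ν (Pieces ds) ∷ [])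
        (x₀ ⊗ (x₁ ⊝ x₂) ⊕ x₃ ⊑ x₄) (▹ x₅ ⊕ x₆ ⊑ x₄ ∷ ▹ x₇ ⊑ x₅ ∷ ▹ x₈ ⊑ x₆ ∷ ▹ x₀ ⊗ (x₁ ⊝ x₂) ≃ x₇ ∷
        ▹ x₃ ≃ x₈ ∷ []) (measurable-Piece d (Pieces (d ∷ ds)) ,
        ν-mono (Piece d) (Pieces (d ∷ ds) ∩ Piece d) (λ e → here e , e) ,
        ν-mono (Pieces ds) (Pieces (d ∷ ds) ∩ ∁ (Piece d)) (λ i → there i , λ { ≡.refl → All.lookup d∉ds i ≡.refl }) ,
        sym (ν-Piece d) , sym (ν-Pieces u) , tt))

    ν-U : ν U ≈ total cs
    ν-U = trans (≤-antisym (ν-mono U (Pieces cs) λ {ω} _ → complete-cs (index ω)) (ν-mono (Pieces cs) U _))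
      (ν-Pieces unique-cs)

    Points : I → List ℝ → Pred Ω 0ℓ
    Points c zs ω = index ω ≡ c × Any (position ω ≈_) zs

    ν-Points : ∀ c zs → ν (Points c zs) ≈ 0#
    ν-Points c [] = trans (≤-antisym (ν-mono (Points c []) ∅ λ ()) (ν-mono ∅ (Points c []) λ ())) ν-∅
    ν-Points c (z ∷ zs) = ≤-antisym (≤-by-ε (2 ÷ 1 * w c) (lin (w c ∷ []) (𝟘 ⊑ 2 /1+ 0 ⊗ x₀)
      (2 /1+ 0 ▸ 𝟘 ⊑ x₀ ∷ []) (0≤w c , tt)) upper) (ν-nonNeg _)
      where
      upper : ∀ ε → 0# < ε → ν (Points c (z ∷ zs)) ≤ 0# + 2 ÷ 1 * w c * ε
      upper ε 0<ε = lin (ν (Points c (z ∷ zs)) ∷ w c ∷ ε ∷ ν (Box c (z - ε) (z + ε) ∪ Points c zs) ∷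
        ν (Box c (z - ε) (z + ε)) ∷ ν (Points c zs) ∷ z ∷ []) (x₀ ⊑ 𝟘 ⊕ 2 /1+ 0 ⊗ x₁ ⊗ x₂)
        (▹ x₀ ⊑ x₃ ∷ ▹ x₃ ⊑ x₄ ⊕ x₅ ∷ ▹ x₅ ≃ 𝟘 ∷ ▹ x₄ ⊑ x₁ ⊗ (x₆ ⊕ x₂ ⊝ (x₆ ⊝ x₂)) ∷ [])
        (ν-mono (Points c (z ∷ zs)) (Box c (z - ε) (z + ε) ∪ Points c zs) (λ {ω} → split {ω}) ,
        ν-∪ (Box c (z - ε) (z + ε)) (Points c zs) , ν-Points c zs ,
        ν≤ {Box c (z - ε) (z + ε)} (box c (z - ε) (z + ε) z-ε≤z+ε (λ x → x) ≤-refl) , tt)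
        where
        z-ε≤z+ε : z - ε ≤ z + ε
        z-ε≤z+ε = lin (z ∷ ε ∷ []) (x₀ ⊝ x₁ ⊑ x₀ ⊕ x₁) (2 /1+ 0 ▸ 𝟘 ⊏ x₁ ∷ []) (0<ε , tt)
        near : ∀ {y} → y ≈ z → z - ε < y × y < z + ε
        near {y} e = (lin (z ∷ ε ∷ y ∷ []) (x₀ ⊝ x₁ ⊏ x₂) (▹ x₀ ≃ x₂ ∷ ▹ 𝟘 ⊏ x₁ ∷ []) (sym e , 0<ε ,
          tt)) , (lin (y ∷ z ∷ ε ∷ []) (x₀ ⊏ x₁ ⊕ x₂) (▹ x₀ ≃ x₁ ∷ ▹ 𝟘 ⊏ x₂ ∷
          []) (e , 0<ε , tt))
        split : Points c (z ∷ zs) ⊆ Box c (z - ε) (z + ε) ∪ Points c zs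
        split (e , here p)  = inj₁ (e , near p)
        split (e , there p) = inj₂ (e , p)

    -- Finite sets of positions are null, so on each piece the set may be replaced by one that
    -- agrees with it at all but finitely many positions. The description `M c` is used on piece `c`
    -- alone.
    measurable-piecewise : (M : I → Pred Ω 0ℓ) → (∀ c → IsMeasurable (M c)) → (zs : I → List ℝ) →
      (∀ ω → ¬ Any (position ω ≈_) (zs (index ω)) →
        (ω ∈ M (index ω) → ω ∈ A) × (ω ∈ A → ω ∈ M (index ω))) → IsMeasurable A
    measurable-piecewise {A} M mM zs h = measurable-from-boxes λ c a b a≤b → ≤-trans
      (measurable-mod-null (ν-Points c (zs c)) (λ { ω (≡.refl , _) n → h ω (λ any → n (≡.refl , any)) })
        (mM c (Box c a b)))
      (ν≤ (box c a b a≤b (λ x → x) ≤-refl))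

-- Labellings of the three coordinates.

data Triple : Fin 3 → Fin 3 → Fin 3 → Set where
  012F : Triple 0F 1F 2F
  021F : Triple 0F 2F 1F
  102F : Triple 1F 0F 2F
  120F : Triple 1F 2F 0F
  201F : Triple 2F 0F 1F
  210F : Triple 2F 1F 0F

-- For the ray which the choice `b` selects on the side opposite `j`: the second index is that of
-- its line, the third is the coordinate left over.
triple : ∀ j b → Triple j (punchIn j b) (punchIn j (opposite b))
triple 0F 0F = 012F
triple 0F 1F = 021F
triple 1F 0F = 102F
triple 1F 1F = 120F
triple 2F 0F = 201F
triple 2F 1F = 210F

rotate : ∀ {i j k} → Triple i j k → Triple j k i
rotate 012F = 120F
rotate 021F = 210F
rotate 102F = 021F
rotate 120F = 201F
rotate 201F = 012F
rotate 210F = 102F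

swap : ∀ {i j k} → Triple i j k → Triple j i k
swap 012F = 102F
swap 021F = 201F
swap 102F = 012F
swap 120F = 210F
swap 201F = 021F
swap 210F = 120F

triple-≢ : ∀ {i j k} → Triple i j k → i ≢ j
triple-≢ 012F ()
triple-≢ 021F ()
triple-≢ 102F ()
triple-≢ 120F ()
triple-≢ 201F ()
triple-≢ 210F ()

triple-of : ∀ i l → l ≢ i → ∃[ m ] Triple i l m
triple-of 0F 1F _ = 2F , 012F
triple-of 0F 2F _ = 1F , 021F
triple-of 1F 0F _ = 2F , 102F
triple-of 1F 2F _ = 0F , 120F
triple-of 2F 0F _ = 1F , 201F
triple-of 2F 1F _ = 0F , 210F
triple-of 0F 0F n = ⊥-elim (n ≡.refl)
triple-of 1F 1F n = ⊥-elim (n ≡.refl)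
triple-of 2F 2F n = ⊥-elim (n ≡.refl)

exhaust : ∀ {i j k} → Triple i j k → ∀ l → l ≡ i ⊎ l ≡ j ⊎ l ≡ k
exhaust {i} {j} {k} t l with l Fin.≟ i | l Fin.≟ j | l Fin.≟ k
... | yes p | _     | _     = inj₁ p
... | no _  | yes p | _     = inj₂ (inj₁ p)
... | no _  | no _  | yes p = inj₂ (inj₂ p)
... | no p  | no q  | no r  = ⊥-elim (none t l p q r)
  where
  none : ∀ {i j k} → Triple i j k → ∀ l → l ≢ i → l ≢ j → l ≢ k → ⊥
  none 012F = λ { 0F p q r → p ≡.refl ; 1F p q r → q ≡.refl ; 2F p q r → r ≡.refl }
  none 021F = λ { 0F p q r → p ≡.refl ; 2F p q r → q ≡.refl ; 1F p q r → r ≡.refl }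
  none 102F = λ { 1F p q r → p ≡.refl ; 0F p q r → q ≡.refl ; 2F p q r → r ≡.refl }
  none 120F = λ { 1F p q r → p ≡.refl ; 2F p q r → q ≡.refl ; 0F p q r → r ≡.refl }
  none 201F = λ { 2F p q r → p ≡.refl ; 0F p q r → q ≡.refl ; 1F p q r → r ≡.refl }
  none 210F = λ { 2F p q r → p ≡.refl ; 1F p q r → q ≡.refl ; 0F p q r → r ≡.refl }

-- Geometry of the triangle: distances, blocks and crossings.

module SimplexGeometry (em : ∀ {ℓ} → ExcludedMiddle ℓ) (𝓡 : CompleteOrderedField) where
  open CompleteOrderedField 𝓡 hiding (zero)
  open LinearArithmetic 𝓡
  open RealNumbers em 𝓡
  open Simplex 𝓡

  private variable
    i j k : Fin 3

  Δ-sum : ∀ {x} → x ∈ Δ {3} → x 0F + x 1F + x 2F ≈ 1#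
  Δ-sum {x} (_ , s) = trans e s
    where
    e : x 0F + x 1F + x 2F ≈ x 0F + (x 1F + (x 2F + 0#))
    e = lin (x 0F ∷ x 1F ∷ x 2F ∷ []) (x₀ ⊕ x₁ ⊕ x₂ ≃ x₀ ⊕ (x₁ ⊕ (x₂ ⊕ 𝟘))) [] tt

  sum-triple : ∀ (x : Point 3) → Triple i j k → x i + x j + x k ≈ x 0F + x 1F + x 2F
  sum-triple x 012F = refl
  sum-triple x 021F = lin (x 0F ∷ x 2F ∷ x 1F ∷ []) (x₀ ⊕ x₁ ⊕ x₂ ≃ x₀ ⊕ x₂ ⊕ x₁) [] tt
  sum-triple x 102F = lin (x 1F ∷ x 0F ∷ x 2F ∷ []) (x₀ ⊕ x₁ ⊕ x₂ ≃ x₁ ⊕ x₀ ⊕ x₂) [] tt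
  sum-triple x 120F = lin (x 1F ∷ x 2F ∷ x 0F ∷ []) (x₀ ⊕ x₁ ⊕ x₂ ≃ x₂ ⊕ x₀ ⊕ x₁) [] tt
  sum-triple x 201F = lin (x 2F ∷ x 0F ∷ x 1F ∷ []) (x₀ ⊕ x₁ ⊕ x₂ ≃ x₁ ⊕ x₂ ⊕ x₀) [] tt
  sum-triple x 210F = lin (x 2F ∷ x 1F ∷ x 0F ∷ []) (x₀ ⊕ x₁ ⊕ x₂ ≃ x₂ ⊕ x₁ ⊕ x₀) [] tt

  triple-sum : ∀ {x} → Triple i j k → x ∈ Δ {3} → x i + x j + x k ≈ 1#
  triple-sum {x = x} t x∈Δ = trans (sum-triple x t) (Δ-sum x∈Δ)

  Δ-intro : ∀ {x : Point 3} → 0# ≤ x 0F → 0# ≤ x 1F → 0# ≤ x 2F → x 0F + x 1F + x 2F ≈ 1# → x ∈ Δ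
  Δ-intro {x} a b c s = (λ { 0F → a ; 1F → b ; 2F → c }) , trans e s
    where
    e : x 0F + (x 1F + (x 2F + 0#)) ≈ x 0F + x 1F + x 2F
    e = lin (x 0F ∷ x 1F ∷ x 2F ∷ []) (x₀ ⊕ (x₁ ⊕ (x₂ ⊕ 𝟘)) ≃ x₀ ⊕ x₁ ⊕ x₂) [] tt

  Δ≤1 : ∀ {x} → x ∈ Δ {3} → ∀ i → x i ≤ 1#
  Δ≤1 {x} x∈Δ@(0≤x , _) i = lin (x i ∷ x (punchIn i 0F) ∷ x (punchIn i (opposite 0F)) ∷ []) (x₀ ⊑ 𝟙)
    (▹ x₀ ⊕ x₁ ⊕ x₂ ≃ 𝟙 ∷ ▹ 𝟘 ⊑ x₁ ∷ ▹ 𝟘 ⊑ x₂ ∷ []) (triple-sum (triple i 0F) x∈Δ ,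
    0≤x (punchIn i 0F) , 0≤x (punchIn i (opposite 0F)) , tt)

  lerp∈Δ : ∀ {x y s} → x ∈ Δ {3} → y ∈ Δ → 0# ≤ s → s ≤ 1# → lerp x y s ∈ Δ
  lerp∈Δ {x} {y} {s} x∈Δ y∈Δ 0≤s s≤1 = Δ-intro (nonNeg 0F) (nonNeg 1F) (nonNeg 2F) total
    where
    nonNeg : ∀ i → 0# ≤ (1# - s) * x i + s * y i
    nonNeg i = 0≤x+y (*-nonNeg (x≤y⇒0≤y-x s≤1) (proj₁ x∈Δ i)) (*-nonNeg 0≤s (proj₁ y∈Δ i))
    total : ((1# - s) * x 0F + s * y 0F) + ((1# - s) * x 1F + s * y 1F) + ((1# - s) * x 2F + s * y 2F) ≈ 1#
    total = lin (s ∷ x 0F ∷ y 0F ∷ x 1F ∷ y 1F ∷ x 2F ∷ y 2F ∷ []) ((𝟙 ⊝ x₀) ⊗ x₁ ⊕ x₀ ⊗ x₂ ⊕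
      ((𝟙 ⊝ x₀) ⊗ x₃ ⊕ x₀ ⊗ x₄) ⊕ ((𝟙 ⊝ x₀) ⊗ x₅ ⊕ x₀ ⊗ x₆) ≃ 𝟙)
      (▹ (𝟙 ⊝ x₀) ⊗ (x₁ ⊕ x₃ ⊕ x₅) ≃ (𝟙 ⊝ x₀) ⊗ 𝟙 ∷ ▹ x₀ ⊗ (x₂ ⊕ x₄ ⊕ x₆) ≃ x₀ ⊗ 𝟙 ∷ [])
      (*-congᵗ (1# - s) (Δ-sum x∈Δ) , *-congᵗ s (Δ-sum y∈Δ) , tt)

  -- Coordinates lie between 0 and 1, so each changes at a speed between -1 and 1. The certificates
  -- average two products, of the factors ∣ s - t ∣ ± (s - t) with the factors 1 ± (y i - x i).
  lerp-Lipschitz : ∀ {x y} → x ∈ Δ {3} → y ∈ Δ → ∀ s t i → ∣ lerp x y s i - lerp x y t i ∣ ≤ ∣ s - t ∣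
  lerp-Lipschitz {x} {y} x∈Δ y∈Δ s t i = ∣x∣≤ (lin (s ∷ x i ∷ y i ∷ t ∷ (∣ s - t ∣) ∷ [])
    ((𝟙 ⊝ x₀) ⊗ x₁ ⊕ x₀ ⊗ x₂ ⊝ ((𝟙 ⊝ x₃) ⊗ x₁ ⊕ x₃ ⊗ x₂) ⊑ x₄)
    (1 /1+ 1 ▸ 𝟘 ⊑ (x₄ ⊝ (x₀ ⊝ x₃)) ⊗ (𝟙 ⊕ (x₂ ⊝ x₁)) ∷
    1 /1+ 1 ▸ 𝟘 ⊑ (x₄ ⊕ (x₀ ⊝ x₃)) ⊗ (𝟙 ⊝ (x₂ ⊝ x₁)) ∷ []) (*-nonNeg a d , *-nonNeg b c , tt)) (lin
    (s ∷ x i ∷ y i ∷ t ∷ (∣ s - t ∣) ∷ [])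
    (⊖ ((𝟙 ⊝ x₀) ⊗ x₁ ⊕ x₀ ⊗ x₂ ⊝ ((𝟙 ⊝ x₃) ⊗ x₁ ⊕ x₃ ⊗ x₂)) ⊑ x₄)
    (1 /1+ 1 ▸ 𝟘 ⊑ (x₄ ⊝ (x₀ ⊝ x₃)) ⊗ (𝟙 ⊝ (x₂ ⊝ x₁)) ∷
    1 /1+ 1 ▸ 𝟘 ⊑ (x₄ ⊕ (x₀ ⊝ x₃)) ⊗ (𝟙 ⊕ (x₂ ⊝ x₁)) ∷ []) (*-nonNeg a c , *-nonNeg b d , tt))
    where
    a : 0# ≤ ∣ s - t ∣ - (s - t)
    a = lin ((∣ s - t ∣) ∷ s ∷ t ∷ []) (𝟘 ⊑ x₀ ⊝ (x₁ ⊝ x₂)) (▹ x₁ ⊝ x₂ ⊑ x₀ ∷ []) (x≤∣x∣ (s - t) ,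
      tt)
    b : 0# ≤ ∣ s - t ∣ + (s - t)
    b = lin ((∣ s - t ∣) ∷ s ∷ t ∷ []) (𝟘 ⊑ x₀ ⊕ (x₁ ⊝ x₂)) (▹ ⊖ (x₁ ⊝ x₂) ⊑ x₀ ∷ [])
      (-x≤∣x∣ (s - t) , tt)
    c : 0# ≤ 1# - (y i - x i)
    c = lin (y i ∷ x i ∷ []) (𝟘 ⊑ 𝟙 ⊝ (x₀ ⊝ x₁)) (▹ x₀ ⊑ 𝟙 ∷ ▹ 𝟘 ⊑ x₁ ∷ []) (Δ≤1 y∈Δ i ,
      proj₁ x∈Δ i , tt)
    d : 0# ≤ 1# + (y i - x i)
    d = lin (y i ∷ x i ∷ []) (𝟘 ⊑ 𝟙 ⊕ (x₀ ⊝ x₁)) (▹ x₁ ⊑ 𝟙 ∷ ▹ 𝟘 ⊑ x₀ ∷ []) (Δ≤1 x∈Δ i ,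
      proj₁ y∈Δ i , tt)

  dist≤ : ∀ {x y : Point 3} ε → (∀ i → ∣ x i - y i ∣ ≤ ε) → dist x y ≤ 3 ÷ 2 * ε
  dist≤ {x} {y} ε h = bound
    where
    bound : (1 ÷ 2) * (∣ x 0F - y 0F ∣ + (∣ x 1F - y 1F ∣ + (∣ x 2F - y 2F ∣ + 0#))) ≤ 3 ÷ 2 * ε
    bound = lin ((∣ x 0F - y 0F ∣) ∷ (∣ x 1F - y 1F ∣) ∷ (∣ x 2F - y 2F ∣) ∷ ε ∷ [])
      (1 /1+ 1 ⊗ (x₀ ⊕ (x₁ ⊕ (x₂ ⊕ 𝟘))) ⊑ 3 /1+ 1 ⊗ x₃) (1 /1+ 1 ▸ x₀ ⊑ x₃ ∷ 1 /1+ 1 ▸ x₁ ⊑ x₃ ∷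
      1 /1+ 1 ▸ x₂ ⊑ x₃ ∷ []) (h 0F , h 1F , h 2F , tt)

  dist-lerp : ∀ {x y} → x ∈ Δ {3} → y ∈ Δ → ∀ s t → dist (lerp x y s) (lerp x y t) ≤ 3 ÷ 2 * ∣ s - t ∣
  dist-lerp x∈Δ y∈Δ s t = dist≤ ∣ s - t ∣ (lerp-Lipschitz x∈Δ y∈Δ s t)

  dist-coordinate : ∀ {x y : Point 3} {δ} → dist x y < δ → ∀ i → ∣ x i - y i ∣ < 2 ÷ 1 * δ
  dist-coordinate {x} {y} {δ} p = λ { 0F → (lin ((∣ x 0F - y 0F ∣) ∷ δ ∷ (∣ x 1F - y 1F ∣) ∷
    (∣ x 2F - y 2F ∣) ∷ []) (x₀ ⊏ 2 /1+ 0 ⊗ x₁) (2 /1+ 0 ▸ 1 /1+ 1 ⊗ (x₀ ⊕ (x₂ ⊕ (x₃ ⊕ 𝟘))) ⊏ x₁ ∷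
    ▹ 𝟘 ⊑ x₂ ∷ ▹ 𝟘 ⊑ x₃ ∷ []) (q , n 1F , n 2F , tt)) ; 1F → (lin ((∣ x 1F - y 1F ∣) ∷
    δ ∷ (∣ x 0F - y 0F ∣) ∷ (∣ x 2F - y 2F ∣) ∷ []) (x₀ ⊏ 2 /1+ 0 ⊗ x₁)
    (2 /1+ 0 ▸ 1 /1+ 1 ⊗ (x₂ ⊕ (x₀ ⊕ (x₃ ⊕ 𝟘))) ⊏ x₁ ∷ ▹ 𝟘 ⊑ x₂ ∷ ▹ 𝟘 ⊑ x₃ ∷ []) (q , n 0F , n 2F ,
    tt)) ; 2F → (lin
    ((∣ x 2F - y 2F ∣) ∷ δ ∷ (∣ x 0F - y 0F ∣) ∷ (∣ x 1F - y 1F ∣) ∷ []) (x₀ ⊏ 2 /1+ 0 ⊗ x₁)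
    (2 /1+ 0 ▸ 1 /1+ 1 ⊗ (x₂ ⊕ (x₃ ⊕ (x₀ ⊕ 𝟘))) ⊏ x₁ ∷ ▹ 𝟘 ⊑ x₂ ∷ ▹ 𝟘 ⊑ x₃ ∷ []) (q , n 0F , n 1F ,
    tt)) }
    where
    q : (1 ÷ 2) * (∣ x 0F - y 0F ∣ + (∣ x 1F - y 1F ∣ + (∣ x 2F - y 2F ∣ + 0#))) < δ
    q = p
    n : ∀ i → 0# ≤ ∣ x i - y i ∣
    n i = 0≤∣x∣ _

  -- The radius 2δ/3 in the parameter corresponds to the distance δ, because of the factor 3/2 in
  -- `dist-lerp`.
  scale-pos : ∀ {δ} → 0# < δ → 0# < 2 ÷ 3 * δ
  scale-pos {δ} p = lin (δ ∷ []) (𝟘 ⊏ 2 /1+ 2 ⊗ x₀) (2 /1+ 2 ▸ 𝟘 ⊏ x₀ ∷ []) (p , tt)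

  module _ (C : Cut 3) where
    open Cut C

    -- Blocks are arbitrary predicates on functions into a setoid. That they respect equality of
    -- coordinates is a consequence of being polyhedral, as half-spaces respect it.
    block-resp : ∀ {i x y} → x ∈ Δ → y ∈ Δ → (∀ l → x l ≈ y l) → x ∈ block i → y ∈ block i
    block-resp {i} {x} {y} x∈Δ y∈Δ x≈y x∈B = let _ , h = polyhedral i in
      Equivalence.from (h y y∈Δ) (Any.map (All.map (λ {H} → half H)) (Equivalence.to (h x x∈Δ) x∈B))
      where
      open MonoidSum +-monoid using (sum-cong-≋)
      cong : ∀ n → sum (λ l → n l * x l) ≈ sum (λ l → n l * y l)
      cong n = sum-cong-≋ {3} (λ l → *-congᵗ (n l) (x≈y l))
      half : ∀ H → x ∈ʰ H → y ∈ʰ H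
      half (closed n c) p = ≤-trans (≤-reflexive (sym (cong n))) p
      half (open′ n c)  p = ≤-<-trans (≤-reflexive (sym (cong n))) p

    -- If two neighbouring points lay in different blocks at every scale, they would witness that
    -- `x` is a boundary point. The block is not named, since in `path` it is inherited from a point
    -- already reached.
    interior : ∀ {x} → x ∈ Δ → ¬ (x ∈ Boundary C) → ∃[ δ ] 0# < δ × (∀ y z i → y ∈ Δ → z ∈ Δ →
      dist x y < δ → dist x z < δ → y ∈ block i → z ∈ block i)
    interior {x} x∈Δ x∉∂ = by-contradiction λ n → x∉∂ (x∈Δ , λ δ 0<δ → by-contradiction λ m →
      n (δ , 0<δ , λ y z i y∈Δ z∈Δ xy xz y∈i → same y z i y∈Δ z∈Δ y∈i (covers z z∈Δ)
        λ j i≢j z∈j → m (y , z , y∈Δ , z∈Δ , xy , xz , i , j , i≢j , y∈i , z∈j)))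
      where
      same : ∀ y z i → y ∈ Δ → z ∈ Δ → y ∈ block i → (∃[ j ] z ∈ block j) →
             (∀ j → i ≢ j → z ∈ block j → ⊥) → z ∈ block i
      same y z i _ _ y∈i (j , z∈j) h with i Fin.≟ j
      ... | yes ≡.refl = z∈j
      ... | no i≢j     = ⊥-elim (h j i≢j z∈j)

    -- By `interior` every parameter has a neighbourhood that is mapped into one block, which is the
    -- step of `real-induction`. Through this lemma information on the boundary becomes information
    -- on blocks.
    path : ∀ {x y i} → x ∈ Δ → y ∈ Δ → (∀ s → 0# ≤ s → s ≤ 1# → ¬ (lerp x y s ∈ Boundary C)) →
           x ∈ block i → y ∈ block i
    path {x} {y} {i} x∈Δ y∈Δ avoids x∈i =
      block-resp (lerp∈Δ x∈Δ y∈Δ 0≤1 ≤-refl) y∈Δ (λ l → at-1 l)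
        (real-induction 0≤1 (λ s → lerp x y s ∈ block i)
          (block-resp x∈Δ (lerp∈Δ x∈Δ y∈Δ ≤-refl 0≤1) (λ l → at-0 l) x∈i) step)
      where
      at-0 : ∀ l → x l ≈ (1# - 0#) * x l + 0# * y l
      at-0 l = lin (x l ∷ y l ∷ []) (x₀ ≃ (𝟙 ⊝ 𝟘) ⊗ x₀ ⊕ 𝟘 ⊗ x₁) [] tt
      at-1 : ∀ l → (1# - 1#) * x l + 1# * y l ≈ y l
      at-1 l = lin (x l ∷ y l ∷ []) ((𝟙 ⊝ 𝟙) ⊗ x₀ ⊕ 𝟙 ⊗ x₁ ≃ x₁) [] tt
      step : ∀ c → 0# ≤ c → c ≤ 1# → ∃[ η ] 0# < η × (∀ s t → 0# ≤ s → c - η < s → s ≤ c → c ≤ t →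
        t < c + η → t ≤ 1# → lerp x y s ∈ block i → lerp x y t ∈ block i)
      step c 0≤c c≤1 = let δ , 0<δ , same = interior (lerp∈Δ x∈Δ y∈Δ 0≤c c≤1) (avoids c 0≤c c≤1) in
        2 ÷ 3 * δ , scale-pos 0<δ , λ s t 0≤s p q r u t≤1 →
          same _ _ i (lerp∈Δ x∈Δ y∈Δ 0≤s (≤-trans q c≤1)) (lerp∈Δ x∈Δ y∈Δ (≤-trans 0≤c r) t≤1)
            (≤-<-trans (dist-lerp x∈Δ y∈Δ c s) (left p q)) (≤-<-trans (dist-lerp x∈Δ y∈Δ c t) (right r u 0<δ))
        where
        left : ∀ {s δ} → c - 2 ÷ 3 * δ < s → s ≤ c → 3 ÷ 2 * ∣ c - s ∣ < δ
        left {s} {δ} p q = lin ((∣ c - s ∣) ∷ δ ∷ c ∷ s ∷ []) (3 /1+ 1 ⊗ x₀ ⊏ x₁)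
          (3 /1+ 1 ▸ x₀ ≃ x₂ ⊝ x₃ ∷ 3 /1+ 1 ▸ x₂ ⊝ 2 /1+ 2 ⊗ x₁ ⊏ x₃ ∷ []) (∣x∣≈x (x≤y⇒0≤y-x q) ,
          p , tt)
        right : ∀ {t δ} → c ≤ t → t < c + 2 ÷ 3 * δ → 0# < δ → 3 ÷ 2 * ∣ c - t ∣ < δ
        right {t} {δ} p q 0<δ = lin ((∣ c - t ∣) ∷ δ ∷ []) (3 /1+ 1 ⊗ x₀ ⊏ x₁)
          (3 /1+ 1 ▸ x₀ ⊏ 2 /1+ 2 ⊗ x₁ ∷ []) (∣x∣< {c - t} {2 ÷ 3 * δ} (lower p 0<δ) (upper q) , tt)
          where
          lower : c ≤ t → 0# < δ → c - t < 2 ÷ 3 * δ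
          lower p 0<δ = lin (c ∷ t ∷ δ ∷ []) (x₀ ⊝ x₁ ⊏ 2 /1+ 2 ⊗ x₂) (▹ x₀ ⊑ x₁ ∷
            2 /1+ 2 ▸ 𝟘 ⊏ x₂ ∷ []) (p , 0<δ , tt)
          upper : t < c + 2 ÷ 3 * δ → - (c - t) < 2 ÷ 3 * δ
          upper q = lin (c ∷ t ∷ δ ∷ []) (⊖ (x₀ ⊝ x₁) ⊏ 2 /1+ 2 ⊗ x₂) (▹ x₁ ⊏ x₀ ⊕ 2 /1+ 2 ⊗ x₂ ∷
            []) (q , tt)

    module _ (e : Segment 3) where
      open Segment e

      at∈Δ : ∀ {s} → 0# ≤ s → s ≤ 1# → at s ∈ Δ
      at∈Δ = lerp∈Δ source∈Δ target∈Δ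

      crossing⇒inside : ∀ {t} → t ∈ Crossing C e → 0# ≤ t × t ≤ 1#
      crossing⇒inside cr = let _ , _ , 0≤s , _ , s<t , t<s′ , _ , s′≤1 , _ = cr 1# (0≤1 , 0≉1) in
        ≤-trans 0≤s (<⇒≤ s<t) , ≤-trans (<⇒≤ t<s′) s′≤1

      crossing⇒boundary : ∀ {t} → t ∈ Crossing C e → at t ∈ Boundary C
      crossing⇒boundary {t} cr = let 0≤t , t≤1 = crossing⇒inside cr in at∈Δ 0≤t t≤1 , λ δ 0<δ →
        let s , s′ , 0≤s , p , s<t , t<s′ , q , s′≤1 , sep = cr (2 ÷ 3 * δ) (scale-pos 0<δ) in
        at s , at s′ , at∈Δ 0≤s (≤-trans (<⇒≤ s<t) t≤1) , at∈Δ (≤-trans 0≤t (<⇒≤ t<s′)) s′≤1 ,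
        ≤-<-trans (dist-lerp source∈Δ target∈Δ t s) (left p s<t) ,
        ≤-<-trans (dist-lerp source∈Δ target∈Δ t s′) (right q t<s′) , sep
        where
        left : ∀ {s δ} → t - 2 ÷ 3 * δ < s → s < t → 3 ÷ 2 * ∣ t - s ∣ < δ
        left {s} {δ} p q = lin ((∣ t - s ∣) ∷ δ ∷ t ∷ s ∷ []) (3 /1+ 1 ⊗ x₀ ⊏ x₁)
          (3 /1+ 1 ▸ x₀ ≃ x₂ ⊝ x₃ ∷ 3 /1+ 1 ▸ x₂ ⊝ 2 /1+ 2 ⊗ x₁ ⊏ x₃ ∷ [])
          (∣x∣≈x (x≤y⇒0≤y-x (<⇒≤ q)) , p , tt)
        right : ∀ {s δ} → s < t + 2 ÷ 3 * δ → t < s → 3 ÷ 2 * ∣ t - s ∣ < δ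
        right {s} {δ} p q = lin ((∣ t - s ∣) ∷ δ ∷ t ∷ s ∷ []) (3 /1+ 1 ⊗ x₀ ⊏ x₁)
          (3 /1+ 1 ▸ x₀ ≃ ⊖ (x₂ ⊝ x₃) ∷ 3 /1+ 1 ▸ x₃ ⊏ x₂ ⊕ 2 /1+ 2 ⊗ x₁ ∷ [])
          (∣x∣≈-x {t - s} t-s≤0 , p , tt)
          where
          t-s≤0 : t - s ≤ 0#
          t-s≤0 = lin (t ∷ s ∷ []) (x₀ ⊝ x₁ ⊑ 𝟘) (▹ x₀ ⊏ x₁ ∷ []) (q , tt)

      crossing-intro : ∀ {a b t η} → a ≢ b → 0# < t → t < 1# → 0# < η →
        (∀ s → 0# ≤ s → t - η < s → s < t → at s ∈ block a) →
        (∀ s → t < s → s < t + η → s ≤ 1# → at s ∈ block b) → t ∈ Crossing C e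
      crossing-intro {a} {b} {t} {η} a≢b 0<t t<1 0<η before after δ 0<δ =
        t - h , t + h , 0≤t-h , t-δ<t-h , t-h<t , t<t+h , t+h<t+δ , t+h≤1 ,
        a , b , a≢b , before (t - h) 0≤t-h t-η<t-h t-h<t , after (t + h) t<t+h t+h<t+η t+h≤1
        where
        h′ h : ℝ
        h′ = min (min t (1# - t)) (min δ η)
        h = (1 ÷ 2) * h′
        0<h′ : 0# < h′
        0<h′ = min-glb-< (min-glb-< 0<t (x<y⇒0<y-x t<1)) (min-glb-< 0<δ 0<η)
        h′≤t : h′ ≤ t
        h′≤t = ≤-trans (min≤x _ _) (min≤x _ _)
        h′≤1-t : h′ ≤ 1# - t
        h′≤1-t = ≤-trans (min≤x _ _) (min≤y _ _)
        h′≤δ : h′ ≤ δ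
        h′≤δ = ≤-trans (min≤y _ _) (min≤x _ _)
        h′≤η : h′ ≤ η
        h′≤η = ≤-trans (min≤y _ _) (min≤y _ _)
        0≤t-h : 0# ≤ t - h
        0≤t-h = lin (t ∷ h′ ∷ []) (𝟘 ⊑ x₀ ⊝ 1 /1+ 1 ⊗ x₁) (▹ x₁ ⊑ x₀ ∷ 1 /1+ 1 ▸ 𝟘 ⊏ x₁ ∷ [])
          (h′≤t , 0<h′ , tt)
        t-δ<t-h : t - δ < t - h
        t-δ<t-h = lin (t ∷ δ ∷ h′ ∷ []) (x₀ ⊝ x₁ ⊏ x₀ ⊝ 1 /1+ 1 ⊗ x₂) (▹ x₂ ⊑ x₁ ∷
          1 /1+ 1 ▸ 𝟘 ⊏ x₂ ∷ []) (h′≤δ , 0<h′ , tt)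
        t-η<t-h : t - η < t - h
        t-η<t-h = lin (t ∷ η ∷ h′ ∷ []) (x₀ ⊝ x₁ ⊏ x₀ ⊝ 1 /1+ 1 ⊗ x₂) (▹ x₂ ⊑ x₁ ∷
          1 /1+ 1 ▸ 𝟘 ⊏ x₂ ∷ []) (h′≤η , 0<h′ , tt)
        t-h<t : t - h < t
        t-h<t = lin (t ∷ h′ ∷ []) (x₀ ⊝ 1 /1+ 1 ⊗ x₁ ⊏ x₀) (1 /1+ 1 ▸ 𝟘 ⊏ x₁ ∷ []) (0<h′ , tt)
        t<t+h : t < t + h
        t<t+h = lin (t ∷ h′ ∷ []) (x₀ ⊏ x₀ ⊕ 1 /1+ 1 ⊗ x₁) (1 /1+ 1 ▸ 𝟘 ⊏ x₁ ∷ []) (0<h′ , tt)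
        t+h<t+δ : t + h < t + δ
        t+h<t+δ = lin (t ∷ h′ ∷ δ ∷ []) (x₀ ⊕ 1 /1+ 1 ⊗ x₁ ⊏ x₀ ⊕ x₂) (▹ x₁ ⊑ x₂ ∷
          1 /1+ 1 ▸ 𝟘 ⊏ x₁ ∷ []) (h′≤δ , 0<h′ , tt)
        t+h<t+η : t + h < t + η
        t+h<t+η = lin (t ∷ h′ ∷ η ∷ []) (x₀ ⊕ 1 /1+ 1 ⊗ x₁ ⊏ x₀ ⊕ x₂) (▹ x₁ ⊑ x₂ ∷
          1 /1+ 1 ▸ 𝟘 ⊏ x₁ ∷ []) (h′≤η , 0<h′ , tt)
        t+h≤1 : t + h ≤ 1#
        t+h≤1 = lin (t ∷ h′ ∷ []) (x₀ ⊕ 1 /1+ 1 ⊗ x₁ ⊑ 𝟙) (▹ x₁ ⊑ 𝟙 ⊝ x₀ ∷ 1 /1+ 1 ▸ 𝟘 ⊏ x₁ ∷ [])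
          (h′≤1-t , 0<h′ , tt)

-- Where a segment passes from one block to another.

module CutCrossings (em : ∀ {ℓ} → ExcludedMiddle ℓ) (𝓡 : CompleteOrderedField) where
  open CompleteOrderedField 𝓡 hiding (zero)
  open LinearArithmetic 𝓡
  open RealNumbers em 𝓡
  open SimplexGeometry em 𝓡
  open Simplex 𝓡

  private variable
    i j k : Fin 3

  unit : Fin 3 → Point 3
  unit i l with l Fin.≟ i
  ... | yes _ = 1#
  ... | no _  = 0#

  unit-self : ∀ i → unit i i ≈ 1#
  unit-self i with i Fin.≟ i
  ... | yes _ = refl
  ... | no n  = ⊥-elim (n ≡.refl)

  unit-other : ∀ {i l} → l ≢ i → unit i l ≈ 0#
  unit-other {i} {l} l≢i with l Fin.≟ i
  ... | yes p = ⊥-elim (l≢i p)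
  ... | no _  = refl

  unit∈Δ : ∀ i → unit i ∈ Δ
  unit∈Δ 0F = Δ-intro 0≤1 ≤-refl ≤-refl (lin [] (𝟙 ⊕ 𝟘 ⊕ 𝟘 ≃ 𝟙) [] tt)
  unit∈Δ 1F = Δ-intro ≤-refl 0≤1 ≤-refl (lin [] (𝟘 ⊕ 𝟙 ⊕ 𝟘 ≃ 𝟙) [] tt)
  unit∈Δ 2F = Δ-intro ≤-refl ≤-refl 0≤1 (lin [] (𝟘 ⊕ 𝟘 ⊕ 𝟙 ≃ 𝟙) [] tt)

  unit-vertex : ∀ i → unit i ∈ IsVertex i
  unit-vertex i = unit∈Δ i , unit-self i

  module _ {x : Point 3} (x∈Δ : x ∈ Δ) {s : ℝ} (0≤s : 0# ≤ s) (s≤1 : s ≤ 1#) where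

    toward-self : ∀ i → x i ≤ lerp x (unit i) s i
    toward-self i = lin (x i ∷ s ∷ unit i i ∷ []) (x₀ ⊑ (𝟙 ⊝ x₁) ⊗ x₀ ⊕ x₁ ⊗ x₂)
      (▹ x₁ ⊗ 𝟙 ≃ x₁ ⊗ x₂ ∷ ▹ 𝟘 ⊑ x₁ ⊗ (𝟙 ⊝ x₀) ∷ []) (sym (*-congᵗ s (unit-self i)) ,
      *-nonNeg 0≤s (x≤y⇒0≤y-x (Δ≤1 x∈Δ i)) , tt)

    toward-other : ∀ {i l} → l ≢ i → lerp x (unit i) s l ≤ x l
    toward-other {i} {l} l≢i = lin (s ∷ x l ∷ unit i l ∷ []) ((𝟙 ⊝ x₀) ⊗ x₁ ⊕ x₀ ⊗ x₂ ⊑ x₁)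
      (▹ x₀ ⊗ x₂ ≃ x₀ ⊗ 𝟘 ∷ ▹ 𝟘 ⊑ x₀ ⊗ x₁ ∷ []) (*-congᵗ s (unit-other l≢i) ,
      *-nonNeg 0≤s (proj₁ x∈Δ l) , tt)

  block-by-path : ∀ (C : Cut 3) {i x} → x ∈ Δ →
    (∀ s → 0# ≤ s → s ≤ 1# → ¬ (lerp x (unit i) s ∈ Boundary C)) → x ∈ Cut.block C i
  block-by-path C {i} {x} x∈Δ avoids =
    let j , x∈j = Cut.covers C x x∈Δ
        j≡i = Cut.disjoint C (unit i) j i (unit∈Δ i) (path C x∈Δ (unit∈Δ i) avoids x∈j)
                (Cut.vertex C i (unit i) (unit-vertex i))
    in ≡.subst (λ l → x ∈ Cut.block C l) j≡i x∈j

  at-shift : ∀ (e : Segment 3) s t i → let open Segment e in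
             at t i - at s i ≈ (t - s) * (target i - source i)
  at-shift e s t i = goal
    where
    open Segment e
    goal : (1# - t) * source i + t * target i - ((1# - s) * source i + s * target i) ≈ (t - s) * (target i - source i)
    goal = lin (t ∷ source i ∷ target i ∷ s ∷ [])
      ((𝟙 ⊝ x₀) ⊗ x₁ ⊕ x₀ ⊗ x₂ ⊝ ((𝟙 ⊝ x₃) ⊗ x₁ ⊕ x₃ ⊗ x₂) ≃ (x₀ ⊝ x₃) ⊗ (x₂ ⊝ x₁)) [] tt

  module _ (e : Segment 3) where
    open Segment e

    at-mono : ∀ {s t i} → source i < target i → s < t → at s i < at t i
    at-mono {s} {t} {i} p q = lin (at s i ∷ at t i ∷ t ∷ s ∷ target i ∷ source i ∷ []) (x₀ ⊏ x₁)
      (▹ 𝟘 ⊏ (x₂ ⊝ x₃) ⊗ (x₄ ⊝ x₅) ∷ ▹ (x₂ ⊝ x₃) ⊗ (x₄ ⊝ x₅) ≃ x₁ ⊝ x₀ ∷ [])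
      (*-pos (x<y⇒0<y-x q) (x<y⇒0<y-x p) , sym (at-shift e s t i) , tt)

    at-anti : ∀ {s t i} → target i < source i → s < t → at t i < at s i
    at-anti {s} {t} {i} p q = lin (at t i ∷ at s i ∷ t ∷ s ∷ source i ∷ target i ∷ []) (x₀ ⊏ x₁)
      (▹ 𝟘 ⊏ (x₂ ⊝ x₃) ⊗ (x₄ ⊝ x₅) ∷ ▹ x₀ ⊝ x₁ ≃ (x₂ ⊝ x₃) ⊗ (x₅ ⊝ x₄) ∷ [])
      (*-pos (x<y⇒0<y-x q) (x<y⇒0<y-x p) , at-shift e s t i , tt)

    at-near : ∀ {s t η} i → s - η < t → t < s + η → at s i - η < at t i × at t i < at s i + η
    at-near {s} {t} {η} i p q = (lin (at s i ∷ η ∷ at t i ∷ (∣ at s i - at t i ∣) ∷ (∣ s - t ∣) ∷ [])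
      (x₀ ⊝ x₁ ⊏ x₂) (▹ x₃ ⊑ x₄ ∷ ▹ x₄ ⊏ x₁ ∷ ▹ x₀ ⊝ x₂ ⊑ x₃ ∷ []) (lip , ∣x∣< lo hi ,
      x≤∣x∣ (at s i - at t i) , tt)) , (lin (at t i ∷
      at s i ∷ η ∷ (∣ at s i - at t i ∣) ∷ (∣ s - t ∣) ∷ []) (x₀ ⊏ x₁ ⊕ x₂) (▹ x₃ ⊑ x₄ ∷ ▹ x₄ ⊏ x₂ ∷
      ▹ ⊖ (x₁ ⊝ x₀) ⊑ x₃ ∷ []) (lip , ∣x∣< lo hi , -x≤∣x∣ (at s i - at t i) , tt))
      where
      lip : ∣ at s i - at t i ∣ ≤ ∣ s - t ∣
      lip = lerp-Lipschitz source∈Δ target∈Δ s t i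
      lo : s - t < η
      lo = lin (s ∷ t ∷ η ∷ []) (x₀ ⊝ x₁ ⊏ x₂) (▹ x₀ ⊝ x₂ ⊏ x₁ ∷ []) (p , tt)
      hi : - (s - t) < η
      hi = lin (s ∷ t ∷ η ∷ []) (⊖ (x₀ ⊝ x₁) ⊏ x₂) (▹ x₁ ⊏ x₀ ⊕ x₂ ∷ []) (q , tt)

    source≉target⇒< : ∀ {i} → ¬ (source i ≈ target i) → source i < target i ⊎ target i < source i
    source≉target⇒< {i} ne with compare (source i) (target i)
    ... | inj₁ p        = inj₁ p
    ... | inj₂ (inj₁ q) = ⊥-elim (ne q)
    ... | inj₂ (inj₂ p) = inj₂ p

  -- The side of the crossing is read off from coordinate `m` rather than from the parameter. If
  -- that coordinate decreases along `e`, the blocks `a` and `b` exchange their order.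
  transversal-crossing : ∀ (C : Cut 3) (e : Segment 3) {a b m s η} → let open Segment e in
    a ≢ b → ¬ (source m ≈ target m) → 0# < s → s < 1# → 0# < η →
    (∀ t → 0# ≤ t → t ≤ 1# → s - η < t → t < s + η → at t m < at s m → at t ∈ Cut.block C a) →
    (∀ t → 0# ≤ t → t ≤ 1# → s - η < t → t < s + η → at s m < at t m → at t ∈ Cut.block C b) →
    s ∈ Crossing C e
  transversal-crossing C e {a} {b} {m} {s} {η} a≢b ne 0<s s<1 0<η below above
    with source≉target⇒< e ne
  ... | inj₁ p = crossing-intro C e a≢b 0<s s<1 0<η
    (λ t 0≤t q r → below t 0≤t (<⇒≤ (<-trans r s<1)) q (<-trans r s<s+η) (at-mono e p r))
    (λ t r q t≤1 → above t (<⇒≤ (<-trans 0<s r)) t≤1 (<-trans s-η<s r) q (at-mono e p r))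
    where
    s<s+η : s < s + η
    s<s+η = lin (s ∷ η ∷ []) (x₀ ⊏ x₀ ⊕ x₁) (▹ 𝟘 ⊏ x₁ ∷ []) (0<η , tt)
    s-η<s : s - η < s
    s-η<s = lin (s ∷ η ∷ []) (x₀ ⊝ x₁ ⊏ x₀) (▹ 𝟘 ⊏ x₁ ∷ []) (0<η , tt)
  ... | inj₂ p = crossing-intro C e (a≢b ∘ ≡.sym) 0<s s<1 0<η
    (λ t 0≤t q r → above t 0≤t (<⇒≤ (<-trans r s<1)) q (<-trans r s<s+η) (at-anti e p r))
    (λ t r q t≤1 → below t (<⇒≤ (<-trans 0<s r)) t≤1 (<-trans s-η<s r) q (at-anti e p r))
    where
    s<s+η : s < s + η
    s<s+η = lin (s ∷ η ∷ []) (x₀ ⊏ x₀ ⊕ x₁) (▹ 𝟘 ⊏ x₁ ∷ []) (0<η , tt)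
    s-η<s : s - η < s
    s-η<s = lin (s ∷ η ∷ []) (x₀ ⊝ x₁ ⊏ x₀) (▹ 𝟘 ⊏ x₁ ∷ []) (0<η , tt)

  record BallLike (C : Cut 3) (r : Point 3) (rays : Vec (Fin 2) 3) : Set where
    field
      boundary : ∀ x → x ∈ Boundary C ⇔ (∃[ j ] x ∈ Ray r j (lookup rays j))

    selected : Fin 3 → Fin 3
    selected j = punchIn j (lookup rays j)

    selected≢ : ∀ j → selected j ≢ j
    selected≢ j = Fin.punchInᵢ≢i j (lookup rays j)

    -- On the way to vertex `i`, coordinate `i` stays above `r i` and coordinate `j` below `r j`.
    -- The ray to side `i` needs `y i ≤ r i`, and the ray to side `k` lies on line `i` or `j`, so
    -- neither is met. There remains the ray to side `j`, in case it lies on line `k`: either that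
    -- line is not met because `y k` stays below `r k`, or the selection on side `j` is line `i`.
    in-block : ∀ {i j k x} → Triple i j k → x ∈ Δ → r i < x i → x j < r j → x k < r k ⊎ selected j ≡ i →
               x ∈ Cut.block C i
    in-block {i} {j} {k} {x} t x∈Δ ri<xi xj<rj alternative = block-by-path C x∈Δ avoids
      where
      j≢i : j ≢ i
      j≢i = triple-≢ (swap t)
      k≢i : k ≢ i
      k≢i = triple-≢ (rotate (rotate t))
      avoids : ∀ s → 0# ≤ s → s ≤ 1# → ¬ (lerp x (unit i) s ∈ Boundary C)
      avoids s 0≤s s≤1 y∈∂ = off-rays (Equivalence.to (boundary y) y∈∂)
        where
        y : Point 3
        y = lerp x (unit i) s
        ri<yi : r i < y i
        ri<yi = <-≤-trans ri<xi (toward-self x∈Δ 0≤s s≤1 i)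
        yj<rj : y j < r j
        yj<rj = ≤-<-trans (toward-other x∈Δ 0≤s s≤1 j≢i) xj<rj
        yk≤xk : y k ≤ x k
        yk≤xk = toward-other x∈Δ 0≤s s≤1 k≢i
        on-line-k : selected j ≡ k → x k < r k ⊎ selected j ≡ i → y k ≈ r k → ⊥
        on-line-k _ (inj₁ xk<rk) yk≈rk = proj₂ (≤-<-trans yk≤xk xk<rk) yk≈rk
        on-line-k p (inj₂ q)     _     = k≢i (≡.trans (≡.sym p) q)
        off-line : ∀ l → l ≢ k → y l ≈ r l → ⊥
        off-line l l≢k e with exhaust t l
        ... | inj₁ ≡.refl        = >⇒≉ ri<yi e
        ... | inj₂ (inj₁ ≡.refl) = <⇒≉ yj<rj e
        ... | inj₂ (inj₂ l≡k)    = l≢k l≡k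
        off-rays : ¬ (∃[ l ] y ∈ Ray r l (lookup rays l))
        off-rays (l , _ , on , yl≤rl) with exhaust t l
        ... | inj₁ ≡.refl        = <-irrefl (<-≤-trans ri<yi yl≤rl)
        ... | inj₂ (inj₂ ≡.refl) = off-line (selected k) (selected≢ k) on
        ... | inj₂ (inj₁ ≡.refl) with selected j Fin.≟ k
        ...   | yes p = on-line-k p alternative (≡.subst (λ m → y m ≈ r m) p on)
        ...   | no  n = off-line (selected j) n on

    -- Near a point inside the selected ray, coordinate `j` stays below and coordinate `k` above the
    -- centre. On the low side of line `m` this is block `k`. On the high side both `m` and `k`
    -- exceed the centre, and the selection on side `j` decides for `m`.
    ray-crossing : ∀ (e : Segment 3) {j m k s} → let open Segment e in Triple j m k → selected j ≡ m →
      ¬ (source m ≈ target m) → 0# < s → s < 1# → at s m ≈ r m → at s j < r j → r k < at s k → s ∈ Crossing C e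
    ray-crossing e {j} {m} {k} {s} t sel ne 0<s s<1 on xj<rj rk<xk =
      transversal-crossing C e (triple-≢ (swap (rotate t)) ) ne 0<s s<1 0<η
        (λ u 0≤u u≤1 p q below → in-block (rotate (rotate t)) (at∈Δ C e 0≤u u≤1)
          (rk<uk p q) (uj<rj p q) (inj₁ (below-m below)))
        (λ u 0≤u u≤1 p q above → in-block (swap t) (at∈Δ C e 0≤u u≤1)
          (above-m above) (uj<rj p q) (inj₂ sel))
      where
      open Segment e
      η : ℝ
      η = min (r j - at s j) (at s k - r k)
      0<η : 0# < η
      0<η = min-glb-< (x<y⇒0<y-x xj<rj) (x<y⇒0<y-x rk<xk)
      rk<uk : ∀ {u} → s - η < u → u < s + η → r k < at u k
      rk<uk {u} p q = lin (r k ∷ at u k ∷ at s k ∷ min (r j - at s j) (at s k - r k) ∷ []) (x₀ ⊏ x₁)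
        (▹ x₂ ⊝ x₃ ⊏ x₁ ∷ ▹ x₃ ⊑ x₂ ⊝ x₀ ∷ []) (proj₁ (at-near e k p q) ,
        min≤y (r j - at s j) (at s k - r k) , tt)
      uj<rj : ∀ {u} → s - η < u → u < s + η → at u j < r j
      uj<rj {u} p q = lin (at u j ∷ r j ∷ at s j ∷ min (r j - at s j) (at s k - r k) ∷ []) (x₀ ⊏ x₁)
        (▹ x₀ ⊏ x₂ ⊕ x₃ ∷ ▹ x₃ ⊑ x₁ ⊝ x₂ ∷ []) (proj₂ (at-near e j p q) ,
        min≤x (r j - at s j) (at s k - r k) , tt)
      below-m : ∀ {u} → at u m < at s m → at u m < r m
      below-m {u} p = lin (at u m ∷ r m ∷ at s m ∷ []) (x₀ ⊏ x₁) (▹ x₀ ⊏ x₂ ∷ ▹ x₂ ≃ x₁ ∷ []) (p ,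
        on , tt)
      above-m : ∀ {u} → at s m < at u m → r m < at u m
      above-m {u} p = lin (r m ∷ at u m ∷ at s m ∷ []) (x₀ ⊏ x₁) (▹ x₂ ⊏ x₁ ∷ ▹ x₀ ≃ x₂ ∷ []) (p ,
        sym on , tt)

    -- Here all three lines are met at the centre. After it only coordinate `i` is large, which is
    -- block `i`; before it both others are large, and the selection on side `i` decides between
    -- them. Either way the block on that side is not `i`. This happens along a line of centres.
    centre-crossing : ∀ (e : Segment 3) {i j k s} → let open Segment e in Triple i j k →
      ¬ (source i ≈ target i) → 0# < s → s < 1# → (∀ l → at s l ≈ r l) →
      (∀ u → at u i < at s i → at s j < at u j × at s k < at u k) →
      (∀ u → at s i < at u i → at u j < at s j × at u k < at s k) → s ∈ Crossing C e
    centre-crossing e {i} {j} {k} {s} t ne 0<s s<1 centre below above =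
      transversal-crossing C e {a = selected i} {b = i} (selected≢ i) ne 0<s s<1 (0≤1 , 0≉1)
        (λ u 0≤u u≤1 _ _ p → let q , q′ = below u p in beyond (at∈Δ C e 0≤u u≤1) p q q′ (exhaust t (selected i)))
        (λ u 0≤u u≤1 _ _ p → let q , q′ = above u p in in-block t (at∈Δ C e 0≤u u≤1)
          (up p) (down q) (inj₁ (down q′)))
      where
      open Segment e
      up : ∀ {u l} → at s l < at u l → r l < at u l
      up {u} {l} p = lin (r l ∷ at u l ∷ at s l ∷ []) (x₀ ⊏ x₁) (▹ x₂ ⊏ x₁ ∷ ▹ x₀ ≃ x₂ ∷ []) (p ,
        sym (centre l) , tt)
      down : ∀ {u l} → at u l < at s l → at u l < r l
      down {u} {l} p = lin (at u l ∷ r l ∷ at s l ∷ []) (x₀ ⊏ x₁) (▹ x₀ ⊏ x₂ ∷ ▹ x₂ ≃ x₁ ∷ []) (p ,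
        centre l , tt)
      beyond : ∀ {u} → at u ∈ Δ → at u i < at s i → at s j < at u j → at s k < at u k →
        selected i ≡ i ⊎ selected i ≡ j ⊎ selected i ≡ k → at u ∈ Cut.block C (selected i)
      beyond u∈Δ p q q′ (inj₁ e) = ⊥-elim (selected≢ i e)
      beyond u∈Δ p q q′ (inj₂ (inj₁ e)) = ≡.subst (λ l → _ ∈ Cut.block C l) (≡.sym e)
        (in-block (swap t) u∈Δ (up q) (down p) (inj₂ e))
      beyond u∈Δ p q q′ (inj₂ (inj₂ e)) = ≡.subst (λ l → _ ∈ Cut.block C l) (≡.sym e)
        (in-block (rotate (rotate t)) u∈Δ (up q′) (down p) (inj₂ e))

  record CornerLike (C : Cut 3) (k : Fin 3) (ρ : ℝ) : Set where
    field
      2/3<ρ    : 2 ÷ 3 < ρ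
      boundary : ∀ x → x ∈ Boundary C ⇔ (x ∈ Δ × ∃[ i ] i ≢ k × x i ≈ ρ)

    -- A coordinate above 2/3 leaves less than 1/3 for the others. Hence the two lines of a corner
    -- cut do not meet in the triangle and can be treated separately.
    others-small : ∀ {i l x} → x ∈ Δ → l ≢ i → 2 ÷ 3 < x i → x l < ρ
    others-small {i} {l} {x} x∈Δ l≢i p = let m , t = triple-of i l l≢i in small-rest t
      where
      small-rest : ∀ {m} → Triple i l m → x l < ρ
      small-rest {m} t = lin (x l ∷ ρ ∷ x i ∷ x m ∷ []) (x₀ ⊏ x₁) (▹ x₂ ⊕ x₀ ⊕ x₃ ≃ 𝟙 ∷ ▹ 𝟘 ⊑ x₃ ∷
        ▹ 2 /1+ 2 ⊏ x₁ ∷ ▹ 2 /1+ 2 ⊏ x₂ ∷ []) (triple-sum t x∈Δ , proj₁ x∈Δ m , 2/3<ρ , p , tt)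

    in-chosen : ∀ {i x} → i ≢ k → x ∈ Δ → ρ < x i → x ∈ Cut.block C i
    in-chosen {i} {x} i≢k x∈Δ ρ<xi = block-by-path C x∈Δ λ s 0≤s s≤1 y∈∂ →
      let _ , l , l≢k , yl≈ρ = Equivalence.to (boundary _) y∈∂ in avoids 0≤s s≤1 l yl≈ρ
      where
      avoids : ∀ {s} → 0# ≤ s → s ≤ 1# → ∀ l → lerp x (unit i) s l ≈ ρ → ⊥
      avoids {s} 0≤s s≤1 l e = by-index (l Fin.≟ i)
        where
        by-index : Dec (l ≡ i) → ⊥
        by-index (yes ≡.refl) = >⇒≉ (<-≤-trans ρ<xi (toward-self x∈Δ 0≤s s≤1 i)) e
        by-index (no l≢i)     = <⇒≉ (≤-<-trans (toward-other x∈Δ 0≤s s≤1 l≢i)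
                                  (others-small x∈Δ l≢i (<-trans 2/3<ρ ρ<xi))) e

    in-unchosen : ∀ {x} → x ∈ Δ → (∀ l → l ≢ k → x l < ρ) → x ∈ Cut.block C k
    in-unchosen {x} x∈Δ h = block-by-path C x∈Δ λ s 0≤s s≤1 y∈∂ →
      let _ , l , l≢k , yl≈ρ = Equivalence.to (boundary _) y∈∂ in
      <⇒≉ (≤-<-trans (toward-other x∈Δ 0≤s s≤1 l≢k) (h l l≢k)) yl≈ρ

    corner-crossing : ∀ (e : Segment 3) {i s} → let open Segment e in i ≢ k →
      ¬ (source i ≈ target i) → 0# < s → s < 1# → at s i ≈ ρ → s ∈ Crossing C e
    corner-crossing e {i} {s} i≢k ne 0<s s<1 on =
      transversal-crossing C e {a = k} {b = i} (i≢k ∘ ≡.sym) ne 0<s s<1 0<η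
        (λ u 0≤u u≤1 p q below → in-unchosen (at∈Δ C e 0≤u u≤1) (below-ρ (at∈Δ C e 0≤u u≤1) p q below))
        (λ u 0≤u u≤1 p q above → in-chosen i≢k (at∈Δ C e 0≤u u≤1) (lin (ρ ∷ at u i ∷ at s i ∷ [])
          (x₀ ⊏ x₁) (▹ x₂ ⊏ x₁ ∷ ▹ x₀ ≃ x₂ ∷ []) (above , sym on , tt)))
      where
      open Segment e
      0<η : 0# < ρ - 2 ÷ 3
      0<η = x<y⇒0<y-x 2/3<ρ
      below-ρ : ∀ {u} → at u ∈ Δ → s - (ρ - 2 ÷ 3) < u → u < s + (ρ - 2 ÷ 3) → at u i < at s i → ∀ l → l ≢ k → at u l < ρ
      below-ρ {u} u∈Δ p q below l l≢k = by-index (l Fin.≟ i)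
        where
        by-index : Dec (l ≡ i) → at u l < ρ
        by-index (yes ≡.refl) = lin (at u i ∷ ρ ∷ at s i ∷ []) (x₀ ⊏ x₁) (▹ x₀ ⊏ x₂ ∷ ▹ x₂ ≃ x₁ ∷
          []) (below , on , tt)
        by-index (no l≢i)     = others-small u∈Δ l≢i (lin (at u i ∷ at s i ∷ ρ ∷ []) (2 /1+ 2 ⊏ x₀)
          (▹ x₁ ⊝ (x₂ ⊝ 2 /1+ 2) ⊏ x₀ ∷ ▹ x₂ ≃ x₁ ∷ []) (proj₁ (at-near e i p q) , sym on , tt))

-- Counting by injections.

module InjectionCounting (em : ∀ {ℓ} → ExcludedMiddle ℓ) where

  -- The decision is an argument since `em` does not compute: lemmas are proved for an arbitrary
  -- `Dec` and then used at `em`.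
  bump : {P : Set} → Dec P → ℕ → ℕ
  bump (yes _) n = suc n
  bump (no _)  n = n

  bump-imp : ∀ {Q R : Set} (d : Dec Q) (f : Dec R) → (Q → R) → ∀ {m k} → m ℕ.≤ k → bump d m ℕ.≤ bump f k
  bump-imp (yes q) (yes r) h p = ℕ.s≤s p
  bump-imp (yes q) (no ¬r) h p = ⊥-elim (¬r (h q))
  bump-imp (no _)  (yes r) h p = ℕ.≤-trans p (ℕ.n≤1+n _)
  bump-imp (no _)  (no _)  h p = p

  count : ∀ {N} → (Fin N → Set) → ℕ
  count {zero}  P = 0
  count {suc N} P = bump (em {P = P zero}) (count (P ∘ suc))

  Injection : ∀ {n N} → (Fin n → Fin N) → Set
  Injection f = ∀ {i j} → f i ≡ f j → i ≡ j

  rank : ∀ {N} (P : Fin N → Set) j → P j → Fin (count P)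
  rank {suc N} P zero    p with em {P = P zero}
  ... | yes _ = zero
  ... | no ¬p = ⊥-elim (¬p p)
  rank {suc N} P (suc j) p with em {P = P zero}
  ... | yes _ = suc (rank (P ∘ suc) j p)
  ... | no _  = rank (P ∘ suc) j p

  rank-injective : ∀ {N} (P : Fin N → Set) i j p q → rank P i p ≡ rank P j q → i ≡ j
  rank-injective {suc N} P zero zero p q e = ≡.refl
  rank-injective {suc N} P zero (suc j) p q e with em {P = P zero} | e
  ... | yes _ | ()
  ... | no ¬p | _ = ⊥-elim (¬p p)
  rank-injective {suc N} P (suc i) zero p q e with em {P = P zero} | e
  ... | yes _ | ()
  ... | no ¬p | _ = ⊥-elim (¬p q)
  rank-injective {suc N} P (suc i) (suc j) p q e with em {P = P zero}
  ... | yes _ = ≡.cong suc (rank-injective (P ∘ suc) i j p q (Fin.suc-injective e))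
  ... | no _  = ≡.cong suc (rank-injective (P ∘ suc) i j p q e)

  injection⇒≤count : ∀ {n N} (P : Fin N → Set) (f : Fin n → Fin N) → Injection f → (∀ i → P (f i)) →
                     n ℕ.≤ count P
  injection⇒≤count P f inj Pf = Fin.injective⇒≤ {f = λ i → rank P (f i) (Pf i)}
    (λ {i} {j} e → inj (rank-injective P (f i) (f j) (Pf i) (Pf j) e))

  ≤count⇒injection : ∀ {n N} (P : Fin N → Set) → n ℕ.≤ count P →
                     Σ[ f ∈ (Fin n → Fin N) ] Injection f × (∀ i → P (f i))
  ≤count⇒injection {N = zero} P ℕ.z≤n = (λ ()) , (λ { {()} }) , λ ()
  ≤count⇒injection {n} {suc N} P = by-head em
    where
    extend : ∀ {n} → P zero → (f : Fin n → Fin N) → Injection f → (∀ i → P (suc (f i))) →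
             Σ[ g ∈ (Fin (suc n) → Fin (suc N)) ] Injection g × (∀ i → P (g i))
    extend {n} p f inj Pf = g , g-inj , λ { zero → p ; (suc i) → Pf i }
      where
      g : Fin (suc n) → Fin (suc N)
      g zero    = zero
      g (suc i) = suc (f i)
      g-inj : Injection g
      g-inj {zero}  {zero}  _ = ≡.refl
      g-inj {suc i} {suc j} e = ≡.cong suc (inj (Fin.suc-injective e))
    by-head : ∀ {n} → (d : Dec (P zero)) → n ℕ.≤ bump d (count (P ∘ suc)) →
              Σ[ f ∈ (Fin n → Fin (suc N)) ] Injection f × (∀ i → P (f i))
    by-head (no _) le = let f , inj , Pf = ≤count⇒injection (P ∘ suc) le in
      suc ∘ f , (λ e → inj (Fin.suc-injective e)) , Pf
    by-head {zero}  (yes p) le = (λ ()) , (λ { {()} }) , λ ()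
    by-head {suc n} (yes p) (ℕ.s≤s le) = let f , inj , Pf = ≤count⇒injection (P ∘ suc) le in
      extend p f inj Pf

-- The number of crossings, and affine functions of the parameter.

module CutCounts (em : ∀ {ℓ} → ExcludedMiddle ℓ) (𝓡 : CompleteOrderedField) where
  open CompleteOrderedField 𝓡 hiding (zero)
  open LinearArithmetic 𝓡
  open RealNumbers em 𝓡
  open SimplexGeometry em 𝓡
  open CutCrossings em 𝓡
  open InjectionCounting em
  open Simplex 𝓡

  -- The crossings of e are the hits, of which the j-th kind occurs, then exactly
  -- once, if and only if Q j.
  module _ (C : Cut 3) (e : Segment 3) {N : ℕ} (Hit : Fin N → ℝ → Set) (Q : Fin N → Set)
    (crossing⇒hit : ∀ s → s ∈ Crossing C e → ∃[ j ] Hit j s)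
    (hit⇒crossing : ∀ j s → Hit j s → s ∈ Crossing C e)
    (hit-unique   : ∀ j s s′ → Hit j s → Hit j s′ → s ≈ s′)
    (hit-disjoint : ∀ j j′ s s′ → Hit j s → Hit j′ s′ → s ≈ s′ → j ≡ j′)
    (occurs       : ∀ j → Q j → ∃[ s ] Hit j s)
    (hit⇒occurs   : ∀ j s → Hit j s → Q j) where

    -- Crossings inject into the kinds because each kind is hit at most once, and the kinds that
    -- occur inject into the crossings because different kinds are hit at different parameters.
    cuts⇔count : ∀ n → CutsAtLeast C e n ⇔ n ℕ.≤ count Q
    cuts⇔count n = mk⇔ to from
      where
      to : CutsAtLeast C e n → n ℕ.≤ count Q
      to (t , crossing , distinct) = injection⇒≤count Q f f-injective
        (λ i → hit⇒occurs (f i) (t i) (proj₂ (crossing⇒hit (t i) (crossing i))))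
        where
        f : Fin n → Fin N
        f i = proj₁ (crossing⇒hit (t i) (crossing i))
        f-injective : Injection f
        f-injective {i} {j} e with i Fin.≟ j
        ... | yes p = p
        ... | no i≢j = ⊥-elim (distinct i j i≢j (hit-unique (f i) (t i) (t j)
                (proj₂ (crossing⇒hit (t i) (crossing i)))
                (≡.subst (λ l → Hit l (t j)) (≡.sym e) (proj₂ (crossing⇒hit (t j) (crossing j))))))
      from : n ℕ.≤ count Q → CutsAtLeast C e n
      from le = let f , inj , Qf = ≤count⇒injection Q le in
        (λ i → proj₁ (occurs (f i) (Qf i))) ,
        (λ i → hit⇒crossing (f i) _ (proj₂ (occurs (f i) (Qf i)))) ,
        λ i j i≢j ti≈tj → i≢j (inj (hit-disjoint (f i) (f j) _ _ (proj₂ (occurs (f i) (Qf i)))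
          (proj₂ (occurs (f j) (Qf j))) ti≈tj))

  Between : ℝ → ℝ → Pred ℝ 0ℓ
  Between X Y z = (X < z × z < Y) ⊎ (Y < z × z < X)

  affine : ℝ → ℝ → ℝ → ℝ
  affine a b s = (1# - s) * a + s * b

  affine-mono : ∀ {a b s t} → a < b → s < t → affine a b s < affine a b t
  affine-mono {a} {b} {s} {t} p q = goal
    where
    goal : (1# - s) * a + s * b < (1# - t) * a + t * b
    goal = lin (s ∷ a ∷ b ∷ t ∷ []) ((𝟙 ⊝ x₀) ⊗ x₁ ⊕ x₀ ⊗ x₂ ⊏ (𝟙 ⊝ x₃) ⊗ x₁ ⊕ x₃ ⊗ x₂)
      (▹ 𝟘 ⊏ (x₂ ⊝ x₁) ⊗ (x₃ ⊝ x₀) ∷ []) (*-pos (x<y⇒0<y-x p) (x<y⇒0<y-x q) , tt)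

  affine-flip : ∀ a b s → affine a b s ≈ affine b a (1# - s)
  affine-flip a b s = goal
    where
    goal : (1# - s) * a + s * b ≈ (1# - (1# - s)) * b + (1# - s) * a
    goal = lin (s ∷ a ∷ b ∷ []) ((𝟙 ⊝ x₀) ⊗ x₁ ⊕ x₀ ⊗ x₂ ≃ (𝟙 ⊝ (𝟙 ⊝ x₀)) ⊗ x₂ ⊕ (𝟙 ⊝ x₀) ⊗ x₁)
      [] tt

  affine-anti : ∀ {a b s t} → b < a → s < t → affine a b t < affine a b s
  affine-anti {a} {b} {s} {t} p q = lin (affine a b t ∷ affine a b s ∷ affine b a (1# - s) ∷
    affine b a (1# - t) ∷ []) (x₀ ⊏ x₁) (▹ x₂ ≃ x₁ ∷ ▹ x₀ ≃ x₃ ∷ ▹ x₃ ⊏ x₂ ∷ [])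
    (sym (affine-flip a b s) , affine-flip a b t , affine-mono {b} {a} {1# - t} {1# - s} p 1-t<1-s ,
    tt)
    where
    1-t<1-s : 1# - t < 1# - s
    1-t<1-s = lin (t ∷ s ∷ []) (𝟙 ⊝ x₀ ⊏ 𝟙 ⊝ x₁) (▹ x₁ ⊏ x₀ ∷ []) (q , tt)

  affine-cong : ∀ a b {s t} → s ≈ t → affine a b s ≈ affine a b t
  affine-cong a b {s} {t} e = goal
    where
    goal : (1# - s) * a + s * b ≈ (1# - t) * a + t * b
    goal = lin (s ∷ a ∷ b ∷ t ∷ []) ((𝟙 ⊝ x₀) ⊗ x₁ ⊕ x₀ ⊗ x₂ ≃ (𝟙 ⊝ x₃) ⊗ x₁ ⊕ x₃ ⊗ x₂)
      (▹ x₁ ⊗ x₃ ≃ x₁ ⊗ x₀ ∷ ▹ x₂ ⊗ x₀ ≃ x₂ ⊗ x₃ ∷ []) (sym (*-congᵗ a e) , *-congᵗ b e , tt)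

  affine-reflects-< : ∀ {a b s t} → a < b → affine a b s < affine a b t → s < t
  affine-reflects-< {a} {b} {s} {t} p q with compare s t
  ... | inj₁ r        = r
  ... | inj₂ (inj₁ r) = ⊥-elim (proj₂ q (affine-cong a b r))
  ... | inj₂ (inj₂ r) = ⊥-elim (<-irrefl (<-trans q (affine-mono p r)))

  affine-injective : ∀ {a b s t} → ¬ (a ≈ b) → affine a b s ≈ affine a b t → s ≈ t
  affine-injective {a} {b} {s} {t} ne e = *-cancelˡ-≈ {s} {t} {b - a} (λ z → ne (b-a≈0 z)) goal
    where
    b-a≈0 : b - a ≈ 0# → a ≈ b
    b-a≈0 z = lin (a ∷ b ∷ []) (x₀ ≃ x₁) (▹ 𝟘 ≃ x₁ ⊝ x₀ ∷ []) (sym z , tt)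
    e′ : (1# - s) * a + s * b ≈ (1# - t) * a + t * b
    e′ = e
    goal : (b - a) * s ≈ (b - a) * t
    goal = lin (b ∷ a ∷ s ∷ t ∷ []) ((x₀ ⊝ x₁) ⊗ x₂ ≃ (x₀ ⊝ x₁) ⊗ x₃)
      (▹ (𝟙 ⊝ x₂) ⊗ x₁ ⊕ x₂ ⊗ x₀ ≃ (𝟙 ⊝ x₃) ⊗ x₁ ⊕ x₃ ⊗ x₀ ∷ []) (e′ , tt)

  affine-surjective : ∀ {a b} → ¬ (a ≈ b) → ∀ z → ∃[ s ] affine a b s ≈ z
  affine-surjective {a} {b} ne z = let s , e = divide (z - a) {b - a} (λ e → ne (b-a≈0 e)) in s , goal s e
    where
    b-a≈0 : b - a ≈ 0# → a ≈ b
    b-a≈0 z = lin (a ∷ b ∷ []) (x₀ ≃ x₁) (▹ 𝟘 ≃ x₁ ⊝ x₀ ∷ []) (sym z , tt)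
    goal : ∀ s → (b - a) * s ≈ z - a → (1# - s) * a + s * b ≈ z
    goal s e = lin (s ∷ a ∷ b ∷ z ∷ []) ((𝟙 ⊝ x₀) ⊗ x₁ ⊕ x₀ ⊗ x₂ ≃ x₃) (▹ (x₂ ⊝ x₁) ⊗ x₀ ≃ x₃ ⊝ x₁ ∷
      []) (e , tt)

  affine-0 : ∀ a b → affine a b 0# ≈ a
  affine-0 a b = goal
    where
    goal : (1# - 0#) * a + 0# * b ≈ a
    goal = lin (a ∷ b ∷ []) ((𝟙 ⊝ 𝟘) ⊗ x₀ ⊕ 𝟘 ⊗ x₁ ≃ x₀) [] tt

  affine-1 : ∀ a b → affine a b 1# ≈ b
  affine-1 a b = goal
    where
    goal : (1# - 1#) * a + 1# * b ≈ b
    goal = lin (a ∷ b ∷ []) ((𝟙 ⊝ 𝟙) ⊗ x₀ ⊕ 𝟙 ⊗ x₁ ≃ x₁) [] tt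

  Between-resp : ∀ {X X′ Y Y′ z z′} → X ≈ X′ → Y ≈ Y′ → z ≈ z′ → Between X Y z → Between X′ Y′ z′
  Between-resp {X} {X′} {Y} {Y′} {z} {z′} p q r (inj₁ (a , b)) = inj₁ ((lin (X′ ∷ z′ ∷ X ∷ z ∷ [])
    (x₀ ⊏ x₁) (▹ x₀ ≃ x₂ ∷ ▹ x₃ ≃ x₁ ∷ ▹ x₂ ⊏ x₃ ∷ []) (sym p , r , a , tt)) , (lin
    (z′ ∷ Y′ ∷ Y ∷ z ∷ []) (x₀ ⊏ x₁) (▹ x₂ ≃ x₁ ∷ ▹ x₀ ≃ x₃ ∷ ▹ x₃ ⊏ x₂ ∷ []) (q , sym r , b , tt)))
  Between-resp {X} {X′} {Y} {Y′} {z} {z′} p q r (inj₂ (a , b)) = inj₂ ((lin (Y′ ∷ z′ ∷ Y ∷ z ∷ [])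
    (x₀ ⊏ x₁) (▹ x₀ ≃ x₂ ∷ ▹ x₃ ≃ x₁ ∷ ▹ x₂ ⊏ x₃ ∷ []) (sym q , r , a , tt)) , (lin
    (z′ ∷ X′ ∷ X ∷ z ∷ []) (x₀ ⊏ x₁) (▹ x₂ ≃ x₁ ∷ ▹ x₀ ≃ x₃ ∷ ▹ x₃ ⊏ x₂ ∷ []) (p , sym r , b , tt)))

  between-affine : ∀ {a b s₁ s₂ s} → ¬ (a ≈ b) → s₁ < s → s < s₂ →
                   Between (affine a b s₁) (affine a b s₂) (affine a b s)
  between-affine {a} {b} ne p q with compare a b
  ... | inj₁ r        = inj₁ (affine-mono r p , affine-mono r q)
  ... | inj₂ (inj₁ r) = ⊥-elim (ne r)
  ... | inj₂ (inj₂ r) = inj₂ (affine-anti r q , affine-anti r p)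

  affine-reflects-> : ∀ {a b s t} → b < a → affine a b s < affine a b t → t < s
  affine-reflects-> {a} {b} {s} {t} p q with compare s t
  ... | inj₁ r        = ⊥-elim (<-irrefl (<-trans q (affine-anti p r)))
  ... | inj₂ (inj₁ r) = ⊥-elim (proj₂ q (affine-cong a b r))
  ... | inj₂ (inj₂ r) = r

  between-affine⁻ : ∀ {a b s₁ s₂ s} → s₁ ≤ s₂ → ¬ (a ≈ b) →
                    Between (affine a b s₁) (affine a b s₂) (affine a b s) → s₁ < s × s < s₂
  between-affine⁻ {a} {b} {s₁} {s₂} {s} s₁≤s₂ ne bet with compare a b | bet
  ... | inj₁ r        | inj₁ (p , q) = affine-reflects-< r p , affine-reflects-< r q
  ... | inj₁ r        | inj₂ (p , q) = ⊥-elim (<-irrefl (≤-<-trans s₁≤s₂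
                          (<-trans (affine-reflects-< r p) (affine-reflects-< r q))))
  ... | inj₂ (inj₁ r) | _            = ⊥-elim (ne r)
  ... | inj₂ (inj₂ r) | inj₂ (p , q) = affine-reflects-> r q , affine-reflects-> r p
  ... | inj₂ (inj₂ r) | inj₁ (p , q) = ⊥-elim (<-irrefl (≤-<-trans s₁≤s₂
                          (<-trans (affine-reflects-> r q) (affine-reflects-> r p))))

  between⇒≉ : ∀ {X Y z} → Between X Y z → ¬ (X ≈ Y)
  between⇒≉ (inj₁ (p , q)) e = proj₂ (<-trans p q) e
  between⇒≉ (inj₂ (p , q)) e = proj₂ (<-trans p q) (sym e)

  -- An affine function that does not vanish at both ends changes sign at most once inside the
  -- segment, at σ; the flag `true` means that it is negative first. When there is no change,
  -- `split` takes σ to be 1.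
  Split : (g : ℝ → ℝ) (σ : ℝ) → Bool → Set
  Split g σ true  = ∀ s → 0# < s → s < 1# → (s < σ → g s < 0#) × (σ < s → 0# < g s)
  Split g σ false = ∀ s → 0# < s → s < 1# → (s < σ → 0# < g s) × (σ < s → g s < 0#)

  split-resp-- : ∀ {g h σ} f → (∀ s → h s ≈ - g s) → Split g σ f → Split h σ (not f)
  split-resp-- {g} {h} true e S s p q =
    (λ r → positive (proj₁ (S s p q) r)) , λ r → negative (proj₂ (S s p q) r)
    where
    positive : g s < 0# → 0# < h s
    positive u = lin (h s ∷ g s ∷ []) (𝟘 ⊏ x₀) (▹ ⊖ x₁ ≃ x₀ ∷ ▹ x₁ ⊏ 𝟘 ∷ []) (sym (e s) , u , tt)
    negative : 0# < g s → h s < 0#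
    negative u = lin (h s ∷ g s ∷ []) (x₀ ⊏ 𝟘) (▹ x₀ ≃ ⊖ x₁ ∷ ▹ 𝟘 ⊏ x₁ ∷ []) (e s , u , tt)
  split-resp-- {g} {h} false e S s p q =
    (λ r → negative (proj₁ (S s p q) r)) , λ r → positive (proj₂ (S s p q) r)
    where
    positive : g s < 0# → 0# < h s
    positive u = lin (h s ∷ g s ∷ []) (𝟘 ⊏ x₀) (▹ ⊖ x₁ ≃ x₀ ∷ ▹ x₁ ⊏ 𝟘 ∷ []) (sym (e s) , u , tt)
    negative : 0# < g s → h s < 0#
    negative u = lin (h s ∷ g s ∷ []) (x₀ ⊏ 𝟘) (▹ x₀ ≃ ⊖ x₁ ∷ ▹ 𝟘 ⊏ x₁ ∷ []) (e s , u , tt)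

  affine-- : ∀ a b s → affine a b s ≈ - affine (- a) (- b) s
  affine-- a b s = goal
    where
    goal : (1# - s) * a + s * b ≈ - ((1# - s) * - a + s * - b)
    goal = lin (s ∷ a ∷ b ∷ []) ((𝟙 ⊝ x₀) ⊗ x₁ ⊕ x₀ ⊗ x₂ ≃ ⊖ ((𝟙 ⊝ x₀) ⊗ (⊖ x₁) ⊕ x₀ ⊗ (⊖ x₂)))
      [] tt

  affine-negative : ∀ {a b} → a ≤ 0# → b ≤ 0# → ¬ (a ≈ 0# × b ≈ 0#) →
                    ∀ s → 0# < s → s < 1# → affine a b s < 0#
  affine-negative {a} {b} a≤0 b≤0 ne s 0<s s<1 = by-cases (compare a 0#) (compare b 0#)
    where
    goal-a : a < 0# → (1# - s) * a + s * b < 0#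
    goal-a a<0 = lin (s ∷ a ∷ b ∷ []) ((𝟙 ⊝ x₀) ⊗ x₁ ⊕ x₀ ⊗ x₂ ⊏ 𝟘) (▹ 𝟘 ⊏ (𝟙 ⊝ x₀) ⊗ (𝟘 ⊝ x₁) ∷
      ▹ 𝟘 ⊑ x₀ ⊗ (𝟘 ⊝ x₂) ∷ []) (*-pos (x<y⇒0<y-x s<1) (x<y⇒0<y-x a<0) ,
      *-nonNeg (<⇒≤ 0<s) (x≤y⇒0≤y-x b≤0) , tt)
    goal-b : b < 0# → (1# - s) * a + s * b < 0#
    goal-b b<0 = lin (s ∷ a ∷ b ∷ []) ((𝟙 ⊝ x₀) ⊗ x₁ ⊕ x₀ ⊗ x₂ ⊏ 𝟘) (▹ 𝟘 ⊑ (𝟙 ⊝ x₀) ⊗ (𝟘 ⊝ x₁) ∷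
      ▹ 𝟘 ⊏ x₀ ⊗ (𝟘 ⊝ x₂) ∷ []) (*-nonNeg (<⇒≤ (x<y⇒0<y-x s<1)) (x≤y⇒0≤y-x a≤0) ,
      *-pos 0<s (x<y⇒0<y-x b<0) , tt)
    by-cases : a < 0# ⊎ a ≈ 0# ⊎ 0# < a → b < 0# ⊎ b ≈ 0# ⊎ 0# < b → affine a b s < 0#
    by-cases (inj₁ p) _ = goal-a p
    by-cases (inj₂ (inj₂ p)) _ = ⊥-elim (<-irrefl (lin (a ∷ []) (𝟘 ⊏ 𝟘) (▹ 𝟘 ⊏ x₀ ∷ ▹ x₀ ⊑ 𝟘 ∷ []) (p , a≤0 , tt)))
    by-cases _ (inj₁ q) = goal-b q
    by-cases _ (inj₂ (inj₂ q)) = ⊥-elim (<-irrefl (lin (b ∷ []) (𝟘 ⊏ 𝟘) (▹ 𝟘 ⊏ x₀ ∷ ▹ x₀ ⊑ 𝟘 ∷ []) (q , b≤0 , tt)))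
    by-cases (inj₂ (inj₁ p)) (inj₂ (inj₁ q)) = ⊥-elim (ne (p , q))

  HasSplit : (ℝ → ℝ) → Set
  HasSplit g = ∃[ σ ] ∃[ f ] 0# ≤ σ × σ ≤ 1# × Split g σ f

  split-nonPos : ∀ {a b} → a ≤ 0# → b ≤ 0# → ¬ (a ≈ 0# × b ≈ 0#) → HasSplit (affine a b)
  split-nonPos a≤0 b≤0 ne = 1# , true , 0≤1 , ≤-refl , λ s 0<s s<1 →
    (λ _ → affine-negative a≤0 b≤0 ne s 0<s s<1) , λ q → ⊥-elim (<-irrefl (<-trans q s<1))

  split-crossing : ∀ {a b} → a < 0# → 0# < b → HasSplit (affine a b)
  split-crossing {a} {b} a<0 0<b = let σ , e = affine-surjective (proj₂ (<-trans a<0 0<b)) 0# in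
    σ , true , affine-reflects-≤ (at-0 e) , affine-reflects-≤ (at-1 e) , λ s _ _ →
      (λ q → below e (affine-mono (<-trans a<0 0<b) q)) , λ q → above e (affine-mono (<-trans a<0 0<b) q)
    where
    affine-reflects-≤ : ∀ {s t} → affine a b s < affine a b t → s ≤ t
    affine-reflects-≤ p = <⇒≤ (affine-reflects-< (<-trans a<0 0<b) p)
    at-0 : ∀ {σ} → affine a b σ ≈ 0# → affine a b 0# < affine a b σ
    at-0 {σ} e = lin (affine a b 0# ∷ affine a b σ ∷ a ∷ []) (x₀ ⊏ x₁) (▹ x₀ ≃ x₂ ∷ ▹ 𝟘 ≃ x₁ ∷
      ▹ x₂ ⊏ 𝟘 ∷ []) (affine-0 a b , sym e , a<0 , tt)
    at-1 : ∀ {σ} → affine a b σ ≈ 0# → affine a b σ < affine a b 1#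
    at-1 {σ} e = lin (affine a b σ ∷ affine a b 1# ∷ b ∷ []) (x₀ ⊏ x₁) (▹ x₂ ≃ x₁ ∷ ▹ x₀ ≃ 𝟘 ∷
      ▹ 𝟘 ⊏ x₂ ∷ []) (sym (affine-1 a b) , e , 0<b , tt)
    below : ∀ {s σ} → affine a b σ ≈ 0# → affine a b s < affine a b σ → affine a b s < 0#
    below {s} {σ} e p = lin (affine a b s ∷ affine a b σ ∷ []) (x₀ ⊏ 𝟘) (▹ x₁ ≃ 𝟘 ∷ ▹ x₀ ⊏ x₁ ∷ [])
      (e , p , tt)
    above : ∀ {s σ} → affine a b σ ≈ 0# → affine a b σ < affine a b s → 0# < affine a b s
    above {s} {σ} e p = lin (affine a b s ∷ affine a b σ ∷ []) (𝟘 ⊏ x₀) (▹ 𝟘 ≃ x₁ ∷ ▹ x₁ ⊏ x₀ ∷ [])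
      (sym e , p , tt)

  split-negate : ∀ {a b} → HasSplit (affine (- a) (- b)) → HasSplit (affine a b)
  split-negate {a} {b} (σ , f , p , q , S) = σ , not f , p , q , split-resp-- f (affine-- a b) S

  abstract
    split : ∀ a b → ¬ (a ≈ 0# × b ≈ 0#) → HasSplit (affine a b)
    split a b ne = by-signs (≤-<-connex a 0#) (≤-<-connex b 0#)
      where
      neg-≤ : ∀ {x} → 0# ≤ x → - x ≤ 0#
      neg-≤ {x} p = lin (x ∷ []) (⊖ x₀ ⊑ 𝟘) (▹ 𝟘 ⊑ x₀ ∷ []) (p , tt)
      neg-≈ : ∀ {x} → - x ≈ 0# → x ≈ 0#
      neg-≈ {x} p = lin (x ∷ []) (x₀ ≃ 𝟘) (▹ 𝟘 ≃ ⊖ x₀ ∷ []) (sym p , tt)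
      neg-< : ∀ {x} → 0# < x → - x < 0#
      neg-< {x} p = lin (x ∷ []) (⊖ x₀ ⊏ 𝟘) (▹ 𝟘 ⊏ x₀ ∷ []) (p , tt)
      neg-> : ∀ {x} → x < 0# → 0# < - x
      neg-> {x} p = lin (x ∷ []) (𝟘 ⊏ ⊖ x₀) (▹ x₀ ⊏ 𝟘 ∷ []) (p , tt)
      nonNeg : 0# ≤ a → 0# ≤ b → HasSplit (affine a b)
      nonNeg p q = split-negate (split-nonPos (neg-≤ p) (neg-≤ q) λ (e , e′) → ne (neg-≈ e , neg-≈ e′))
      by-signs : a ≤ 0# ⊎ 0# < a → b ≤ 0# ⊎ 0# < b → HasSplit (affine a b)
      by-signs (inj₁ p) (inj₁ q) = split-nonPos p q ne
      by-signs (inj₂ p) (inj₂ q) = nonNeg (<⇒≤ p) (<⇒≤ q)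
      by-signs (inj₁ p) (inj₂ q) with compare a 0#
      ... | inj₁ r        = split-crossing r q
      ... | inj₂ (inj₁ r) = nonNeg (≤-reflexive (sym r)) (<⇒≤ q)
      ... | inj₂ (inj₂ r) = ⊥-elim (<-irrefl (<-≤-trans r p))
      by-signs (inj₂ p) (inj₁ q) with compare b 0#
      ... | inj₁ r        = split-negate (split-crossing (neg-< p) (neg-> r))
      ... | inj₂ (inj₁ r) = nonNeg (<⇒≤ p) (≤-reflexive (sym r))
      ... | inj₂ (inj₂ r) = ⊥-elim (<-irrefl (<-≤-trans r q))

-- The cuts of a segment by a ball cut.

module BallCutCounts (em : ∀ {ℓ} → ExcludedMiddle ℓ) (𝓡 : CompleteOrderedField) where
  open CompleteOrderedField 𝓡 hiding (zero)
  open LinearArithmetic 𝓡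
  open RealNumbers em 𝓡
  open SimplexGeometry em 𝓡
  open CutCrossings em 𝓡
  open InjectionCounting em
  open CutCounts em 𝓡
  open Simplex 𝓡

  -- The i-th coordinate of the centre is α + β t, and γ is the inverse of β.
  α β γ : Line → Fin 3 → ℝ
  α _  0F = 2 ÷ 3
  α ac 1F = 1 ÷ 3
  α ac 2F = 0#
  α bd 1F = 0#
  α bd 2F = 1 ÷ 3
  β _ 0F = - (2 ÷ 3)
  β _ 1F = 1 ÷ 3
  β _ 2F = 1 ÷ 3
  γ _ 0F = - (3 ÷ 2)
  γ _ 1F = 3 ÷ 1
  γ _ 2F = 3 ÷ 1

  centre-affine : ∀ l t i → centre l t i ≈ α l i + β l i * t
  centre-affine ac t 0F = goal
    where
    goal : (1# - t) * (2 ÷ 3) + t * 0# ≈ 2 ÷ 3 + - (2 ÷ 3) * t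
    goal = lin (t ∷ []) ((𝟙 ⊝ x₀) ⊗ 2 /1+ 2 ⊕ x₀ ⊗ 𝟘 ≃ 2 /1+ 2 ⊕ ⊖ 2 /1+ 2 ⊗ x₀) [] tt
  centre-affine bd t 0F = goal
    where
    goal : (1# - t) * (2 ÷ 3) + t * 0# ≈ 2 ÷ 3 + - (2 ÷ 3) * t
    goal = lin (t ∷ []) ((𝟙 ⊝ x₀) ⊗ 2 /1+ 2 ⊕ x₀ ⊗ 𝟘 ≃ 2 /1+ 2 ⊕ ⊖ 2 /1+ 2 ⊗ x₀) [] tt
  centre-affine ac t 1F = goal
    where
    goal : (1# - t) * (1 ÷ 3) + t * (2 ÷ 3) ≈ 1 ÷ 3 + 1 ÷ 3 * t
    goal = lin (t ∷ []) ((𝟙 ⊝ x₀) ⊗ 1 /1+ 2 ⊕ x₀ ⊗ 2 /1+ 2 ≃ 1 /1+ 2 ⊕ 1 /1+ 2 ⊗ x₀) [] tt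
  centre-affine ac t 2F = goal
    where
    goal : (1# - t) * 0# + t * (1 ÷ 3) ≈ 0# + 1 ÷ 3 * t
    goal = lin (t ∷ []) ((𝟙 ⊝ x₀) ⊗ 𝟘 ⊕ x₀ ⊗ 1 /1+ 2 ≃ 𝟘 ⊕ 1 /1+ 2 ⊗ x₀) [] tt
  centre-affine bd t 1F = goal
    where
    goal : (1# - t) * 0# + t * (1 ÷ 3) ≈ 0# + 1 ÷ 3 * t
    goal = lin (t ∷ []) ((𝟙 ⊝ x₀) ⊗ 𝟘 ⊕ x₀ ⊗ 1 /1+ 2 ≃ 𝟘 ⊕ 1 /1+ 2 ⊗ x₀) [] tt
  centre-affine bd t 2F = goal
    where
    goal : (1# - t) * (1 ÷ 3) + t * (2 ÷ 3) ≈ 1 ÷ 3 + 1 ÷ 3 * t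
    goal = lin (t ∷ []) ((𝟙 ⊝ x₀) ⊗ 1 /1+ 2 ⊕ x₀ ⊗ 2 /1+ 2 ≃ 1 /1+ 2 ⊕ 1 /1+ 2 ⊗ x₀) [] tt

  βγ≈1 : ∀ l i → β l i * γ l i ≈ 1#
  βγ≈1 _ 0F = goal
    where
    goal : - (2 ÷ 3) * - (3 ÷ 2) ≈ 1#
    goal = lin [] (⊖ 2 /1+ 2 ⊗ (⊖ 3 /1+ 1) ≃ 𝟙) [] tt
  βγ≈1 _ 1F = goal
    where
    goal : (1 ÷ 3) * (3 ÷ 1) ≈ 1#
    goal = lin [] (1 /1+ 2 ⊗ 3 /1+ 0 ≃ 𝟙) [] tt
  βγ≈1 _ 2F = goal
    where
    goal : (1 ÷ 3) * (3 ÷ 1) ≈ 1#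
    goal = lin [] (1 /1+ 2 ⊗ 3 /1+ 0 ≃ 𝟙) [] tt

  α-sum : ∀ l → α l 0F + α l 1F + α l 2F ≈ 1#
  α-sum ac = goal
    where
    goal : 2 ÷ 3 + 1 ÷ 3 + 0# ≈ 1#
    goal = lin [] (2 /1+ 2 ⊕ 1 /1+ 2 ⊕ 𝟘 ≃ 𝟙) [] tt
  α-sum bd = goal
    where
    goal : 2 ÷ 3 + 0# + 1 ÷ 3 ≈ 1#
    goal = lin [] (2 /1+ 2 ⊕ 𝟘 ⊕ 1 /1+ 2 ≃ 𝟙) [] tt

  centre-sum : ∀ {i j k} l t → Triple i j k → centre l t i + centre l t j + centre l t k ≈ 1#
  centre-sum l t triple = trans (sum-triple (centre l t) triple)
    (lin (centre l t 0F ∷ centre l t 1F ∷ centre l t 2F ∷ α l 0F ∷ β l 0F ∷ t ∷ α l 1F ∷ β l 1F ∷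
      α l 2F ∷ β l 2F ∷ []) (x₀ ⊕ x₁ ⊕ x₂ ≃ 𝟙) (▹ x₀ ≃ x₃ ⊕ x₄ ⊗ x₅ ∷ ▹ x₁ ≃ x₆ ⊕ x₇ ⊗ x₅ ∷
      ▹ x₂ ≃ x₈ ⊕ x₉ ⊗ x₅ ∷ ▹ x₃ ⊕ x₆ ⊕ x₈ ≃ 𝟙 ∷ ▹ x₄ ⊗ x₅ ⊕ x₇ ⊗ x₅ ⊕ x₉ ⊗ x₅ ≃ 𝟘 ∷ [])
      (centre-affine l t 0F , centre-affine l t 1F , centre-affine l t 2F , α-sum l , slopes , tt))
    where
    slopes : β l 0F * t + β l 1F * t + β l 2F * t ≈ 0#
    slopes = goal
      where
      goal : - (2 ÷ 3) * t + 1 ÷ 3 * t + 1 ÷ 3 * t ≈ 0#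
      goal = lin (t ∷ []) (⊖ 2 /1+ 2 ⊗ x₀ ⊕ 1 /1+ 2 ⊗ x₀ ⊕ 1 /1+ 2 ⊗ x₀ ≃ 𝟘) [] tt

  -- The parameter of the centre whose i-th coordinate is x.
  φ : Line → Fin 3 → ℝ → ℝ
  φ l i x = (x - α l i) * γ l i

  φ-centre : ∀ {l i x t} → x ≈ centre l t i → t ≈ φ l i x
  φ-centre {l} {i} {x} {t} e = goal
    where
    goal : t ≈ (x - α l i) * γ l i
    goal = lin (t ∷ x ∷ α l i ∷ γ l i ∷ centre l t i ∷ β l i ∷ []) (x₀ ≃ (x₁ ⊝ x₂) ⊗ x₃)
      (▹ x₃ ⊗ x₄ ≃ x₃ ⊗ x₁ ∷ ▹ x₃ ⊗ (x₂ ⊕ x₅ ⊗ x₀) ≃ x₃ ⊗ x₄ ∷ ▹ x₀ ⊗ 𝟙 ≃ x₀ ⊗ (x₅ ⊗ x₃) ∷ [])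
      (sym (*-congᵗ (γ l i) e) , sym (*-congᵗ (γ l i) (centre-affine l t i)) ,
      sym (*-congᵗ t (βγ≈1 l i)) , tt)

  centre-φ : ∀ {l i x t} → t ≈ φ l i x → x ≈ centre l t i
  centre-φ {l} {i} {x} {t} e = lin (x ∷ centre l t i ∷ β l i ∷ t ∷ α l i ∷ γ l i ∷ []) (x₀ ≃ x₁)
    (▹ x₂ ⊗ ((x₀ ⊝ x₄) ⊗ x₅) ≃ x₂ ⊗ x₃ ∷ ▹ x₄ ⊕ x₂ ⊗ x₃ ≃ x₁ ∷
    ▹ (x₀ ⊝ x₄) ⊗ 𝟙 ≃ (x₀ ⊝ x₄) ⊗ (x₂ ⊗ x₅) ∷ []) (sym (*-congᵗ (β l i) e) ,
    sym (centre-affine l t i) , sym (*-congᵗ (x - α l i) (βγ≈1 l i)) , tt)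

  -- The position of `j` among the two coordinates other than `punchIn j b`; it tells which of the
  -- two rays of that line leads to side `j`.
  side-index : Fin 3 → Fin 2 → Fin 2
  side-index 0F 0F = 0F
  side-index 0F 1F = 0F
  side-index 1F 0F = 0F
  side-index 1F 1F = 1F
  side-index 2F 0F = 1F
  side-index 2F 1F = 1F

  punchIn-side-index : ∀ j b → punchIn (punchIn j b) (side-index j b) ≡ j
  punchIn-side-index 0F 0F = ≡.refl
  punchIn-side-index 0F 1F = ≡.refl
  punchIn-side-index 1F 0F = ≡.refl
  punchIn-side-index 1F 1F = ≡.refl
  punchIn-side-index 2F 0F = ≡.refl
  punchIn-side-index 2F 1F = ≡.refl

  -- For each line only the gap in the first of the two other coordinates is analysed. The gap in
  -- the second one is its negative, so the flag is reversed.
  orient : Fin 2 → Bool → Bool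
  orient 0F f = f
  orient 1F f = not f

  -- When e runs along the segment carrying the centres, it meets all three lines
  -- x i = r i in the same point, so they must not be counted separately.
  Degenerate : Line → Segment 3 → Set
  Degenerate l e = ∃[ a ] ∃[ b ] (∀ i → source i ≈ centre l a i) × (∀ i → target i ≈ centre l b i)
    where open Segment e

  module OnLine (l : Line) (e : Segment 3) where
    open Segment e

    -- The parameters whose centre has its line `i` through the source and through the target. For
    -- an intermediate point of `e` the parameter is the affine interpolation of the two.
    A B : Fin 3 → ℝ
    A i = φ l i (source i)
    B i = φ l i (target i)

    parameter : ∀ {s t i} → at s i ≈ centre l t i → t ≈ affine (A i) (B i) s
    parameter {s} {t} {i} on = trans (φ-centre {l} {i} on) goal
      where
      goal : ((1# - s) * source i + s * target i - α l i) * γ l i ≈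
             (1# - s) * ((source i - α l i) * γ l i) + s * ((target i - α l i) * γ l i)
      goal = lin (s ∷ source i ∷ target i ∷ α l i ∷ γ l i ∷ []) (((𝟙 ⊝ x₀) ⊗ x₁ ⊕
        x₀ ⊗ x₂ ⊝ x₃) ⊗ x₄ ≃ (𝟙 ⊝ x₀) ⊗ ((x₁ ⊝ x₃) ⊗ x₄) ⊕ x₀ ⊗ ((x₂ ⊝ x₃) ⊗ x₄)) [] tt

    parameter⁻ : ∀ {s t i} → t ≈ affine (A i) (B i) s → at s i ≈ centre l t i
    parameter⁻ {s} {t} {i} p = centre-φ {l} {i} (trans p goal)
      where
      goal : (1# - s) * ((source i - α l i) * γ l i) + s * ((target i - α l i) * γ l i) ≈
             ((1# - s) * source i + s * target i - α l i) * γ l i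
      goal = lin (s ∷ source i ∷ α l i ∷ γ l i ∷ target i ∷ []) ((𝟙 ⊝ x₀) ⊗ ((x₁ ⊝ x₂) ⊗ x₃) ⊕
        x₀ ⊗ ((x₄ ⊝ x₂) ⊗ x₃) ≃ ((𝟙 ⊝ x₀) ⊗ x₁ ⊕ x₀ ⊗ x₄ ⊝ x₂) ⊗ x₃) [] tt

    A≉B⇒ : ∀ {i} → ¬ (A i ≈ B i) → ¬ (source i ≈ target i)
    A≉B⇒ {i} ne p = ne goal
      where
      goal : (source i - α l i) * γ l i ≈ (target i - α l i) * γ l i
      goal = lin (source i ∷ α l i ∷ γ l i ∷ target i ∷ []) ((x₀ ⊝ x₁) ⊗ x₂ ≃ (x₃ ⊝ x₁) ⊗ x₂)
        (▹ x₂ ⊗ x₀ ≃ x₂ ⊗ x₃ ∷ []) (*-congᵗ (γ l i) p , tt)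

    affine-const : ∀ {a b} s → a ≈ b → affine a b s ≈ a
    affine-const {a} {b} s p = goal
      where
      goal : (1# - s) * a + s * b ≈ a
      goal = lin (s ∷ a ∷ b ∷ []) ((𝟙 ⊝ x₀) ⊗ x₁ ⊕ x₀ ⊗ x₂ ≃ x₁) (▹ x₀ ⊗ x₂ ≃ x₀ ⊗ x₁ ∷ [])
        (sym (*-congᵗ s p) , tt)

    gap₀ gap₁ : Fin 3 → Fin 3 → ℝ
    gap₀ i j = source j - centre l (A i) j
    gap₁ i j = target j - centre l (B i) j

    -- With the centre chosen so that its line `i` passes through `at s`, this is the excess of
    -- coordinate `j` there over the centre. The point is on the ray to side `j` when the gap is not
    -- positive. Both terms being affine in `s`, so is the gap.
    gap : Fin 3 → Fin 3 → ℝ → ℝ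
    gap i j = affine (gap₀ i j) (gap₁ i j)

    gap-at : ∀ {i s t} j → t ≈ affine (A i) (B i) s → at s j - centre l t j ≈ gap i j s
    gap-at {i} {s} {t} j p = goal
      where
      p′ : t ≈ (1# - s) * A i + s * B i
      p′ = p
      goal : (1# - s) * source j + s * target j - centre l t j ≈
             (1# - s) * (source j - centre l (A i) j) + s * (target j - centre l (B i) j)
      goal = lin (s ∷ source j ∷ target j ∷ centre l t j ∷ centre l (A i) j ∷ centre l (B i) j ∷
        α l j ∷ β l j ∷ t ∷ A i ∷ B i ∷ [])
        ((𝟙 ⊝ x₀) ⊗ x₁ ⊕ x₀ ⊗ x₂ ⊝ x₃ ≃ (𝟙 ⊝ x₀) ⊗ (x₁ ⊝ x₄) ⊕ x₀ ⊗ (x₂ ⊝ x₅))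
        (▹ x₆ ⊕ x₇ ⊗ x₈ ≃ x₃ ∷ ▹ (𝟙 ⊝ x₀) ⊗ x₄ ≃ (𝟙 ⊝ x₀) ⊗ (x₆ ⊕ x₇ ⊗ x₉) ∷
        ▹ x₀ ⊗ x₅ ≃ x₀ ⊗ (x₆ ⊕ x₇ ⊗ (var 10)) ∷ ▹ x₇ ⊗ ((𝟙 ⊝ x₀) ⊗ x₉ ⊕ x₀ ⊗ (var 10)) ≃ x₇ ⊗ x₈ ∷
        []) (sym (centre-affine l t j) , *-congᵗ (1# - s) (centre-affine l (A i) j) ,
        *-congᵗ s (centre-affine l (B i) j) , sym (*-congᵗ (β l j) p′) , tt)

    gap-opposite : ∀ {i j k} → Triple i j k → ∀ s → gap i k s ≈ - gap i j s
    gap-opposite {i} {j} {k} t s = goal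
      where
      zero₀ : source k - centre l (A i) k ≈ - (source j - centre l (A i) j)
      zero₀ = lin (source k ∷ centre l (A i) k ∷ source j ∷ centre l (A i) j ∷ source i ∷
        centre l (A i) i ∷ []) (x₀ ⊝ x₁ ≃ ⊖ (x₂ ⊝ x₃)) (▹ x₄ ⊕ x₂ ⊕ x₀ ≃ 𝟙 ∷ ▹ 𝟙 ≃ x₅ ⊕ x₃ ⊕ x₁ ∷
        ▹ x₅ ≃ x₄ ∷ []) (triple-sum t source∈Δ , sym (centre-sum l (A i) t) ,
        sym (centre-φ {l} {i} {source i} {A i} refl) , tt)
      zero₁ : target k - centre l (B i) k ≈ - (target j - centre l (B i) j)
      zero₁ = lin (target k ∷ centre l (B i) k ∷ target j ∷ centre l (B i) j ∷ target i ∷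
        centre l (B i) i ∷ []) (x₀ ⊝ x₁ ≃ ⊖ (x₂ ⊝ x₃)) (▹ x₄ ⊕ x₂ ⊕ x₀ ≃ 𝟙 ∷ ▹ 𝟙 ≃ x₅ ⊕ x₃ ⊕ x₁ ∷
        ▹ x₅ ≃ x₄ ∷ []) (triple-sum t target∈Δ , sym (centre-sum l (B i) t) ,
        sym (centre-φ {l} {i} {target i} {B i} refl) , tt)
      goal : (1# - s) * (source k - centre l (A i) k) + s * (target k - centre l (B i) k) ≈
             - ((1# - s) * (source j - centre l (A i) j) + s * (target j - centre l (B i) j))
      goal = lin (s ∷ source k ∷ centre l (A i) k ∷ target k ∷ centre l (B i) k ∷ source j ∷
        centre l (A i) j ∷ target j ∷ centre l (B i) j ∷ []) ((𝟙 ⊝ x₀) ⊗ (x₁ ⊝ x₂) ⊕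
        x₀ ⊗ (x₃ ⊝ x₄) ≃ ⊖ ((𝟙 ⊝ x₀) ⊗ (x₅ ⊝ x₆) ⊕ x₀ ⊗ (x₇ ⊝ x₈)))
        (▹ (𝟙 ⊝ x₀) ⊗ (x₁ ⊝ x₂) ≃ (𝟙 ⊝ x₀) ⊗ (⊖ (x₅ ⊝ x₆)) ∷ ▹ x₀ ⊗ (x₃ ⊝ x₄) ≃ x₀ ⊗ (⊖ (x₇ ⊝ x₈)) ∷
        []) (*-congᵗ (1# - s) zero₀ , *-congᵗ s zero₁ , tt)

    module Nondegenerate (nondegenerate : ¬ Degenerate l e) where

      -- Coordinate `i` agrees with a centre at either end by the choice of `A i` and `B i`. If a
      -- second coordinate agreed too, so would the third, as all coordinates sum to 1, and `e`
      -- would run along the line of centres.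
      gaps-nonzero : ∀ i → ¬ (gap₀ i (punchIn i 0F) ≈ 0# × gap₁ i (punchIn i 0F) ≈ 0#)
      gaps-nonzero i (p , q) = nondegenerate (A i , B i ,
        (λ m → on-line source∈Δ (A i) (centre-φ {l} {i} refl) (vanish p) m (exhaust t m)) ,
        (λ m → on-line target∈Δ (B i) (centre-φ {l} {i} refl) (vanish q) m (exhaust t m)))
        where
        t : Triple i (punchIn i 0F) (punchIn i 1F)
        t = triple i 0F
        vanish : ∀ {x y} → x - y ≈ 0# → x ≈ y
        vanish {x} {y} p = lin (x ∷ y ∷ []) (x₀ ≃ x₁) (▹ x₀ ⊝ x₁ ≃ 𝟘 ∷ []) (p , tt)
        on-line : ∀ {x} → x ∈ Δ → ∀ a → x i ≈ centre l a i → x (punchIn i 0F) ≈ centre l a (punchIn i 0F) →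
          ∀ m → m ≡ i ⊎ m ≡ punchIn i 0F ⊎ m ≡ punchIn i 1F → x m ≈ centre l a m
        on-line x∈Δ a p q m (inj₁ ≡.refl) = p
        on-line x∈Δ a p q m (inj₂ (inj₁ ≡.refl)) = q
        on-line {x} x∈Δ a p q m (inj₂ (inj₂ ≡.refl)) = lin (x (punchIn i 1F) ∷
          centre l a (punchIn i 1F) ∷ x i ∷ centre l a i ∷ x (punchIn i 0F) ∷
          centre l a (punchIn i 0F) ∷ []) (x₀ ≃ x₁) (▹ x₃ ≃ x₂ ∷ ▹ x₅ ≃ x₄ ∷ ▹ x₂ ⊕ x₄ ⊕ x₀ ≃ 𝟙 ∷
          ▹ 𝟙 ≃ x₃ ⊕ x₅ ⊕ x₁ ∷ []) (sym p , sym q , triple-sum t x∈Δ , sym (centre-sum l a t) , tt)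

      splitting : ∀ i → HasSplit (gap i (punchIn i 0F))
      splitting i = split _ _ (gaps-nonzero i)

      σ : Fin 3 → ℝ
      σ i = proj₁ (splitting i)

      forward : Fin 3 → Bool
      forward i = proj₁ (proj₂ (splitting i))

      0≤σ : ∀ i → 0# ≤ σ i
      0≤σ i = proj₁ (proj₂ (proj₂ (splitting i)))

      σ≤1 : ∀ i → σ i ≤ 1#
      σ≤1 i = proj₁ (proj₂ (proj₂ (proj₂ (splitting i))))

      T : Fin 3 → ℝ
      T i = affine (A i) (B i) (σ i)

      -- At `T i` the point met by line `i` passes from one of its rays to the other. The flag
      -- `true` denotes the half of the parameters next to the source.
      start end : Fin 3 → Bool → ℝ
      start i true  = A i
      start i false = T i
      end i true  = T i
      end i false = B i

      -- Excluding `A` and `B` keeps the lines off the ends of `e`, and also excludes a line that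
      -- contains `e`, since then `A i` and `B i` coincide with the parameter. Excluding `T` gives
      -- the gaps a strict sign at every hit.
      bad : List ℝ
      bad = tabulate A ++ tabulate B ++ tabulate T

      half : Fin 3 → Fin 2 → Bool
      half j b = orient (side-index j b) (forward (punchIn j b))

      split-side : ∀ j b → Split (gap (punchIn j b) j) (σ (punchIn j b)) (half j b)
      split-side j b = ≡.subst (λ m → Split (gap i m) (σ i) (half j b)) (punchIn-side-index j b)
        (oriented (side-index j b))
        where
        i : Fin 3
        i = punchIn j b
        oriented : ∀ c → Split (gap i (punchIn i c)) (σ i) (orient c (forward i))
        oriented 0F = proj₂ (proj₂ (proj₂ (proj₂ (splitting i))))
        oriented 1F = split-resp-- (forward i) (gap-opposite (triple i 0F))
          (proj₂ (proj₂ (proj₂ (proj₂ (splitting i)))))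

      module _ {C : Cut 3} {rays : Vec (Fin 2) 3} {z : ℝ} (z∉bad : ¬ Any (z ≈_) bad)
        (ballLike : BallLike C (centre l z) rays) where
        open BallLike ballLike

        Hit : Fin 3 → ℝ → Set
        Hit j s = 0# ≤ s × s ≤ 1# × at s ∈ Ray (centre l z) j (lookup rays j)

        Occurs : Fin 3 → Set
        Occurs j = Between (start i f) (end i f) z
          where
          i : Fin 3
          i = selected j
          f : Bool
          f = half j (lookup rays j)

        z≉A : ∀ i → ¬ (z ≈ A i)
        z≉A i p = z∉bad (++⁺ˡ (tabulate⁺ {f = A} i p))

        z≉B : ∀ i → ¬ (z ≈ B i)
        z≉B i p = z∉bad (++⁺ʳ (tabulate A) (++⁺ˡ (tabulate⁺ {f = B} i p)))

        z≉T : ∀ i → ¬ (z ≈ T i)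
        z≉T i p = z∉bad (++⁺ʳ (tabulate A) (++⁺ʳ (tabulate B) (tabulate⁺ {f = T} i p)))

        module HitFacts (j : Fin 3) {s : ℝ} (hit : Hit j s) where
          i : Fin 3
          i = selected j
          on : at s i ≈ centre l z i
          on = proj₁ (proj₂ (proj₂ (proj₂ hit)))
          z≈ : z ≈ affine (A i) (B i) s
          z≈ = parameter on
          A≉B : ¬ (A i ≈ B i)
          A≉B p = z≉A i (trans z≈ (affine-const s p))
          0<s : 0# < s
          0<s = ≤∧≉⇒< (proj₁ hit) λ p → z≉A i (trans z≈
            (trans (affine-cong (A i) (B i) (sym p)) (affine-0 (A i) (B i))))
          s<1 : s < 1#
          s<1 = ≤∧≉⇒< (proj₁ (proj₂ hit)) λ p → z≉B i (trans z≈
            (trans (affine-cong (A i) (B i) p) (affine-1 (A i) (B i))))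
          s≉σ : ¬ (s ≈ σ i)
          s≉σ p = z≉T i (trans z≈ (affine-cong (A i) (B i) p))
          gap≤0 : gap i j s ≤ 0#
          gap≤0 = lin (gap i j s ∷ at s j ∷ centre l z j ∷ []) (x₀ ⊑ 𝟘) (▹ x₀ ≃ x₁ ⊝ x₂ ∷
            ▹ x₁ ⊑ x₂ ∷ []) (sym (gap-at {i} {s} {z} j z≈) , proj₂ (proj₂ (proj₂ (proj₂ hit))) , tt)

          -- As `s` differs from `σ i`, the gap has a strict sign, and being on the ray leaves only
          -- the negative one. This decides on which side of `σ i` the parameter `s` lies, hence
          -- which half contains `z`.
          classify : ∀ f → Split (gap i j) (σ i) f → gap i j s < 0# × Between (start i f) (end i f) z
          classify true S with compare s (σ i)
          ... | inj₁ p        = proj₁ (S s 0<s s<1) p ,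
                Between-resp (affine-0 (A i) (B i)) refl (sym z≈) (between-affine A≉B 0<s p)
          ... | inj₂ (inj₁ p) = ⊥-elim (s≉σ p)
          ... | inj₂ (inj₂ p) = ⊥-elim (<-irrefl (<-≤-trans (proj₂ (S s 0<s s<1) p) gap≤0))
          classify false S with compare s (σ i)
          ... | inj₁ p        = ⊥-elim (<-irrefl (<-≤-trans (proj₁ (S s 0<s s<1) p) gap≤0))
          ... | inj₂ (inj₁ p) = ⊥-elim (s≉σ p)
          ... | inj₂ (inj₂ p) = proj₂ (S s 0<s s<1) p ,
                Between-resp refl (affine-1 (A i) (B i)) (sym z≈) (between-affine A≉B p s<1)

          occurs : Occurs j
          occurs = proj₂ (classify (half j (lookup rays j)) (split-side j (lookup rays j)))

          below : at s j < centre l z j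
          below = lin (at s j ∷ centre l z j ∷ gap i j s ∷ []) (x₀ ⊏ x₁) (▹ x₀ ⊝ x₁ ≃ x₂ ∷
            ▹ x₂ ⊏ 𝟘 ∷ []) (gap-at {i} {s} {z} j z≈ ,
            proj₁ (classify (half j (lookup rays j)) (split-side j (lookup rays j))) , tt)

          k : Fin 3
          k = punchIn j (opposite (lookup rays j))

          jik : Triple j i k
          jik = triple j (lookup rays j)

          above : centre l z k < at s k
          above = lin (centre l z k ∷ at s k ∷ at s j ∷ centre l z j ∷ at s i ∷ centre l z i ∷ [])
            (x₀ ⊏ x₁) (▹ x₂ ⊏ x₃ ∷ ▹ x₄ ≃ x₅ ∷ ▹ 𝟙 ≃ x₂ ⊕ x₄ ⊕ x₁ ∷ ▹ x₃ ⊕ x₅ ⊕ x₀ ≃ 𝟙 ∷ [])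
            (below , on , sym (triple-sum jik (at∈Δ C e (proj₁ hit) (proj₁ (proj₂ hit)))) ,
            centre-sum l z jik , tt)

        crossing⇒hit : ∀ s → s ∈ Crossing C e → ∃[ j ] Hit j s
        crossing⇒hit s cr = let 0≤s , s≤1 = crossing⇒inside C e cr
                                j , ray = Equivalence.to (boundary (at s)) (crossing⇒boundary C e cr)
                            in j , 0≤s , s≤1 , ray

        hit⇒crossing : ∀ j s → Hit j s → s ∈ Crossing C e
        hit⇒crossing j s hit = ray-crossing e jik ≡.refl (A≉B⇒ A≉B) 0<s s<1 on below above
          where open HitFacts j hit

        hit-unique : ∀ j s s′ → Hit j s → Hit j s′ → s ≈ s′
        hit-unique j s s′ hit hit′ = affine-injective (HitFacts.A≉B j hit)
          (trans (sym (HitFacts.z≈ j hit)) (HitFacts.z≈ j hit′))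

        -- A hit of kind `j` lies on line `i`, with coordinate `j` strictly below and `k` strictly
        -- above the centre. A second kind at the same point cannot be `k`, which would have to be
        -- below, nor `i`, whose ray lies on line `j` or `k`.
        hit-disjoint : ∀ j j′ s s′ → Hit j s → Hit j′ s′ → s ≈ s′ → j ≡ j′
        hit-disjoint j j′ s s′ hit hit′ s≈s′ = by-index (exhaust jik j′)
          where
          open HitFacts j hit
          same : ∀ m → at s m ≈ at s′ m
          same m = affine-cong (source m) (target m) s≈s′
          low : ∀ m → at s′ m ≈ centre l z m → m ≡ j → ⊥
          low m p ≡.refl = <⇒≉ below (trans (same m) p)
          high : ∀ m → at s′ m ≤ centre l z m → m ≡ k → ⊥
          high m p ≡.refl = <-irrefl (lin (centre l z k ∷ at s k ∷ at s′ k ∷ []) (𝟘 ⊏ 𝟘) (▹ x₀ ⊏ x₁ ∷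
            ▹ x₁ ≃ x₂ ∷ ▹ x₂ ⊑ x₀ ∷ []) (above , same m , p , tt))
          by-index : j′ ≡ j ⊎ j′ ≡ i ⊎ j′ ≡ k → j ≡ j′
          by-index (inj₁ p) = ≡.sym p
          by-index (inj₂ (inj₂ p)) = ⊥-elim (high j′ (<⇒≤ (HitFacts.below j′ hit′)) p)
          by-index (inj₂ (inj₁ p)) with exhaust jik (selected j′)
          ... | inj₁ q        = ⊥-elim (low (selected j′) (HitFacts.on j′ hit′) q)
          ... | inj₂ (inj₁ q) = ⊥-elim (selected≢ j′ (≡.trans q (≡.sym p)))
          ... | inj₂ (inj₂ q) = ⊥-elim (high (selected j′)
                  (≤-reflexive (HitFacts.on j′ hit′)) q)

        occurs⇒hit : ∀ j → Occurs j → ∃[ s ] Hit j s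
        occurs⇒hit j = from (half j (lookup rays j)) (split-side j (lookup rays j))
          where
          i : Fin 3
          i = selected j
          build : ∀ s → 0# < s → s < 1# → affine (A i) (B i) s ≈ z → gap i j s < 0# → Hit j s
          build s 0<s s<1 p q = <⇒≤ 0<s , <⇒≤ s<1 , at∈Δ C e (<⇒≤ 0<s) (<⇒≤ s<1) ,
            parameter⁻ (sym p) , (lin (at s j ∷ centre l z j ∷ gap i j s ∷ []) (x₀ ⊑ x₁)
              (▹ x₀ ⊝ x₁ ≃ x₂ ∷ ▹ x₂ ⊏ 𝟘 ∷ []) (gap-at {i} {s} {z} j (sym p) , q , tt))
          from : ∀ f → Split (gap i j) (σ i) f → Between (start i f) (end i f) z → ∃[ s ] Hit j s
          from true S bet = let s , p = affine-surjective A≉B z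
                                0<s , s<σ = between-affine⁻ (0≤σ i) A≉B
                                  (Between-resp (sym (affine-0 (A i) (B i))) refl (sym p) bet)
                                s<1 = <-≤-trans s<σ (σ≤1 i)
                            in s , build s 0<s s<1 p (proj₁ (S s 0<s s<1) s<σ)
            where
            A≉B : ¬ (A i ≈ B i)
            A≉B p = between⇒≉ bet (sym (affine-const (σ i) p))
          from false S bet = let s , p = affine-surjective A≉B z
                                 σ<s , s<1 = between-affine⁻ (σ≤1 i) A≉B
                                   (Between-resp refl (sym (affine-1 (A i) (B i))) (sym p) bet)
                                 0<s = ≤-<-trans (0≤σ i) σ<s
                             in s , build s 0<s s<1 p (proj₂ (S s 0<s s<1) σ<s)
            where
            A≉B : ¬ (A i ≈ B i)
            A≉B p = between⇒≉ bet (trans (affine-const (σ i) p) p)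

        cuts : ∀ n → CutsAtLeast C e n ⇔ n ℕ.≤ count Occurs
        cuts = cuts⇔count C e Hit Occurs crossing⇒hit hit⇒crossing hit-unique hit-disjoint
          occurs⇒hit (λ j s → HitFacts.occurs j)

-- Degenerate segments and corner cuts; crossings as spans of the parameter.

module CutAnalysis (em : ∀ {ℓ} → ExcludedMiddle ℓ) (𝓡 : CompleteOrderedField) where
  open CompleteOrderedField 𝓡 hiding (zero)
  open LinearArithmetic 𝓡
  open RealNumbers em 𝓡
  open SimplexGeometry em 𝓡
  open CutCrossings em 𝓡
  open InjectionCounting em
  open CutCounts em 𝓡
  open BallCutCounts em 𝓡
  open Simplex 𝓡

  affine-resp : ∀ {a a′ b b′} s → a ≈ a′ → b ≈ b′ → affine a b s ≈ affine a′ b′ s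
  affine-resp {a} {a′} {b} {b′} s p q = goal
    where
    goal : (1# - s) * a + s * b ≈ (1# - s) * a′ + s * b′
    goal = lin (s ∷ a ∷ b ∷ a′ ∷ b′ ∷ []) ((𝟙 ⊝ x₀) ⊗ x₁ ⊕ x₀ ⊗ x₂ ≃ (𝟙 ⊝ x₀) ⊗ x₃ ⊕ x₀ ⊗ x₄)
      (▹ (𝟙 ⊝ x₀) ⊗ x₁ ≃ (𝟙 ⊝ x₀) ⊗ x₃ ∷ ▹ x₀ ⊗ x₂ ≃ x₀ ⊗ x₄ ∷ []) (*-congᵗ (1# - s) p ,
      *-congᵗ s q , tt)

  source≉target : ∀ (e : Segment 3) → let open Segment e in ¬ (∀ i → source i ≈ target i)
  source≉target e same = proj₂ 0<length (≤-antisym (proj₁ 0<length) length≤0)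
    where
    open Segment e
    small-differences : ∀ i → ∣ source i - target i ∣ ≤ 0#
    small-differences i = ∣x∣≤ (lin (source i ∷ target i ∷ []) (x₀ ⊝ x₁ ⊑ 𝟘) (▹ x₀ ≃ x₁ ∷ [])
      (same i , tt)) (lin (source i ∷ target i ∷ []) (⊖ (x₀ ⊝ x₁) ⊑ 𝟘)
      (▹ x₁ ≃ x₀ ∷ []) (sym (same i) , tt))
    length≤0 : dist source target ≤ 0#
    length≤0 = lin (dist source target ∷ []) (x₀ ⊑ 𝟘) (▹ x₀ ⊑ 3 /1+ 1 ⊗ 𝟘 ∷ [])
      (dist≤ {source} {target} 0# small-differences , tt)

  module DegenerateBall (l : Line) (e : Segment 3) (a b : ℝ)
    (source≈ : ∀ i → Segment.source e i ≈ centre l a i) (target≈ : ∀ i → Segment.target e i ≈ centre l b i) where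
    open Segment e
    open OnLine l e

    A≈a : ∀ i → A i ≈ a
    A≈a i = sym (φ-centre {l} {i} (source≈ i))

    B≈b : ∀ i → B i ≈ b
    B≈b i = sym (φ-centre {l} {i} (target≈ i))

    a≉b : ¬ (a ≈ b)
    a≉b p = source≉target e λ i → lin (source i ∷ target i ∷ centre l a i ∷ centre l b i ∷ α l i ∷
      β l i ∷ a ∷ b ∷ []) (x₀ ≃ x₁) (▹ x₀ ≃ x₂ ∷ ▹ x₃ ≃ x₁ ∷ ▹ x₂ ≃ x₄ ⊕ x₅ ⊗ x₆ ∷
      ▹ x₄ ⊕ x₅ ⊗ x₇ ≃ x₃ ∷ ▹ x₅ ⊗ x₆ ≃ x₅ ⊗ x₇ ∷ []) (source≈ i , sym (target≈ i) ,
      centre-affine l a i , sym (centre-affine l b i) , *-congᵗ (β l i) p , tt)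

    at-affine : ∀ u i → at u i ≈ α l i + β l i * affine a b u
    at-affine u i = goal
      where
      goal : (1# - u) * source i + u * target i ≈ α l i + β l i * ((1# - u) * a + u * b)
      goal = lin (u ∷ source i ∷ target i ∷ α l i ∷ β l i ∷ a ∷ b ∷ centre l a i ∷ centre l b i ∷
        []) ((𝟙 ⊝ x₀) ⊗ x₁ ⊕ x₀ ⊗ x₂ ≃ x₃ ⊕ x₄ ⊗ ((𝟙 ⊝ x₀) ⊗ x₅ ⊕ x₀ ⊗ x₆))
        (▹ (𝟙 ⊝ x₀) ⊗ x₁ ≃ (𝟙 ⊝ x₀) ⊗ x₇ ∷ ▹ x₀ ⊗ x₂ ≃ x₀ ⊗ x₈ ∷
        ▹ (𝟙 ⊝ x₀) ⊗ x₇ ≃ (𝟙 ⊝ x₀) ⊗ (x₃ ⊕ x₄ ⊗ x₅) ∷ ▹ x₀ ⊗ x₈ ≃ x₀ ⊗ (x₃ ⊕ x₄ ⊗ x₆) ∷ [])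
        (*-congᵗ (1# - u) (source≈ i) , *-congᵗ u (target≈ i) ,
        *-congᵗ (1# - u) (centre-affine l a i) , *-congᵗ u (centre-affine l b i) , tt)

    module _ {C : Cut 3} {rays : Vec (Fin 2) 3} {z : ℝ} (z≉a : ¬ (z ≈ a)) (z≉b : ¬ (z ≈ b))
      (ballLike : BallLike C (centre l z) rays) where
      open BallLike ballLike

      Hit : Fin 1 → ℝ → Set
      Hit _ s = 0# ≤ s × s ≤ 1# × z ≈ affine a b s

      -- Whichever ray is met, its line yields the same parameter, because `A` and `B` are
      -- independent of the coordinate here. One kind of hit is enough.
      crossing⇒hit : ∀ s → s ∈ Crossing C e → ∃[ j ] Hit j s
      crossing⇒hit s cr = let 0≤s , s≤1 = crossing⇒inside C e cr
                              j , _ , on , _ = Equivalence.to (boundary (at s)) (crossing⇒boundary C e cr)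
                          in 0F , 0≤s , s≤1 , trans (parameter {s} {z} {selected j} on)
                               (affine-resp s (A≈a (selected j)) (B≈b (selected j)))

      hit-inside : ∀ j s → Hit j s → 0# < s × s < 1#
      hit-inside j s (0≤s , s≤1 , p) =
        ≤∧≉⇒< 0≤s (λ q → z≉a (trans p (trans (affine-cong a b (sym q)) (affine-0 a b)))) ,
        ≤∧≉⇒< s≤1 (λ q → z≉b (trans p (trans (affine-cong a b q) (affine-1 a b))))

      hit⇒crossing : ∀ j s → Hit j s → s ∈ Crossing C e
      hit⇒crossing j s hit@(0≤s , s≤1 , p) =
        -- Along a line of centres the first coordinate moves against the other two: the slopes are
        -- -2/3, 1/3 and 1/3.
        centre-crossing e 012F (A≉B⇒ {0F} λ q → a≉b (trans (sym (A≈a 0F)) (trans q (B≈b 0F))))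
          (proj₁ (hit-inside j s hit)) (proj₂ (hit-inside j s hit))
          (λ i → parameter⁻ {s} {z} {i} (trans p (affine-resp s (sym (A≈a i)) (sym (B≈b i)))))
          (λ u q → up q 1F (slope 1F) , up q 2F (slope 2F)) (λ u q → down q 1F (slope 1F) , down q 2F (slope 2F))
        where
        slope : ∀ m → ∀ u → at u m ≈ α l m + β l m * affine a b u
        slope m u = at-affine u m
        up : ∀ {u} → at u 0F < at s 0F → ∀ m → (∀ u → at u m ≈ α l m + 1 ÷ 3 * affine a b u) → at s m < at u m
        up {u} q m h = lin (at s m ∷ at u m ∷ at u 0F ∷ at s 0F ∷ α l 0F ∷ affine a b u ∷
          affine a b s ∷ α l m ∷ []) (x₀ ⊏ x₁) (1 /1+ 1 ▸ x₂ ⊏ x₃ ∷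
          1 /1+ 1 ▸ x₄ ⊕ ⊖ 2 /1+ 2 ⊗ x₅ ≃ x₂ ∷ 1 /1+ 1 ▸ x₃ ≃ x₄ ⊕ ⊖ 2 /1+ 2 ⊗ x₆ ∷
          ▹ x₇ ⊕ 1 /1+ 2 ⊗ x₅ ≃ x₁ ∷ ▹ x₀ ≃ x₇ ⊕ 1 /1+ 2 ⊗ x₆ ∷ []) (q , sym (at-affine u 0F) ,
          at-affine s 0F , sym (h u) , h s , tt)
        down : ∀ {u} → at s 0F < at u 0F → ∀ m → (∀ u → at u m ≈ α l m + 1 ÷ 3 * affine a b u) → at u m < at s m
        down {u} q m h = lin (at u m ∷ at s m ∷ at s 0F ∷ at u 0F ∷ α l 0F ∷ affine a b u ∷
          affine a b s ∷ α l m ∷ []) (x₀ ⊏ x₁) (1 /1+ 1 ▸ x₂ ⊏ x₃ ∷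
          1 /1+ 1 ▸ x₃ ≃ x₄ ⊕ ⊖ 2 /1+ 2 ⊗ x₅ ∷ 1 /1+ 1 ▸ x₄ ⊕ ⊖ 2 /1+ 2 ⊗ x₆ ≃ x₂ ∷
          ▹ x₀ ≃ x₇ ⊕ 1 /1+ 2 ⊗ x₅ ∷ ▹ x₇ ⊕ 1 /1+ 2 ⊗ x₆ ≃ x₁ ∷ []) (q , at-affine u 0F ,
          sym (at-affine s 0F) , h u , sym (h s) , tt)

      Occurs : Fin 1 → Set
      Occurs _ = Between a b z

      occurs⇒hit : ∀ j → Occurs j → ∃[ s ] Hit j s
      occurs⇒hit j bet = let s , p = affine-surjective a≉b z
                             0<s , s<1 = between-affine⁻ 0≤1 a≉b
                               (Between-resp (sym (affine-0 a b)) (sym (affine-1 a b)) (sym p) bet)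
                         in s , <⇒≤ 0<s , <⇒≤ s<1 , sym p

      hit⇒occurs : ∀ j s → Hit j s → Occurs j
      hit⇒occurs j s hit@(_ , _ , p) = Between-resp (affine-0 a b) (affine-1 a b) (sym p)
        (between-affine a≉b (proj₁ (hit-inside j s hit)) (proj₂ (hit-inside j s hit)))

      cuts : ∀ n → CutsAtLeast C e n ⇔ n ℕ.≤ count Occurs
      cuts = cuts⇔count C e Hit Occurs crossing⇒hit hit⇒crossing
        (λ j s s′ (_ , _ , p) (_ , _ , p′) → affine-injective a≉b (trans (sym p) p′))
        (λ { 0F 0F _ _ _ _ _ → ≡.refl }) occurs⇒hit hit⇒occurs

  module CornerCounts (e : Segment 3) (k : Fin 3) where
    open Segment e

    bad : List ℝ
    bad = tabulate source ++ tabulate target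

    module _ {C : Cut 3} {ρ : ℝ} (ρ∉bad : ¬ Any (ρ ≈_) bad) (cornerLike : CornerLike C k ρ) where
      open CornerLike cornerLike

      Hit : Fin 2 → ℝ → Set
      Hit c s = 0# ≤ s × s ≤ 1# × at s (punchIn k c) ≈ ρ

      Occurs : Fin 2 → Set
      Occurs c = Between (source (punchIn k c)) (target (punchIn k c)) ρ

      ρ≉source : ∀ i → ¬ (ρ ≈ source i)
      ρ≉source i p = ρ∉bad (++⁺ˡ (tabulate⁺ {f = source} i p))

      ρ≉target : ∀ i → ¬ (ρ ≈ target i)
      ρ≉target i p = ρ∉bad (++⁺ʳ (tabulate source) (tabulate⁺ {f = target} i p))

      crossing⇒hit : ∀ s → s ∈ Crossing C e → ∃[ c ] Hit c s
      crossing⇒hit s cr = let 0≤s , s≤1 = crossing⇒inside C e cr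
                              _ , i , i≢k , on = Equivalence.to (boundary (at s)) (crossing⇒boundary C e cr)
                              k≢i = λ p → i≢k (≡.sym p)
                          in punchOut k≢i , 0≤s , s≤1 ,
                             ≡.subst (λ m → at s m ≈ ρ) (≡.sym (Fin.punchIn-punchOut k≢i)) on

      module HitFacts (c : Fin 2) {s : ℝ} (hit : Hit c s) where
        i : Fin 3
        i = punchIn k c
        on : affine (source i) (target i) s ≈ ρ
        on = proj₂ (proj₂ hit)
        0<s : 0# < s
        0<s = ≤∧≉⇒< (proj₁ hit) λ p → ρ≉source i (trans (sym on)
          (trans (affine-cong (source i) (target i) (sym p)) (affine-0 (source i) (target i))))
        s<1 : s < 1#
        s<1 = ≤∧≉⇒< (proj₁ (proj₂ hit)) λ p → ρ≉target i (trans (sym on)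
          (trans (affine-cong (source i) (target i) p) (affine-1 (source i) (target i))))
        moves : ¬ (source i ≈ target i)
        moves p = ρ≉source i (trans (sym on) (OnLine.affine-const ac e s p))

      hit⇒crossing : ∀ c s → Hit c s → s ∈ Crossing C e
      hit⇒crossing c s hit = corner-crossing e (Fin.punchInᵢ≢i k c) moves 0<s s<1 on
        where open HitFacts c hit

      hit-unique : ∀ c s s′ → Hit c s → Hit c s′ → s ≈ s′
      hit-unique c s s′ hit hit′ = affine-injective (HitFacts.moves c hit)
        (trans (HitFacts.on c hit) (sym (HitFacts.on c hit′)))

      hit-disjoint : ∀ c c′ s s′ → Hit c s → Hit c′ s′ → s ≈ s′ → c ≡ c′
      hit-disjoint c c′ s s′ hit hit′ s≈s′ with c Fin.≟ c′
      ... | yes p = p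
      ... | no c≢c′ = ⊥-elim (<⇒≉ (others-small (at∈Δ C e (proj₁ hit′) (proj₁ (proj₂ hit′)))
              (λ p → c≢c′ (Fin.punchIn-injective k c c′ p)) big)
            (trans (affine-cong (source (punchIn k c)) (target (punchIn k c)) (sym s≈s′)) (HitFacts.on c hit)))
        where
        big : 2 ÷ 3 < at s′ (punchIn k c′)
        big = lin (at s′ (punchIn k c′) ∷ ρ ∷ []) (2 /1+ 2 ⊏ x₀) (▹ 2 /1+ 2 ⊏ x₁ ∷ ▹ x₁ ≃ x₀ ∷ [])
          (2/3<ρ , sym (HitFacts.on c′ hit′) , tt)

      occurs⇒hit : ∀ c → Occurs c → ∃[ s ] Hit c s
      occurs⇒hit c bet = let s , p = affine-surjective moves ρ
                             0<s , s<1 = between-affine⁻ 0≤1 moves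
                               (Between-resp (sym (affine-0 _ _)) (sym (affine-1 _ _)) (sym p) bet)
                         in s , <⇒≤ 0<s , <⇒≤ s<1 , p
        where
        moves : ¬ (source (punchIn k c) ≈ target (punchIn k c))
        moves = between⇒≉ bet

      hit⇒occurs : ∀ c s → Hit c s → Occurs c
      hit⇒occurs c s hit = Between-resp (affine-0 _ _) (affine-1 _ _) on (between-affine moves 0<s s<1)
        where open HitFacts c hit

      cuts : ∀ n → CutsAtLeast C e n ⇔ n ℕ.≤ count Occurs
      cuts = cuts⇔count C e Hit Occurs crossing⇒hit hit⇒crossing hit-unique hit-disjoint occurs⇒hit hit⇒occurs

  data Component : Set where
    ball   : Line → Vec (Fin 2) 3 → Component
    corner : Fin 3 → Component

  toChoice : Component → ℝ → Choice
  toChoice (ball l rays) t = ball l t rays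
  toChoice (corner k)    ρ = corner k ρ

  -- The cuts of e by a random cut from the component c, as a function of the
  -- parameter z: up to finitely many z, their number is that of the spans around z.
  record SpanAnalysis (c : Component) (e : Segment 3) : Set₁ where
    field
      spans : ℕ
      X Y   : Fin spans → ℝ
      bad   : List ℝ
      cuts  : ∀ z C → Realises (toChoice c z) C → ¬ Any (z ≈_) bad →
              ∀ n → CutsAtLeast C e n ⇔ n ℕ.≤ count (λ j → Between (X j) (Y j) z)

  realises⇒ballLike : ∀ {l t rays C} → Realises (ball l t rays) C → BallLike C (centre l t) rays
  realises⇒ballLike (_ , _ , boundary) = record { boundary = boundary }

  realises⇒cornerLike : ∀ {k ρ C} → Realises (corner k ρ) C → CornerLike C k ρ
  realises⇒cornerLike (2/3<ρ , _ , boundary) = record { 2/3<ρ = 2/3<ρ ; boundary = boundary }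

  ball-analysis : ∀ l rays e → Dec (Degenerate l e) → SpanAnalysis (ball l rays) e
  ball-analysis l rays e (yes (a , b , p , q)) = record
    { spans = 1
    ; X     = λ _ → a
    ; Y     = λ _ → b
    ; bad   = a ∷ b ∷ []
    ; cuts  = λ z C r z∉bad → DegenerateBall.cuts l e a b p q {C} {rays} {z} (λ w → z∉bad (here w))
                (λ w → z∉bad (there (here w))) (realises⇒ballLike {l} {z} {rays} {C} r)
    }
  ball-analysis l rays e (no nd) = record
    { spans = 3
    ; X     = λ j → start (punchIn j (lookup rays j)) (half j (lookup rays j))
    ; Y     = λ j → end (punchIn j (lookup rays j)) (half j (lookup rays j))
    ; bad   = bad
    ; cuts  = λ z C r z∉bad → cuts {C} {rays} {z} z∉bad (realises⇒ballLike {l} {z} {rays} {C} r)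
    }
    where
    open OnLine l e
    open Nondegenerate nd

  corner-analysis : ∀ k e → SpanAnalysis (corner k) e
  corner-analysis k e = record
    { spans = 2
    ; X     = λ c → Segment.source e (punchIn k c)
    ; Y     = λ c → Segment.target e (punchIn k c)
    ; bad   = CornerCounts.bad e k
    ; cuts  = λ z C r z∉bad → CornerCounts.cuts e k {C} {z} z∉bad (realises⇒cornerLike {k} {z} {C} r)
    }

  analysis : ∀ c e → SpanAnalysis c e
  analysis (ball l rays) e = ball-analysis l rays e em
  analysis (corner k)    e = corner-analysis k e

-- The total weighted length of the spans.

module SpanLengths (em : ∀ {ℓ} → ExcludedMiddle ℓ) (𝓡 : CompleteOrderedField) where
  open CompleteOrderedField 𝓡 hiding (zero)
  open LinearArithmetic 𝓡
  open RealNumbers em 𝓡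
  open SimplexGeometry em 𝓡
  open CutCrossings em 𝓡
  open CutCounts em 𝓡
  open BallCutCounts em 𝓡
  open CutAnalysis em 𝓡
  open Simplex 𝓡

  ∣x-y∣≈y-x : ∀ {x y} → x ≤ y → ∣ x - y ∣ ≈ y - x
  ∣x-y∣≈y-x {x} {y} p = lin ((∣ x - y ∣) ∷ y ∷ x ∷ []) (x₀ ≃ x₁ ⊝ x₂) (▹ x₀ ≃ ⊖ (x₂ ⊝ x₁) ∷ [])
    (∣x∣≈-x x-y≤0 , tt)
    where
    x-y≤0 : x - y ≤ 0#
    x-y≤0 = lin (x ∷ y ∷ []) (x₀ ⊝ x₁ ⊑ 𝟘) (▹ x₀ ⊑ x₁ ∷ []) (p , tt)

  ∣x-y∣≈x-y : ∀ {x y} → y ≤ x → ∣ x - y ∣ ≈ x - y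
  ∣x-y∣≈x-y p = ∣x∣≈x (x≤y⇒0≤y-x p)

  clamp-cong : ∀ a b {x y} → x ≈ y → clamp a b x ≈ clamp a b y
  clamp-cong a b p = ≤-antisym (clamp-mono a b (≤-reflexive p))
    (clamp-mono a b (≤-reflexive (sym p)))

  -- The start of the parameter range and the density with respect to it: 1/22 is 8/11 times 1/2
  -- times 1/8, and for a corner the mass 3/11 times 1/3 is spread over an interval of length 1/3.
  lo w : Component → ℝ
  lo (ball _ _) = 0#
  lo (corner _) = 2 ÷ 3
  w (ball _ _)  = 1 ÷ 22
  w (corner _)  = 3 ÷ 11

  -- The length of the part of the interval between X and Y that lies in [a , 1].
  within : ℝ → ℝ → ℝ → ℝ
  within a X Y = ∣ clamp a 1# X - clamp a 1# Y ∣

  within-cong : ∀ a {X X′ Y Y′} → X ≈ X′ → Y ≈ Y′ → within a X Y ≈ within a X′ Y′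
  within-cong a {X} {X′} {Y} {Y′} p q = ≤-antisym (bound (clamp-cong a 1# p) (clamp-cong a 1# q))
    (bound (sym (clamp-cong a 1# p)) (sym (clamp-cong a 1# q)))
    where
    bound : ∀ {x x′ y y′} → x ≈ x′ → y ≈ y′ → ∣ x - y ∣ ≤ ∣ x′ - y′ ∣
    bound {x} {x′} {y} {y′} e f = ∣x∣≤ (lin (x ∷ y ∷ (∣ x′ - y′ ∣) ∷ x′ ∷ y′ ∷ []) (x₀ ⊝ x₁ ⊑ x₂)
      (▹ x₀ ≃ x₃ ∷ ▹ x₄ ≃ x₁ ∷ ▹ x₃ ⊝ x₄ ⊑ x₂ ∷ []) (e , sym f , x≤∣x∣ (x′ - y′) , tt)) (lin (x ∷ y ∷
      (∣ x′ - y′ ∣) ∷ x′ ∷ y′ ∷ []) (⊖ (x₀ ⊝ x₁) ⊑ x₂) (▹ x₃ ≃ x₀ ∷ ▹ x₁ ≃ x₄ ∷ ▹ ⊖ (x₃ ⊝ x₄) ⊑ x₂ ∷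
      []) (sym e , f , -x≤∣x∣ (x′ - y′) , tt))

  within-sym : ∀ a X Y → within a X Y ≈ within a Y X
  within-sym a X Y = ≤-antisym (bound (clamp a 1# X) (clamp a 1# Y)) (bound (clamp a 1# Y) (clamp a 1# X))
    where
    bound : ∀ x y → ∣ x - y ∣ ≤ ∣ y - x ∣
    bound x y = ∣x∣≤ (lin (x ∷ y ∷ (∣ y - x ∣) ∷ []) (x₀ ⊝ x₁ ⊑ x₂) (▹ ⊖ (x₁ ⊝ x₀) ⊑ x₂ ∷ [])
      (-x≤∣x∣ (y - x) , tt)) (lin (x ∷ y ∷ (∣ y - x ∣) ∷ []) (⊖ (x₀ ⊝ x₁) ⊑ x₂)
      (▹ x₁ ⊝ x₀ ⊑ x₂ ∷ []) (x≤∣x∣ (y - x) , tt))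

  within-mono : ∀ a {X Y} → X ≤ Y → within a X Y ≈ clamp a 1# Y - clamp a 1# X
  within-mono a p = ∣x-y∣≈y-x (clamp-mono a 1# p)

  within-anti : ∀ a {X Y} → Y ≤ X → within a X Y ≈ clamp a 1# X - clamp a 1# Y
  within-anti a p = ∣x-y∣≈x-y (clamp-mono a 1# p)

  within-affine : ∀ c {a b σ} → 0# ≤ σ → σ ≤ 1# → within c a (affine a b σ) + within c (affine a b σ) b ≈ within c a b
  within-affine c {a} {b} {σ} 0≤σ σ≤1 = by-order (≤-<-connex a b)
    where
    T : ℝ
    T = (1# - σ) * a + σ * b
    by-order : a ≤ b ⊎ b < a → within c a T + within c T b ≈ within c a b
    by-order (inj₁ p) = lin (within c a T ∷ within c T b ∷ within c a b ∷ clamp c 1# T ∷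
      clamp c 1# a ∷ clamp c 1# b ∷ []) (x₀ ⊕ x₁ ≃ x₂) (▹ x₀ ≃ x₃ ⊝ x₄ ∷ ▹ x₁ ≃ x₅ ⊝ x₃ ∷
      ▹ x₅ ⊝ x₄ ≃ x₂ ∷ []) (within-mono c a≤T , within-mono c T≤b , sym (within-mono c p) , tt)
      where
      a≤T : a ≤ T
      a≤T = lin (a ∷ σ ∷ b ∷ []) (x₀ ⊑ (𝟙 ⊝ x₁) ⊗ x₀ ⊕ x₁ ⊗ x₂) (▹ 𝟘 ⊑ x₁ ⊗ (x₂ ⊝ x₀) ∷ [])
        (*-nonNeg 0≤σ (x≤y⇒0≤y-x p) , tt)
      T≤b : T ≤ b
      T≤b = lin (σ ∷ a ∷ b ∷ []) ((𝟙 ⊝ x₀) ⊗ x₁ ⊕ x₀ ⊗ x₂ ⊑ x₂) (▹ 𝟘 ⊑ (𝟙 ⊝ x₀) ⊗ (x₂ ⊝ x₁) ∷ [])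
        (*-nonNeg (x≤y⇒0≤y-x σ≤1) (x≤y⇒0≤y-x p) , tt)
    by-order (inj₂ p) = lin (within c a T ∷ within c T b ∷ within c a b ∷ clamp c 1# a ∷
      clamp c 1# T ∷ clamp c 1# b ∷ []) (x₀ ⊕ x₁ ≃ x₂) (▹ x₀ ≃ x₃ ⊝ x₄ ∷ ▹ x₁ ≃ x₄ ⊝ x₅ ∷
      ▹ x₃ ⊝ x₅ ≃ x₂ ∷ []) (within-anti c T≤a , within-anti c b≤T , sym (within-anti c (<⇒≤ p)) ,
      tt)
      where
      T≤a : T ≤ a
      T≤a = lin (σ ∷ a ∷ b ∷ []) ((𝟙 ⊝ x₀) ⊗ x₁ ⊕ x₀ ⊗ x₂ ⊑ x₁) (▹ 𝟘 ⊑ x₀ ⊗ (x₁ ⊝ x₂) ∷ [])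
        (*-nonNeg 0≤σ (x≤y⇒0≤y-x (<⇒≤ p)) , tt)
      b≤T : b ≤ T
      b≤T = lin (b ∷ σ ∷ a ∷ []) (x₀ ⊑ (𝟙 ⊝ x₁) ⊗ x₂ ⊕ x₁ ⊗ x₀) (▹ 𝟘 ⊑ (𝟙 ⊝ x₁) ⊗ (x₂ ⊝ x₀) ∷ [])
        (*-nonNeg (x≤y⇒0≤y-x σ≤1) (x≤y⇒0≤y-x (<⇒≤ p)) , tt)

  all-rays : List (Vec (Fin 2) 3)
  all-rays = (0F ∷ 0F ∷ 0F ∷ []) ∷ (0F ∷ 0F ∷ 1F ∷ []) ∷ (0F ∷ 1F ∷ 0F ∷ []) ∷ (0F ∷ 1F ∷ 1F ∷ []) ∷
             (1F ∷ 0F ∷ 0F ∷ []) ∷ (1F ∷ 0F ∷ 1F ∷ []) ∷ (1F ∷ 1F ∷ 0F ∷ []) ∷ (1F ∷ 1F ∷ 1F ∷ []) ∷ []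

  ∈-all-rays : ∀ v → v List.∈ all-rays
  ∈-all-rays (0F ∷ 0F ∷ 0F ∷ []) = here ≡.refl
  ∈-all-rays (0F ∷ 0F ∷ 1F ∷ []) = there (here ≡.refl)
  ∈-all-rays (0F ∷ 1F ∷ 0F ∷ []) = there (there (here ≡.refl))
  ∈-all-rays (0F ∷ 1F ∷ 1F ∷ []) = there (there (there (here ≡.refl)))
  ∈-all-rays (1F ∷ 0F ∷ 0F ∷ []) = there (there (there (there (here ≡.refl))))
  ∈-all-rays (1F ∷ 0F ∷ 1F ∷ []) = there (there (there (there (there (here ≡.refl)))))
  ∈-all-rays (1F ∷ 1F ∷ 0F ∷ []) = there (there (there (there (there (there (here ≡.refl))))))
  ∈-all-rays (1F ∷ 1F ∷ 1F ∷ []) = there (there (there (there (there (there (there (here ≡.refl)))))))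

  components : List Component
  components = map (ball ac) all-rays ++ map (ball bd) all-rays ++ map corner (0F ∷ 1F ∷ 2F ∷ [])

  ∈-components : ∀ c → c List.∈ components
  ∈-components (ball ac v) = ∈-++⁺ˡ (∈-map⁺ (ball ac) (∈-all-rays v))
  ∈-components (ball bd v) = ∈-++⁺ʳ (map (ball ac) all-rays) (∈-++⁺ˡ (∈-map⁺ (ball bd) (∈-all-rays v)))
  ∈-components (corner k)  = ∈-++⁺ʳ (map (ball ac) all-rays) (∈-++⁺ʳ (map (ball bd) all-rays)
    (∈-map⁺ corner (∈-012 k)))
    where
    ∈-012 : ∀ k → k List.∈ (0F ∷ 1F ∷ 2F ∷ [])
    ∈-012 0F = here ≡.refl
    ∈-012 1F = there (here ≡.refl)
    ∈-012 2F = there (there (here ≡.refl))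

  _≟ᶜ_ : DecidableEquality Component
  ball ac u ≟ᶜ ball ac v with Vec.≡-dec Fin._≟_ u v
  ... | yes ≡.refl = yes ≡.refl
  ... | no n       = no λ { ≡.refl → n ≡.refl }
  ball bd u ≟ᶜ ball bd v with Vec.≡-dec Fin._≟_ u v
  ... | yes ≡.refl = yes ≡.refl
  ... | no n       = no λ { ≡.refl → n ≡.refl }
  ball ac u ≟ᶜ ball bd v = no λ ()
  ball bd u ≟ᶜ ball ac v = no λ ()
  ball _ _  ≟ᶜ corner _  = no λ ()
  corner _  ≟ᶜ ball _ _  = no λ ()
  corner k  ≟ᶜ corner l with k Fin.≟ l
  ... | yes ≡.refl = yes ≡.refl
  ... | no n       = no λ { ≡.refl → n ≡.refl }

  unique-components : Unique components
  unique-components = from-yes (DecUnique.unique? _≟ᶜ_ components)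

  spanTotal : ∀ {c e} → SpanAnalysis c e → ℝ
  spanTotal {c} A = sum (λ j → within (lo c) (X j) (Y j))
    where open SpanAnalysis A

  module _ (e : Segment 3) where
    open Segment e

    lineTotal : Line → ℝ
    lineTotal l = within 0# (A 0F) (B 0F) + within 0# (A 1F) (B 1F) + within 0# (A 2F) (B 2F)
      where open OnLine l e

    -- Each half of the parameters of a line occurs in four of the eight ray selections, and the two
    -- halves make up the whole. Along the line of centres there is one span per selection: eight
    -- equal lengths, against four times three on the right.
    line-bound : ∀ l (d : Dec (Degenerate l e)) →
      sumOver (λ v → spanTotal (ball-analysis l v e d)) all-rays ≤ 4 ÷ 1 * lineTotal l
    line-bound l (yes (a , b , p , q)) = bound
      where
      open OnLine l e
      open DegenerateBall l e a b p q
      x : ℝ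
      x = within 0# a b
      same : ∀ i → within 0# (A i) (B i) ≈ x
      same i = within-cong 0# (A≈a i) (B≈b i)
      bound : (x + 0#) + ((x + 0#) + ((x + 0#) + ((x + 0#) + ((x + 0#) + ((x + 0#) + ((x + 0#) + ((x + 0#) + 0#))))))) ≤
              4 ÷ 1 * (within 0# (A 0F) (B 0F) + within 0# (A 1F) (B 1F) + within 0# (A 2F) (B 2F))
      bound = lin ((∣ clamp 0# 1# a - clamp 0# 1# b ∣) ∷ within 0# (A 0F) (B 0F) ∷
        within 0# (A 1F) (B 1F) ∷ within 0# (A 2F) (B 2F) ∷ []) (x₀ ⊕ 𝟘 ⊕ (x₀ ⊕ 𝟘 ⊕ (x₀ ⊕ 𝟘 ⊕ (x₀ ⊕
        𝟘 ⊕ (x₀ ⊕ 𝟘 ⊕ (x₀ ⊕ 𝟘 ⊕ (x₀ ⊕ 𝟘 ⊕ (x₀ ⊕ 𝟘 ⊕ 𝟘))))))) ⊑ 4 /1+ 0 ⊗ (x₁ ⊕ x₂ ⊕ x₃))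
        (4 /1+ 0 ▸ x₀ ≃ x₁ ∷ 4 /1+ 0 ▸ x₀ ≃ x₂ ∷ 4 /1+ 0 ▸ x₀ ≃ x₃ ∷ 4 /1+ 0 ▸ 𝟘 ⊑ x₀ ∷ [])
        (sym (same 0F) , sym (same 1F) , sym (same 2F) , 0≤∣x∣ (clamp 0# 1# a - clamp 0# 1# b) , tt)
    line-bound l (no nd) = bound
      where
      open OnLine l e
      open Nondegenerate nd
      L : Fin 3 → Bool → ℝ
      L i f = within 0# (start i f) (end i f)
      pair : ∀ i f → L i f + L i (not f) ≈ within 0# (A i) (B i)
      pair i true  = within-affine 0# (0≤σ i) (σ≤1 i)
      pair i false = trans (+-comm _ _) (within-affine 0# (0≤σ i) (σ≤1 i))
      -- The first index is the side, the second the ray selected on it.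
      a₀₀ a₀₁ a₁₀ a₁₁ a₂₀ a₂₁ : ℝ
      a₀₀ = L 1F (forward 1F)
      a₀₁ = L 2F (forward 2F)
      a₁₀ = L 0F (forward 0F)
      a₁₁ = L 2F (not (forward 2F))
      a₂₀ = L 0F (not (forward 0F))
      a₂₁ = L 1F (not (forward 1F))
      bound : (a₀₀ + (a₁₀ + (a₂₀ + 0#))) + ((a₀₀ + (a₁₀ + (a₂₁ + 0#))) + ((a₀₀ + (a₁₁ + (a₂₀ + 0#))) +
              ((a₀₀ + (a₁₁ + (a₂₁ + 0#))) + ((a₀₁ + (a₁₀ + (a₂₀ + 0#))) + ((a₀₁ + (a₁₀ + (a₂₁ + 0#))) +
              ((a₀₁ + (a₁₁ + (a₂₀ + 0#))) + ((a₀₁ + (a₁₁ + (a₂₁ + 0#))) + 0#))))))) ≤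
              4 ÷ 1 * (within 0# (A 0F) (B 0F) + within 0# (A 1F) (B 1F) + within 0# (A 2F) (B 2F))
      bound = lin (a₀₀ ∷ a₁₀ ∷ a₂₀ ∷ a₂₁ ∷ a₁₁ ∷ a₀₁ ∷ within 0# (A 0F) (B 0F) ∷
        within 0# (A 1F) (B 1F) ∷ within 0# (A 2F) (B 2F) ∷ []) (x₀ ⊕ (x₁ ⊕ (x₂ ⊕ 𝟘)) ⊕ (x₀ ⊕ (x₁ ⊕
        (x₃ ⊕ 𝟘)) ⊕ (x₀ ⊕ (x₄ ⊕ (x₂ ⊕ 𝟘)) ⊕ (x₀ ⊕ (x₄ ⊕ (x₃ ⊕ 𝟘)) ⊕ (x₅ ⊕ (x₁ ⊕ (x₂ ⊕ 𝟘)) ⊕ (x₅ ⊕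
        (x₁ ⊕ (x₃ ⊕ 𝟘)) ⊕ (x₅ ⊕ (x₄ ⊕ (x₂ ⊕ 𝟘)) ⊕ (x₅ ⊕ (x₄ ⊕ (x₃ ⊕ 𝟘)) ⊕ 𝟘))))))) ⊑ 4 /1+ 0 ⊗ (x₆ ⊕
        x₇ ⊕ x₈)) (4 /1+ 0 ▸ x₁ ⊕ x₂ ≃ x₆ ∷ 4 /1+ 0 ▸ x₀ ⊕ x₃ ≃ x₇ ∷ 4 /1+ 0 ▸ x₅ ⊕ x₄ ≃ x₈ ∷ [])
        (pair 0F (forward 0F) , pair 1F (forward 1F) , pair 2F (forward 2F) , tt)

    cornerTotal : ℝ
    cornerTotal = within (2 ÷ 3) (source 0F) (target 0F) + within (2 ÷ 3) (source 1F) (target 1F) +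
                  within (2 ÷ 3) (source 2F) (target 2F)

    -- Each terminal is chosen in two of the three corner components.
    corner-bound : sumOver (λ k → spanTotal (corner-analysis k e)) (0F ∷ 1F ∷ 2F ∷ []) ≤ 2 ÷ 1 * cornerTotal
    corner-bound = bound
      where
      M : Fin 3 → ℝ
      M i = within (2 ÷ 3) (source i) (target i)
      bound : (M 1F + (M 2F + 0#)) + ((M 0F + (M 2F + 0#)) + ((M 0F + (M 1F + 0#)) + 0#)) ≤
              2 ÷ 1 * (M 0F + M 1F + M 2F)
      bound = lin (M 1F ∷ M 2F ∷ M 0F ∷ []) (x₀ ⊕ (x₁ ⊕ 𝟘) ⊕ (x₂ ⊕ (x₁ ⊕ 𝟘) ⊕ (x₂ ⊕ (x₀ ⊕ 𝟘) ⊕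
        𝟘)) ⊑ 2 /1+ 0 ⊗ (x₂ ⊕ x₀ ⊕ x₁)) [] tt

  -- The clamped parameters of the centres whose first coordinate is x (on both lines),
  -- and of those with second or third coordinate x, which is less than 1/3 on one line
  -- and greater on the other.  Up to a common factor these measure the choices met
  -- below the coordinate x, and the corner cuts contribute what is beyond 2/3: the
  -- total rate is constant in x.
  descending near far : ℝ → ℝ
  descending x = clamp 0# 1# ((x - 2 ÷ 3) * - (3 ÷ 2))
  near x       = clamp 0# 1# ((x - 0#) * (3 ÷ 1))
  far x        = clamp 0# 1# ((x - 1 ÷ 3) * (3 ÷ 1))

  top : ℝ → ℝ
  top = clamp (2 ÷ 3) 1#

  top-below : ∀ {x} → x ≤ 2 ÷ 3 → top x ≈ 2 ÷ 3
  top-below = clamp-below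

  descending-top : ∀ {x} → 0# ≤ x → x ≤ 1# → 2 ÷ 3 * descending x ≈ top x - x
  descending-top {x} 0≤x x≤1 = by-order (≤-<-connex x (2 ÷ 3))
    where
    y : ℝ
    y = (x - 2 ÷ 3) * - (3 ÷ 2)
    by-order : x ≤ 2 ÷ 3 ⊎ 2 ÷ 3 < x → 2 ÷ 3 * clamp 0# 1# y ≈ top x - x
    by-order (inj₁ p) = lin (clamp 0# 1# y ∷ top x ∷ x ∷ []) (2 /1+ 2 ⊗ x₀ ≃ x₁ ⊝ x₂)
      (2 /1+ 2 ▸ x₀ ≃ (x₂ ⊝ 2 /1+ 2) ⊗ (⊖ 3 /1+ 1) ∷ ▹ 2 /1+ 2 ≃ x₁ ∷ [])
      (clamp-inside {0#} {1#} 0≤y y≤1 , sym (top-below p) , tt)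
      where
      0≤y : 0# ≤ y
      0≤y = lin (x ∷ []) (𝟘 ⊑ (x₀ ⊝ 2 /1+ 2) ⊗ (⊖ 3 /1+ 1)) (3 /1+ 1 ▸ x₀ ⊑ 2 /1+ 2 ∷ []) (p , tt)
      y≤1 : y ≤ 1#
      y≤1 = lin (x ∷ []) ((x₀ ⊝ 2 /1+ 2) ⊗ (⊖ 3 /1+ 1) ⊑ 𝟙) (3 /1+ 1 ▸ 𝟘 ⊑ x₀ ∷ []) (0≤x , tt)
    by-order (inj₂ p) = lin (clamp 0# 1# y ∷ clamp (2 ÷ 3) 1# x ∷ x ∷ []) (2 /1+ 2 ⊗ x₀ ≃ x₁ ⊝ x₂)
      (2 /1+ 2 ▸ x₀ ≃ 𝟘 ∷ ▹ x₂ ≃ x₁ ∷ []) (clamp-below {0#} {1#} y≤0 ,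
      sym (clamp-inside (<⇒≤ p) x≤1) , tt)
      where
      y≤0 : y ≤ 0#
      y≤0 = lin (x ∷ []) ((x₀ ⊝ 2 /1+ 2) ⊗ (⊖ 3 /1+ 1) ⊑ 𝟘) (3 /1+ 1 ▸ 2 /1+ 2 ⊏ x₀ ∷ []) (p , tt)

  -- The three terms on the left grow in turn at unit rate: the first on the lowest third of the
  -- unit interval, the second on the middle third, the last on the highest.
  near-far-top : ∀ {x} → 0# ≤ x → x ≤ 1# → 1 ÷ 3 * near x + 1 ÷ 3 * far x + top x ≈ x + 2 ÷ 3
  near-far-top {x} 0≤x x≤1 = by-order (≤-<-connex x (1 ÷ 3)) (≤-<-connex x (2 ÷ 3))
    where
    y z : ℝ
    y = (x - 0#) * (3 ÷ 1)
    z = (x - 1 ÷ 3) * (3 ÷ 1)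
    0≤y : 0# ≤ y
    0≤y = lin (x ∷ []) (𝟘 ⊑ (x₀ ⊝ 𝟘) ⊗ 3 /1+ 0) (3 /1+ 0 ▸ 𝟘 ⊑ x₀ ∷ []) (0≤x , tt)
    1≤y : 1 ÷ 3 < x → 1# ≤ y
    1≤y p = lin (x ∷ []) (𝟙 ⊑ (x₀ ⊝ 𝟘) ⊗ 3 /1+ 0) (3 /1+ 0 ▸ 1 /1+ 2 ⊏ x₀ ∷ []) (p , tt)
    0≤z : 1 ÷ 3 < x → 0# ≤ z
    0≤z p = lin (x ∷ []) (𝟘 ⊑ (x₀ ⊝ 1 /1+ 2) ⊗ 3 /1+ 0) (3 /1+ 0 ▸ 1 /1+ 2 ⊏ x₀ ∷ []) (p , tt)
    Goal : Set
    Goal = 1 ÷ 3 * clamp 0# 1# y + 1 ÷ 3 * clamp 0# 1# z + top x ≈ x + 2 ÷ 3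
    low-case : x ≤ 1 ÷ 3 → Goal
    low-case p = goal
      where
      y≤1 : y ≤ 1#
      y≤1 = lin (x ∷ []) ((x₀ ⊝ 𝟘) ⊗ 3 /1+ 0 ⊑ 𝟙) (3 /1+ 0 ▸ x₀ ⊑ 1 /1+ 2 ∷ []) (p , tt)
      z≤0 : z ≤ 0#
      z≤0 = lin (x ∷ []) ((x₀ ⊝ 1 /1+ 2) ⊗ 3 /1+ 0 ⊑ 𝟘) (3 /1+ 0 ▸ x₀ ⊑ 1 /1+ 2 ∷ []) (p , tt)
      x≤2/3 : x ≤ 2 ÷ 3
      x≤2/3 = lin (x ∷ []) (x₀ ⊑ 2 /1+ 2) (▹ x₀ ⊑ 1 /1+ 2 ∷ []) (p , tt)
      goal : 1 ÷ 3 * clamp 0# 1# y + 1 ÷ 3 * clamp 0# 1# z + top x ≈ x + 2 ÷ 3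
      goal = lin (clamp 0# 1# y ∷ clamp 0# 1# z ∷ top x ∷ x ∷ [])
        (1 /1+ 2 ⊗ x₀ ⊕ 1 /1+ 2 ⊗ x₁ ⊕ x₂ ≃ x₃ ⊕ 2 /1+ 2) (1 /1+ 2 ▸ x₀ ≃ (x₃ ⊝ 𝟘) ⊗ 3 /1+ 0 ∷
        1 /1+ 2 ▸ x₁ ≃ 𝟘 ∷ ▹ x₂ ≃ 2 /1+ 2 ∷ []) (clamp-inside {0#} {1#} 0≤y y≤1 ,
        clamp-below {0#} {1#} z≤0 , top-below x≤2/3 , tt)
    middle-case : 1 ÷ 3 < x → x ≤ 2 ÷ 3 → Goal
    middle-case p q = goal
      where
      z≤1 : z ≤ 1#
      z≤1 = lin (x ∷ []) ((x₀ ⊝ 1 /1+ 2) ⊗ 3 /1+ 0 ⊑ 𝟙) (3 /1+ 0 ▸ x₀ ⊑ 2 /1+ 2 ∷ []) (q , tt)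
      goal : 1 ÷ 3 * clamp 0# 1# y + 1 ÷ 3 * clamp 0# 1# z + top x ≈ x + 2 ÷ 3
      goal = lin (clamp 0# 1# y ∷ clamp 0# 1# z ∷ top x ∷ x ∷ [])
        (1 /1+ 2 ⊗ x₀ ⊕ 1 /1+ 2 ⊗ x₁ ⊕ x₂ ≃ x₃ ⊕ 2 /1+ 2) (1 /1+ 2 ▸ x₀ ≃ 𝟙 ∷
        1 /1+ 2 ▸ x₁ ≃ (x₃ ⊝ 1 /1+ 2) ⊗ 3 /1+ 0 ∷ ▹ x₂ ≃ 2 /1+ 2 ∷ [])
        (clamp-above {0#} {1#} 0≤1 (1≤y p) , clamp-inside {0#} {1#} (0≤z p) z≤1 , top-below q , tt)
    high-case : 2 ÷ 3 < x → Goal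
    high-case q = goal
      where
      p : 1 ÷ 3 < x
      p = lin (x ∷ []) (1 /1+ 2 ⊏ x₀) (▹ 2 /1+ 2 ⊏ x₀ ∷ []) (q , tt)
      1≤z : 1# ≤ z
      1≤z = lin (x ∷ []) (𝟙 ⊑ (x₀ ⊝ 1 /1+ 2) ⊗ 3 /1+ 0) (3 /1+ 0 ▸ 2 /1+ 2 ⊏ x₀ ∷ []) (q , tt)
      goal : 1 ÷ 3 * clamp 0# 1# y + 1 ÷ 3 * clamp 0# 1# z + top x ≈ x + 2 ÷ 3
      goal = lin (clamp 0# 1# y ∷ clamp 0# 1# z ∷ clamp (2 ÷ 3) 1# x ∷ x ∷ [])
        (1 /1+ 2 ⊗ x₀ ⊕ 1 /1+ 2 ⊗ x₁ ⊕ x₂ ≃ x₃ ⊕ 2 /1+ 2) (1 /1+ 2 ▸ x₀ ≃ 𝟙 ∷ 1 /1+ 2 ▸ x₁ ≃ 𝟙 ∷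
        ▹ x₂ ≃ x₃ ∷ []) (clamp-above {0#} {1#} 0≤1 (1≤y p) , clamp-above {0#} {1#} 0≤1 1≤z ,
        clamp-inside (<⇒≤ q) x≤1 , tt)
    by-order : x ≤ 1 ÷ 3 ⊎ 1 ÷ 3 < x → x ≤ 2 ÷ 3 ⊎ 2 ÷ 3 < x → Goal
    by-order (inj₁ p) _        = low-case p
    by-order (inj₂ p) (inj₁ q) = middle-case p q
    by-order (inj₂ _) (inj₂ q) = high-case q

  -- The factor 1/3 compares the weights of a line and of the corners: four selections of density
  -- 1/22 make 2/11, two corner components of density 3/11 make 6/11.
  coordinateTotal : Fin 3 → ℝ → ℝ → ℝ
  coordinateTotal i x y = 1 ÷ 3 * (within 0# (φ ac i x) (φ ac i y) + within 0# (φ bd i x) (φ bd i y)) +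
                          within (2 ÷ 3) x y

  coordinate-mono : ∀ i {x y} → 0# ≤ x → y ≤ 1# → x ≤ y → coordinateTotal i x y ≈ y - x
  coordinate-mono 0F {x} {y} 0≤x y≤1 x≤y = goal
    where
    X Y : ℝ
    X = (x - 2 ÷ 3) * - (3 ÷ 2)
    Y = (y - 2 ÷ 3) * - (3 ÷ 2)
    Y≤X : Y ≤ X
    Y≤X = lin (y ∷ x ∷ []) ((x₀ ⊝ 2 /1+ 2) ⊗ (⊖ 3 /1+ 1) ⊑ (x₁ ⊝ 2 /1+ 2) ⊗ (⊖ 3 /1+ 1))
      (3 /1+ 1 ▸ x₁ ⊑ x₀ ∷ []) (x≤y , tt)
    x-value : 2 ÷ 3 * clamp 0# 1# X ≈ clamp (2 ÷ 3) 1# x - x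
    x-value = descending-top 0≤x (≤-trans x≤y y≤1)
    y-value : 2 ÷ 3 * clamp 0# 1# Y ≈ clamp (2 ÷ 3) 1# y - y
    y-value = descending-top (≤-trans 0≤x x≤y) y≤1
    goal : 1 ÷ 3 * (within 0# X Y + within 0# X Y) + within (2 ÷ 3) x y ≈ y - x
    goal = lin (within 0# X Y ∷ within (2 ÷ 3) x y ∷ y ∷ x ∷ clamp 0# 1# X ∷ clamp 0# 1# Y ∷
      clamp (2 ÷ 3) 1# y ∷ clamp (2 ÷ 3) 1# x ∷ []) (1 /1+ 2 ⊗ (x₀ ⊕ x₀) ⊕ x₁ ≃ x₂ ⊝ x₃)
      (2 /1+ 2 ▸ x₀ ≃ x₄ ⊝ x₅ ∷ ▹ x₁ ≃ x₆ ⊝ x₇ ∷ ▹ 2 /1+ 2 ⊗ x₄ ≃ x₇ ⊝ x₃ ∷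
      ▹ x₆ ⊝ x₂ ≃ 2 /1+ 2 ⊗ x₅ ∷ []) (within-anti 0# Y≤X , within-mono (2 ÷ 3) x≤y , x-value ,
      sym y-value , tt)
  coordinate-mono 1F {x} {y} 0≤x y≤1 x≤y = goal
    where
    X Y X′ Y′ : ℝ
    X = (x - 1 ÷ 3) * (3 ÷ 1)
    Y = (y - 1 ÷ 3) * (3 ÷ 1)
    X′ = (x - 0#) * (3 ÷ 1)
    Y′ = (y - 0#) * (3 ÷ 1)
    X≤Y : X ≤ Y
    X≤Y = lin (x ∷ y ∷ []) ((x₀ ⊝ 1 /1+ 2) ⊗ 3 /1+ 0 ⊑ (x₁ ⊝ 1 /1+ 2) ⊗ 3 /1+ 0)
      (3 /1+ 0 ▸ x₀ ⊑ x₁ ∷ []) (x≤y , tt)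
    X′≤Y′ : X′ ≤ Y′
    X′≤Y′ = lin (x ∷ y ∷ []) ((x₀ ⊝ 𝟘) ⊗ 3 /1+ 0 ⊑ (x₁ ⊝ 𝟘) ⊗ 3 /1+ 0) (3 /1+ 0 ▸ x₀ ⊑ x₁ ∷ [])
      (x≤y , tt)
    x-value : 1 ÷ 3 * clamp 0# 1# X′ + 1 ÷ 3 * clamp 0# 1# X + clamp (2 ÷ 3) 1# x ≈ x + 2 ÷ 3
    x-value = near-far-top 0≤x (≤-trans x≤y y≤1)
    y-value : 1 ÷ 3 * clamp 0# 1# Y′ + 1 ÷ 3 * clamp 0# 1# Y + clamp (2 ÷ 3) 1# y ≈ y + 2 ÷ 3
    y-value = near-far-top (≤-trans 0≤x x≤y) y≤1
    goal : 1 ÷ 3 * (within 0# X Y + within 0# X′ Y′) + within (2 ÷ 3) x y ≈ y - x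
    goal = lin (within 0# X Y ∷ within 0# X′ Y′ ∷ within (2 ÷ 3) x y ∷ y ∷ x ∷ clamp 0# 1# Y ∷
      clamp 0# 1# X ∷ clamp 0# 1# Y′ ∷ clamp 0# 1# X′ ∷ clamp (2 ÷ 3) 1# y ∷ clamp (2 ÷ 3) 1# x ∷
      []) (1 /1+ 2 ⊗ (x₀ ⊕ x₁) ⊕ x₂ ≃ x₃ ⊝ x₄) (1 /1+ 2 ▸ x₀ ≃ x₅ ⊝ x₆ ∷ 1 /1+ 2 ▸ x₁ ≃ x₇ ⊝ x₈ ∷
      ▹ x₂ ≃ x₉ ⊝ (var 10) ∷ ▹ x₄ ⊕ 2 /1+ 2 ≃ 1 /1+ 2 ⊗ x₈ ⊕ 1 /1+ 2 ⊗ x₆ ⊕ (var 10) ∷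
      ▹ 1 /1+ 2 ⊗ x₇ ⊕ 1 /1+ 2 ⊗ x₅ ⊕ x₉ ≃ x₃ ⊕ 2 /1+ 2 ∷ []) (within-mono 0# X≤Y ,
      within-mono 0# X′≤Y′ , within-mono (2 ÷ 3) x≤y , sym x-value , y-value , tt)
  -- Exchanging the last two coordinates exchanges the lines `ac` and `bd`.
  coordinate-mono 2F {x} {y} 0≤x y≤1 x≤y = trans (+-congʳ (*-congˡ (+-comm _ _)))
    (coordinate-mono 1F 0≤x y≤1 x≤y)

  coordinate-total : ∀ i {x y} → 0# ≤ x → x ≤ 1# → 0# ≤ y → y ≤ 1# → coordinateTotal i x y ≤ ∣ x - y ∣
  coordinate-total i {x} {y} 0≤x x≤1 0≤y y≤1 = by-order (≤-<-connex x y)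
    where
    by-order : x ≤ y ⊎ y < x → coordinateTotal i x y ≤ ∣ x - y ∣
    by-order (inj₁ p) = lin (coordinateTotal i x y ∷ (∣ x - y ∣) ∷ y ∷ x ∷ []) (x₀ ⊑ x₁)
      (▹ x₀ ≃ x₂ ⊝ x₃ ∷ ▹ ⊖ (x₃ ⊝ x₂) ⊑ x₁ ∷ []) (coordinate-mono i 0≤x y≤1 p , -x≤∣x∣ (x - y) , tt)
    by-order (inj₂ p) = lin (within 0# (φ ac i x) (φ ac i y) ∷ within 0# (φ bd i x) (φ bd i y) ∷
      within (2 ÷ 3) x y ∷ (∣ x - y ∣) ∷ within 0# (φ ac i y) (φ ac i x) ∷
      within 0# (φ bd i y) (φ bd i x) ∷ within (2 ÷ 3) y x ∷ x ∷ y ∷ [])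
      (1 /1+ 2 ⊗ (x₀ ⊕ x₁) ⊕ x₂ ⊑ x₃) (▹ 1 /1+ 2 ⊗ (x₄ ⊕ x₅) ⊕ x₆ ≃ x₇ ⊝ x₈ ∷ 1 /1+ 2 ▸ x₀ ≃ x₄ ∷
      1 /1+ 2 ▸ x₁ ≃ x₅ ∷ ▹ x₂ ≃ x₆ ∷ ▹ x₇ ⊝ x₈ ⊑ x₃ ∷ []) (coordinate-mono i 0≤y x≤1 (<⇒≤ p) ,
      within-sym 0# (φ ac i x) (φ ac i y) , within-sym 0# (φ bd i x) (φ bd i y) ,
      within-sym (2 ÷ 3) x y , x≤∣x∣ (x - y) , tt)

  sumOver-scale : ∀ {A B : Set} (f : B → ℝ) (g : A → B) (h : A → ℝ) k → (∀ x → f (g x) ≈ k * h x) →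
                  ∀ xs → sumOver f (map g xs) ≈ k * sumOver h xs
  sumOver-scale f g h k e []       = sym (zeroʳ k)
  sumOver-scale f g h k e (x ∷ xs) = trans (+-cong (e x) (sumOver-scale f g h k e xs)) (sym (distribˡ k _ _))

  weighted : Segment 3 → Component → ℝ
  weighted e c = w c * spanTotal (analysis c e)

  weighted-total : ∀ e → sumOver (weighted e) components ≤ 12 ÷ 11 * Segment.length e
  weighted-total e = bound
    where
    open Segment e
    balls : Line → ℝ
    balls l = sumOver (λ v → spanTotal (ball-analysis l v e em)) all-rays
    corners : ℝ
    corners = sumOver (λ k → spanTotal (corner-analysis k e)) (0F ∷ 1F ∷ 2F ∷ [])
    ball-part : ∀ l → sumOver (weighted e) (map (ball l) all-rays) ≈ 1 ÷ 22 * balls l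
    ball-part l = sumOver-scale (weighted e) (ball l) (λ v → spanTotal (ball-analysis l v e em)) (1 ÷ 22)
      (λ _ → refl) all-rays
    corner-part : sumOver (weighted e) (map corner (0F ∷ 1F ∷ 2F ∷ [])) ≈ 3 ÷ 11 * corners
    corner-part = sumOver-scale (weighted e) corner (λ k → spanTotal (corner-analysis k e)) (3 ÷ 11)
      (λ _ → refl) (0F ∷ 1F ∷ 2F ∷ [])
    parts : sumOver (weighted e) components ≈ 1 ÷ 22 * balls ac + (1 ÷ 22 * balls bd + 3 ÷ 11 * corners)
    parts = trans (sumOver-++ (weighted e) (map (ball ac) all-rays)
      (map (ball bd) all-rays ++ map corner (0F ∷ 1F ∷ 2F ∷ []))) (+-cong (ball-part ac)
      (trans (sumOver-++ (weighted e) (map (ball bd) all-rays) (map corner (0F ∷ 1F ∷ 2F ∷ [])))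
        (+-cong (ball-part bd) corner-part)))
    line : Line → Fin 3 → ℝ
    line l i = within 0# (φ l i (source i)) (φ l i (target i))
    M : Fin 3 → ℝ
    M i = within (2 ÷ 3) (source i) (target i)
    ball-bound : ∀ l → balls l ≤ 4 ÷ 1 * (line l 0F + line l 1F + line l 2F)
    ball-bound l = line-bound e l em
    corners-bound : corners ≤ 2 ÷ 1 * (M 0F + M 1F + M 2F)
    corners-bound = corner-bound e
    coordinate : ∀ i → 1 ÷ 3 * (line ac i + line bd i) + M i ≤ ∣ source i - target i ∣
    coordinate i = coordinate-total i (proj₁ source∈Δ i) (Δ≤1 source∈Δ i) (proj₁ target∈Δ i) (Δ≤1 target∈Δ i)
    bound : sumOver (weighted e) components ≤ 12 ÷ 11 * ((1 ÷ 2) *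
      (∣ source 0F - target 0F ∣ + (∣ source 1F - target 1F ∣ + (∣ source 2F - target 2F ∣ + 0#))))
    bound = lin (sumOver (weighted e) components ∷ (∣ source 0F - target 0F ∣) ∷
      (∣ source 1F - target 1F ∣) ∷ (∣ source 2F - target 2F ∣) ∷ balls ac ∷ balls bd ∷ corners ∷
      line ac 0F ∷ line ac 1F ∷ line ac 2F ∷ line bd 0F ∷ line bd 1F ∷ line bd 2F ∷ M 0F ∷ M 1F ∷
      M 2F ∷ []) (x₀ ⊑ 12 /1+ 10 ⊗ (1 /1+ 1 ⊗ (x₁ ⊕ (x₂ ⊕ (x₃ ⊕ 𝟘)))))
      (▹ x₀ ≃ 1 /1+ 21 ⊗ x₄ ⊕ (1 /1+ 21 ⊗ x₅ ⊕ 3 /1+ 10 ⊗ x₆) ∷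
      1 /1+ 21 ▸ x₄ ⊑ 4 /1+ 0 ⊗ (x₇ ⊕ x₈ ⊕ x₉) ∷
      1 /1+ 21 ▸ x₅ ⊑ 4 /1+ 0 ⊗ ((var 10) ⊕ (var 11) ⊕ (var 12)) ∷
      3 /1+ 10 ▸ x₆ ⊑ 2 /1+ 0 ⊗ ((var 13) ⊕ (var 14) ⊕ (var 15)) ∷
      6 /1+ 10 ▸ 1 /1+ 2 ⊗ (x₇ ⊕ (var 10)) ⊕ (var 13) ⊑ x₁ ∷
      6 /1+ 10 ▸ 1 /1+ 2 ⊗ (x₈ ⊕ (var 11)) ⊕ (var 14) ⊑ x₂ ∷
      6 /1+ 10 ▸ 1 /1+ 2 ⊗ (x₉ ⊕ (var 12)) ⊕ (var 15) ⊑ x₃ ∷ []) (parts , ball-bound ac ,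
      ball-bound bd , corners-bound , coordinate 0F , coordinate 1F , coordinate 2F , tt)

-- Finite additivity and a bound for lower sums.

module ProbabilityTheory (em : ∀ {ℓ} → ExcludedMiddle ℓ) (𝓡 : CompleteOrderedField) where
  open CompleteOrderedField 𝓡 hiding (zero)
  open LinearArithmetic 𝓡
  open RealNumbers em 𝓡
  open MeasureTheory em 𝓡
  open InjectionCounting em
  open Simplex 𝓡 using (ProbabilitySpace)

  module FiniteAdditivity (S : ProbabilitySpace) where
    open ProbabilitySpace S

    private variable
      A B E : Pred Ω 0ℓ

    measurable-∅ : Measurable ∅
    measurable-∅ = resp-≐ ((λ n → n tt) , λ ()) (compl univ)

    measurable-pairing : Measurable A → Measurable B → ∀ n → Measurable (pairing A B n)
    measurable-pairing mA mB zero          = mA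
    measurable-pairing mA mB (suc zero)    = mB
    measurable-pairing mA mB (suc (suc n)) = measurable-∅

    measurable-∪ : Measurable A → Measurable B → Measurable (A ∪ B)
    measurable-∪ {A} {B} mA mB = resp-≐ (⋃pairing⊆∪ {A = A} {B = B} , ∪⊆⋃pairing)
      (union (pairing A B) (measurable-pairing mA mB))

    measurable-∩ : Measurable A → Measurable B → Measurable (A ∩ B)
    measurable-∩ {A} {B} mA mB = resp-≐ (fwd , λ { (a , b) (inj₁ ¬a) → ¬a a ; (a , b) (inj₂ ¬b) → ¬b b })
      (compl (measurable-∪ (compl mA) (compl mB)))
      where
      fwd : ∁ (∁ A ∪ ∁ B) ⊆ A ∩ B
      fwd n = by-contradiction (λ ¬a → n (inj₁ ¬a)) , by-contradiction (λ ¬b → n (inj₂ ¬b))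

    -- Countable additivity for the constant sequence of empty sets bounds twice the measure by the
    -- measure.
    μ-∅ : μ ∅ ≈ 0#
    μ-∅ = ≤-antisym (lin (μ ∅ ∷ []) (x₀ ⊑ 𝟘) (▹ x₀ ⊕ (x₀ ⊕ 𝟘) ⊑ x₀ ∷ []) (doubled , tt)) (μ-nonNeg measurable-∅)
      where
      total : IsSup _≤_ (λ s → ∃[ n ] s ≈ Σ< n (λ _ → μ ∅)) (μ (⋃ ℕ (λ _ → ∅)))
      total = μ-union (λ _ → ∅) (λ _ → measurable-∅) (λ _ _ _ _ ())
      same : μ (⋃ ℕ (λ _ → ∅)) ≈ μ ∅
      same = μ-cong (union (λ _ → ∅) (λ _ → measurable-∅)) ((λ ()) , λ ())
      doubled : μ ∅ + (μ ∅ + 0#) ≤ μ ∅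
      doubled = lin (μ ∅ ∷ μ (⋃ ℕ (λ _ → ∅)) ∷ []) (x₀ ⊕ (x₀ ⊕ 𝟘) ⊑ x₀) (▹ x₁ ≃ x₀ ∷
        ▹ x₀ ⊕ (x₀ ⊕ 𝟘) ⊑ x₁ ∷ []) (same , proj₁ total (μ ∅ + (μ ∅ + 0#)) (2 , refl) , tt)

    μ-∪ : Measurable A → Measurable B → Empty (A ∩ B) → μ (A ∪ B) ≈ μ A + μ B
    μ-∪ {A} {B} mA mB disjoint = trans (μ-cong (measurable-∪ mA mB) (∪⊆⋃pairing , ⋃pairing⊆∪ {A = A} {B = B}))
      (≤-antisym (proj₂ total (μ A + μ B) (λ x (n , e) → below n e)) (lin (μ A ∷ μ B ∷
        μ (⋃ ℕ (pairing A B)) ∷ []) (x₀ ⊕ x₁ ⊑ x₂) (▹ x₀ ⊕ (x₁ ⊕ 𝟘) ⊑ x₂ ∷ [])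
        (proj₁ total (μ A + (μ B + 0#)) (2 , refl) , tt)))
      where
      pairwise : ∀ m n → m ≢ n → Empty (pairing A B m ∩ pairing A B n)
      pairwise 0 0 m≢n = ⊥-elim (m≢n ≡.refl)
      pairwise 0 1 _ = disjoint
      pairwise 1 0 _ x (b , a) = disjoint x (a , b)
      pairwise 1 1 m≢n = ⊥-elim (m≢n ≡.refl)
      pairwise (suc (suc m)) n _ x (() , _)
      pairwise 0 (suc (suc n)) _ x (_ , ())
      pairwise 1 (suc (suc n)) _ x (_ , ())
      total : IsSup _≤_ (λ s → ∃[ n ] s ≈ Σ< n (λ i → μ (pairing A B i))) (μ (⋃ ℕ (pairing A B)))
      total = μ-union (pairing A B) (measurable-pairing mA mB) pairwise
      below : ∀ {x} n → x ≈ Σ< n (λ i → μ (pairing A B i)) → x ≤ μ A + μ B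
      below {x} 0 e = lin (x ∷ μ A ∷ μ B ∷ []) (x₀ ⊑ x₁ ⊕ x₂) (▹ x₀ ≃ 𝟘 ∷ ▹ 𝟘 ⊑ x₁ ∷ ▹ 𝟘 ⊑ x₂ ∷ [])
        (e , μ-nonNeg mA , μ-nonNeg mB , tt)
      below {x} 1 e = lin (x ∷ μ A ∷ μ B ∷ []) (x₀ ⊑ x₁ ⊕ x₂) (▹ x₀ ≃ x₁ ⊕ 𝟘 ∷ ▹ 𝟘 ⊑ x₂ ∷ []) (e ,
        μ-nonNeg mB , tt)
      below {x} (suc (suc n)) e = lin (x ∷ μ A ∷ μ B ∷ Σ< n (λ _ → μ ∅) ∷ []) (x₀ ⊑ x₁ ⊕ x₂)
        (▹ x₀ ≃ x₁ ⊕ (x₂ ⊕ x₃) ∷ ▹ x₃ ≃ 𝟘 ∷ []) (e , Σ<-zero n {λ _ → μ ∅} (λ _ → μ-∅) , tt)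

    μ-split : Measurable A → Measurable B → μ A ≈ μ (A ∩ B) + μ (A ∩ ∁ B)
    μ-split {A} {B} mA mB = trans (μ-cong mA (split , λ { (inj₁ p) → proj₁ p ; (inj₂ p) → proj₁ p }))
      (μ-∪ (measurable-∩ mA mB) (measurable-∩ mA (compl mB)) λ { x ((_ , b) , _ , ¬b) → ¬b b })
      where
      split : A ⊆ (A ∩ B) ∪ (A ∩ ∁ B)
      split {x} a with em {P = x ∈ B}
      ... | yes b = inj₁ (a , b)
      ... | no ¬b = inj₂ (a , ¬b)

    μ-empty : Measurable A → Empty A → μ A ≈ 0#
    μ-empty mA h = trans (μ-cong mA ((λ {x} a → h x a) , λ ())) μ-∅

    listCount : List (Pred Ω 0ℓ) → Ω → ℕ
    listCount []       ω = 0
    listCount (E ∷ Es) ω = bump (em {P = ω ∈ E}) (listCount Es ω)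

    -- In effect the integral over `A` of the number of events of the list that occur.
    μ-meet : Pred Ω 0ℓ → List (Pred Ω 0ℓ) → ℝ
    μ-meet A = sumOver (λ E → μ (E ∩ A))

    μ-meet-nonNeg : ∀ {Es} → Measurable A → All Measurable Es → 0# ≤ μ-meet A Es
    μ-meet-nonNeg mA []         = ≤-refl
    μ-meet-nonNeg mA (mE ∷ mEs) = 0≤x+y (μ-nonNeg (measurable-∩ mE mA)) (μ-meet-nonNeg mA mEs)

    μ-meet-split : ∀ {Es} → Measurable A → Measurable B → All Measurable Es →
                   μ-meet A Es ≈ μ-meet (A ∩ B) Es + μ-meet (A ∩ ∁ B) Es
    μ-meet-split mA mB [] = sym (+-identityˡ 0#)
    μ-meet-split {A} {B} {E ∷ Es} mA mB (mE ∷ mEs) =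
      lin (μ (E ∩ A) ∷ μ-meet A Es ∷ μ (E ∩ A ∩ B) ∷ μ-meet (A ∩ B) Es ∷ μ (E ∩ A ∩ ∁ B) ∷
        μ-meet (A ∩ ∁ B) Es ∷ μ ((E ∩ A) ∩ B) ∷ μ ((E ∩ A) ∩ ∁ B) ∷ [])
        (x₀ ⊕ x₁ ≃ x₂ ⊕ x₃ ⊕ (x₄ ⊕ x₅)) (▹ x₀ ≃ x₆ ⊕ x₇ ∷ ▹ x₆ ≃ x₂ ∷ ▹ x₇ ≃ x₄ ∷ ▹ x₁ ≃ x₃ ⊕ x₅ ∷
        []) (μ-split {E ∩ A} {B} (measurable-∩ mE mA) mB , reassociate B mB ,
        reassociate (∁ B) (compl mB) , μ-meet-split {A} {B} {Es} mA mB mEs , tt)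
      where
      reassociate : ∀ B → Measurable B → μ ((E ∩ A) ∩ B) ≈ μ (E ∩ (A ∩ B))
      reassociate B mB = μ-cong (measurable-∩ (measurable-∩ mE mA) mB)
        ((λ { ((e , a) , b) → e , a , b }) , λ { (e , a , b) → (e , a) , b })

    n·x≈ : ∀ n x → n · x ≈ (n · 1#) * x
    n·x≈ zero    x = sym (zeroˡ x)
    n·x≈ (suc n) x = lin (x ∷ n · x ∷ n · 1# ∷ []) (x₀ ⊕ x₁ ≃ (𝟙 ⊕ x₂) ⊗ x₀) (▹ x₁ ≃ x₂ ⊗ x₀ ∷ [])
      (n·x≈ n x , tt)

    -- Markov's inequality for a sum of indicator functions.
    μ-count : ∀ {Es} n → Measurable A → All Measurable Es → (∀ ω → ω ∈ A → n ℕ.≤ listCount Es ω) →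
              n · μ A ≤ μ-meet A Es
    μ-count zero mA mEs h = μ-meet-nonNeg mA mEs
    μ-count {A} {[]} (suc n) mA [] h = lin (suc n · μ A ∷ suc n · 1# ∷ μ A ∷ []) (x₀ ⊑ 𝟘)
      (▹ x₀ ≃ x₁ ⊗ x₂ ∷ ▹ x₁ ⊗ x₂ ≃ x₁ ⊗ 𝟘 ∷ []) (n·x≈ (suc n) (μ A) ,
      *-congᵗ (suc n · 1#) (μ-empty mA (λ ω a → 1+n≰0 (h ω a))) , tt)
      where
      1+n≰0 : ¬ (suc n ℕ.≤ 0)
      1+n≰0 ()
    -- Where `E` occurs, at least `n` further events do; elsewhere all `suc n` are among the rest.
    μ-count {A} {E ∷ Es} (suc n) mA (mE ∷ mEs) h =
      lin (suc n · μ A ∷ μ (E ∩ A) ∷ μ-meet A Es ∷ n · 1# ∷ μ A ∷ n · μ (A ∩ E) ∷ μ (A ∩ E) ∷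
        suc n · μ (A ∩ ∁ E) ∷ μ (A ∩ ∁ E) ∷ μ-meet (A ∩ E) Es ∷ μ-meet (A ∩ ∁ E) Es ∷ [])
        (x₀ ⊑ x₁ ⊕ x₂) (▹ x₀ ≃ (𝟙 ⊕ x₃) ⊗ x₄ ∷ ▹ x₃ ⊗ x₆ ≃ x₅ ∷ ▹ (𝟙 ⊕ x₃) ⊗ x₈ ≃ x₇ ∷
        ▹ x₄ ≃ x₆ ⊕ x₈ ∷ ▹ x₃ ⊗ x₄ ≃ x₃ ⊗ (x₆ ⊕ x₈) ∷ ▹ x₅ ⊑ x₉ ∷ ▹ x₇ ⊑ (var 10) ∷
        ▹ x₉ ⊕ (var 10) ≃ x₂ ∷ ▹ x₆ ≃ x₁ ∷ []) (n·x≈ (suc n) (μ A) , sym (n·x≈ n (μ (A ∩ E))) ,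
        sym (n·x≈ (suc n) (μ (A ∩ ∁ E))) , μ-split mA mE , *-congᵗ (n · 1#) (μ-split mA mE) ,
        μ-count {A ∩ E} {Es} n (measurable-∩ mA mE) mEs inside ,
        μ-count {A ∩ ∁ E} {Es} (suc n) (measurable-∩ mA (compl mE)) mEs outside ,
        sym (μ-meet-split {A} {E} {Es} mA mE mEs) , commuted , tt)
      where
      commuted : μ (A ∩ E) ≈ μ (E ∩ A)
      commuted = μ-cong (measurable-∩ mA mE) ((λ (a , e) → e , a) , λ (e , a) → a , e)
      bump-pred : ∀ {P : Set} (d : Dec P) {m k} → suc m ℕ.≤ bump d k → m ℕ.≤ k
      bump-pred (yes _) (ℕ.s≤s p) = p
      bump-pred (no _)  p         = ℕ.<⇒≤ p
      bump-skip : ∀ {P : Set} (d : Dec P) {m k} → ¬ P → m ℕ.≤ bump d k → m ℕ.≤ k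
      bump-skip (yes p) ¬p _ = ⊥-elim (¬p p)
      bump-skip (no _)  _  q = q
      inside : ∀ ω → ω ∈ A ∩ E → n ℕ.≤ listCount Es ω
      inside ω (a , _) = bump-pred em (h ω a)
      outside : ∀ ω → ω ∈ A ∩ ∁ E → suc n ℕ.≤ listCount Es ω
      outside ω (a , ¬e) = bump-skip em ¬e (h ω a)

    -- The sets of the simple function are removed from `B` one after another, and each is charged
    -- only for its own part of the integral.
    sum-count : ∀ {Es} m (n : Fin m → ℕ) (A : Fin m → Pred Ω 0ℓ) → (∀ i → Measurable (A i)) →
      (∀ i j → i ≢ j → Empty (A i ∩ A j)) → ∀ {B} → Measurable B → All Measurable Es → (∀ i → A i ⊆ B) →
      (∀ i ω → ω ∈ A i → n i ℕ.≤ listCount Es ω) → sum (λ i → n i · μ (A i)) ≤ μ-meet B Es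
    sum-count zero n A mA dA mB mEs A⊆B h = μ-meet-nonNeg mB mEs
    sum-count {Es} (suc m) n A mA dA {B} mB mEs A⊆B h = ≤-trans
      (+-mono-≤ (μ-count {A zero} {Es} (n zero) (mA zero) mEs (h zero))
        (sum-count {Es} m (n ∘ suc) (A ∘ suc) (mA ∘ suc) (λ i j i≢j → dA (suc i) (suc j) (i≢j ∘ Fin.suc-injective))
          (measurable-∩ mB (compl (mA zero))) mEs
          (λ i {ω} a → A⊆B (suc i) a , λ a₀ → dA zero (suc i) (λ ()) ω (a₀ , a)) (h ∘ suc)))
      (≤-reflexive (trans (+-congʳ (first mEs)) (sym (μ-meet-split {B} {A zero} {Es} mB (mA zero) mEs))))
      where
      first : ∀ {Es} → All Measurable Es → μ-meet (A zero) Es ≈ μ-meet (B ∩ A zero) Es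
      first [] = refl
      first (mE ∷ mEs) = +-cong (μ-cong (measurable-∩ mE (mA zero))
        ((λ (e , a) → e , A⊆B zero a , a) , λ (e , _ , a) → e , a)) (first mEs)

    lower-sum-bound : ∀ {Es} m (n : Fin m → ℕ) (A : Fin m → Pred Ω 0ℓ) → (∀ i → Measurable (A i)) →
      (∀ i j → i ≢ j → Empty (A i ∩ A j)) → All Measurable Es →
      (∀ i ω → ω ∈ A i → n i ℕ.≤ listCount Es ω) → sum (λ i → n i · μ (A i)) ≤ sumOver μ Es
    lower-sum-bound {Es} m n A mA dA mEs h = ≤-trans
      (sum-count {Es} m n A mA dA {U} univ mEs (λ _ _ → tt) h) (≤-reflexive (whole mEs))
      where
      whole : ∀ {Es} → All Measurable Es → μ-meet U Es ≈ sumOver μ Es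
      whole [] = refl
      whole (mE ∷ mEs) = +-cong (μ-cong (measurable-∩ mE univ) (proj₁ , λ e → e , tt)) (whole mEs)

-- The upper bound for the density on every segment.

module CutDensity (em : ∀ {ℓ} → ExcludedMiddle ℓ) (𝓡 : CompleteOrderedField) where
  open CompleteOrderedField 𝓡 hiding (zero)
  open LinearArithmetic 𝓡
  open RealNumbers em 𝓡
  open InjectionCounting em
  open CutCounts em 𝓡
  open CutAnalysis em 𝓡
  open SpanLengths em 𝓡
  open ProbabilityTheory em 𝓡
  open Simplex 𝓡
  open AddSupremum _≤_ using ([_]; _≤⊤⁺)

  UpToChoice : Component → ℝ → Pred Choice 0ℓ
  UpToChoice (ball l rays) u = BallUpTo l rays u
  UpToChoice (corner k)    u = CornerUpTo k u

  component : Choice → Component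
  component (ball l t rays) = ball l rays
  component (corner k ρ)    = corner k

  position : Choice → ℝ
  position (ball l t rays) = t
  position (corner k ρ)    = ρ

  toChoice-inverse : ∀ χ → toChoice (component χ) (position χ) ≡ χ
  toChoice-inverse (ball l t rays) = ≡.refl
  toChoice-inverse (corner k ρ)    = ≡.refl

  upTo⁺ : ∀ χ {u} → position χ ≤ u → χ ∈ UpToChoice (component χ) u
  upTo⁺ (ball l t rays) p = ≡.refl , ≡.refl , p
  upTo⁺ (corner k ρ)    p = ≡.refl , p

  upTo⁻ : ∀ χ {u} → χ ∈ UpToChoice (component χ) u → position χ ≤ u
  upTo⁻ (ball l t rays) (_ , _ , p) = p
  upTo⁻ (corner k ρ)    (_ , p)     = p

  upTo-mono : ∀ c {u v} → u ≤ v → UpToChoice c u ⊆ UpToChoice c v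
  upTo-mono (ball l rays) u≤v {ball _ _ _} (p , q , r) = p , q , ≤-trans r u≤v
  upTo-mono (corner k)    u≤v {corner _ _} (p , r)     = p , ≤-trans r u≤v

  realises⇒range : ∀ χ {C} → Realises χ C → lo (component χ) < position χ × position χ ≤ 1#
  realises⇒range (ball l t rays) (p , q , _) = p , <⇒≤ q
  realises⇒range (corner k ρ)    (p , q , _) = p , q

  lo≤1 : ∀ c → lo c ≤ 1#
  lo≤1 (ball _ _) = 0≤1
  lo≤1 (corner k) = lin [] (2 /1+ 2 ⊑ 𝟙) [] tt

  0≤w : ∀ c → 0# ≤ w c
  0≤w (ball l v) = lin [] (𝟘 ⊑ 1 /1+ 21) [] tt
  0≤w (corner k) = lin [] (𝟘 ⊑ 3 /1+ 10) [] tt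

  w≤1 : ∀ c → w c ≤ 1#
  w≤1 (ball l v) = lin [] (1 /1+ 21 ⊑ 𝟙) [] tt
  w≤1 (corner k) = lin [] (3 /1+ 10 ⊑ 𝟙) [] tt

  ratio≤ : ∀ {c L k} → 0# < L → c ≤ k * L → c * L ⁻¹ ≤ k
  ratio≤ {c} {L} {k} 0<L p = lin (c ∷ (L ⁻¹) ∷ k ∷ L ∷ []) (x₀ ⊗ x₁ ⊑ x₂)
    (▹ 𝟘 ⊑ x₁ ⊗ (x₂ ⊗ x₃ ⊝ x₀) ∷ ▹ x₂ ⊗ (x₃ ⊗ x₁) ≃ x₂ ⊗ 𝟙 ∷ [])
    (*-nonNeg (<⇒≤ (⁻¹-pos 0<L)) (x≤y⇒0≤y-x p) , *-congᵗ k (x*x⁻¹≈1 0<L) , tt)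

  ratio≥ : ∀ {c L k} → 0# < L → k * L ≤ c → k ≤ c * L ⁻¹
  ratio≥ {c} {L} {k} 0<L p = lin (k ∷ c ∷ (L ⁻¹) ∷ L ∷ []) (x₀ ⊑ x₁ ⊗ x₂)
    (▹ 𝟘 ⊑ x₂ ⊗ (x₁ ⊝ x₀ ⊗ x₃) ∷ ▹ x₀ ⊗ 𝟙 ≃ x₀ ⊗ (x₃ ⊗ x₂) ∷ [])
    (*-nonNeg (<⇒≤ (⁻¹-pos 0<L)) (x≤y⇒0≤y-x p) , sym (*-congᵗ k (x*x⁻¹≈1 0<L)) , tt)

  ≈⇒-ε< : ∀ {z b ε} → z ≈ b → 0# < ε → b - ε < z
  ≈⇒-ε< {z} {b} {ε} p q = lin (b ∷ ε ∷ z ∷ []) (x₀ ⊝ x₁ ⊏ x₂) (▹ x₀ ≃ x₂ ∷ ▹ 𝟘 ⊏ x₁ ∷ []) (sym p ,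
    q , tt)

  maximum : ∀ {m} → (Fin m → ℕ) → ℕ
  maximum {zero}  n = 0
  maximum {suc m} n = n zero ℕ.⊔ maximum (n ∘ suc)

  ≤maximum : ∀ {m} (n : Fin m → ℕ) i → n i ℕ.≤ maximum n
  ≤maximum n zero    = ℕ.m≤m⊔n _ _
  ≤maximum n (suc i) = ℕ.≤-trans (≤maximum (n ∘ suc) i) (ℕ.m≤n⊔m (n zero) _)

  module _ (P : CuttingScheme 3) (isBallCorner : IsBallCornerScheme P) where
    open CuttingScheme P
    open IsBallCornerScheme isBallCorner
    open FiniteAdditivity space

    UpTo : Component → ℝ → Pred Ω 0ℓ
    UpTo c u = choice ⊢ UpToChoice c u

    measurable-UpTo : ∀ c u → Measurable (UpTo c u)
    measurable-UpTo (ball l rays) u = ball-measurable l rays u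
    measurable-UpTo (corner k)    u = corner-measurable k u

    μ-UpTo : ∀ c {u} → lo c ≤ u → u ≤ 1# → μ (UpTo c u) ≈ w c * (u - lo c)
    μ-UpTo (ball l rays) {u} p q = trans (ball-law l rays u p q) goal
      where
      goal : (8 ÷ 11) * (1 ÷ 2) * (1 ÷ 8) * u ≈ 1 ÷ 22 * (u - 0#)
      goal = lin (u ∷ []) (8 /1+ 10 ⊗ 1 /1+ 1 ⊗ 1 /1+ 7 ⊗ x₀ ≃ 1 /1+ 21 ⊗ (x₀ ⊝ 𝟘)) [] tt
    μ-UpTo (corner k) {u} p q = trans (corner-law k u p q) goal
      where
      third : ℝ
      third = (1 ÷ 3) ⁻¹
      0<1/3 : 0# < 1 ÷ 3
      0<1/3 = lin [] (𝟘 ⊏ 1 /1+ 2) [] tt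
      third≈ : (1 ÷ 3) * third ≈ 1#
      third≈ = x*x⁻¹≈1 0<1/3
      goal : (3 ÷ 11) * (1 ÷ 3) * ((u - 2 ÷ 3) * third) ≈ 3 ÷ 11 * (u - 2 ÷ 3)
      goal = lin (u ∷ third ∷ [])
        (3 /1+ 10 ⊗ 1 /1+ 2 ⊗ ((x₀ ⊝ 2 /1+ 2) ⊗ x₁) ≃ 3 /1+ 10 ⊗ (x₀ ⊝ 2 /1+ 2))
        (3 /1+ 10 ▸ (x₀ ⊝ 2 /1+ 2) ⊗ (1 /1+ 2 ⊗ x₁) ≃ (x₀ ⊝ 2 /1+ 2) ⊗ 𝟙 ∷ [])
        (*-congᵗ (u - 2 ÷ 3) third≈ , tt)

    Slice : Component → ℝ → ℝ → Pred Ω 0ℓ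
    Slice c u v = UpTo c v ∩ ∁ (UpTo c u)

    measurable-Slice : ∀ c u v → Measurable (Slice c u v)
    measurable-Slice c u v = measurable-∩ (measurable-UpTo c v) (compl (measurable-UpTo c u))

    μ-Slice : ∀ c {u v} → lo c ≤ u → u ≤ v → v ≤ 1# → μ (Slice c u v) ≈ w c * (v - u)
    μ-Slice c {u} {v} p q r = lin (μ (UpTo c v ∩ ∁ (UpTo c u)) ∷ w c ∷ v ∷ u ∷ μ (UpTo c v) ∷
      μ (UpTo c v ∩ UpTo c u) ∷ μ (UpTo c u) ∷ lo c ∷ []) (x₀ ≃ x₁ ⊗ (x₂ ⊝ x₃)) (▹ x₅ ⊕ x₀ ≃ x₄ ∷
      ▹ x₆ ≃ x₅ ∷ ▹ x₄ ≃ x₁ ⊗ (x₂ ⊝ x₇) ∷ ▹ x₁ ⊗ (x₃ ⊝ x₇) ≃ x₆ ∷ [])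
      (sym (μ-split {UpTo c v} {UpTo c u} (measurable-UpTo c v) (measurable-UpTo c u)) ,
      sym nested , μ-UpTo c (≤-trans p q) r , sym (μ-UpTo c p (≤-trans q r)) , tt)
      where
      nested : μ (UpTo c v ∩ UpTo c u) ≈ μ (UpTo c u)
      nested = μ-cong (measurable-∩ (measurable-UpTo c v) (measurable-UpTo c u))
        (proj₂ , λ {ω} x → upTo-mono c q {choice ω} x , x)

    clampTo : Component → ℝ → ℝ
    clampTo c = clamp (lo c) 1#

    -- The part of component c whose parameter is between X and Y.
    SpanEvent : Component → ℝ → ℝ → Pred Ω 0ℓ
    SpanEvent c X Y = Slice c (min (clampTo c X) (clampTo c Y)) (max (clampTo c X) (clampTo c Y))

    μ-SpanEvent : ∀ c X Y → μ (SpanEvent c X Y) ≈ w c * within (lo c) X Y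
    μ-SpanEvent c X Y = trans
      (μ-Slice c (min-glb (a≤clamp (lo c) 1# X) (a≤clamp (lo c) 1# Y)) (≤-trans (min≤x x y) (x≤max x y))
        (max-lub (clamp≤b X (lo≤1 c)) (clamp≤b Y (lo≤1 c))))
      (*-congˡ (by-order (≤-<-connex x y)))
      where
      x y : ℝ
      x = clampTo c X
      y = clampTo c Y
      by-order : x ≤ y ⊎ y < x → max x y - min x y ≈ ∣ x - y ∣
      by-order (inj₁ p) = trans (+-cong (≤-antisym (max-lub p ≤-refl) (y≤max x y))
        (-‿cong (≤-antisym (min≤x x y) (min-glb ≤-refl p)))) (sym (∣x-y∣≈y-x p))
      by-order (inj₂ p) = trans (+-cong (≤-antisym (max-lub ≤-refl (<⇒≤ p)) (x≤max x y))
        (-‿cong (≤-antisym (min≤y x y) (min-glb (<⇒≤ p) ≤-refl)))) (sym (∣x-y∣≈x-y (<⇒≤ p)))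

    clamp-≥ : ∀ c {x z} → lo c < z → z ≤ 1# → z ≤ x → z ≤ clampTo c x
    clamp-≥ c {x} p q r = ≤-trans (≤-reflexive (sym (clamp-inside (<⇒≤ p) q)))
      (clamp-mono (lo c) 1# r)

    range : ∀ ω → lo (component (choice ω)) < position (choice ω) × position (choice ω) ≤ 1#
    range ω = realises⇒range (choice ω) (realises ω)

    between⇒SpanEvent : ∀ ω X Y → Between X Y (position (choice ω)) → ω ∈ SpanEvent (component (choice ω)) X Y
    between⇒SpanEvent ω X Y (inj₁ (p , q)) =
      upTo⁺ (choice ω) (≤-trans (clamp-≥ (component (choice ω)) (proj₁ (range ω)) (proj₂ (range ω)) (<⇒≤ q)) (y≤max _ _)) ,
      λ x → <-irrefl (≤-<-trans (≤-trans (upTo⁻ (choice ω) x) (min≤x _ _)) (clamp-< 1# (proj₁ (range ω)) p))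
    between⇒SpanEvent ω X Y (inj₂ (p , q)) =
      upTo⁺ (choice ω) (≤-trans (clamp-≥ (component (choice ω)) (proj₁ (range ω)) (proj₂ (range ω)) (<⇒≤ q)) (x≤max _ _)) ,
      λ x → <-irrefl (≤-<-trans (≤-trans (upTo⁻ (choice ω) x) (min≤y _ _)) (clamp-< 1# (proj₁ (range ω)) p))

    -- The law of a scheme speaks of initial intervals only. A single parameter `b` is enclosed in
    -- the half-open interval from `b - ε` to `b`, whose probability is at most ε as the densities
    -- do not exceed 1.
    PointEvent : ℝ → Component → ℝ → Pred Ω 0ℓ
    PointEvent ε c b = Slice c (clampTo c (b - ε)) (clampTo c b)

    μ-PointEvent : ∀ {ε} → 0# < ε → ∀ c b → μ (PointEvent ε c b) ≤ ε
    μ-PointEvent {ε} 0<ε c b = lin (μ (Slice c (clamp (lo c) 1# (b - ε)) (clamp (lo c) 1# b)) ∷ ε ∷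
      w c ∷ clamp (lo c) 1# b ∷ clamp (lo c) 1# (b - ε) ∷ b ∷ []) (x₀ ⊑ x₁) (▹ x₀ ≃ x₂ ⊗ (x₃ ⊝ x₄) ∷
      ▹ x₂ ⊗ (x₃ ⊝ x₄) ⊑ x₂ ⊗ (x₅ ⊝ (x₅ ⊝ x₁)) ∷ ▹ 𝟘 ⊑ (𝟙 ⊝ x₂) ⊗ x₁ ∷ [])
      (μ-Slice c (a≤clamp (lo c) 1# (b - ε)) (clamp-mono (lo c) 1# b-ε≤b) (clamp≤b b (lo≤1 c)) ,
      *-monoˡ-nonNeg (0≤w c) (clamp-Lipschitz {lo c} {1#} b-ε≤b) ,
      *-nonNeg (x≤y⇒0≤y-x (w≤1 c)) (<⇒≤ 0<ε) , tt)
      where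
      b-ε≤b : b - ε ≤ b
      b-ε≤b = lin (b ∷ ε ∷ []) (x₀ ⊝ x₁ ⊑ x₀) (▹ 𝟘 ⊏ x₁ ∷ []) (0<ε , tt)

    point⇒PointEvent : ∀ {ε} → 0# < ε → ∀ ω {b} → position (choice ω) ≈ b → ω ∈ PointEvent ε (component (choice ω)) b
    point⇒PointEvent {ε} 0<ε ω {b} z≈b =
      upTo⁺ (choice ω) (clamp-≥ (component (choice ω)) (proj₁ (range ω)) (proj₂ (range ω)) (≤-reflexive z≈b)) ,
      λ x → <-irrefl (≤-<-trans (upTo⁻ (choice ω) x) (clamp-< 1# (proj₁ (range ω)) (≈⇒-ε< z≈b 0<ε)))

    module _ (e : Segment 3) where
      open Segment e using (length)

      module _ (N : ℕ) (ε : ℝ) (0<ε : 0# < ε) where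

        pointEvents : Component → List ℝ → List (Pred Ω 0ℓ)
        pointEvents c []       = []
        pointEvents c (b ∷ bs) = replicate N (PointEvent ε c b) ++ pointEvents c bs

        -- The exceptional parameters are made to count N times.
        events : Component → List (Pred Ω 0ℓ)
        events c = tabulate (λ j → SpanEvent c (X j) (Y j)) ++ pointEvents c bad
          where open SpanAnalysis (analysis c e)

        measurable-pointEvents : ∀ c bs → All Measurable (pointEvents c bs)
        measurable-pointEvents c []       = []
        measurable-pointEvents c (b ∷ bs) =
          All.++⁺ (All.replicate⁺ N (measurable-Slice c _ _)) (measurable-pointEvents c bs)

        measurable-events : ∀ c → All Measurable (events c)
        measurable-events c = All.++⁺ (All.tabulate⁺ (λ j → measurable-Slice c _ _)) (measurable-pointEvents c bad)
          where open SpanAnalysis (analysis c e)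

        listCount-++ˡ : ∀ Es Fs ω → listCount Es ω ℕ.≤ listCount (Es ++ Fs) ω
        listCount-++ˡ []       Fs ω = ℕ.z≤n
        listCount-++ˡ (E ∷ Es) Fs ω = bump-mono em (listCount-++ˡ Es Fs ω)
          where
          bump-mono : ∀ {Q : Set} (d : Dec Q) {m n} → m ℕ.≤ n → bump d m ℕ.≤ bump d n
          bump-mono (yes _) p = ℕ.s≤s p
          bump-mono (no _)  p = p

        listCount-++ʳ : ∀ Es Fs ω → listCount Fs ω ℕ.≤ listCount (Es ++ Fs) ω
        listCount-++ʳ []       Fs ω = ℕ.≤-refl
        listCount-++ʳ (E ∷ Es) Fs ω = ℕ.≤-trans (listCount-++ʳ Es Fs ω) (n≤bump em)
          where
          n≤bump : ∀ {Q : Set} (d : Dec Q) {n} → n ℕ.≤ bump d n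
          n≤bump (yes _) = ℕ.n≤1+n _
          n≤bump (no _)  = ℕ.≤-refl

        listCount-replicate : ∀ n {E : Pred Ω 0ℓ} {ω} → ω ∈ E → n ℕ.≤ listCount (replicate n E) ω
        listCount-replicate zero    x = ℕ.z≤n
        listCount-replicate (suc n) {E} {ω} x = bump-yes em (listCount-replicate n x)
          where
          bump-yes : (d : Dec (ω ∈ E)) → ∀ {m k} → m ℕ.≤ k → suc m ℕ.≤ bump d k
          bump-yes (yes _) p = ℕ.s≤s p
          bump-yes (no ¬p) _ = ⊥-elim (¬p x)

        count≤listCount : ∀ {n ω} (Q : Fin n → Set) (E : Fin n → Pred Ω 0ℓ) → (∀ j → Q j → ω ∈ E j) →
                          count Q ℕ.≤ listCount (tabulate E) ω
        count≤listCount {zero}  Q E h = ℕ.z≤n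
        count≤listCount {suc n} Q E h = bump-imp em em (h zero) (count≤listCount (Q ∘ suc) (E ∘ suc) (h ∘ suc))

        bad≤listCount : ∀ ω bs → Any (position (choice ω) ≈_) bs →
                        N ℕ.≤ listCount (pointEvents (component (choice ω)) bs) ω
        bad≤listCount ω (b ∷ bs) (here p)  = ℕ.≤-trans (listCount-replicate N (point⇒PointEvent 0<ε ω p))
          (listCount-++ˡ (replicate N _) _ ω)
        bad≤listCount ω (b ∷ bs) (there p) = ℕ.≤-trans (bad≤listCount ω bs p)
          (listCount-++ʳ (replicate N _) _ ω)

        -- At an ordinary parameter the spans around it account for all cuts. At an exceptional one
        -- the number of cuts is not known, but `n ≤ N` is covered by the repetitions of its
        -- `PointEvent`.
        cuts≤events : ∀ ω n → n ℕ.≤ N → CutsAtLeast (cut ω) e n → n ℕ.≤ listCount (events (component (choice ω))) ω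
        cuts≤events ω n n≤N cuts-n = by-position em
          where
          open SpanAnalysis (analysis (component (choice ω)) e)
          spanEvents : List (Pred Ω 0ℓ)
          spanEvents = tabulate (λ j → SpanEvent (component (choice ω)) (X j) (Y j))
          by-position : Dec (Any (position (choice ω) ≈_) bad) → n ℕ.≤ listCount (events (component (choice ω))) ω
          by-position (yes p) = ℕ.≤-trans n≤N (ℕ.≤-trans (bad≤listCount ω bad p) (listCount-++ʳ spanEvents _ ω))
          by-position (no p)  = ℕ.≤-trans
            (Equivalence.to (cuts (position (choice ω)) (cut ω)
              (≡.subst (λ χ → Realises χ (cut ω)) (≡.sym (toChoice-inverse (choice ω))) (realises ω)) p n) cuts-n)
            (ℕ.≤-trans (count≤listCount _ (λ j → SpanEvent (component (choice ω)) (X j) (Y j))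
                (λ j → between⇒SpanEvent ω (X j) (Y j)))
              (listCount-++ˡ spanEvents _ ω))

        sum-replicate : ∀ n {E : Pred Ω 0ℓ} → μ E ≤ ε → sumOver μ (replicate n E) ≤ (n · 1#) * ε
        sum-replicate zero    p = ≤-reflexive (sym (zeroˡ ε))
        sum-replicate (suc n) {E} p = lin (μ E ∷ sumOver μ (replicate n E) ∷ n · 1# ∷ ε ∷ [])
          (x₀ ⊕ x₁ ⊑ (𝟙 ⊕ x₂) ⊗ x₃) (▹ x₁ ⊑ x₂ ⊗ x₃ ∷ ▹ x₀ ⊑ x₃ ∷ []) (sum-replicate n p , p , tt)

        sum-pointEvents : ∀ c bs → sumOver μ (pointEvents c bs) ≤ sumOver (λ _ → N · 1#) bs * ε
        sum-pointEvents c []       = ≤-reflexive (sym (zeroˡ ε))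
        sum-pointEvents c (b ∷ bs) = lin
          (sumOver μ (replicate N (PointEvent ε c b) ++ pointEvents c bs) ∷ N · 1# ∷
          sumOver (λ _ → N · 1#) bs ∷ ε ∷ sumOver μ (replicate N (PointEvent ε c b)) ∷
          sumOver μ (pointEvents c bs) ∷ []) (x₀ ⊑ (x₁ ⊕ x₂) ⊗ x₃) (▹ x₀ ≃ x₄ ⊕ x₅ ∷
          ▹ x₄ ⊑ x₁ ⊗ x₃ ∷ ▹ x₅ ⊑ x₂ ⊗ x₃ ∷ [])
          (sumOver-++ μ (replicate N (PointEvent ε c b)) (pointEvents c bs) ,
          sum-replicate N {PointEvent ε c b} (μ-PointEvent 0<ε c b) , sum-pointEvents c bs , tt)

        sum-tabulate : ∀ {n} c (E : Fin n → Pred Ω 0ℓ) (h : Fin n → ℝ) → (∀ j → μ (E j) ≈ w c * h j) →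
                       sumOver μ (tabulate E) ≈ w c * sum h
        sum-tabulate {zero}  c E h p = sym (zeroʳ (w c))
        sum-tabulate {suc n} c E h p = trans (+-cong (p zero) (sum-tabulate c (E ∘ suc) (h ∘ suc) (p ∘ suc)))
          (sym (distribˡ (w c) _ _))

        excess : Component → ℝ
        excess c = sumOver (λ _ → N · 1#) bad
          where open SpanAnalysis (analysis c e)

        sum-events : ∀ c → sumOver μ (events c) ≤ weighted e c + excess c * ε
        sum-events c = ≤-trans
          (≤-reflexive (sumOver-++ μ (tabulate (λ j → SpanEvent c (X j) (Y j))) (pointEvents c bad)))
          (+-mono-≤ (≤-reflexive (sum-tabulate c (λ j → SpanEvent c (X j) (Y j))
            (λ j → within (lo c) (X j) (Y j)) (λ j → μ-SpanEvent c (X j) (Y j)))) (sum-pointEvents c bad))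
          where open SpanAnalysis (analysis c e)

        all-events : List Component → List (Pred Ω 0ℓ)
        all-events = concatMap events

        measurable-all-events : ∀ cs → All Measurable (all-events cs)
        measurable-all-events []       = []
        measurable-all-events (c ∷ cs) = All.++⁺ (measurable-events c) (measurable-all-events cs)

        events≤all-events : ∀ {c cs} → c List.∈ cs → ∀ ω → listCount (events c) ω ℕ.≤ listCount (all-events cs) ω
        events≤all-events {c} {_ ∷ cs} (here ≡.refl) ω = listCount-++ˡ (events c) (all-events cs) ω
        events≤all-events {c} {d ∷ cs} (there i)     ω = ℕ.≤-trans (events≤all-events i ω)
          (listCount-++ʳ (events d) (all-events cs) ω)

        sum-all-events : ∀ cs → sumOver μ (all-events cs) ≤ sumOver (weighted e) cs + sumOver excess cs * ε
        sum-all-events []       = lin (ε ∷ []) (𝟘 ⊑ 𝟘 ⊕ 𝟘 ⊗ x₀) [] tt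
        sum-all-events (c ∷ cs) = lin (sumOver μ (events c ++ all-events cs) ∷ weighted e c ∷
          sumOver (weighted e) cs ∷ excess c ∷ sumOver excess cs ∷ ε ∷ sumOver μ (events c) ∷
          sumOver μ (all-events cs) ∷ []) (x₀ ⊑ x₁ ⊕ x₂ ⊕ (x₃ ⊕ x₄) ⊗ x₅) (▹ x₀ ≃ x₆ ⊕ x₇ ∷
          ▹ x₆ ⊑ x₁ ⊕ x₃ ⊗ x₅ ∷ ▹ x₇ ⊑ x₂ ⊕ x₄ ⊗ x₅ ∷ []) (sumOver-++ μ (events c) (all-events cs) ,
          sum-events c , sum-all-events cs , tt)

      sumOver-nonNeg : ∀ {a} {A : Set a} (f : A → ℝ) → (∀ x → 0# ≤ f x) → ∀ xs → 0# ≤ sumOver f xs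
      sumOver-nonNeg f h []       = ≤-refl
      sumOver-nonNeg f h (x ∷ xs) = 0≤x+y (h x) (sumOver-nonNeg f h xs)

      lower-sum≤ : ∀ v → v ∈ IsLowerSum P e → v ≤⁺ [ 12 ÷ 11 * length ]
      lower-sum≤ v (m , n , A , mA , dA , A⊆ , ≡.refl) = [ ≤-by-ε K 0≤K bound ]
        where
        N : ℕ
        N = maximum n
        K : ℝ
        -- `K` has to be fixed before ε varies. The value of `excess` is the same for every ε, so
        -- `1#` may stand for all of them.
        K = sumOver (excess N 1# (0≤1 , 0≉1)) components
        0≤K : 0# ≤ K
        0≤K = sumOver-nonNeg _ (λ c → sumOver-nonNeg _ (λ _ → 0≤n N) (SpanAnalysis.bad (analysis c e))) components
        bound : ∀ ε → 0# < ε → sum (λ i → n i · μ (A i)) ≤ 12 ÷ 11 * length + K * ε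
        bound ε 0<ε = ≤-trans (lower-sum-bound m n A mA dA (measurable-all-events N ε 0<ε components)
            (λ i ω a → ℕ.≤-trans (cuts≤events N ε 0<ε ω (n i) (≤maximum n i) (A⊆ i a))
              (events≤all-events N ε 0<ε {component (choice ω)} (∈-components _) ω)))
          (≤-trans (sum-all-events N ε 0<ε components) (+-mono-≤ (weighted-total e) ≤-refl))

      density≤ : ∀ d → d ∈ IsDensity P e → d ≤⁺ [ 12 ÷ 11 ]
      density≤ _ (finite {c} (_ , least)) with least _ lower-sum≤
      ... | [ c≤ ] = [ ratio≤ (Segment.0<length e) c≤ ]
      density≤ _ (infinite (_ , least)) with least _ lower-sum≤
      ... | ()

-- Construction of ball and corner cuts from thresholds.

module ThresholdCuts (em : ∀ {ℓ} → ExcludedMiddle ℓ) (𝓡 : CompleteOrderedField) where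
  open CompleteOrderedField 𝓡 hiding (zero)
  open LinearArithmetic 𝓡
  open RealNumbers em 𝓡
  open SimplexGeometry em 𝓡
  open CutCrossings em 𝓡
  open Simplex 𝓡

  decided : {P : Set} → Dec P → Bool
  decided (yes _) = true
  decided (no _)  = false

  above : ℝ → ℝ → Bool
  above θ x = decided (em {P = θ < x})

  above-true : ∀ {θ x} → θ < x → above θ x ≡ true
  above-true {θ} {x} p = lemma em
    where
    lemma : (d : Dec (θ < x)) → decided d ≡ true
    lemma (yes _) = ≡.refl
    lemma (no n)  = ⊥-elim (n p)

  above-false : ∀ {θ x} → x ≤ θ → above θ x ≡ false
  above-false {θ} {x} p = lemma em
    where
    lemma : (d : Dec (θ < x)) → decided d ≡ false
    lemma (no _)  = ≡.refl
    lemma (yes q) = ⊥-elim (<-irrefl (<-≤-trans q p))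

  Pattern : Set
  Pattern = Bool × Bool × Bool

  coordinate : Pattern → Fin 3 → Bool
  coordinate (a , b , c) 0F = a
  coordinate (a , b , c) 1F = b
  coordinate (a , b , c) 2F = c

  patterns : List Pattern
  patterns = (false , false , false) ∷ (false , false , true) ∷ (false , true , false) ∷ (false , true , true) ∷
             (true , false , false) ∷ (true , false , true) ∷ (true , true , false) ∷ (true , true , true) ∷ []

  ∈-patterns : ∀ p → p List.∈ patterns
  ∈-patterns (false , false , false) = here ≡.refl
  ∈-patterns (false , false , true)  = there (here ≡.refl)
  ∈-patterns (false , true  , false) = there (there (here ≡.refl))
  ∈-patterns (false , true  , true)  = there (there (there (here ≡.refl)))
  ∈-patterns (true  , false , false) = there (there (there (there (here ≡.refl))))
  ∈-patterns (true  , false , true)  = there (there (there (there (there (here ≡.refl)))))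
  ∈-patterns (true  , true  , false) = there (there (there (there (there (there (here ≡.refl))))))
  ∈-patterns (true  , true  , true)  = there (there (there (there (there (there (there (here ≡.refl)))))))

  -- The cut by the lines x i = θ i: a point exceeding its threshold in the coordinate i
  -- only is in block i, one exceeding it in both coordinates other than j is in block
  -- m j, and the remaining points are in block d.
  module ThresholdCut (θ : Point 3) (m : Fin 3 → Fin 3) (d : Fin 3)
    (0≤θ : ∀ i → 0# ≤ θ i) (θ<1 : ∀ i → θ i < 1#) where

    winner : Pattern → Fin 3
    winner (true  , false , false) = 0F
    winner (false , true  , false) = 1F
    winner (false , false , true)  = 2F
    winner (false , true  , true)  = m 0F
    winner (true  , false , true)  = m 1F
    winner (true  , true  , false) = m 2F
    winner _                       = d

    abstract
      pattern-of : Point 3 → Pattern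
      pattern-of x = above (θ 0F) (x 0F) , above (θ 1F) (x 1F) , above (θ 2F) (x 2F)

      pattern-coordinate : ∀ x i → coordinate (pattern-of x) i ≡ above (θ i) (x i)
      pattern-coordinate x 0F = ≡.refl
      pattern-coordinate x 1F = ≡.refl
      pattern-coordinate x 2F = ≡.refl

    pattern-≡ : ∀ p q → (∀ i → coordinate p i ≡ coordinate q i) → p ≡ q
    pattern-≡ (_ , _ , _) (_ , _ , _) h = ≡.cong₂ _,_ (h 0F) (≡.cong₂ _,_ (h 1F) (h 2F))

    winner-single : ∀ {i j k} p → Triple i j k → coordinate p i ≡ true → coordinate p j ≡ false →
                    coordinate p k ≡ false → winner p ≡ i
    winner-single (_ , _ , _) 012F ≡.refl ≡.refl ≡.refl = ≡.refl
    winner-single (_ , _ , _) 021F ≡.refl ≡.refl ≡.refl = ≡.refl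
    winner-single (_ , _ , _) 102F ≡.refl ≡.refl ≡.refl = ≡.refl
    winner-single (_ , _ , _) 120F ≡.refl ≡.refl ≡.refl = ≡.refl
    winner-single (_ , _ , _) 201F ≡.refl ≡.refl ≡.refl = ≡.refl
    winner-single (_ , _ , _) 210F ≡.refl ≡.refl ≡.refl = ≡.refl

    winner-double : ∀ {i j k} p → Triple i j k → coordinate p i ≡ true → coordinate p j ≡ true →
                    coordinate p k ≡ false → winner p ≡ m k
    winner-double (_ , _ , _) 012F ≡.refl ≡.refl ≡.refl = ≡.refl
    winner-double (_ , _ , _) 021F ≡.refl ≡.refl ≡.refl = ≡.refl
    winner-double (_ , _ , _) 102F ≡.refl ≡.refl ≡.refl = ≡.refl
    winner-double (_ , _ , _) 120F ≡.refl ≡.refl ≡.refl = ≡.refl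
    winner-double (_ , _ , _) 201F ≡.refl ≡.refl ≡.refl = ≡.refl
    winner-double (_ , _ , _) 210F ≡.refl ≡.refl ≡.refl = ≡.refl

    winner-none : ∀ {i j k} p → Triple i j k → coordinate p i ≡ false → coordinate p j ≡ false →
                  coordinate p k ≡ false → winner p ≡ d
    winner-none (_ , _ , _) 012F ≡.refl ≡.refl ≡.refl = ≡.refl
    winner-none (_ , _ , _) 021F ≡.refl ≡.refl ≡.refl = ≡.refl
    winner-none (_ , _ , _) 102F ≡.refl ≡.refl ≡.refl = ≡.refl
    winner-none (_ , _ , _) 120F ≡.refl ≡.refl ≡.refl = ≡.refl
    winner-none (_ , _ , _) 201F ≡.refl ≡.refl ≡.refl = ≡.refl
    winner-none (_ , _ , _) 210F ≡.refl ≡.refl ≡.refl = ≡.refl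

    winner-low : ∀ {j k l} p → Triple j k l → coordinate p j ≡ false → coordinate p k ≡ true → m j ≡ k →
                 winner p ≡ k
    winner-low {l = l} p t pj pk mj≡k = by-last (coordinate p l) ≡.refl
      where
      by-last : ∀ b → coordinate p l ≡ b → winner p ≡ _
      by-last true  pl = ≡.trans (winner-double p (rotate t) pk pl pj) mj≡k
      by-last false pl = winner-single p (swap t) pk pj pl

    block : Fin 3 → Pred (Point 3) 0ℓ
    block i x = winner (pattern-of x) ≡ i

    -- Thresholds count as exceeded only when exceeded strictly, so one side of each line is open
    -- and the other closed. Each pattern is then an intersection of three half-spaces, and a block
    -- is a union of patterns.
    half-space : Fin 3 → Bool → HalfSpace 3
    half-space i true  = open′ (λ l → - unit i l) (- θ i)
    half-space i false = closed (unit i) (θ i)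

    unit-sum : ∀ i (x : Point 3) → sum (λ l → unit i l * x l) ≈ x i
    unit-sum 0F x = goal
      where
      goal : 1# * x 0F + (0# * x 1F + (0# * x 2F + 0#)) ≈ x 0F
      goal = lin (x 0F ∷ x 1F ∷ x 2F ∷ []) (𝟙 ⊗ x₀ ⊕ (𝟘 ⊗ x₁ ⊕ (𝟘 ⊗ x₂ ⊕ 𝟘)) ≃ x₀) [] tt
    unit-sum 1F x = goal
      where
      goal : 0# * x 0F + (1# * x 1F + (0# * x 2F + 0#)) ≈ x 1F
      goal = lin (x 0F ∷ x 1F ∷ x 2F ∷ []) (𝟘 ⊗ x₀ ⊕ (𝟙 ⊗ x₁ ⊕ (𝟘 ⊗ x₂ ⊕ 𝟘)) ≃ x₁) [] tt
    unit-sum 2F x = goal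
      where
      goal : 0# * x 0F + (0# * x 1F + (1# * x 2F + 0#)) ≈ x 2F
      goal = lin (x 0F ∷ x 1F ∷ x 2F ∷ []) (𝟘 ⊗ x₀ ⊕ (𝟘 ⊗ x₁ ⊕ (𝟙 ⊗ x₂ ⊕ 𝟘)) ≃ x₂) [] tt

    -unit-sum : ∀ i (x : Point 3) → sum (λ l → - unit i l * x l) ≈ - x i
    -unit-sum i x = trans goal (-‿cong (unit-sum i x))
      where
      goal : - unit i 0F * x 0F + (- unit i 1F * x 1F + (- unit i 2F * x 2F + 0#)) ≈
             - (unit i 0F * x 0F + (unit i 1F * x 1F + (unit i 2F * x 2F + 0#)))
      goal = lin (unit i 0F ∷ x 0F ∷ unit i 1F ∷ x 1F ∷ unit i 2F ∷ x 2F ∷ []) (⊖ x₀ ⊗ x₁ ⊕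
        (⊖ x₂ ⊗ x₃ ⊕ (⊖ x₄ ⊗ x₅ ⊕ 𝟘)) ≃ ⊖ (x₀ ⊗ x₁ ⊕ (x₂ ⊗ x₃ ⊕ (x₄ ⊗ x₅ ⊕ 𝟘)))) [] tt

    ∈half-space⁺ : ∀ i x → x ∈ʰ half-space i (coordinate (pattern-of x) i)
    ∈half-space⁺ i x = ≡.subst (λ b → x ∈ʰ half-space i b) (≡.sym (pattern-coordinate x i)) (by-side em)
      where
      by-side : (q : Dec (θ i < x i)) → x ∈ʰ half-space i (decided q)
      by-side (yes p) = exceeds
        where
        exceeds : sum (λ l → - unit i l * x l) < - θ i
        exceeds = lin (sum (λ u → - unit i u * x u) ∷ θ i ∷ x i ∷ []) (x₀ ⊏ ⊖ x₁) (▹ x₀ ≃ ⊖ x₂ ∷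
          ▹ x₁ ⊏ x₂ ∷ []) (-unit-sum i x , p , tt)
      by-side (no n) = bounded
        where
        bounded : sum (λ l → unit i l * x l) ≤ θ i
        bounded = lin (sum (λ u → unit i u * x u) ∷ θ i ∷ x i ∷ []) (x₀ ⊑ x₁) (▹ x₀ ≃ x₂ ∷
          ▹ x₂ ⊑ x₁ ∷ []) (unit-sum i x , ≮⇒≥ n , tt)

    ∈half-space⁻ : ∀ i x b → x ∈ʰ half-space i b → coordinate (pattern-of x) i ≡ b
    ∈half-space⁻ i x true p = ≡.trans (pattern-coordinate x i) (above-true θ<x)
      where
      p′ : sum (λ l → - unit i l * x l) < - θ i
      p′ = p
      θ<x : θ i < x i
      θ<x = lin (θ i ∷ x i ∷ sum (λ u → - unit i u * x u) ∷ []) (x₀ ⊏ x₁) (▹ ⊖ x₁ ≃ x₂ ∷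
        ▹ x₂ ⊏ ⊖ x₀ ∷ []) (sym (-unit-sum i x) , p′ , tt)
    ∈half-space⁻ i x false p = ≡.trans (pattern-coordinate x i) (above-false x≤θ)
      where
      p′ : sum (λ l → unit i l * x l) ≤ θ i
      p′ = p
      x≤θ : x i ≤ θ i
      x≤θ = lin (x i ∷ θ i ∷ sum (λ u → unit i u * x u) ∷ []) (x₀ ⊑ x₁) (▹ x₀ ≃ x₂ ∷ ▹ x₂ ⊑ x₁ ∷ [])
        (sym (unit-sum i x) , p′ , tt)

    half-spaces : Pattern → List (HalfSpace 3)
    half-spaces p = half-space 0F (coordinate p 0F) ∷ half-space 1F (coordinate p 1F) ∷
                    half-space 2F (coordinate p 2F) ∷ []

    cut : Cut 3
    cut = record
      { block      = block
      ; covers     = λ x _ → winner (pattern-of x) , ≡.refl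
      ; disjoint   = λ x i j _ p q → ≡.trans (≡.sym p) q
      ; polyhedral = polyhedral
      ; vertex     = vertex
      }
      where
      vertex : ∀ i x → x ∈ IsVertex i → x ∈ block i
      vertex i x (x∈Δ , xi≈1) = winner-single (pattern-of x) (triple i 0F)
        (≡.trans (pattern-coordinate x i) (above-true θi<xi)) (low 0F (triple i 0F)) (low 1F (rotate (swap (triple i 0F))))
        where
        θi<xi : θ i < x i
        θi<xi = lin (θ i ∷ x i ∷ []) (x₀ ⊏ x₁) (▹ 𝟙 ≃ x₁ ∷ ▹ x₀ ⊏ 𝟙 ∷ []) (sym xi≈1 , θ<1 i , tt)
        low : ∀ {l} b → Triple i (punchIn i b) l → coordinate (pattern-of x) (punchIn i b) ≡ false
        low {l} b t = ≡.trans (pattern-coordinate x (punchIn i b)) (above-false (lin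
          (x (punchIn i b) ∷ θ (punchIn i b) ∷ x i ∷ x l ∷ []) (x₀ ⊑ x₁) (▹ 𝟙 ≃ x₂ ∷
          ▹ x₂ ⊕ x₀ ⊕ x₃ ≃ 𝟙 ∷ ▹ 𝟘 ⊑ x₃ ∷ ▹ 𝟘 ⊑ x₁ ∷ []) (sym xi≈1 , triple-sum t x∈Δ ,
          proj₁ x∈Δ l , 0≤θ (punchIn i b) , tt)))
      polyhedral : ∀ i → Polyhedral (block i)
      polyhedral i = map half-spaces (filter (λ p → winner p Fin.≟ i) patterns) , λ x _ → mk⇔ (to x) (from x)
        where
        to : ∀ x → x ∈ block i → Any (All (x ∈ʰ_)) (map half-spaces (filter (λ p → winner p Fin.≟ i) patterns))
        to x w = List.lose (∈-map⁺ half-spaces (∈-filter⁺ (λ p → winner p Fin.≟ i) (∈-patterns (pattern-of x)) w))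
          (∈half-space⁺ 0F x ∷ ∈half-space⁺ 1F x ∷ ∈half-space⁺ 2F x ∷ [])
        from : ∀ x → Any (All (x ∈ʰ_)) (map half-spaces (filter (λ p → winner p Fin.≟ i) patterns)) → x ∈ block i
        from x any = let hs , hs∈ , all = List.find any
                         p , p∈ , hs≡ = ∈-map⁻ half-spaces hs∈
                         _ , w = ∈-filter⁻ (λ p → winner p Fin.≟ i) {xs = patterns} p∈
                     in ≡.trans (≡.cong winner (matches p (≡.subst (All (x ∈ʰ_)) hs≡ all))) w
          where
          matches : ∀ p → All (x ∈ʰ_) (half-spaces p) → pattern-of x ≡ p
          matches p (a ∷ b ∷ c ∷ []) = pattern-≡ (pattern-of x) p λ
            { 0F → ∈half-space⁻ 0F x (coordinate p 0F) a
            ; 1F → ∈half-space⁻ 1F x (coordinate p 1F) b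
            ; 2F → ∈half-space⁻ 2F x (coordinate p 2F) c }

    high : ∀ x i → θ i < x i → coordinate (pattern-of x) i ≡ true
    high x i p = ≡.trans (pattern-coordinate x i) (above-true p)

    low : ∀ x i → x i ≤ θ i → coordinate (pattern-of x) i ≡ false
    low x i p = ≡.trans (pattern-coordinate x i) (above-false p)

    stable : ∀ {x i} → ¬ (x i ≈ θ i) → ∃[ δ ] 0# < δ × (∀ y → dist x y < δ →
             coordinate (pattern-of y) i ≡ coordinate (pattern-of x) i)
    stable {x} {i} ne with compare (x i) (θ i)
    ... | inj₁ p = (1 ÷ 2) * (θ i - x i) , half-pos (x<y⇒0<y-x p) , λ y q →
            ≡.trans (low y i (still y (dist-coordinate {x} {y} q i))) (≡.sym (low x i (<⇒≤ p)))
      where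
      still : ∀ y → ∣ x i - y i ∣ < 2 ÷ 1 * ((1 ÷ 2) * (θ i - x i)) → y i ≤ θ i
      still y q = lin (y i ∷ θ i ∷ (∣ x i - y i ∣) ∷ x i ∷ []) (x₀ ⊑ x₁)
        (▹ x₂ ⊏ 2 /1+ 0 ⊗ (1 /1+ 1 ⊗ (x₁ ⊝ x₃)) ∷ ▹ ⊖ (x₃ ⊝ x₀) ⊑ x₂ ∷ []) (q , -x≤∣x∣ (x i - y i) ,
        tt)
    ... | inj₂ (inj₁ p) = ⊥-elim (ne p)
    ... | inj₂ (inj₂ p) = (1 ÷ 2) * (x i - θ i) , half-pos (x<y⇒0<y-x p) , λ y q →
            ≡.trans (high y i (still y (dist-coordinate {x} {y} q i))) (≡.sym (high x i p))
      where
      still : ∀ y → ∣ x i - y i ∣ < 2 ÷ 1 * ((1 ÷ 2) * (x i - θ i)) → θ i < y i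
      still y q = lin (θ i ∷ y i ∷ (∣ x i - y i ∣) ∷ x i ∷ []) (x₀ ⊏ x₁)
        (▹ x₂ ⊏ 2 /1+ 0 ⊗ (1 /1+ 1 ⊗ (x₃ ⊝ x₀)) ∷ ▹ x₃ ⊝ x₁ ⊑ x₂ ∷ []) (q , x≤∣x∣ (x i - y i) , tt)

    LocallyConstant : Point 3 → Set
    LocallyConstant x = ∃[ b ] ∃[ δ ] 0# < δ × (∀ y → y ∈ Δ → dist x y < δ → winner (pattern-of y) ≡ b)

    constant⇒∉boundary : ∀ {x} → LocallyConstant x → ¬ (x ∈ Boundary cut)
    constant⇒∉boundary (b , δ , 0<δ , h) (_ , near) =
      let y , z , y∈Δ , z∈Δ , xy , xz , i , j , i≢j , y∈i , z∈j = near δ 0<δ in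
      i≢j (≡.trans (≡.sym y∈i) (≡.trans (h y y∈Δ xy) (≡.trans (≡.sym (h z z∈Δ xz)) z∈j)))

    stable⇒constant : ∀ {x b} i j → ¬ (x i ≈ θ i) → ¬ (x j ≈ θ j) →
      (∀ y → y ∈ Δ → coordinate (pattern-of y) i ≡ coordinate (pattern-of x) i →
                     coordinate (pattern-of y) j ≡ coordinate (pattern-of x) j → winner (pattern-of y) ≡ b) →
      LocallyConstant x
    stable⇒constant {x} i j p q h = let δ , 0<δ , s = stable {x} p ; ε , 0<ε , s′ = stable {x} q in
      _ , min δ ε , min-glb-< 0<δ 0<ε , λ y y∈Δ r →
        h y y∈Δ (s y (<-≤-trans r (min≤x δ ε))) (s′ y (<-≤-trans r (min≤y δ ε)))

    -- Moving slightly from `x` towards two different terminals gives arbitrarily near points in two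
    -- different blocks.
    boundary-intro : ∀ {x} a b → a ≢ b → x ∈ Δ →
      (∀ s → 0# < s → s ≤ 1# → winner (pattern-of (lerp x (unit a) s)) ≡ a) →
      (∀ s → 0# < s → s ≤ 1# → winner (pattern-of (lerp x (unit b) s)) ≡ b) → x ∈ Boundary cut
    boundary-intro {x} a b a≢b x∈Δ near-a near-b = x∈Δ , λ δ 0<δ → let s , 0<s , s≤1 , close = step δ 0<δ in
      lerp x (unit a) s , lerp x (unit b) s , lerp∈Δ x∈Δ (unit∈Δ a) (<⇒≤ 0<s) s≤1 , lerp∈Δ x∈Δ (unit∈Δ b) (<⇒≤ 0<s) s≤1 ,
      close a , close b , a , b , a≢b , near-a s 0<s s≤1 , near-b s 0<s s≤1
      where
      moved : ∀ v s → 0# < s → ∀ i → ∣ x i - lerp x (unit v) s i ∣ ≤ s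
      moved v s 0<s i = ∣x∣≤
        (lin (x i ∷ s ∷ unit v i ∷ []) (x₀ ⊝ ((𝟙 ⊝ x₁) ⊗ x₀ ⊕ x₁ ⊗ x₂) ⊑ x₁)
          (▹ 𝟘 ⊑ x₁ ⊗ (x₂ ⊕ (𝟙 ⊝ x₀)) ∷ [])
          (*-nonNeg (<⇒≤ 0<s) (0≤x+y (proj₁ (unit∈Δ v) i) (x≤y⇒0≤y-x (Δ≤1 x∈Δ i))) , tt))
        (lin (x i ∷ s ∷ unit v i ∷ []) (⊖ (x₀ ⊝ ((𝟙 ⊝ x₁) ⊗ x₀ ⊕ x₁ ⊗ x₂)) ⊑ x₁)
          (▹ 𝟘 ⊑ x₁ ⊗ (x₀ ⊕ (𝟙 ⊝ x₂)) ∷ [])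
          (*-nonNeg (<⇒≤ 0<s) (0≤x+y (proj₁ x∈Δ i) (x≤y⇒0≤y-x (Δ≤1 (unit∈Δ v) i))) , tt))
      step : ∀ δ → 0# < δ → ∃[ s ] 0# < s × s ≤ 1# × (∀ v → dist x (lerp x (unit v) s) < δ)
      step δ 0<δ = s , 0<s , min≤x _ _ , λ v → ≤-<-trans (dist≤ {x} {lerp x (unit v) s} s (moved v s 0<s)) small-s
        where
        s : ℝ
        -- The step `s` moves each coordinate by at most `s`, hence the point by at most 3s/2, which
        -- is at most 3δ/4.
        s = min 1# ((1 ÷ 2) * δ)
        0<δ/2 : 0# < (1 ÷ 2) * δ
        0<δ/2 = lin (δ ∷ []) (𝟘 ⊏ 1 /1+ 1 ⊗ x₀) (1 /1+ 1 ▸ 𝟘 ⊏ x₀ ∷ []) (0<δ , tt)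
        0<s : 0# < s
        0<s = min-glb-< (0≤1 , 0≉1) 0<δ/2
        small-s : 3 ÷ 2 * s < δ
        small-s = lin (min 1# (1 ÷ 2 * δ) ∷ δ ∷ []) (3 /1+ 1 ⊗ x₀ ⊏ x₁)
          (3 /1+ 1 ▸ x₀ ⊑ 1 /1+ 1 ⊗ x₁ ∷ 1 /1+ 3 ▸ 𝟘 ⊏ x₁ ∷ []) (min≤y 1# ((1 ÷ 2) * δ) , 0<δ , tt)

  module _ (r : Point 3) (0<r : ∀ i → 0# < r i) (r∈Δ : r ∈ Δ) (rays : Vec (Fin 2) 3) where

    private
      selected : Fin 3 → Fin 3
      selected j = punchIn j (lookup rays j)

    r<1 : ∀ i → r i < 1#
    r<1 i = lin (r i ∷ r (punchIn i 0F) ∷ r (punchIn i (opposite 0F)) ∷ []) (x₀ ⊏ 𝟙)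
      (▹ x₀ ⊕ x₁ ⊕ x₂ ≃ 𝟙 ∷ ▹ 𝟘 ⊏ x₁ ∷ ▹ 𝟘 ⊏ x₂ ∷ []) (triple-sum (triple i 0F) r∈Δ ,
      0<r (punchIn i 0F) , 0<r (punchIn i (opposite 0F)) , tt)

    -- A point of the triangle that exceeds `r` in no coordinate is `r` itself, and none exceeds it
    -- in all three. So the default block `0F` concerns a single point.
    open ThresholdCut r selected 0F (λ i → <⇒≤ (0<r i)) r<1

    ballCut : Cut 3
    ballCut = cut

    ballCut-boundary : ∀ x → x ∈ Boundary cut ⇔ (∃[ j ] x ∈ Ray r j (lookup rays j))
    ballCut-boundary x = mk⇔ to from
      where
      OnRay : Set
      OnRay = ∃[ j ] x ∈ Ray r j (lookup rays j)

      from : OnRay → x ∈ Boundary cut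
      -- The point is on line `l`, with coordinate `k` at least that of the centre. Towards `l`
      -- coordinate `l` rises above its threshold and wins by the selection on side `j`; towards `k`
      -- it does not, and only coordinate `k` is above.
      from (j , x∈Δ , on , xj≤rj) = boundary-intro l k (triple-≢ (rotate t)) x∈Δ
          (λ s 0<s s≤1 → winner-low (pattern-of (lerp x (unit l) s)) t
            (low (lerp x (unit l) s) j (j-low s 0<s s≤1 (triple-≢ t))) (high (lerp x (unit l) s) l (l-high s 0<s s≤1)) ≡.refl)
          (λ s 0<s s≤1 → winner-single (pattern-of (lerp x (unit k) s)) (rotate (rotate t))
            (high (lerp x (unit k) s) k (k-high s 0<s s≤1))
            (low (lerp x (unit k) s) j (j-low s 0<s s≤1 (triple-≢ (swap (rotate (rotate t))))))
            (low (lerp x (unit k) s) l (l-low s 0<s s≤1)))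
        where
        l k : Fin 3
        l = selected j
        k = punchIn j (opposite (lookup rays j))
        t : Triple j l k
        t = triple j (lookup rays j)
        rk≤xk : r k ≤ x k
        rk≤xk = lin (r k ∷ x k ∷ x l ∷ r l ∷ x j ∷ r j ∷ []) (x₀ ⊑ x₁) (▹ x₂ ≃ x₃ ∷ ▹ x₄ ⊑ x₅ ∷
          ▹ 𝟙 ≃ x₄ ⊕ x₂ ⊕ x₁ ∷ ▹ x₅ ⊕ x₃ ⊕ x₀ ≃ 𝟙 ∷ []) (on , xj≤rj , sym (triple-sum t x∈Δ) ,
          triple-sum t r∈Δ , tt)
        j-low : ∀ s → 0# < s → s ≤ 1# → ∀ {v} → j ≢ v → lerp x (unit v) s j ≤ r j
        j-low s 0<s s≤1 j≢v = ≤-trans (toward-other {x} x∈Δ (<⇒≤ 0<s) s≤1 j≢v) xj≤rj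
        l-high : ∀ s → 0# < s → s ≤ 1# → r l < (1# - s) * x l + s * unit l l
        l-high s 0<s s≤1 = lin (r l ∷ s ∷ x l ∷ unit l l ∷ []) (x₀ ⊏ (𝟙 ⊝ x₁) ⊗ x₂ ⊕ x₁ ⊗ x₃)
          (▹ x₁ ⊗ 𝟙 ≃ x₁ ⊗ x₃ ∷ ▹ (𝟙 ⊝ x₁) ⊗ x₀ ≃ (𝟙 ⊝ x₁) ⊗ x₂ ∷ ▹ 𝟘 ⊏ x₁ ⊗ (𝟙 ⊝ x₀) ∷ [])
          (sym (*-congᵗ s (unit-self l)) , sym (*-congᵗ (1# - s) on) ,
          *-pos 0<s (x<y⇒0<y-x (r<1 l)) , tt)
        k-high : ∀ s → 0# < s → s ≤ 1# → r k < (1# - s) * x k + s * unit k k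
        k-high s 0<s s≤1 = lin (r k ∷ s ∷ x k ∷ unit k k ∷ []) (x₀ ⊏ (𝟙 ⊝ x₁) ⊗ x₂ ⊕ x₁ ⊗ x₃)
          (▹ x₁ ⊗ 𝟙 ≃ x₁ ⊗ x₃ ∷ ▹ 𝟘 ⊑ (𝟙 ⊝ x₁) ⊗ (x₂ ⊝ x₀) ∷ ▹ 𝟘 ⊏ x₁ ⊗ (𝟙 ⊝ x₀) ∷ [])
          (sym (*-congᵗ s (unit-self k)) , *-nonNeg (x≤y⇒0≤y-x s≤1) (x≤y⇒0≤y-x rk≤xk) ,
          *-pos 0<s (x<y⇒0<y-x (r<1 k)) , tt)
        l-low : ∀ s → 0# < s → s ≤ 1# → lerp x (unit k) s l ≤ r l
        l-low s 0<s s≤1 = ≤-trans (toward-other {x} x∈Δ (<⇒≤ 0<s) s≤1 (triple-≢ (rotate t)))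
          (≤-reflexive on)

      to : x ∈ Boundary cut → OnRay
      to x∈∂ = by-contradiction λ off → constant⇒∉boundary (locally-constant off) x∈∂
        where
        x∈Δ : x ∈ Δ
        x∈Δ = proj₁ x∈∂
        -- On the ray of line `i` that is not selected, side `j` is decided in favour of `k`. Block
        -- `k` then lies on both sides of line `i`.
        below : ∀ {i j k} → Triple i j k → ¬ OnRay → x i ≈ r i → x j < r j → LocallyConstant x
        below {i} {j} {k} t off on xj<rj = by-selection (exhaust t (selected j))
          where
          rk<xk : r k < x k
          rk<xk = lin (r k ∷ x k ∷ x i ∷ r i ∷ x j ∷ r j ∷ []) (x₀ ⊏ x₁) (▹ x₂ ≃ x₃ ∷ ▹ x₄ ⊏ x₅ ∷
            ▹ 𝟙 ≃ x₂ ⊕ x₄ ⊕ x₁ ∷ ▹ x₃ ⊕ x₅ ⊕ x₀ ≃ 𝟙 ∷ []) (on , xj<rj , sym (triple-sum t x∈Δ) ,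
            triple-sum t r∈Δ , tt)
          by-selection : selected j ≡ i ⊎ selected j ≡ j ⊎ selected j ≡ k → LocallyConstant x
          by-selection (inj₁ p) = ⊥-elim (off (j , x∈Δ , ≡.subst (λ m → x m ≈ r m) (≡.sym p) on , <⇒≤ xj<rj))
          by-selection (inj₂ (inj₁ p)) = ⊥-elim (Fin.punchInᵢ≢i j (lookup rays j) p)
          by-selection (inj₂ (inj₂ p)) = stable⇒constant {x} j k (<⇒≉ xj<rj) (>⇒≉ rk<xk) λ y _ q q′ →
            winner-low (pattern-of y) (rotate t) (≡.trans q (low x j (<⇒≤ xj<rj))) (≡.trans q′ (high x k rk<xk)) p
        on-line : ∀ {i j k} → Triple i j k → ¬ OnRay → x i ≈ r i → LocallyConstant x
        on-line {i} {j} {k} t off on = by-order (compare (x j) (r j))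
          where
          rest : x i + x j + x k ≈ r i + r j + r k
          rest = trans (triple-sum t x∈Δ) (sym (triple-sum t r∈Δ))
          xk<rk : r j < x j → x k < r k
          xk<rk p = lin (x k ∷ r k ∷ x i ∷ r i ∷ r j ∷ x j ∷ []) (x₀ ⊏ x₁) (▹ x₃ ≃ x₂ ∷ ▹ x₄ ⊏ x₅ ∷
            ▹ x₂ ⊕ x₅ ⊕ x₀ ≃ x₃ ⊕ x₄ ⊕ x₁ ∷ []) (sym on , p , rest , tt)
          xk≈rk : x j ≈ r j → x k ≈ r k
          xk≈rk p = lin (x k ∷ r k ∷ x i ∷ r i ∷ x j ∷ r j ∷ []) (x₀ ≃ x₁) (▹ x₃ ≃ x₂ ∷ ▹ x₅ ≃ x₄ ∷
            ▹ x₂ ⊕ x₄ ⊕ x₀ ≃ x₃ ⊕ x₅ ⊕ x₁ ∷ []) (sym on , sym p , rest , tt)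
          at-centre : x j ≈ r j → ∀ l → l ≡ i ⊎ l ≡ j ⊎ l ≡ k → x l ≈ r l
          at-centre p l (inj₁ q)        = ≡.subst (λ m → x m ≈ r m) (≡.sym q) on
          at-centre p l (inj₂ (inj₁ q)) = ≡.subst (λ m → x m ≈ r m) (≡.sym q) p
          at-centre p l (inj₂ (inj₂ q)) = ≡.subst (λ m → x m ≈ r m) (≡.sym q) (xk≈rk p)
          by-order : x j < r j ⊎ x j ≈ r j ⊎ r j < x j → LocallyConstant x
          by-order (inj₁ p)        = below t off on p
          by-order (inj₂ (inj₂ p)) = below (swap (rotate (rotate t))) off on (xk<rk p)
          -- The centre belongs to the ray on every side; side `0F` is an arbitrary choice.
          by-order (inj₂ (inj₁ p)) = ⊥-elim (off (0F , x∈Δ , at-centre p (selected 0F) (exhaust t (selected 0F)) ,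
            ≤-reflexive (at-centre p 0F (exhaust t 0F))))
        locally-constant : ¬ OnRay → LocallyConstant x
        locally-constant off = by-lines em em em
          where
          by-lines : Dec (x 0F ≈ r 0F) → Dec (x 1F ≈ r 1F) → Dec (x 2F ≈ r 2F) → LocallyConstant x
          by-lines (yes p) _       _       = on-line 012F off p
          by-lines (no _)  (yes p) _       = on-line 102F off p
          by-lines (no _)  (no _)  (yes p) = on-line 201F off p
          by-lines (no p)  (no q)  (no s)  =
            let δ , 0<δ , f = stable {x} p
                ε , 0<ε , g = stable {x} q
                η , 0<η , h = stable {x} s
            in winner (pattern-of x) , min δ (min ε η) , min-glb-< 0<δ (min-glb-< 0<ε 0<η) , λ y _ u →
              ≡.cong winner (pattern-≡ (pattern-of y) (pattern-of x) λ
                { 0F → f y (<-≤-trans u (min≤x _ _))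
                ; 1F → g y (<-≤-trans u (≤-trans (min≤y _ _) (min≤x _ _)))
                ; 2F → h y (<-≤-trans u (≤-trans (min≤y _ _) (min≤y _ _))) })

  module _ (k : Fin 3) (ρ : ℝ) (2/3<ρ : 2 ÷ 3 < ρ) (ρ<1 : ρ < 1#) where

    0≤ρ : 0# ≤ ρ
    0≤ρ = lin (ρ ∷ []) (𝟘 ⊑ x₀) (▹ 2 /1+ 2 ⊏ x₀ ∷ []) (2/3<ρ , tt)

    -- The same threshold is placed on coordinate `k`. It creates no boundary, because block `k` is
    -- also the default. At most one coordinate can exceed `ρ`, so no point of the triangle is
    -- decided by `λ _ → k`.
    open ThresholdCut (λ _ → ρ) (λ _ → k) k (λ _ → 0≤ρ) (λ _ → ρ<1)

    cornerCut : Cut 3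
    cornerCut = cut

    cornerCut-boundary : ∀ x → x ∈ Boundary cut ⇔ (x ∈ Δ × ∃[ i ] i ≢ k × x i ≈ ρ)
    cornerCut-boundary x = mk⇔ to from
      where
      others-low : ∀ {y i j l} → Triple i j l → y ∈ Δ → ρ < y i → y j ≤ ρ
      others-low {y} {i} {j} {l} t y∈Δ p = lin (y j ∷ ρ ∷ y i ∷ y l ∷ []) (x₀ ⊑ x₁) (▹ x₁ ⊏ x₂ ∷
        2 /1+ 0 ▸ 2 /1+ 2 ⊏ x₁ ∷ ▹ x₂ ⊕ x₀ ⊕ x₃ ≃ 𝟙 ∷ ▹ 𝟘 ⊑ x₃ ∷ []) (p , 2/3<ρ , triple-sum t y∈Δ ,
        proj₁ y∈Δ l , tt)
      chosen : ∀ {y i j l} → Triple i j l → y ∈ Δ → coordinate (pattern-of y) i ≡ true → winner (pattern-of y) ≡ i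
      chosen {y} {i} {j} {l} t y∈Δ p = winner-single (pattern-of y) t p (low y j (others-low t y∈Δ ρ<yi))
        (low y l (others-low (rotate (swap t)) y∈Δ ρ<yi))
        where
        ρ<yi : ρ < y i
        ρ<yi = ≰⇒> λ q → true≢false (≡.trans (≡.sym p) (low y i q))
          where
          true≢false : true ≢ false
          true≢false ()
      unchosen : ∀ {y i j} → Triple k i j → coordinate (pattern-of y) i ≡ false → coordinate (pattern-of y) j ≡ false →
                 winner (pattern-of y) ≡ k
      unchosen {y} {i} {j} t p q = by-k (coordinate (pattern-of y) k) ≡.refl
        where
        by-k : ∀ b → coordinate (pattern-of y) k ≡ b → winner (pattern-of y) ≡ k
        by-k true  e = winner-single (pattern-of y) t e p q
        by-k false e = winner-none (pattern-of y) t e p q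

      from : x ∈ Δ × (∃[ i ] i ≢ k × x i ≈ ρ) → x ∈ Boundary cut
      from (x∈Δ , i , i≢k , on) = let j , t = triple-of k i i≢k in approach t
        where
        approach : ∀ {j} → Triple k i j → x ∈ Boundary cut
        approach {j} t = boundary-intro i k i≢k x∈Δ
          (λ s 0<s s≤1 → chosen {lerp x (unit i) s} (rotate t) (lerp∈Δ x∈Δ (unit∈Δ i) (<⇒≤ 0<s) s≤1)
            (high (lerp x (unit i) s) i (i-high s 0<s)))
          (λ s 0<s s≤1 → unchosen {lerp x (unit k) s} t
            (low (lerp x (unit k) s) i (i-low s 0<s s≤1)) (low (lerp x (unit k) s) j (j-low s 0<s s≤1)))
          where
          i-high : ∀ s → 0# < s → ρ < (1# - s) * x i + s * unit i i
          i-high s 0<s = lin (ρ ∷ s ∷ x i ∷ unit i i ∷ []) (x₀ ⊏ (𝟙 ⊝ x₁) ⊗ x₂ ⊕ x₁ ⊗ x₃)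
            (▹ x₁ ⊗ 𝟙 ≃ x₁ ⊗ x₃ ∷ ▹ (𝟙 ⊝ x₁) ⊗ x₀ ≃ (𝟙 ⊝ x₁) ⊗ x₂ ∷ ▹ 𝟘 ⊏ x₁ ⊗ (𝟙 ⊝ x₀) ∷ [])
            (sym (*-congᵗ s (unit-self i)) , sym (*-congᵗ (1# - s) on) , *-pos 0<s (x<y⇒0<y-x ρ<1) ,
            tt)
          i-low : ∀ s → 0# < s → s ≤ 1# → lerp x (unit k) s i ≤ ρ
          i-low s 0<s s≤1 = ≤-trans (toward-other {x} x∈Δ (<⇒≤ 0<s) s≤1 i≢k) (≤-reflexive on)
          j-low : ∀ s → 0# < s → s ≤ 1# → lerp x (unit k) s j ≤ ρ
          j-low s 0<s s≤1 = ≤-trans (toward-other {x} x∈Δ (<⇒≤ 0<s) s≤1 (triple-≢ (rotate (rotate t))))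
            (lin (x j ∷ ρ ∷ x i ∷ x k ∷ []) (x₀ ⊑ x₁) (▹ x₁ ≃ x₂ ∷ 2 /1+ 0 ▸ 2 /1+ 2 ⊏ x₁ ∷
              ▹ x₃ ⊕ x₂ ⊕ x₀ ≃ 𝟙 ∷ ▹ 𝟘 ⊑ x₃ ∷ []) (sym on , 2/3<ρ , triple-sum t x∈Δ , proj₁ x∈Δ k ,
              tt))

      to : x ∈ Boundary cut → x ∈ Δ × (∃[ i ] i ≢ k × x i ≈ ρ)
      to x∈∂ = proj₁ x∈∂ , by-contradiction λ off →
        constant⇒∉boundary (locally-constant (triple k 0F) off) x∈∂
        where
        locally-constant : ∀ {i j} → Triple k i j → ¬ (∃[ i ] i ≢ k × x i ≈ ρ) → LocallyConstant x
        locally-constant {i} {j} t off = by-order (compare (x i) ρ) (compare (x j) ρ)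
          where
          by-order : x i < ρ ⊎ x i ≈ ρ ⊎ ρ < x i → x j < ρ ⊎ x j ≈ ρ ⊎ ρ < x j → LocallyConstant x
          by-order (inj₂ (inj₁ p)) _ = ⊥-elim (off (i , triple-≢ (swap t) , p))
          by-order _ (inj₂ (inj₁ p)) = ⊥-elim (off (j , triple-≢ (rotate (rotate t)) , p))
          by-order (inj₂ (inj₂ p)) (inj₁ q) = stable⇒constant {x} i j (>⇒≉ p) (<⇒≉ q) λ y y∈Δ u _ →
                chosen {y} (rotate t) y∈Δ (≡.trans u (high x i p))
          by-order (inj₂ (inj₂ p)) (inj₂ (inj₂ q)) = stable⇒constant {x} i j (>⇒≉ p) (>⇒≉ q) λ y y∈Δ u _ →
                chosen {y} (rotate t) y∈Δ (≡.trans u (high x i p))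
          by-order (inj₁ p) (inj₂ (inj₂ q)) = stable⇒constant {x} i j (<⇒≉ p) (>⇒≉ q) λ y y∈Δ _ u →
                chosen {y} (rotate (rotate t)) y∈Δ (≡.trans u (high x j q))
          by-order (inj₁ p) (inj₁ q) = stable⇒constant {x} i j (<⇒≉ p) (<⇒≉ q) λ y y∈Δ u v →
                unchosen {y} t (≡.trans u (low x i (<⇒≤ p))) (≡.trans v (low x j (<⇒≤ q)))

-- Existence of the ball/corner scheme.

module SchemeExistence (em : ∀ {ℓ} → ExcludedMiddle ℓ) (𝓡 : CompleteOrderedField) where
  open CompleteOrderedField 𝓡 hiding (zero)
  open LinearArithmetic 𝓡
  open RealNumbers em 𝓡
  open SimplexGeometry em 𝓡
  open InjectionCounting em
  open CutCounts em 𝓡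
  open BallCutCounts em 𝓡
  open CutAnalysis em 𝓡
  open SpanLengths em 𝓡
  open CutDensity em 𝓡 using (0≤w)
  open ThresholdCuts em 𝓡
  open IntervalMixture em 𝓡
  open Simplex 𝓡

  lo<1 : ∀ c → lo c < 1#
  lo<1 (ball _ _) = 0≤1 , 0≉1
  lo<1 (corner k) = lin [] (2 /1+ 2 ⊏ 𝟙) [] tt

  open Mixture Component _≟ᶜ_ w lo (λ _ → 1#) 0≤w lo<1 components ∈-components unique-components (corner 0F)

  total-mass : total components ≈ 1#
  total-mass = goal
    where
    b c : ℝ
    b = 1 ÷ 22 * (1# - 0#)
    c = 3 ÷ 11 * (1# - 2 ÷ 3)
    b≈ : b ≈ 1 ÷ 22
    b≈ = lin [] (1 /1+ 21 ⊗ (𝟙 ⊝ 𝟘) ≃ 1 /1+ 21) [] tt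
    c≈ : c ≈ 1 ÷ 11
    c≈ = lin [] (3 /1+ 10 ⊗ (𝟙 ⊝ 2 /1+ 2) ≃ 1 /1+ 10) [] tt
    goal : b + (b + (b + (b + (b + (b + (b + (b + (b + (b + (b + (b + (b + (b + (b + (b +
           (c + (c + (c + 0#)))))))))))))))))) ≈ 1#
    goal = lin (b ∷ c ∷ []) (x₀ ⊕ (x₀ ⊕ (x₀ ⊕ (x₀ ⊕ (x₀ ⊕ (x₀ ⊕ (x₀ ⊕ (x₀ ⊕ (x₀ ⊕ (x₀ ⊕ (x₀ ⊕ (x₀ ⊕
      (x₀ ⊕ (x₀ ⊕ (x₀ ⊕ (x₀ ⊕ (x₁ ⊕ (x₁ ⊕ (x₁ ⊕ 𝟘)))))))))))))))))) ≃ 𝟙) (16 /1+ 0 ▸ x₀ ≃ 1 /1+ 21 ∷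
      3 /1+ 0 ▸ x₁ ≃ 1 /1+ 10 ∷ []) (b≈ , c≈ , tt)

  0≤α : ∀ l i → 0# ≤ α l i
  0≤α ac 0F = lin [] (𝟘 ⊑ 2 /1+ 2) [] tt
  0≤α bd 0F = lin [] (𝟘 ⊑ 2 /1+ 2) [] tt
  0≤α ac 1F = lin [] (𝟘 ⊑ 1 /1+ 2) [] tt
  0≤α ac 2F = ≤-refl
  0≤α bd 1F = ≤-refl
  0≤α bd 2F = lin [] (𝟘 ⊑ 1 /1+ 2) [] tt

  centre-pos : ∀ l {t} → 0# < t → t < 1# → ∀ i → 0# < centre l t i
  centre-pos l {t} p q 0F = lin (centre l t 0F ∷ t ∷ []) (𝟘 ⊏ x₀) (▹ 2 /1+ 2 ⊕ ⊖ 2 /1+ 2 ⊗ x₁ ≃ x₀ ∷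
    2 /1+ 2 ▸ x₁ ⊏ 𝟙 ∷ []) (sym (centre-affine l t 0F) , q , tt)
  centre-pos l {t} p q 1F = lin (centre l t 1F ∷ α l 1F ∷ t ∷ []) (𝟘 ⊏ x₀)
    (▹ x₁ ⊕ 1 /1+ 2 ⊗ x₂ ≃ x₀ ∷ 1 /1+ 2 ▸ 𝟘 ⊏ x₂ ∷ ▹ 𝟘 ⊑ x₁ ∷ []) (sym (centre-affine l t 1F) , p ,
    0≤α l 1F , tt)
  centre-pos l {t} p q 2F = lin (centre l t 2F ∷ α l 2F ∷ t ∷ []) (𝟘 ⊏ x₀)
    (▹ x₁ ⊕ 1 /1+ 2 ⊗ x₂ ≃ x₀ ∷ 1 /1+ 2 ▸ 𝟘 ⊏ x₂ ∷ ▹ 𝟘 ⊑ x₁ ∷ []) (sym (centre-affine l t 2F) , p ,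
    0≤α l 2F , tt)

  centre∈Δ : ∀ l {t} → 0# < t → t < 1# → centre l t ∈ Δ
  centre∈Δ l {t} p q = Δ-intro (<⇒≤ (centre-pos l p q 0F)) (<⇒≤ (centre-pos l p q 1F)) (<⇒≤ (centre-pos l p q 2F))
    (centre-sum l t 012F)

  choiceAt : Ω → Choice
  choiceAt (c , z , _) = toChoice c z

  cutAt : Ω → Cut 3
  cutAt (ball l rays , z , p , q) = ballCut (centre l z) (centre-pos l p q) (centre∈Δ l p q) rays
  cutAt (corner k    , z , p , q) = cornerCut k z p q

  cutAt-realises : ∀ ω → Realises (choiceAt ω) (cutAt ω)
  cutAt-realises (ball l rays , z , p , q) =
    p , q , ballCut-boundary (centre l z) (centre-pos l p q) (centre∈Δ l p q) rays
  cutAt-realises (corner k , z , p , q) = p , <⇒≤ q , cornerCut-boundary k z p q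

  -- The symmetric difference of two initial intervals: this is the span, up to its ends, without
  -- regard to their order.
  SpanSet : Component → ℝ → ℝ → Pred Ω 0ℓ
  SpanSet c X Y = (UpTo c Y ∩ ∁ (UpTo c X)) ∪ (UpTo c X ∩ ∁ (UpTo c Y))

  measurable-SpanSet : ∀ c X Y → IsMeasurable (SpanSet c X Y)
  measurable-SpanSet c X Y = measurable-∪
    (measurable-∩ (measurable-UpTo c Y) (measurable-∁ (measurable-UpTo c X)))
    (measurable-∩ (measurable-UpTo c X) (measurable-∁ (measurable-UpTo c Y)))

  -- At least `suc n` events occur if the first one does and at least `n` of the rest, or if at
  -- least `suc n` of the rest do.
  measurable-count : ∀ {N} n (E : Fin N → Pred Ω 0ℓ) → (∀ j → IsMeasurable (E j)) →
                     IsMeasurable (λ ω → n ℕ.≤ count (λ j → ω ∈ E j))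
  measurable-count zero E mE = measurable-≐ ((λ _ → ℕ.z≤n) , λ _ → tt) measurable-U
  measurable-count {zero} (suc n) E mE = measurable-≐ ((λ ()) , λ ()) measurable-∅
  measurable-count {suc N} (suc n) E mE = measurable-≐ ((λ {ω} → bump⁺ em) , λ {ω} → bump⁻ em)
    (measurable-∪ (measurable-∩ (mE zero) (measurable-count n (E ∘ suc) (mE ∘ suc)))
                  (measurable-count (suc n) (E ∘ suc) (mE ∘ suc)))
    where
    bump⁺ : ∀ {Q : Set} (d : Dec Q) {k} → (Q × n ℕ.≤ k) ⊎ suc n ℕ.≤ k → suc n ℕ.≤ bump d k
    bump⁺ (yes _) (inj₁ (_ , p)) = ℕ.s≤s p
    bump⁺ (yes _) (inj₂ p)       = ℕ.≤-trans p (ℕ.n≤1+n _)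
    bump⁺ (no ¬q) (inj₁ (q , _)) = ⊥-elim (¬q q)
    bump⁺ (no _)  (inj₂ p)       = p
    bump⁻ : ∀ {Q : Set} (d : Dec Q) {k} → suc n ℕ.≤ bump d k → (Q × n ℕ.≤ k) ⊎ suc n ℕ.≤ k
    bump⁻ (yes q) (ℕ.s≤s p) = inj₁ (q , p)
    bump⁻ (no _)  p         = inj₂ p

  count-mono : ∀ {N} (P Q : Fin N → Set) → (∀ j → P j → Q j) → count P ℕ.≤ count Q
  count-mono {zero}  P Q h = ℕ.z≤n
  count-mono {suc N} P Q h = bump-imp em em (h zero) (count-mono (P ∘ suc) (Q ∘ suc) (h ∘ suc))

  cutAt-measurable : ∀ e n → IsMeasurable (λ ω → CutsAtLeast (cutAt ω) e n)
  cutAt-measurable e n = measurable-piecewise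
    (λ c ω → n ℕ.≤ count (λ j → ω ∈ SpanSet c (X c j) (Y c j)))
    (λ c → measurable-count n _ (λ j → measurable-SpanSet c (X c j) (Y c j)))
    -- The ends of the spans are excepted as well, since `SpanSet` is half-open while `Between` is
    -- open.
    (λ c → bad c ++ (tabulate (X c) ++ tabulate (Y c)))
    (λ ω ω∉ → agree ω ω∉)
    where
    module A c = SpanAnalysis (analysis c e)
    X Y : ∀ c → Fin (A.spans c) → ℝ
    X c = A.X c
    Y c = A.Y c
    bad : Component → List ℝ
    bad c = A.bad c
    agree : ∀ ω → ¬ Any (position ω ≈_) (bad (index ω) ++ (tabulate (X (index ω)) ++ tabulate (Y (index ω)))) →
      (n ℕ.≤ count (λ j → ω ∈ SpanSet (index ω) (X (index ω) j) (Y (index ω) j)) → CutsAtLeast (cutAt ω) e n) ×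
      (CutsAtLeast (cutAt ω) e n → n ℕ.≤ count (λ j → ω ∈ SpanSet (index ω) (X (index ω) j) (Y (index ω) j)))
    agree ω@(c , z , r) ω∉ =
      (λ le → Equivalence.from (cuts n) (ℕ.≤-trans le (count-mono (λ j → ω ∈ SpanSet c (X c j) (Y c j)) _ between))) ,
      (λ c≥n → ℕ.≤-trans (Equivalence.to (cuts n) c≥n) (count-mono _ (λ j → ω ∈ SpanSet c (X c j) (Y c j)) inside))
      where
      cuts : ∀ n → CutsAtLeast (cutAt ω) e n ⇔ n ℕ.≤ count (λ j → Between (X c j) (Y c j) z)
      cuts = A.cuts c z (cutAt ω) (cutAt-realises ω) (λ p → ω∉ (++⁺ˡ p))
      z≉X : ∀ j → ¬ (z ≈ X c j)
      z≉X j p = ω∉ (++⁺ʳ (bad c) (++⁺ˡ (tabulate⁺ {f = X c} j p)))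
      z≉Y : ∀ j → ¬ (z ≈ Y c j)
      z≉Y j p = ω∉ (++⁺ʳ (bad c) (++⁺ʳ (tabulate (X c)) (tabulate⁺ {f = Y c} j p)))
      between : ∀ j → ω ∈ SpanSet c (X c j) (Y c j) → Between (X c j) (Y c j) z
      between j (inj₁ ((_ , z≤Y) , z≰X)) = inj₁ (≰⇒> (λ p → z≰X (≡.refl , p)) , ≤∧≉⇒< z≤Y (z≉Y j))
      between j (inj₂ ((_ , z≤X) , z≰Y)) = inj₂ (≰⇒> (λ p → z≰Y (≡.refl , p)) , ≤∧≉⇒< z≤X (z≉X j))
      inside : ∀ j → Between (X c j) (Y c j) z → ω ∈ SpanSet c (X c j) (Y c j)
      inside j (inj₁ (p , q)) = inj₁ ((≡.refl , <⇒≤ q) , λ (_ , r) → <-irrefl (<-≤-trans p r))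
      inside j (inj₂ (p , q)) = inj₂ ((≡.refl , <⇒≤ q) , λ (_ , r) → <-irrefl (<-≤-trans p r))

  ballCornerScheme : CuttingScheme 3
  ballCornerScheme = record
    { space          = probabilitySpace (trans ν-U total-mass)
    ; cut            = cutAt
    ; cut-measurable = cutAt-measurable
    }

  isBallCornerScheme : IsBallCornerScheme ballCornerScheme
  isBallCornerScheme = record
    { choice            = choiceAt
    ; realises          = cutAt-realises
    ; ball-measurable   = λ l rays u → measurable-≐ (ball-event l rays u) (measurable-UpTo (ball l rays) u)
    ; ball-law          = λ l rays u 0≤u u≤1 → trans (same (ball-event l rays u))
        (trans (ν-UpTo {ball l rays} 0≤u u≤1) (ball-mass u))
    ; corner-measurable = λ k u → measurable-≐ (corner-event k u) (measurable-UpTo (corner k) u)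
    ; corner-law        = λ k u 2/3≤u u≤1 → trans (same (corner-event k u))
        (trans (ν-UpTo {corner k} 2/3≤u u≤1) (corner-mass u))
    }
    where
    same : ∀ {A B} → A ≐ B → ν B ≈ ν A
    same {A} {B} (A⊆B , B⊆A) = ≤-antisym (ν-mono B A (λ {ω} → B⊆A {ω})) (ν-mono A B (λ {ω} → A⊆B {ω}))
    ball-event : ∀ l rays u → UpTo (ball l rays) u ≐ (choiceAt ⊢ BallUpTo l rays u)
    ball-event l rays u = (λ { {ball _ _ , _} (≡.refl , p) → ≡.refl , ≡.refl , p }) ,
      λ { {ball _ _ , _} (≡.refl , ≡.refl , p) → ≡.refl , p }
    corner-event : ∀ k u → UpTo (corner k) u ≐ (choiceAt ⊢ CornerUpTo k u)
    corner-event k u = (λ { {corner _ , _} (≡.refl , p) → ≡.refl , p }) ,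
      λ { {corner _ , _} (≡.refl , p) → ≡.refl , p }
    ball-mass : ∀ u → 1 ÷ 22 * (u - 0#) ≈ (8 ÷ 11) * (1 ÷ 2) * (1 ÷ 8) * u
    ball-mass u = lin (u ∷ []) (1 /1+ 21 ⊗ (x₀ ⊝ 𝟘) ≃ 8 /1+ 10 ⊗ 1 /1+ 1 ⊗ 1 /1+ 7 ⊗ x₀) [] tt
    0<1/3 : 0# < 1 ÷ 3
    0<1/3 = lin [] (𝟘 ⊏ 1 /1+ 2) [] tt
    third : ℝ
    third = (1 ÷ 3) ⁻¹
    third≈ : (1 ÷ 3) * third ≈ 1#
    third≈ = x*x⁻¹≈1 0<1/3
    corner-mass : ∀ u → 3 ÷ 11 * (u - 2 ÷ 3) ≈ (3 ÷ 11) * (1 ÷ 3) * ((u - 2 ÷ 3) * third)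
    corner-mass u = lin (u ∷ third ∷ [])
      (3 /1+ 10 ⊗ (x₀ ⊝ 2 /1+ 2) ≃ 3 /1+ 10 ⊗ 1 /1+ 2 ⊗ ((x₀ ⊝ 2 /1+ 2) ⊗ x₁))
      (3 /1+ 10 ▸ (x₀ ⊝ 2 /1+ 2) ⊗ 𝟙 ≃ (x₀ ⊝ 2 /1+ 2) ⊗ (1 /1+ 2 ⊗ x₁) ∷ [])
      (sym (*-congᵗ (u - 2 ÷ 3) third≈) , tt)

-- The segment of maximum density, and the infimum over all schemes.

module MaximumDensity (em : ∀ {ℓ} → ExcludedMiddle ℓ) (𝓡 : CompleteOrderedField) where
  open CompleteOrderedField 𝓡 hiding (zero)
  open LinearArithmetic 𝓡
  open RealNumbers em 𝓡
  open SimplexGeometry em 𝓡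
  open CutCrossings em 𝓡
  open BallCutCounts em 𝓡
  open CutAnalysis em 𝓡
  open SpanLengths em 𝓡
  open CutDensity em 𝓡
  open SchemeExistence em 𝓡 using (ballCornerScheme; isBallCornerScheme)
  open Simplex 𝓡
  open AddSupremum _≤_ using ([_]; _≤⊤⁺)

  module _ (P : CuttingScheme 3) (e : Segment 3) where

    0∈lower-sums : [ 0# ] ∈ IsLowerSum P e
    0∈lower-sums = 0 , (λ ()) , (λ ()) , (λ ()) , (λ ()) , (λ ()) , ≡.refl

    -- The lower sums form a predicate in a higher universe; after resizing, their supremum exists
    -- by completeness, and it is then a supremum in the extended sense too.
    expected-cuts-finite : (∃[ b ] ∀ v → v ∈ IsLowerSum P e → v ≤⁺ [ b ]) → ∃[ c ] 0# ≤ c × [ c ] ∈ IsExpectedCuts P e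
    expected-cuts-finite (b , v≤b) = proj₁ supremum , proj₁ (proj₂ supremum) 0# (small 0∈lower-sums) , upper , least
      where
      S : Pred ℝ 0ℓ
      S x = Small ([ x ] ∈ IsLowerSum P e)
      unbox : ∀ {x y} → [ x ] ≤⁺ [ y ] → x ≤ y
      unbox [ p ] = p
      supremum : ∃ (IsSup _≤_ S)
      supremum = complete S (0# , small 0∈lower-sums) (b , λ x x∈S → unbox (v≤b _ (large x∈S)))
      upper : ∀ v → v ∈ IsLowerSum P e → v ≤⁺ [ proj₁ supremum ]
      upper _ x@(_ , _ , _ , _ , _ , _ , ≡.refl) = [ proj₁ (proj₂ supremum) _ (small x) ]
      least : ∀ u → (∀ v → v ∈ IsLowerSum P e → v ≤⁺ u) → [ proj₁ supremum ] ≤⁺ u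
      least ⊤⁺    h = _ ≤⊤⁺
      least [ y ] h = [ proj₂ (proj₂ supremum) y (λ x x∈S → unbox (h _ (large x∈S))) ]

    -- With excluded middle the lower sums of an arbitrary scheme are bounded or not, and a density
    -- exists in both cases. It yields the lower bound 0 which the infimum over all schemes
    -- requires.
    density-exists : ∃[ d ] d ∈ IsDensity P e × [ 0# ] ≤⁺ d
    density-exists with em {P = ∃[ b ] ∀ v → v ∈ IsLowerSum P e → v ≤⁺ [ b ]}
    ... | yes bounded = let c , 0≤c , c-exp = expected-cuts-finite bounded in
          [ c * Segment.length e ⁻¹ ] , finite c-exp , [ *-nonNeg 0≤c (<⇒≤ (⁻¹-pos (Segment.0<length e))) ]
    ... | no unbounded = ⊤⁺ , infinite ((λ v _ → v ≤⊤⁺) , least) , (_ ≤⊤⁺)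
      where
      least : ∀ u → (∀ v → v ∈ IsLowerSum P e → v ≤⁺ u) → ⊤⁺ ≤⁺ u
      least ⊤⁺    h = _ ≤⊤⁺
      least [ b ] h = ⊥-elim (unbounded (b , h))

  -- Parallel to the side opposite vertex 0, at the height of the points a and b.
  level : Segment 3
  level = record
    { source   = source
    ; target   = target
    ; source∈Δ = source∈Δ
    ; target∈Δ = target∈Δ
    ; 0<length = 0<length
    }
    where
    source target : Point 3
    source = 2 ÷ 3 Vector.∷ 1 ÷ 3 Vector.∷ 0# Vector.∷ Vector.[]
    target = 2 ÷ 3 Vector.∷ 0# Vector.∷ 1 ÷ 3 Vector.∷ Vector.[]
    0≤2/3 : 0# ≤ 2 ÷ 3
    0≤2/3 = lin [] (𝟘 ⊑ 2 /1+ 2) [] tt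
    0≤1/3 : 0# ≤ 1 ÷ 3
    0≤1/3 = lin [] (𝟘 ⊑ 1 /1+ 2) [] tt
    source∈Δ : source ∈ Δ
    source∈Δ = Δ-intro 0≤2/3 0≤1/3 ≤-refl total
      where
      total : 2 ÷ 3 + 1 ÷ 3 + 0# ≈ 1#
      total = lin [] (2 /1+ 2 ⊕ 1 /1+ 2 ⊕ 𝟘 ≃ 𝟙) [] tt
    target∈Δ : target ∈ Δ
    target∈Δ = Δ-intro 0≤2/3 ≤-refl 0≤1/3 total
      where
      total : 2 ÷ 3 + 0# + 1 ÷ 3 ≈ 1#
      total = lin [] (2 /1+ 2 ⊕ 𝟘 ⊕ 1 /1+ 2 ≃ 𝟙) [] tt
    0<length : 0# < (1 ÷ 2) * (∣ 2 ÷ 3 - 2 ÷ 3 ∣ + (∣ 1 ÷ 3 - 0# ∣ + (∣ 0# - 1 ÷ 3 ∣ + 0#)))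
    0<length = lin ((∣ 2 ÷ 3 - 2 ÷ 3 ∣) ∷ (∣ 1 ÷ 3 - 0# ∣) ∷ (∣ 0# - 1 ÷ 3 ∣) ∷ [])
      (𝟘 ⊏ 1 /1+ 1 ⊗ (x₀ ⊕ (x₁ ⊕ (x₂ ⊕ 𝟘)))) (1 /1+ 1 ▸ 𝟘 ⊑ x₀ ∷ 1 /1+ 1 ▸ 1 /1+ 2 ⊝ 𝟘 ⊑ x₁ ∷
      1 /1+ 1 ▸ 𝟘 ⊑ x₂ ∷ []) (0≤∣x∣ (2 ÷ 3 - 2 ÷ 3) , x≤∣x∣ (1 ÷ 3 - 0#) , 0≤∣x∣ (0# - 1 ÷ 3) , tt)

  open Segment level using () renaming (length to level-length; at to level-at)

  level-length≈ : level-length ≤ 1 ÷ 3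
  level-length≈ = goal
    where
    d₀ : ∣ 2 ÷ 3 - 2 ÷ 3 ∣ ≤ 0#
    d₀ = ∣x∣≤ (lin [] (2 /1+ 2 ⊝ 2 /1+ 2 ⊑ 𝟘) [] tt) (lin [] (⊖ (2 /1+ 2 ⊝ 2 /1+ 2) ⊑ 𝟘) [] tt)
    d₁ : ∣ 1 ÷ 3 - 0# ∣ ≤ 1 ÷ 3
    d₁ = ∣x∣≤ (lin [] (1 /1+ 2 ⊝ 𝟘 ⊑ 1 /1+ 2) [] tt) (lin [] (⊖ (1 /1+ 2 ⊝ 𝟘) ⊑ 1 /1+ 2) [] tt)
    d₂ : ∣ 0# - 1 ÷ 3 ∣ ≤ 1 ÷ 3
    d₂ = ∣x∣≤ (lin [] (𝟘 ⊝ 1 /1+ 2 ⊑ 1 /1+ 2) [] tt) (lin [] (⊖ (𝟘 ⊝ 1 /1+ 2) ⊑ 1 /1+ 2) [] tt)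
    goal : (1 ÷ 2) * (∣ 2 ÷ 3 - 2 ÷ 3 ∣ + (∣ 1 ÷ 3 - 0# ∣ + (∣ 0# - 1 ÷ 3 ∣ + 0#))) ≤ 1 ÷ 3
    goal = lin ((∣ 2 ÷ 3 - 2 ÷ 3 ∣) ∷ (∣ 1 ÷ 3 - 0# ∣) ∷ (∣ 0# - 1 ÷ 3 ∣) ∷ [])
      (1 /1+ 1 ⊗ (x₀ ⊕ (x₁ ⊕ (x₂ ⊕ 𝟘))) ⊑ 1 /1+ 2) (1 /1+ 1 ▸ x₀ ⊑ 𝟘 ∷ 1 /1+ 1 ▸ x₁ ⊑ 1 /1+ 2 ∷
      1 /1+ 1 ▸ x₂ ⊑ 1 /1+ 2 ∷ []) (d₀ , d₁ , d₂ , tt)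

  one-cut : ∀ (C : Cut 3) {s} → s ∈ Crossing C level → CutsAtLeast C level 1
  one-cut C {s} cr = (λ _ → s) , (λ _ → cr) , λ { 0F 0F n → ⊥-elim (n ≡.refl) }

  Cutting : Component → Set
  Cutting (ball ac rays) = lookup rays 1F ≡ 1F
  Cutting (ball bd rays) = lookup rays 2F ≡ 1F
  Cutting (corner _)     = ⊥

  cutting⇒cut : ∀ l rays {t C} → Cutting (ball l rays) → Realises (ball l t rays) C → CutsAtLeast C level 1
  cutting⇒cut ac rays {t} {C} sel r@(0<t , t<1 , _) = one-cut C (BallLike.ray-crossing
      (realises⇒ballLike {ac} {t} {rays} {C} r) level {1F} {2F} {0F} {t} 120F (≡.cong (punchIn 1F) sel) moves
      0<t t<1 on below above)
    where
    moves : ¬ (0# ≈ 1 ÷ 3)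
    moves p = <-irrefl (lin [] (𝟘 ⊏ 𝟘) (3 /1+ 0 ▸ 1 /1+ 2 ≃ 𝟘 ∷ []) (sym p , tt))
    on : (1# - t) * 0# + t * (1 ÷ 3) ≈ centre ac t 2F
    on = lin (t ∷ centre ac t 2F ∷ []) ((𝟙 ⊝ x₀) ⊗ 𝟘 ⊕ x₀ ⊗ 1 /1+ 2 ≃ x₁) (▹ 𝟘 ⊕ 1 /1+ 2 ⊗ x₀ ≃ x₁ ∷
      []) (sym (centre-affine ac t 2F) , tt)
    below : (1# - t) * (1 ÷ 3) + t * 0# < centre ac t 1F
    below = lin (t ∷ centre ac t 1F ∷ []) ((𝟙 ⊝ x₀) ⊗ 1 /1+ 2 ⊕ x₀ ⊗ 𝟘 ⊏ x₁)
      (▹ 1 /1+ 2 ⊕ 1 /1+ 2 ⊗ x₀ ≃ x₁ ∷ 2 /1+ 2 ▸ 𝟘 ⊏ x₀ ∷ []) (sym (centre-affine ac t 1F) , 0<t ,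
      tt)
    above : centre ac t 0F < (1# - t) * (2 ÷ 3) + t * (2 ÷ 3)
    above = lin (centre ac t 0F ∷ t ∷ []) (x₀ ⊏ (𝟙 ⊝ x₁) ⊗ 2 /1+ 2 ⊕ x₁ ⊗ 2 /1+ 2)
      (▹ x₀ ≃ 2 /1+ 2 ⊕ ⊖ 2 /1+ 2 ⊗ x₁ ∷ 2 /1+ 2 ▸ 𝟘 ⊏ x₁ ∷ []) (centre-affine ac t 0F , 0<t , tt)
  cutting⇒cut bd rays {t} {C} sel r@(0<t , t<1 , _) = one-cut C (BallLike.ray-crossing
      (realises⇒ballLike {bd} {t} {rays} {C} r) level {2F} {1F} {0F} {1# - t} 210F (≡.cong (punchIn 2F) sel) moves
      0<1-t 1-t<1 on below above)
    where
    moves : ¬ (1 ÷ 3 ≈ 0#)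
    moves p = <-irrefl (lin [] (𝟘 ⊏ 𝟘) (3 /1+ 0 ▸ 1 /1+ 2 ≃ 𝟘 ∷ []) (p , tt))
    0<1-t : 0# < 1# - t
    0<1-t = lin (t ∷ []) (𝟘 ⊏ 𝟙 ⊝ x₀) (▹ x₀ ⊏ 𝟙 ∷ []) (t<1 , tt)
    1-t<1 : 1# - t < 1#
    1-t<1 = lin (t ∷ []) (𝟙 ⊝ x₀ ⊏ 𝟙) (▹ 𝟘 ⊏ x₀ ∷ []) (0<t , tt)
    on : (1# - (1# - t)) * (1 ÷ 3) + (1# - t) * 0# ≈ centre bd t 1F
    on = lin (t ∷ centre bd t 1F ∷ []) ((𝟙 ⊝ (𝟙 ⊝ x₀)) ⊗ 1 /1+ 2 ⊕ (𝟙 ⊝ x₀) ⊗ 𝟘 ≃ x₁)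
      (▹ 𝟘 ⊕ 1 /1+ 2 ⊗ x₀ ≃ x₁ ∷ []) (sym (centre-affine bd t 1F) , tt)
    below : (1# - (1# - t)) * 0# + (1# - t) * (1 ÷ 3) < centre bd t 2F
    below = lin (t ∷ centre bd t 2F ∷ []) ((𝟙 ⊝ (𝟙 ⊝ x₀)) ⊗ 𝟘 ⊕ (𝟙 ⊝ x₀) ⊗ 1 /1+ 2 ⊏ x₁)
      (▹ 1 /1+ 2 ⊕ 1 /1+ 2 ⊗ x₀ ≃ x₁ ∷ 2 /1+ 2 ▸ 𝟘 ⊏ x₀ ∷ []) (sym (centre-affine bd t 2F) , 0<t ,
      tt)
    above : centre bd t 0F < (1# - (1# - t)) * (2 ÷ 3) + (1# - t) * (2 ÷ 3)
    above = lin (centre bd t 0F ∷ t ∷ []) (x₀ ⊏ (𝟙 ⊝ (𝟙 ⊝ x₁)) ⊗ 2 /1+ 2 ⊕ (𝟙 ⊝ x₁) ⊗ 2 /1+ 2)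
      (▹ x₀ ≃ 2 /1+ 2 ⊕ ⊖ 2 /1+ 2 ⊗ x₁ ∷ 2 /1+ 2 ▸ 𝟘 ⊏ x₁ ∷ []) (centre-affine bd t 0F , 0<t , tt)

  cutting : Fin 8 → Component
  cutting 0F = ball ac (0F ∷ 1F ∷ 0F ∷ [])
  cutting 1F = ball ac (0F ∷ 1F ∷ 1F ∷ [])
  cutting 2F = ball ac (1F ∷ 1F ∷ 0F ∷ [])
  cutting 3F = ball ac (1F ∷ 1F ∷ 1F ∷ [])
  cutting 4F = ball bd (0F ∷ 0F ∷ 1F ∷ [])
  cutting 5F = ball bd (0F ∷ 1F ∷ 1F ∷ [])
  cutting 6F = ball bd (1F ∷ 0F ∷ 1F ∷ [])
  cutting 7F = ball bd (1F ∷ 1F ∷ 1F ∷ [])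

  cutting-injective : ∀ i j → cutting i ≡ cutting j → i ≡ j
  cutting-injective = from-yes (Fin.all? λ i → Fin.all? λ j → (cutting i ≟ᶜ cutting j) →-dec (i Fin.≟ j))

  cutting-cuts : ∀ i → Cutting (cutting i)
  cutting-cuts 0F = ≡.refl
  cutting-cuts 1F = ≡.refl
  cutting-cuts 2F = ≡.refl
  cutting-cuts 3F = ≡.refl
  cutting-cuts 4F = ≡.refl
  cutting-cuts 5F = ≡.refl
  cutting-cuts 6F = ≡.refl
  cutting-cuts 7F = ≡.refl

  module _ (P : CuttingScheme 3) (isBallCorner : IsBallCornerScheme P) where
    open CuttingScheme P
    open IsBallCornerScheme isBallCorner

    event : Fin 8 → Pred Ω 0ℓ
    event i = UpTo P isBallCorner (cutting i) 1#

    event⇒component : ∀ i {ω} → ω ∈ event i → cutting i ≡ component (choice ω)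
    event⇒component i {ω} = upTo⇒component (cutting i) (choice ω)
      where
      upTo⇒component : ∀ c χ → χ ∈ UpToChoice c 1# → c ≡ component χ
      upTo⇒component (ball l rays) (ball _ _ _) (≡.refl , ≡.refl , _) = ≡.refl
      upTo⇒component (corner k)    (corner _ _) (≡.refl , _)          = ≡.refl

    event⊆cut : ∀ i → event i ⊆ λ ω → CutsAtLeast (cut ω) level 1
    event⊆cut i {ω} x = by-choice (choice ω) {cut ω} (realises ω)
      (≡.subst Cutting (event⇒component i x) (cutting-cuts i))
      where
      by-choice : ∀ χ {C} → Realises χ C → Cutting (component χ) → CutsAtLeast C level 1
      by-choice (ball l t rays) {C} r c = cutting⇒cut l rays {t} {C} c r

    level-lower-sum : [ sum (λ i → 1 · μ (event i)) ] ∈ IsLowerSum P level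
    level-lower-sum = 8 , (λ _ → 1) , event , (λ i → measurable-UpTo P isBallCorner (cutting i) 1#) ,
      (λ { i j i≢j ω (x , y) → i≢j (cutting-injective i j
        (≡.trans (event⇒component i x) (≡.sym (event⇒component j y)))) }) ,
      event⊆cut , ≡.refl

    μ-event : ∀ i → μ (event i) ≈ 1 ÷ 22
    μ-event i = trans (μ-UpTo P isBallCorner (cutting i) (lo≤1 (cutting i)) ≤-refl) (mass (cutting i) (cutting-cuts i))
      where
      mass : ∀ c → Cutting c → w c * (1# - lo c) ≈ 1 ÷ 22
      mass (ball l rays) _ = goal
        where
        goal : 1 ÷ 22 * (1# - 0#) ≈ 1 ÷ 22
        goal = lin [] (1 /1+ 21 ⊗ (𝟙 ⊝ 𝟘) ≃ 1 /1+ 21) [] tt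

    -- Half of the sixteen ball components cut `level` for every parameter, each with mass 1/22.
    -- Divided by the length 1/3, this gives 12/11.
    level-cuts : 4 ÷ 11 ≤ sum (λ i → 1 · μ (event i))
    level-cuts = goal
      where
      goal : 4 ÷ 11 ≤ (μ (event 0F) + 0#) + ((μ (event 1F) + 0#) + ((μ (event 2F) + 0#) + ((μ (event 3F) + 0#) +
             ((μ (event 4F) + 0#) + ((μ (event 5F) + 0#) + ((μ (event 6F) + 0#) + ((μ (event 7F) + 0#) + 0#)))))))
      goal = lin (μ (event 0F) ∷ μ (event 1F) ∷ μ (event 2F) ∷ μ (event 3F) ∷ μ (event 4F) ∷
        μ (event 5F) ∷ μ (event 6F) ∷ μ (event 7F) ∷ []) (4 /1+ 10 ⊑ x₀ ⊕ 𝟘 ⊕ (x₁ ⊕ 𝟘 ⊕ (x₂ ⊕ 𝟘 ⊕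
        (x₃ ⊕ 𝟘 ⊕ (x₄ ⊕ 𝟘 ⊕ (x₅ ⊕ 𝟘 ⊕ (x₆ ⊕ 𝟘 ⊕ (x₇ ⊕ 𝟘 ⊕ 𝟘)))))))) (▹ 1 /1+ 21 ≃ x₀ ∷
        ▹ 1 /1+ 21 ≃ x₁ ∷ ▹ 1 /1+ 21 ≃ x₂ ∷ ▹ 1 /1+ 21 ≃ x₃ ∷ ▹ 1 /1+ 21 ≃ x₄ ∷ ▹ 1 /1+ 21 ≃ x₅ ∷
        ▹ 1 /1+ 21 ≃ x₆ ∷ ▹ 1 /1+ 21 ≃ x₇ ∷ []) (sym (μ-event 0F) , sym (μ-event 1F) ,
        sym (μ-event 2F) , sym (μ-event 3F) , sym (μ-event 4F) , sym (μ-event 5F) ,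
        sym (μ-event 6F) , sym (μ-event 7F) , tt)

    maximum-density : IsMaximumDensity P [ 12 ÷ 11 ]
    maximum-density = (λ { d (e , d∈) → density≤ P isBallCorner e d d∈ }) , λ u u-upper →
      let c , _ , expected = expected-cuts-finite P level (12 ÷ 11 * level-length , lower-sum≤ P isBallCorner level)
      in attained c u (proj₁ expected _ level-lower-sum) (u-upper _ (level , finite expected))
      where
      ratio : ∀ c → sum (λ i → 1 · μ (event i)) ≤ c → 12 ÷ 11 ≤ c * level-length ⁻¹
      ratio c p = ratio≥ (Segment.0<length level) (lin (level-length ∷ c ∷
        sum (λ u → 1 · μ (event u)) ∷ []) (12 /1+ 10 ⊗ x₀ ⊑ x₁) (▹ x₂ ⊑ x₁ ∷ ▹ 4 /1+ 10 ⊑ x₂ ∷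
        12 /1+ 10 ▸ x₀ ⊑ 1 /1+ 2 ∷ []) (p , level-cuts , level-length≈ , tt))
      attained : ∀ c u → [ sum (λ i → 1 · μ (event i)) ] ≤⁺ [ c ] → [ c * level-length ⁻¹ ] ≤⁺ u → [ 12 ÷ 11 ] ≤⁺ u
      attained c ⊤⁺    _     _     = _ ≤⊤⁺
      attained c [ y ] [ p ] [ q ] = [ ≤-trans (ratio c p) q ]

  maximum-nonNeg : ∀ {d} → (∃[ P ] IsMaximumDensity P [ d ]) → 0# ≤ d
  maximum-nonNeg {d} (P , upper , _) = let _ , density , 0≤ = density-exists P level in
    below 0≤ (upper _ (level , density))
    where
    below : ∀ {v} → [ 0# ] ≤⁺ v → v ≤⁺ [ d ] → 0# ≤ d
    below [ p ] [ q ] = ≤-trans p q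

  -- The infimum is formed over the finite maximum densities alone. An infinite one lies above every
  -- number, and the ball/corner scheme shows that there is a finite one.
  minimum-maximum-density : ∃[ τ ] IsMinimumMaximumDensity 3 τ × τ ≤⁺ [ 12 ÷ 11 ]
  minimum-maximum-density = [ τ ] , (lower , greatest) , [ proj₁ (proj₂ inf) _ attained ]
    where
    S : Pred ℝ _
    S d = Σ (CuttingScheme 3) λ P → IsMaximumDensity P [ d ]
    attained : 12 ÷ 11 ∈ S
    attained = ballCornerScheme , maximum-density ballCornerScheme isBallCornerScheme
    inf : ∃ (IsInfimum S)
    inf = infimum S (12 ÷ 11 , attained) (0# , λ _ → maximum-nonNeg)
    τ : ℝ
    τ = proj₁ inf
    lower : ∀ d → (Σ (CuttingScheme 3) λ P → IsMaximumDensity P d) → [ τ ] ≤⁺ d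
    lower ⊤⁺    _ = _ ≤⊤⁺
    lower [ d ] m = [ proj₁ (proj₂ inf) d m ]
    greatest : ∀ u → (∀ d → (Σ (CuttingScheme 3) λ P → IsMaximumDensity P d) → u ≤⁺ d) → u ≤⁺ [ τ ]
    greatest ⊤⁺    h = ⊥-elim (top≰ (h [ 12 ÷ 11 ] attained))
      where
      top≰ : ∀ {x} → ¬ (⊤⁺ ≤⁺ [ x ])
      top≰ ()
    greatest [ u ] h = [ proj₂ (proj₂ inf) u (λ d m → unbox (h [ d ] m)) ]
      where
      unbox : ∀ {x y} → [ x ] ≤⁺ [ y ] → x ≤ y
      unbox [ p ] = p

theorem4p3 : (∀ {ℓ} → ExcludedMiddle ℓ) → (𝓡 : CompleteOrderedField) →
    let open CompleteOrderedField 𝓡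
        open Simplex 𝓡 in
    (Σ (CuttingScheme 3) λ P → IsBallCornerScheme P) ×
    (∀ P → IsBallCornerScheme P → IsMaximumDensity P [ 12 ÷ 11 ]) ×
    (∃[ τ ] IsMinimumMaximumDensity 3 τ × τ ≤⁺ [ 12 ÷ 11 ])
theorem4p3 em 𝓡 = (ballCornerScheme , isBallCornerScheme) , maximum-density , minimum-maximum-density
  where
  open SchemeExistence em 𝓡
  open MaximumDensity em 𝓡
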